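{- There is a constant $C$ such that for every (simple) graph $G$ with at least one edge, without isolated edges, and with maximum degree $\Delta$, we have $${\rm ch}'_a(G)\leq \Delta + C\Delta^{\frac{1}{2}}(\log\Delta)^4 .$$
   Context: An isolated edge is a connected component consisting of a single edge. For an edge colouring $c$ of $G$ and a vertex $v$, the palette of $v$ is $S_c(v)=\{c(e): e \text{ an edge incident with } v\}$. An edge colouring is adjacent vertex distinguishing if it is proper (edges sharing a vertex receive distinct colours) and $S_c(u)\neq S_c(v)$ for every edge $uv$. The adjacent vertex distinguishing edge choice number ${\rm ch}'_a(G)$ is the least integer $k$ such that for every assignment of lists $L_e$ with $|L_e|= k$ to the edges $e$ of $G$, one can choose $c(e)\in L_e$ for each edge so that $c$ is an adjacent vertex distinguishing edge colouring. Here $\log$ denotes the natural logarithm. -}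

module Defs where

open import Data.Nat using (ℕ; _≤_; _+_; _*_; _∸_; _^_)
open import Data.Nat.Logarithm using (⌈log₂_⌉)
open import Data.Bool using (Bool; true; false)
open import Data.Fin using (Fin)
open import Data.List using (List; length; filterᵇ; allFin)
open import Data.List.Membership.Propositional using (_∈_)
open import Data.List.Relation.Unary.Unique.Propositional using (Unique)
open import Data.Product using (Σ; ∃; ∃-syntax; _×_)
open import Relation.Binary.PropositionalEquality using (_≡_; _≢_)
open import Relation.Nullary using (¬_)

record Graph (n : ℕ) : Set where
  field
    Adj    : Fin n → Fin n → Bool
    sym    : ∀ u v → Adj u v ≡ Adj v u
    irrefl : ∀ v → Adj v v ≡ false

module _ {n : ℕ} (G : Graph n) where
  open Graph G

  Edge : Fin n → Fin n → Set
  Edge u v = Adj u v ≡ true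

  degree : Fin n → ℕ
  degree v = length (filterᵇ (Adj v) (allFin n))

  MaxDegree : ℕ → Set
  MaxDegree Δ = (∀ v → degree v ≤ Δ) × (∃[ v ] degree v ≡ Δ)

  HasEdge : Set
  HasEdge = ∃[ u ] ∃[ v ] Edge u v

  NoIsolatedEdge : Set
  NoIsolatedEdge = ∀ u v → Edge u v → ¬ (degree u ≡ 1 × degree v ≡ 1)

  -- Edge colourings / list assignments: values c u v (= c v u) on edges uv;
  -- values on non-edges are irrelevant.  Colours are natural numbers.
  EdgeColouring : Set
  EdgeColouring = Σ (Fin n → Fin n → ℕ) λ c → ∀ u v → c u v ≡ c v u

  InPalette : (Fin n → Fin n → ℕ) → Fin n → ℕ → Set
  InPalette c v x = ∃[ w ] (Edge v w × c v w ≡ x)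

  SamePalette : (Fin n → Fin n → ℕ) → Fin n → Fin n → Set
  SamePalette c u v = ∀ x → (InPalette c u x → InPalette c v x) × (InPalette c v x → InPalette c u x)

  Proper : (Fin n → Fin n → ℕ) → Set
  Proper c = ∀ u v w → Edge u v → Edge u w → v ≢ w → c u v ≢ c u w

  AVD : (Fin n → Fin n → ℕ) → Set
  AVD c = Proper c × (∀ u v → Edge u v → ¬ SamePalette c u v)

  AVDChoosable : ℕ → Set
  AVDChoosable k =
    (L : Fin n → Fin n → List ℕ) →
    (∀ u v → Edge u v → L u v ≡ L v u) →
    (∀ u v → Edge u v → Unique (L u v) × length (L u v) ≡ k) →
    Σ EdgeColouring λ c → (∀ u v → Edge u v → Σ.proj₁ c u v ∈ L u v) × AVD (Σ.proj₁ c)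

  -- ch'_a(G) ≤ B  (the least such k is ≤ B iff some admissible k is ≤ B)
  chₐ′≤ : ℕ → Set
  chₐ′≤ B = ∃[ k ] (k ≤ B × AVDChoosable k)

-- k ≤ Δ + C Δ^{1/2} ℓ^4, where ℓ = ⌈log₂ Δ⌉, written without square roots:
-- (k ∸ Δ)^2 ≤ C^2 Δ ℓ^8
WithinBound : ℕ → ℕ → ℕ → Set
WithinBound C Δ k = (k ∸ Δ) ^ 2 ≤ C ^ 2 * Δ * ⌈log₂ Δ ⌉ ^ 8

-- An edge is an item, a pair (vertex , colour) a resource, and colouring uv with x an option that uses the item uv
-- and the resources (u , x), (v , x); a list colouring is a matching of options covering all items. It is found by
-- a nibble. In each round every option is selected with probability 1/ℓ and kept when no conflicting option is
-- selected; phantom options make the system regular, so that the surplus ℓ − t of list size over colour degree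
-- shrinks exactly like the square root of the list sizes, up to fluctuations of order √ℓ log ℓ. These are controlled
-- by a supermartingale bound on a decision tree, and all of them at once by Rosenfeld's counting argument in place of
-- the local lemma; the same counting finishes as soon as 8t ≤ ℓ. With L = log Δ this consumes a surplus of order √Δ L².
--
-- Put D of order √Δ L². On the graph H of edges with both ends of degree above D, the first round leaves, for every
-- edge uv of H with more than D edges of H at v, many colours kept at v but not at u. A random set Z u of density
-- 1/√Δ meets these colours and is small on every list, so forbidding Z u at u from then on separates u from v for
-- good. The edges outside H are coloured greedily: each avoids the sets Z and at most one further colour for each of
-- the at most D neighbours whose palette it still has to separate from.
module Submission where

open import Defs
open import Data.Bool using (Bool; true; false; not; _∧_; _∨_; if_then_else_; T)
open import Data.Empty using (⊥; ⊥-elim)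
open import Data.Fin using (Fin; toℕ)
import Data.Fin.Properties as Finₚ
import Data.Integer as ℤ
import Data.Integer.Properties as ℤₚ
open import Data.List using (List; []; _∷_; _++_; length; map; filterᵇ; concatMap; upTo; allFin; cartesianProduct; deduplicate; mapMaybe; take)
open import Data.List.Membership.Propositional using (_∈_)
open import Data.List.Membership.Propositional.Properties using (∈-∃++; ∈-++⁺ˡ; ∈-++⁺ʳ; ∈-++⁻; ∈-map⁺; ∈-map⁻; ∈-allFin; ∈-cartesianProduct⁺; ∈-deduplicate⁺; ∈-upTo⁺; ∈-upTo⁻)
open import Data.List.Properties using (length-++; length-map; length-take; length-upTo; length-mapMaybe; length-filter; filter-all)
import Data.List.Relation.Binary.Permutation.Propositional as ↭
open import Data.List.Relation.Binary.Permutation.Propositional using (_↭_; ↭-sym)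
open import Data.List.Relation.Binary.Permutation.Propositional.Properties using (shift)
import Data.List.Relation.Unary.All as All
open import Data.List.Relation.Unary.All using (All; []; _∷_)
open import Data.List.Relation.Unary.AllPairs using ([]; _∷_)
open import Data.List.Relation.Unary.Any using (here; there)
import Data.List.Relation.Unary.Unique.DecPropositional.Properties as UniqueDec
open import Data.List.Relation.Unary.Unique.Propositional using (Unique)
import Data.List.Relation.Unary.Unique.Propositional.Properties as Uniqueₚ
open import Data.Maybe using (Maybe; just; nothing)
open import Data.Maybe.Properties using (just-injective)
import Data.Nat as ℕ
open import Data.Nat using (ℕ; zero; suc)
import Data.Nat.Properties as ℕₚ
open import Data.Nat.Solver using (module +-*-Solver)
open import Data.Product using (Σ; ∃; ∃-syntax; _×_; _,_; proj₁; proj₂)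
import Data.Product.Properties as Prodₚ
import Data.Rational.Properties as ℚₚ
import Data.Rational.Unnormalised as ℚᵘ
import Data.Rational.Unnormalised.Properties as ℚᵘₚ
open import Data.Sum using (_⊎_; inj₁; inj₂; [_,_]′)
import Data.Sum.Properties as Sumₚ
open import Data.Unit using (⊤; tt)
open import Function using (case_of_)
open import Level using (0ℓ)
open import Relation.Binary.Definitions using (DecidableEquality; tri<; tri≈; tri>)
open import Relation.Binary.PropositionalEquality using (_≡_; _≢_; refl; sym; trans; cong; cong₂; subst; subst₂; module ≡-Reasoning)
open import Relation.Nullary using (¬_; Dec; yes; no)
open import Relation.Nullary.Decidable using (⌊_⌋; decidable-stable; dec⇒maybe)
open import Tactic.RingSolver using (solve-∀)
open import Tactic.RingSolver.Core.AlmostCommutativeRing using (AlmostCommutativeRing; fromCommutativeRing)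

module Num where

  open import Data.Rational using (ℚ; 0ℚ; 1ℚ; _+_; _*_; _-_; -_; _≤_; _<_; mkℚ; toℚᵘ; 1/_; positive; nonNegative; Positive; NonNegative)
  open ℚᵘ using (mkℚᵘ; *≤*; *≡*)

  ℚ-ring : AlmostCommutativeRing 0ℓ 0ℓ
  ℚ-ring = fromCommutativeRing ℚₚ.+-*-commutativeRing (λ x → dec⇒maybe (0ℚ ℚₚ.≟ x))

  ≤-refl : ∀ {x} → x ≤ x
  ≤-refl = ℚₚ.≤-refl

  ≤-trans : ∀ {x y z} → x ≤ y → y ≤ z → x ≤ z
  ≤-trans = ℚₚ.≤-trans

  ≤-reflexive : ∀ {x y} → x ≡ y → x ≤ y
  ≤-reflexive refl = ≤-refl

  +-mono : ∀ {a b c d} → a ≤ b → c ≤ d → a + c ≤ b + d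
  +-mono = ℚₚ.+-mono-≤

  *-monoʳ : ∀ {a b c} → 0ℚ ≤ c → a ≤ b → c * a ≤ c * b
  *-monoʳ {c = c} 0≤c = ℚₚ.*-monoˡ-≤-nonNeg c {{nonNegative 0≤c}}

  *-monoˡ : ∀ {a b c} → 0ℚ ≤ c → a ≤ b → a * c ≤ b * c
  *-monoˡ {c = c} 0≤c = ℚₚ.*-monoʳ-≤-nonNeg c {{nonNegative 0≤c}}

  *-mono : ∀ {a b c d} → 0ℚ ≤ a → 0ℚ ≤ d → a ≤ b → c ≤ d → a * c ≤ b * d
  *-mono 0≤a 0≤d a≤b c≤d = ≤-trans (*-monoʳ 0≤a c≤d) (*-monoˡ 0≤d a≤b)

  0≤+ : ∀ {a b} → 0ℚ ≤ a → 0ℚ ≤ b → 0ℚ ≤ a + b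
  0≤+ = +-mono

  0≤* : ∀ {a b} → 0ℚ ≤ a → 0ℚ ≤ b → 0ℚ ≤ a * b
  0≤* {a} {b} 0≤a 0≤b = subst (_≤ a * b) (ℚₚ.*-zeroʳ a) (*-monoʳ 0≤a 0≤b)

  0≤1 : 0ℚ ≤ 1ℚ
  0≤1 = ℚₚ.≤ᵇ⇒≤ _

  diff : ∀ {a b} → a ≤ b → 0ℚ ≤ b - a
  diff {a} {b} a≤b = subst (_≤ b - a) (ℚₚ.+-inverseʳ a) (+-mono a≤b ≤-refl)

  -- The workhorse for inequalities: the equation is left to the ring solver.
  by-gap : ∀ {a b c} → 0ℚ ≤ c → b ≡ a + c → a ≤ b
  by-gap {a} {b} {c} 0≤c e =
    subst (_≤ b) (ℚₚ.+-identityʳ a) (≤-trans (+-mono (≤-refl {a}) 0≤c) (≤-reflexive (sym e)))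

  neg-mono : ∀ {a b} → a ≤ b → - b ≤ - a
  neg-mono = ℚₚ.neg-antimono-≤

  -ʳ-mono : ∀ {a b c d} → a ≤ b → d ≤ c → a - c ≤ b - d
  -ʳ-mono a≤b d≤c = +-mono a≤b (neg-mono d≤c)

  ≤-dec : ∀ a b → a ≤ b ⊎ b < a
  ≤-dec a b with a ℚₚ.≤? b
  ... | yes h = inj₁ h
  ... | no h = inj₂ (ℚₚ.≰⇒> h)

  cancel-* : ∀ {a b c} → 0ℚ < c → c * a ≤ c * b → a ≤ b
  cancel-* {c = c} 0<c = ℚₚ.*-cancelˡ-≤-pos c {{positive 0<c}}

  *-pos : ∀ {a b} → 0ℚ < a → 0ℚ < b → 0ℚ < a * b
  *-pos {a} {b} 0<a 0<b = ℚₚ.positive⁻¹ (a * b) {{ℚₚ.pos*pos⇒pos a {{positive 0<a}} b {{positive 0<b}}}}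

  inverse : ∀ {x} → 0ℚ < x → Σ ℚ λ y → (x * y ≡ 1ℚ) × (0ℚ < y)
  inverse {x} 0<x = (1/ x) {{nz}} , ℚₚ.*-inverseʳ x {{nz}} , ℚₚ.positive⁻¹ _ {{ℚₚ.1/pos⇒pos x {{positive 0<x}}}}
    where nz = ℚₚ.pos⇒nonZero x {{positive 0<x}}

  sq≥0 : ∀ x → 0ℚ ≤ x * x
  sq≥0 x with ℚₚ.≤-total 0ℚ x
  ... | inj₁ h = 0≤* h h
  ... | inj₂ h = subst (0ℚ ≤_) (lemma x) (0≤* (diff h) (diff h))
    where
    lemma : ∀ x → (0ℚ - x) * (0ℚ - x) ≡ x * x
    lemma = solve-∀ ℚ-ring

  abstract
    ι : ℕ → ℚ
    ι zero = 0ℚ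
    ι (suc n) = 1ℚ + ι n

    ι0 : ι 0 ≡ 0ℚ
    ι0 = refl

    ι1 : ι 1 ≡ 1ℚ
    ι1 = refl

    ι-suc : ∀ n → ι (suc n) ≡ 1ℚ + ι n
    ι-suc n = refl

    ι-+ : ∀ m n → ι (m ℕ.+ n) ≡ ι m + ι n
    ι-+ zero n = sym (ℚₚ.+-identityˡ (ι n))
    ι-+ (suc m) n = trans (cong (1ℚ +_) (ι-+ m n)) (sym (ℚₚ.+-assoc 1ℚ (ι m) (ι n)))

    ι-* : ∀ m n → ι (m ℕ.* n) ≡ ι m * ι n
    ι-* zero n = sym (ℚₚ.*-zeroˡ (ι n))
    ι-* (suc m) n = trans (ι-+ n (m ℕ.* n)) (trans (cong (ι n +_) (ι-* m n)) (lemma (ι m) (ι n)))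
      where
      lemma : ∀ a b → b + a * b ≡ (1ℚ + a) * b
      lemma = solve-∀ ℚ-ring

    0≤ι : ∀ n → 0ℚ ≤ ι n
    0≤ι zero = ≤-refl
    0≤ι (suc n) = 0≤+ 0≤1 (0≤ι n)

    ι-mono : ∀ {m n} → m ℕ.≤ n → ι m ≤ ι n
    ι-mono {n = n} ℕ.z≤n = 0≤ι n
    ι-mono (ℕ.s≤s h) = +-mono (≤-refl {1ℚ}) (ι-mono h)

    private
      ιᵘ : ∀ n → toℚᵘ (ι n) ℚᵘ.≃ mkℚᵘ (ℤ.+ n) 0
      ιᵘ zero = ℚᵘₚ.≃-refl
      ιᵘ (suc n) = ℚᵘₚ.≃-trans (ℚₚ.toℚᵘ-homo-+ 1ℚ (ι n))
        (ℚᵘₚ.≃-trans (ℚᵘₚ.+-congʳ (toℚᵘ 1ℚ) (ιᵘ n)) (*≡* (cong (ℤ._* (ℤ.+ 1)) (cong (λ z → (ℤ.+ 1) ℤ.+ z) (ℤₚ.*-identityʳ (ℤ.+ n))))))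

    archimedean : ∀ x → ∃ λ n → x ≤ ι n
    archimedean x@(mkℚ (ℤ.+ n) d _) = n , ℚₚ.toℚᵘ-cancel-≤ (ℚᵘₚ.≤-respʳ-≃ (ℚᵘₚ.≃-sym (ιᵘ n))
      (*≤* (ℤₚ.*-monoˡ-≤-nonNeg (ℤ.+ n) (ℤ.+≤+ (ℕ.s≤s ℕ.z≤n)))))
    archimedean x@(mkℚ ℤ.-[1+ n ] d _) = 0 , ℚₚ.toℚᵘ-cancel-≤ (*≤* ℤ.-≤+)

  ι-pos : ∀ n → 0ℚ < ι (suc n)
  ι-pos n = ℚₚ.<-≤-trans (ℚₚ.positive⁻¹ 1ℚ) (subst (_≤ ι (suc n)) ι1 (ι-mono (ℕ.s≤s ℕ.z≤n)))

  ι-pos′ : ∀ {n} → 1 ℕ.≤ n → 0ℚ < ι n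
  ι-pos′ {suc n} _ = ι-pos n

  1≤ι : ∀ {n} → 1 ℕ.≤ n → 1ℚ ≤ ι n
  1≤ι {n} h = subst (_≤ ι n) ι1 (ι-mono h)

  <-irrefl : ∀ {a} → ¬ (a < a)
  <-irrefl = ℚₚ.<-irrefl refl

  <⇒≱ : ∀ {a b} → a < b → b ≤ a → ⊥
  <⇒≱ a<b b≤a = <-irrefl (ℚₚ.<-≤-trans a<b b≤a)

  ι-cancel : ∀ {m n} → ι m ≤ ι n → m ℕ.≤ n
  ι-cancel {m} {n} h with m ℕ.≤? n
  ... | yes p = p
  ... | no ¬p = ⊥-elim (<⇒≱ (subst (ι n <_) (sym (ι-suc n)) (ℚₚ.<-respˡ-≡ (ℚₚ.+-identityˡ (ι n)) (ℚₚ.+-mono-<-≤ (ℚₚ.positive⁻¹ 1ℚ) (≤-refl {ι n}))))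
                            (≤-trans (ι-mono (ℕₚ.≰⇒> ¬p)) h))

  ι-∸ : ∀ {m n} → n ℕ.≤ m → ι (m ℕ.∸ n) ≡ ι m - ι n
  ι-∸ {m} {n} n≤m = trans (lemma (ι (m ℕ.∸ n)) (ι n)) (cong (_- ι n) (trans (sym (ι-+ (m ℕ.∸ n) n)) (cong ι (ℕₚ.m∸n+n≡m n≤m))))
    where
    lemma : ∀ a b → a ≡ a + b - b
    lemma = solve-∀ ℚ-ring

  floor : ∀ x → 0ℚ ≤ x → ∃ λ n → (ι n ≤ x) × (x ≤ 1ℚ + ι n)
  floor x 0≤x with archimedean x
  ... | N , x≤N = go N x≤N
    where
    go : ∀ N → x ≤ ι N → ∃ λ n → (ι n ≤ x) × (x ≤ 1ℚ + ι n)
    go zero h = 0 , subst (_≤ x) (sym ι0) 0≤x , ≤-trans h (by-gap 0≤1 (ℚₚ.+-comm 1ℚ (ι 0)))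
    go (suc N) h with ≤-dec (ι N) x
    ... | inj₁ p = N , p , subst (x ≤_) (ι-suc N) h
    ... | inj₂ p = go N (ℚₚ.<⇒≤ p)

  infixr 8 _^_
  _^_ : ℚ → ℕ → ℚ
  x ^ zero = 1ℚ
  x ^ suc n = x * x ^ n

  0≤^ : ∀ {x} → 0ℚ ≤ x → ∀ n → 0ℚ ≤ x ^ n
  0≤^ 0≤x zero = 0≤1
  0≤^ 0≤x (suc n) = 0≤* 0≤x (0≤^ 0≤x n)

  0<^ : ∀ {x} → 0ℚ < x → ∀ n → 0ℚ < x ^ n
  0<^ 0<x zero = ℚₚ.positive⁻¹ 1ℚ
  0<^ 0<x (suc n) = *-pos 0<x (0<^ 0<x n)

  ^-mono : ∀ {x y} → 0ℚ ≤ x → x ≤ y → ∀ n → x ^ n ≤ y ^ n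
  ^-mono 0≤x x≤y zero = ≤-refl
  ^-mono 0≤x x≤y (suc n) = *-mono 0≤x (0≤^ (≤-trans 0≤x x≤y) n) x≤y (^-mono 0≤x x≤y n)

  ^-+ : ∀ x m n → x ^ (m ℕ.+ n) ≡ x ^ m * x ^ n
  ^-+ x zero n = sym (ℚₚ.*-identityˡ _)
  ^-+ x (suc m) n = trans (cong (x *_) (^-+ x m n)) (sym (ℚₚ.*-assoc x (x ^ m) (x ^ n)))

  ^-* : ∀ x m n → x ^ (m ℕ.* n) ≡ (x ^ n) ^ m
  ^-* x zero n = refl
  ^-* x (suc m) n = trans (^-+ x n (m ℕ.* n)) (cong (x ^ n *_) (^-* x m n))

  *-^ : ∀ x y n → (x * y) ^ n ≡ x ^ n * y ^ n
  *-^ x y zero = sym (ℚₚ.*-identityˡ 1ℚ)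
  *-^ x y (suc n) = trans (cong (x * y *_) (*-^ x y n)) (lemma x y (x ^ n) (y ^ n))
    where
    lemma : ∀ a b c d → a * b * (c * d) ≡ a * c * (b * d)
    lemma = solve-∀ ℚ-ring

  1^ : ∀ n → 1ℚ ^ n ≡ 1ℚ
  1^ zero = refl
  1^ (suc n) = trans (ℚₚ.*-identityˡ _) (1^ n)

  1≤^ : ∀ {x} → 1ℚ ≤ x → ∀ n → 1ℚ ≤ x ^ n
  1≤^ {x} h n = subst (_≤ x ^ n) (1^ n) (^-mono 0≤1 h n)

  ^≤1 : ∀ {x} → 0ℚ ≤ x → x ≤ 1ℚ → ∀ n → x ^ n ≤ 1ℚ
  ^≤1 {x} h h′ n = subst (x ^ n ≤_) (1^ n) (^-mono h h′ n)

  ^-antitone : ∀ {x} → 0ℚ ≤ x → x ≤ 1ℚ → ∀ {m n} → m ℕ.≤ n → x ^ n ≤ x ^ m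
  ^-antitone {x} 0≤x x≤1 {m} {n} m≤n =
    subst₂ _≤_ (trans (sym (^-+ x m (n ℕ.∸ m))) (cong (x ^_) (ℕₚ.m+[n∸m]≡n m≤n))) (ℚₚ.*-identityʳ (x ^ m))
      (*-monoʳ (0≤^ 0≤x m) (^≤1 0≤x x≤1 (n ℕ.∸ m)))

  ι-^ : ∀ m n → ι (m ℕ.^ n) ≡ ι m ^ n
  ι-^ m zero = ι1
  ι-^ m (suc n) = trans (ι-* m (m ℕ.^ n)) (cong (ι m *_) (ι-^ m n))

  bernoulli : ∀ {x} → 0ℚ ≤ 1ℚ + x → ∀ n → 1ℚ + ι n * x ≤ (1ℚ + x) ^ n
  bernoulli {x} h zero = ≤-reflexive (trans (cong (λ z → 1ℚ + z * x) ι0) (lemma x))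
    where
    lemma : ∀ x → 1ℚ + 0ℚ * x ≡ 1ℚ
    lemma = solve-∀ ℚ-ring
  bernoulli {x} h (suc n) = ≤-trans
    (by-gap (0≤* (0≤ι n) (sq≥0 x)) (trans (lemma x (ι n)) (cong (λ z → 1ℚ + z * x + ι n * (x * x)) (sym (ι-suc n)))))
    (*-monoʳ h (bernoulli h n))
    where
    lemma : ∀ x n → (1ℚ + x) * (1ℚ + n * x) ≡ 1ℚ + (1ℚ + n) * x + n * (x * x)
    lemma = solve-∀ ℚ-ring

  -- A second order upper bound, valid because the relative error n z stays below 1.
  pow-quadratic : ∀ {z} → 0ℚ ≤ 1ℚ + z → ∀ n → ι n * z ≤ 1ℚ → (1ℚ + z) ^ n ≤ 1ℚ + ι n * z + ι n * z * (ι n * z)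
  pow-quadratic {z} h zero _ = ≤-reflexive (trans (lemma z) (cong (λ w → 1ℚ + w * z + w * z * (w * z)) (sym ι0)))
    where
    lemma : ∀ z → 1ℚ ≡ 1ℚ + 0ℚ * z + 0ℚ * z * (0ℚ * z)
    lemma = solve-∀ ℚ-ring
  pow-quadratic {z} h (suc n) nz≤1 = ≤-trans (*-monoʳ h (pow-quadratic h n nz≤1′))
    (by-gap (0≤* (sq≥0 z) (0≤+ (0≤* (0≤ι n) (diff nz≤1′)) 0≤1))
      (trans (cong (λ w → 1ℚ + w * z + w * z * (w * z)) (ι-suc n)) (lemma z (ι n))))
    where
    nz≤1′ : ι n * z ≤ 1ℚ
    nz≤1′ with ℚₚ.≤-total 0ℚ z
    ... | inj₁ 0≤z = ≤-trans (*-monoˡ 0≤z (ι-mono (ℕₚ.n≤1+n n))) nz≤1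
    ... | inj₂ z≤0 = ≤-trans (subst (ι n * z ≤_) (ℚₚ.*-zeroʳ (ι n)) (*-monoʳ (0≤ι n) z≤0)) 0≤1
    lemma : ∀ z n → 1ℚ + (1ℚ + n) * z + (1ℚ + n) * z * ((1ℚ + n) * z)
          ≡ (1ℚ + z) * (1ℚ + n * z + n * z * (n * z)) + z * z * (n * (1ℚ - n * z) + 1ℚ)
    lemma = solve-∀ ℚ-ring

module Sum where

  open import Data.Rational using (ℚ; 0ℚ; 1ℚ; _+_; _*_; _-_; -_; _≤_; _<_)
  open Num

  true≢false : ∀ {b} → b ≡ true → b ≡ false → ⊥
  true≢false refl ()

  ¬true⇒false : ∀ {b} → ¬ (b ≡ true) → b ≡ false
  ¬true⇒false {true} h = ⊥-elim (h refl)
  ¬true⇒false {false} h = refl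

  bool-case : ∀ b → b ≡ true ⊎ b ≡ false
  bool-case true = inj₁ refl
  bool-case false = inj₂ refl

  bool-ext : ∀ {a b} → (a ≡ true → b ≡ true) → (b ≡ true → a ≡ true) → a ≡ b
  bool-ext {true} {b} f g = sym (f refl)
  bool-ext {false} {true} f g = g refl
  bool-ext {false} {false} f g = refl

  ∧-left : ∀ {a b} → a ∧ b ≡ true → a ≡ true
  ∧-left {true} _ = refl

  ∧-right : ∀ {a b} → a ∧ b ≡ true → b ≡ true
  ∧-right {true} h = h

  ∧-intro : ∀ {a b} → a ≡ true → b ≡ true → a ∧ b ≡ true
  ∧-intro refl h = h

  ∨-case : ∀ {a b} → a ∨ b ≡ true → a ≡ true ⊎ b ≡ true
  ∨-case {true} _ = inj₁ refl
  ∨-case {false} h = inj₂ h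

  ∨-left : ∀ {a b} → a ≡ true → a ∨ b ≡ true
  ∨-left refl = refl

  ∨-right : ∀ {a b} → b ≡ true → a ∨ b ≡ true
  ∨-right {true} _ = refl
  ∨-right {false} h = h

  not-true : ∀ {a} → a ≡ false → not a ≡ true
  not-true refl = refl

  not-elim : ∀ {a} → not a ≡ true → a ≡ false
  not-elim {false} _ = refl

  𝟙 : Bool → ℚ
  𝟙 true = 1ℚ
  𝟙 false = 0ℚ

  0≤𝟙 : ∀ b → 0ℚ ≤ 𝟙 b
  0≤𝟙 true = 0≤1
  0≤𝟙 false = ≤-refl

  𝟙≤1 : ∀ b → 𝟙 b ≤ 1ℚ
  𝟙≤1 true = ≤-refl
  𝟙≤1 false = 0≤1

  𝟙-mono : ∀ {a b} → (a ≡ true → b ≡ true) → 𝟙 a ≤ 𝟙 b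
  𝟙-mono {true} h rewrite h refl = ≤-refl
  𝟙-mono {false} {b} h = 0≤𝟙 b

  𝟙-∧ : ∀ a b → 𝟙 (a ∧ b) ≡ 𝟙 a * 𝟙 b
  𝟙-∧ true b = sym (ℚₚ.*-identityˡ (𝟙 b))
  𝟙-∧ false b = sym (ℚₚ.*-zeroˡ (𝟙 b))

  𝟙-not : ∀ a → 𝟙 (not a) ≡ 1ℚ - 𝟙 a
  𝟙-not true = refl
  𝟙-not false = refl

  module _ {A : Set} where

    ∑ : List A → (A → ℚ) → ℚ
    ∑ [] f = 0ℚ
    ∑ (x ∷ xs) f = f x + ∑ xs f

    ∑-cong : ∀ xs {f g : A → ℚ} → (∀ x → x ∈ xs → f x ≡ g x) → ∑ xs f ≡ ∑ xs g
    ∑-cong [] h = refl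
    ∑-cong (x ∷ xs) h = cong₂ _+_ (h x (here refl)) (∑-cong xs λ y y∈ → h y (there y∈))

    ∑-mono : ∀ xs {f g : A → ℚ} → (∀ x → x ∈ xs → f x ≤ g x) → ∑ xs f ≤ ∑ xs g
    ∑-mono [] h = ≤-refl
    ∑-mono (x ∷ xs) h = +-mono (h x (here refl)) (∑-mono xs λ y y∈ → h y (there y∈))

    ∑-0 : ∀ xs → ∑ xs (λ _ → 0ℚ) ≡ 0ℚ
    ∑-0 [] = refl
    ∑-0 (x ∷ xs) = trans (ℚₚ.+-identityˡ _) (∑-0 xs)

    ∑-≥0 : ∀ xs {f : A → ℚ} → (∀ x → x ∈ xs → 0ℚ ≤ f x) → 0ℚ ≤ ∑ xs f
    ∑-≥0 xs {f} h = subst (_≤ ∑ xs f) (∑-0 xs) (∑-mono xs h)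

    ∑-+ : ∀ xs (f g : A → ℚ) → ∑ xs (λ x → f x + g x) ≡ ∑ xs f + ∑ xs g
    ∑-+ [] f g = refl
    ∑-+ (x ∷ xs) f g = trans (cong (f x + g x +_) (∑-+ xs f g)) (lemma (f x) (g x) (∑ xs f) (∑ xs g))
      where
      lemma : ∀ a b c d → a + b + (c + d) ≡ a + c + (b + d)
      lemma = solve-∀ ℚ-ring

    ∑-* : ∀ c xs (f : A → ℚ) → ∑ xs (λ x → c * f x) ≡ c * ∑ xs f
    ∑-* c [] f = sym (ℚₚ.*-zeroʳ c)
    ∑-* c (x ∷ xs) f = trans (cong (c * f x +_) (∑-* c xs f)) (sym (ℚₚ.*-distribˡ-+ c (f x) (∑ xs f)))

    ∑-*ʳ : ∀ c xs (f : A → ℚ) → ∑ xs (λ x → f x * c) ≡ ∑ xs f * c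
    ∑-*ʳ c xs f = trans (∑-cong xs λ x _ → ℚₚ.*-comm (f x) c) (trans (∑-* c xs f) (ℚₚ.*-comm c (∑ xs f)))

    ∑-- : ∀ xs (f g : A → ℚ) → ∑ xs (λ x → f x - g x) ≡ ∑ xs f - ∑ xs g
    ∑-- [] f g = refl
    ∑-- (x ∷ xs) f g = trans (cong (f x - g x +_) (∑-- xs f g)) (lemma (f x) (g x) (∑ xs f) (∑ xs g))
      where
      lemma : ∀ a b c d → a - b + (c - d) ≡ a + c - (b + d)
      lemma = solve-∀ ℚ-ring

    ∑-const : ∀ c (xs : List A) → ∑ xs (λ _ → c) ≡ ι (length xs) * c
    ∑-const c [] = trans (sym (ℚₚ.*-zeroˡ c)) (cong (_* c) (sym ι0))
    ∑-const c (x ∷ xs) = trans (cong (c +_) (∑-const c xs)) (trans (lemma c (ι (length xs))) (cong (_* c) (sym (ι-suc (length xs)))))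
      where
      lemma : ∀ c n → c + n * c ≡ (1ℚ + n) * c
      lemma = solve-∀ ℚ-ring

    ∑-++ : ∀ xs ys (f : A → ℚ) → ∑ (xs ++ ys) f ≡ ∑ xs f + ∑ ys f
    ∑-++ [] ys f = sym (ℚₚ.+-identityˡ _)
    ∑-++ (x ∷ xs) ys f = trans (cong (f x +_) (∑-++ xs ys f)) (sym (ℚₚ.+-assoc (f x) (∑ xs f) (∑ ys f)))

    # : (A → Bool) → List A → ℕ
    # f xs = length (filterᵇ f xs)

    ι# : ∀ f xs → ι (# f xs) ≡ ∑ xs (λ x → 𝟙 (f x))
    ι# f [] = ι0
    ι# f (x ∷ xs) with f x
    ... | true = trans (ι-suc (# f xs)) (cong (1ℚ +_) (ι# f xs))
    ... | false = trans (ι# f xs) (sym (ℚₚ.+-identityˡ _))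

    ∈-filterᵇ⁺ : ∀ (f : A → Bool) {x xs} → x ∈ xs → f x ≡ true → x ∈ filterᵇ f xs
    ∈-filterᵇ⁺ f {x} {y ∷ xs} (here refl) fx with f x
    ... | true = here refl
    ∈-filterᵇ⁺ f {x} {y ∷ xs} (there x∈) fx with f y
    ... | true = there (∈-filterᵇ⁺ f x∈ fx)
    ... | false = ∈-filterᵇ⁺ f x∈ fx

    ∈-filterᵇ⁻ : ∀ (f : A → Bool) {x} xs → x ∈ filterᵇ f xs → x ∈ xs × f x ≡ true
    ∈-filterᵇ⁻ f (y ∷ xs) x∈ with f y in eq
    ∈-filterᵇ⁻ f (y ∷ xs) (here refl) | true = here refl , eq
    ∈-filterᵇ⁻ f (y ∷ xs) (there x∈) | true = let a , b = ∈-filterᵇ⁻ f xs x∈ in there a , b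
    ... | false = let a , b = ∈-filterᵇ⁻ f xs x∈ in there a , b

    filterᵇ-unique : ∀ (f : A → Bool) {xs} → Unique xs → Unique (filterᵇ f xs)
    filterᵇ-unique f [] = []
    filterᵇ-unique f {x ∷ xs} (x∉ ∷ u) with f x
    ... | true = All.tabulate (λ y∈ → All.lookup x∉ (proj₁ (∈-filterᵇ⁻ f xs y∈))) ∷ filterᵇ-unique f u
    ... | false = filterᵇ-unique f u

    ∑-filter : ∀ (f : A → Bool) xs (g : A → ℚ) → ∑ (filterᵇ f xs) g ≡ ∑ xs (λ x → 𝟙 (f x) * g x)
    ∑-filter f [] g = refl
    ∑-filter f (x ∷ xs) g with f x
    ... | true = cong₂ _+_ (sym (ℚₚ.*-identityˡ (g x))) (∑-filter f xs g)
    ... | false = trans (∑-filter f xs g) (trans (sym (ℚₚ.+-identityˡ _)) (cong (_+ ∑ xs (λ x → 𝟙 (f x) * g x)) (sym (ℚₚ.*-zeroˡ (g x)))))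

    unique-length : ∀ {xs ys : List A} → Unique xs → (∀ x → x ∈ xs → x ∈ ys) → length xs ℕ.≤ length ys
    unique-length {[]} _ _ = ℕ.z≤n
    unique-length {x ∷ xs} (x∉ ∷ u) h with ∈-∃++ (h x (here refl))
    ... | as , bs , refl = subst (suc (length xs) ℕ.≤_) (sym (trans (length-++ as) (trans (ℕₚ.+-suc (length as) (length bs)) (cong suc (sym (length-++ as))))))
        (ℕ.s≤s (unique-length u λ y y∈ → [ ∈-++⁺ˡ , (λ { (here refl) → ⊥-elim (All.lookup x∉ y∈ refl) ; (there q) → ∈-++⁺ʳ as q }) ]′ (∈-++⁻ as (h y (there y∈)))))

    #-≤ : ∀ (f : A → Bool) {xs ys} → Unique xs → (∀ x → x ∈ xs → f x ≡ true → x ∈ ys) → # f xs ℕ.≤ length ys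
    #-≤ f {xs} u h = unique-length (filterᵇ-unique f u) λ x x∈ → let a , b = ∈-filterᵇ⁻ f xs x∈ in h x a b

    #-mono : ∀ (f g : A → Bool) xs → (∀ x → x ∈ xs → f x ≡ true → g x ≡ true) → # f xs ℕ.≤ # g xs
    #-mono f g xs h = ι-cancel (subst₂′ (ι# f xs) (ι# g xs) (∑-mono xs λ x x∈ → 𝟙-mono (h x x∈)))
      where
      subst₂′ : ∀ {a b c d : ℚ} → a ≡ b → c ≡ d → b ≤ d → a ≤ c
      subst₂′ refl refl h = h

    #≤length : ∀ (f : A → Bool) xs → # f xs ℕ.≤ length xs
    #≤length f [] = ℕ.z≤n
    #≤length f (x ∷ xs) with f x
    ... | true = ℕ.s≤s (#≤length f xs)
    ... | false = ℕₚ.m≤n⇒m≤1+n (#≤length f xs)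

    any : (A → Bool) → List A → Bool
    any f [] = false
    any f (x ∷ xs) = f x ∨ any f xs

    any⁺ : ∀ (f : A → Bool) {x xs} → x ∈ xs → f x ≡ true → any f xs ≡ true
    any⁺ f (here refl) h = ∨-left h
    any⁺ f {xs = y ∷ _} (there x∈) h = ∨-right {f y} (any⁺ f x∈ h)

    any⁻ : ∀ (f : A → Bool) xs → any f xs ≡ true → ∃ λ x → x ∈ xs × f x ≡ true
    any⁻ f (x ∷ xs) h with ∨-case {f x} h
    ... | inj₁ e = x , here refl , e
    ... | inj₂ e = let y , y∈ , fy = any⁻ f xs e in y , there y∈ , fy

    any-false : ∀ (f : A → Bool) {x} xs → any f xs ≡ false → x ∈ xs → f x ≡ false
    any-false f {x} xs h x∈ = ¬true⇒false λ e → true≢false (any⁺ f x∈ e) h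

    any-cong : ∀ {f g : A → Bool} xs → (∀ x → x ∈ xs → f x ≡ g x) → any f xs ≡ any g xs
    any-cong [] h = refl
    any-cong (x ∷ xs) h = cong₂ _∨_ (h x (here refl)) (any-cong xs λ y y∈ → h y (there y∈))

    𝟙-any≤ : ∀ (f : A → Bool) xs → 𝟙 (any f xs) ≤ ∑ xs (λ x → 𝟙 (f x))
    𝟙-any≤ f [] = ≤-refl
    𝟙-any≤ f (x ∷ xs) with f x
    ... | true = by-gap (∑-≥0 xs λ y _ → 0≤𝟙 (f y)) refl
    ... | false = ≤-trans (𝟙-any≤ f xs) (≤-reflexive (sym (ℚₚ.+-identityˡ _)))

    #0 : ∀ (f : A → Bool) xs → (∀ x → x ∈ xs → f x ≡ false) → # f xs ≡ 0
    #0 f [] h = refl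
    #0 f (x ∷ xs) h rewrite h x (here refl) = #0 f xs λ y y∈ → h y (there y∈)

    concatMap-length : ∀ {B : Set} (f : A → List B) xs {c} → (∀ x → x ∈ xs → length (f x) ℕ.≤ c) → length (concatMap f xs) ℕ.≤ length xs ℕ.* c
    concatMap-length f [] h = ℕ.z≤n
    concatMap-length f (x ∷ xs) h rewrite length-++ (f x) {concatMap f xs} =
      ℕₚ.+-mono-≤ (h x (here refl)) (concatMap-length f xs λ y y∈ → h y (there y∈))

    ∈-concatMap : ∀ {B : Set} (f : A → List B) {x y xs} → x ∈ xs → y ∈ f x → y ∈ concatMap f xs
    ∈-concatMap f (here refl) y∈ = ∈-++⁺ˡ y∈
    ∈-concatMap f {xs = z ∷ _} (there x∈) y∈ = ∈-++⁺ʳ (f z) (∈-concatMap f x∈ y∈)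

    ∈-concatMap⁻ : ∀ {B : Set} (f : A → List B) {y} xs → y ∈ concatMap f xs → ∃ λ x → x ∈ xs × y ∈ f x
    ∈-concatMap⁻ f (x ∷ xs) y∈ with ∈-++⁻ (f x) y∈
    ... | inj₁ h = x , here refl , h
    ... | inj₂ h = let z , z∈ , w = ∈-concatMap⁻ f xs h in z , there z∈ , w

  ∑-swap : ∀ {A B : Set} xs ys (f : A → B → ℚ) → ∑ xs (λ x → ∑ ys (f x)) ≡ ∑ ys (λ y → ∑ xs (λ x → f x y))
  ∑-swap [] ys f = sym (∑-0 ys)
  ∑-swap (x ∷ xs) ys f = trans (cong (∑ ys (f x) +_) (∑-swap xs ys f)) (sym (∑-+ ys (f x) (λ y → ∑ xs (λ x → f x y))))

  module Eq {A : Set} (_≟_ : DecidableEquality A) where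

    infix 5 _==_ _∈ᵇ_
    _==_ : A → A → Bool
    x == y = ⌊ x ≟ y ⌋

    ==-refl : ∀ x → (x == x) ≡ true
    ==-refl x with x ≟ x
    ... | yes _ = refl
    ... | no h = ⊥-elim (h refl)

    ==-true : ∀ {x y} → (x == y) ≡ true → x ≡ y
    ==-true {x} {y} h with x ≟ y
    ... | yes e = e

    ==-false : ∀ {x y} → x ≢ y → (x == y) ≡ false
    ==-false h = ¬true⇒false λ e → h (==-true e)

    ==-≢ : ∀ {x y} → (x == y) ≡ false → x ≢ y
    ==-≢ {x} h refl = true≢false (==-refl x) h

    ==-sym : ∀ x y → (x == y) ≡ (y == x)
    ==-sym x y = bool-ext (λ e → subst (λ z → (z == x) ≡ true) (==-true e) (==-refl x)) (λ e → subst (λ z → (z == y) ≡ true) (==-true e) (==-refl y))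

    _∈ᵇ_ : A → List A → Bool
    x ∈ᵇ xs = any (x ==_) xs

    ∈ᵇ⁺ : ∀ {x xs} → x ∈ xs → x ∈ᵇ xs ≡ true
    ∈ᵇ⁺ {x} x∈ = any⁺ (x ==_) x∈ (==-refl x)

    ∈ᵇ⁻ : ∀ {x} xs → x ∈ᵇ xs ≡ true → x ∈ xs
    ∈ᵇ⁻ {x} xs h with any⁻ (x ==_) xs h
    ... | y , y∈ , e = subst (_∈ xs) (sym (==-true e)) y∈

    ∉ᵇ : ∀ {x} xs → x ∈ᵇ xs ≡ false → ¬ x ∈ xs
    ∉ᵇ xs h x∈ = true≢false (∈ᵇ⁺ x∈) h

    ∑-single : ∀ {a xs} → Unique xs → a ∈ xs → (f : A → ℚ) → ∑ xs (λ x → 𝟙 (x == a) * f x) ≡ f a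
    ∑-single {a} {x ∷ xs} (x∉ ∷ u) (here refl) f rewrite ==-refl x = trans (cong₂ _+_ (ℚₚ.*-identityˡ (f x))
      (trans (∑-cong xs λ y y∈ → trans (cong (λ b → 𝟙 b * f y) (==-false (λ e → All.lookup x∉ y∈ (sym e)))) (ℚₚ.*-zeroˡ (f y))) (∑-0 xs))) (ℚₚ.+-identityʳ (f x))
    ∑-single {a} {x ∷ xs} (x∉ ∷ u) (there a∈) f rewrite ==-false {x} {a} (All.lookup x∉ a∈) =
      trans (cong₂ _+_ (ℚₚ.*-zeroˡ (f x)) (∑-single u a∈ f)) (ℚₚ.+-identityˡ (f a))

  inj-length : ∀ {A B : Set} (f : A → B) {xs ys} → Unique xs → (∀ x y → x ∈ xs → y ∈ xs → f x ≡ f y → x ≡ y) →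
               (∀ x → x ∈ xs → f x ∈ ys) → length xs ℕ.≤ length ys
  inj-length f {[]} _ _ _ = ℕ.z≤n
  inj-length f {x ∷ xs} (x∉ ∷ u) inj h with ∈-∃++ (h x (here refl))
  ... | as , bs , eq = subst (suc (length xs) ℕ.≤_) (sym (trans (cong length eq) (trans (length-++ as) (trans (ℕₚ.+-suc (length as) (length bs)) (cong suc (sym (length-++ as)))))))
      (ℕ.s≤s (inj-length f u (λ y z y∈ z∈ → inj y z (there y∈) (there z∈)) λ y y∈ → avoid y y∈ (∈-++⁻ as (subst (f y ∈_) eq (h y (there y∈))))))
    where
    avoid : ∀ y → y ∈ xs → f y ∈ as ⊎ f y ∈ f x ∷ bs → f y ∈ as ++ bs
    avoid y y∈ (inj₁ a) = ∈-++⁺ˡ a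
    avoid y y∈ (inj₂ (here e)) = ⊥-elim (All.lookup x∉ y∈ (sym (inj y x (there y∈) (here refl) e)))
    avoid y y∈ (inj₂ (there b)) = ∈-++⁺ʳ as b

  concatMap-unique : ∀ {A B : Set} (f : A → List B) (key : B → A) {xs} → Unique xs → (∀ x → x ∈ xs → Unique (f x)) →
                     (∀ x y → x ∈ xs → y ∈ f x → key y ≡ x) → Unique (concatMap f xs)
  concatMap-unique f key [] _ _ = []
  concatMap-unique f key {x ∷ xs} (x∉ ∷ u) h k = Uniqueₚ.++⁺ (h x (here refl)) (concatMap-unique f key u (λ y y∈ → h y (there y∈)) (λ y z y∈ → k y z (there y∈)))
    λ { (y∈ , y∈′) → let z , z∈ , w = ∈-concatMap⁻ f xs y∈′ in All.lookup x∉ z∈ (trans (sym (k x _ (here refl) y∈)) (k z _ (there z∈) w)) }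

  #-++ : ∀ {A : Set} (f : A → Bool) xs ys → # f (xs ++ ys) ≡ # f xs ℕ.+ # f ys
  #-++ f [] ys = refl
  #-++ f (x ∷ xs) ys with f x
  ... | true = cong suc (#-++ f xs ys)
  ... | false = #-++ f xs ys

  #-map : ∀ {A B : Set} (f : B → Bool) (g : A → B) xs → # f (map g xs) ≡ # (λ x → f (g x)) xs
  #-map f g [] = refl
  #-map f g (x ∷ xs) with f (g x)
  ... | true = cong suc (#-map f g xs)
  ... | false = #-map f g xs

  #-cong : ∀ {A : Set} {f g : A → Bool} xs → (∀ x → x ∈ xs → f x ≡ g x) → # f xs ≡ # g xs
  #-cong [] h = refl
  #-cong {f = f} {g} (x ∷ xs) h with f x | g x | h x (here refl)
  ... | true | .true | refl = cong suc (#-cong xs λ y y∈ → h y (there y∈))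
  ... | false | .false | refl = #-cong xs λ y y∈ → h y (there y∈)

  #-all : ∀ {A : Set} {f : A → Bool} xs → (∀ x → x ∈ xs → f x ≡ true) → # f xs ≡ length xs
  #-all [] h = refl
  #-all (x ∷ xs) h rewrite h x (here refl) = cong suc (#-all xs λ y y∈ → h y (there y∈))

  ∑-⊆ : ∀ {A : Set} {xs ys : List A} {f : A → ℚ} → Unique xs → (∀ x → x ∈ xs → x ∈ ys) → (∀ x → 0ℚ ≤ f x) → ∑ xs f ≤ ∑ ys f
  ∑-⊆ {xs = []} {ys} _ _ h = ∑-≥0 ys λ y _ → h y
  ∑-⊆ {xs = x ∷ xs} {f = f} (x∉ ∷ u) s h with ∈-∃++ (s x (here refl))
  ... | as , bs , refl = ≤-trans (+-mono (≤-refl {f x}) (∑-⊆ {ys = as ++ bs} u (λ y y∈ → [ ∈-++⁺ˡ , (λ { (here refl) → ⊥-elim (All.lookup x∉ y∈ refl) ; (there q) → ∈-++⁺ʳ as q }) ]′ (∈-++⁻ as (s y (there y∈)))) h))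
      (≤-reflexive (trans (cong (f x +_) (∑-++ as bs f)) (trans (lemma (f x) (∑ as f) (∑ bs f)) (sym (∑-++ as (x ∷ bs) f)))))
    where
    lemma : ∀ x a b → x + (a + b) ≡ a + (x + b)
    lemma = solve-∀ ℚ-ring

  #-inside : ∀ {A B : Set} (f : A → List B) (key : B → A) (g : B → Bool) {a xs} → Unique xs → a ∈ xs →
             (∀ x y → x ∈ xs → y ∈ f x → key y ≡ x) → (∀ y → g y ≡ true → key y ≡ a) → (∀ y → y ∈ f a → g y ≡ true) →
             # g (concatMap f xs) ≡ length (f a)
  #-inside f key g {a} {x ∷ xs} (x∉ ∷ u) (here refl) hk h k = trans (#-++ g (f x) (concatMap f xs)) (trans (cong₂ ℕ._+_ (#-all (f x) k)
      (#0 g (concatMap f xs) λ y y∈ → ¬true⇒false λ e → let z , z∈ , w = ∈-concatMap⁻ f xs y∈ in All.lookup x∉ z∈ (trans (sym (h y e)) (hk z y (there z∈) w)))) (ℕₚ.+-identityʳ _))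
  #-inside f key g {a} {x ∷ xs} (x∉ ∷ u) (there a∈) hk h k = trans (#-++ g (f x) (concatMap f xs)) (cong₂ ℕ._+_
      (#0 g (f x) λ y y∈ → ¬true⇒false λ e → All.lookup x∉ a∈ (trans (sym (hk x y (here refl) y∈)) (h y e)))
      (#-inside f key g u a∈ (λ z y z∈ → hk z y (there z∈)) h k))

  #-split : ∀ {A : Set} (f g : A → Bool) xs → # f xs ℕ.≤ # (λ x → f x ∧ g x) xs ℕ.+ # f (filterᵇ (λ x → not (g x)) xs)
  #-split f g [] = ℕ.z≤n
  #-split f g (x ∷ xs) with g x
  ... | true with f x
  ...   | true = ℕ.s≤s (#-split f g xs)
  ...   | false = #-split f g xs
  #-split f g (x ∷ xs) | false with f x
  ...   | true = ℕₚ.≤-trans (ℕ.s≤s (#-split f g xs)) (ℕₚ.≤-reflexive (sym (ℕₚ.+-suc _ _)))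
  ...   | false = #-split f g xs

  filterᵇ-keep : ∀ {A : Set} (f : A → Bool) {x} xs → f x ≡ true → filterᵇ f (x ∷ xs) ≡ x ∷ filterᵇ f xs
  filterᵇ-keep f xs e rewrite e = refl

  filterᵇ-drop : ∀ {A : Set} (f : A → Bool) {x} xs → f x ≡ false → filterᵇ f (x ∷ xs) ≡ filterᵇ f xs
  filterᵇ-drop f xs e rewrite e = refl

  ∈-take : ∀ {A : Set} n {x : A} xs → x ∈ take n xs → x ∈ xs
  ∈-take (suc n) (y ∷ xs) (here e) = here e
  ∈-take (suc n) (y ∷ xs) (there h) = there (∈-take n xs h)

  three₁⁻ : ∀ {A B C : Set} (xs : List A) (ys : List B) (zs : List C) {x} → inj₁ x ∈ map inj₁ xs ++ (map (λ y → inj₂ (inj₁ y)) ys ++ map (λ z → inj₂ (inj₂ z)) zs) → x ∈ xs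
  three₁⁻ xs ys zs x∈ with ∈-++⁻ (map inj₁ xs) x∈
  ... | inj₁ h with ∈-map⁻ inj₁ h
  ...   | _ , o∈ , refl = o∈
  three₁⁻ xs ys zs x∈ | inj₂ h with ∈-++⁻ (map (λ y → inj₂ (inj₁ y)) ys) h
  ...   | inj₁ k with ∈-map⁻ (λ y → inj₂ (inj₁ y)) k
  ...     | _ , _ , ()
  three₁⁻ xs ys zs x∈ | inj₂ h | inj₂ k with ∈-map⁻ (λ z → inj₂ (inj₂ z)) k
  ...     | _ , _ , ()

  three₂⁻ : ∀ {A B C : Set} (xs : List A) (ys : List B) (zs : List C) {y} → inj₂ (inj₁ y) ∈ map inj₁ xs ++ (map (λ y → inj₂ (inj₁ y)) ys ++ map (λ z → inj₂ (inj₂ z)) zs) → y ∈ ys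
  three₂⁻ xs ys zs x∈ with ∈-++⁻ (map inj₁ xs) x∈
  ... | inj₁ h with ∈-map⁻ inj₁ h
  ...   | _ , _ , ()
  three₂⁻ xs ys zs x∈ | inj₂ h with ∈-++⁻ (map (λ y → inj₂ (inj₁ y)) ys) h
  ...   | inj₁ k with ∈-map⁻ (λ y → inj₂ (inj₁ y)) k
  ...     | _ , a∈ , refl = a∈
  three₂⁻ xs ys zs x∈ | inj₂ h | inj₂ k with ∈-map⁻ (λ z → inj₂ (inj₂ z)) k
  ...     | _ , _ , ()

module Greedy where

  open import Data.Nat using (_≤_; _<_; _+_; _*_; _≤ᵇ_)
  open Sum

  module Colouring {n : ℕ} (G : Graph n) where

    open Graph G renaming (sym to Adj-sym)

    V : Set
    V = Fin n

    edge-sym : ∀ {u v} → Edge G u v → Edge G v u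
    edge-sym {u} {v} e = trans (Adj-sym v u) e

    loopless : ∀ {u v} → Edge G u v → u ≢ v
    loopless {u} e refl = true≢false e (irrefl u)

    nbrs : V → List V
    nbrs v = filterᵇ (Adj v) (allFin n)

    nbrs-unique : ∀ v → Unique (nbrs v)
    nbrs-unique v = filterᵇ-unique (Adj v) (Uniqueₚ.allFin⁺ n)

    ∈-nbrs : ∀ {v w} → Edge G v w → w ∈ nbrs v
    ∈-nbrs {v} {w} e = ∈-filterᵇ⁺ (Adj v) (∈-allFin w) e

    nbrs-edge : ∀ {v w} → w ∈ nbrs v → Edge G v w
    nbrs-edge {v} h = proj₂ (∈-filterᵇ⁻ (Adj v) (allFin n) h)

    same-palette-degree : ∀ c → Proper G c → ∀ u v → SamePalette G c u v → degree G u ≤ degree G v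
    same-palette-degree c prop u v same = subst (degree G u ≤_) (length-map (c v) (nbrs v)) (inj-length (c u) (nbrs-unique u)
        (λ x y x∈ y∈ e → decide x y x∈ y∈ e (x Finₚ.≟ y))
        λ w w∈ → let w′ , e , eq = proj₁ (same (c u w)) (w , nbrs-edge w∈ , refl) in subst (_∈ map (c v) (nbrs v)) eq (∈-map⁺ (c v) (∈-nbrs e)))
      where
      decide : ∀ x y → x ∈ nbrs u → y ∈ nbrs u → c u x ≡ c u y → Dec (x ≡ y) → x ≡ y
      decide x y x∈ y∈ e (yes q) = q
      decide x y x∈ y∈ e (no k) = ⊥-elim (prop u x y (nbrs-edge x∈) (nbrs-edge y∈) k e)

    module Threshold (D : ℕ) where

      low : V → Bool
      low v = degree G v ≤ᵇ D

      low⁺ : ∀ {v} → degree G v ≤ D → low v ≡ true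
      low⁺ h = T⇒true (ℕₚ.≤⇒≤ᵇ h)
        where
        T⇒true : ∀ {b} → T b → b ≡ true
        T⇒true {true} _ = refl

      low⁻ : ∀ {v} → low v ≡ true → degree G v ≤ D
      low⁻ {v} h = ℕₚ.≤ᵇ⇒≤ (degree G v) D (subst T (sym h) _)

      high : V → Bool
      high v = not (low v)

      H : V → V → Bool
      H u v = Adj u v ∧ (high u ∧ high v)

      H-edge : ∀ {u v} → H u v ≡ true → Edge G u v
      H-edge h = ∧-left h

      H-sym : ∀ {u v} → H u v ≡ true → H v u ≡ true
      H-sym {u} {v} h = ∧-intro (edge-sym (∧-left h)) (∧-intro (∧-right {high u} (∧-right {Adj u v} h)) (∧-left (∧-right {Adj u v} h)))

      dH : V → ℕ
      dH v = # (H v) (allFin n)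

      poor : V → Bool
      poor v = dH v ≤ᵇ D

      -- Pairs whose palettes are separated while the remaining edges are coloured.
      handled : V → V → Bool
      handled a b = Adj a b ∧ ((low a ∧ low b) ∨ (H a b ∧ (poor a ∧ poor b)))

      handled-sym : ∀ {a b} → handled a b ≡ true → handled b a ≡ true
      handled-sym {a} {b} h = ∧-intro (edge-sym (∧-left h)) (go (∨-case {low a ∧ low b} (∧-right {Adj a b} h)))
        where
        go : low a ∧ low b ≡ true ⊎ H a b ∧ (poor a ∧ poor b) ≡ true → (low b ∧ low a) ∨ (H b a ∧ (poor b ∧ poor a)) ≡ true
        go (inj₁ k) = ∨-left (∧-intro (∧-right {low a} k) (∧-left k))
        go (inj₂ k) = ∨-right {low b ∧ low a} (∧-intro (H-sym (∧-left k)) (∧-intro (∧-right {poor a} (∧-right {H a b} k)) (∧-left {poor a} (∧-right {H a b} k))))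

      partners : V → List V
      partners a = filterᵇ (handled a) (allFin n)

      partners-few : ∀ a → length (partners a) ≤ D
      partners-few a with bool-case (low a)
      ... | inj₁ l = ℕₚ.≤-trans (#-mono (handled a) (Adj a) (allFin n) λ _ _ h → ∧-left h) (low⁻ l)
      ... | inj₂ l with bool-case (poor a)
      ...   | inj₁ p = ℕₚ.≤-trans (#-mono (handled a) (H a) (allFin n) λ b _ h → go b (∨-case {low a ∧ low b} (∧-right {Adj a b} h))) (ℕₚ.≤ᵇ⇒≤ (dH a) D (subst T (sym p) _))
        where
        go : ∀ b → low a ∧ low b ≡ true ⊎ H a b ∧ (poor a ∧ poor b) ≡ true → H a b ≡ true
        go b (inj₁ k) = ⊥-elim (true≢false (∧-left k) l)
        go b (inj₂ k) = ∧-left k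
      ...   | inj₂ p = subst (_≤ D) (sym (#0 (handled a) (allFin n) λ b _ → ¬true⇒false λ h → go b (∨-case {low a ∧ low b} (∧-right {Adj a b} h)))) ℕ.z≤n
        where
        go : ∀ b → low a ∧ low b ≡ true ⊎ H a b ∧ (poor a ∧ poor b) ≡ true → ⊥
        go b (inj₁ k) = true≢false (∧-left k) l
        go b (inj₂ k) = true≢false (∧-left {poor a} (∧-right {H a b} k)) p

      record Seed (L : V → V → List ℕ) (B : ℕ) : Set where
        field
          c        : V → V → ℕ
          c-sym    : ∀ u v → H u v ≡ true → c u v ≡ c v u
          c-list   : ∀ u v → H u v ≡ true → c u v ∈ L u v
          c-proper : ∀ u v w → H u v ≡ true → H u w ≡ true → c u v ≡ c u w → v ≡ w
          Z        : V → ℕ → Bool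
          Z-few    : ∀ u v → Edge G u v → # (Z u) (L u v) ≤ B
          separate : ∀ u v → H u v ≡ true → poor v ≡ false → ∃ λ w → H v w ≡ true × Z u (c v w) ≡ true × (∀ z → H u z ≡ true → c u z ≢ c v w)

  module Extend {n : ℕ} (G : Graph n) (D : ℕ) (isolated : NoIsolatedEdge G) (Δ : ℕ) (deg≤ : ∀ v → degree G v ≤ Δ) (k : ℕ) (L : Fin n → Fin n → List ℕ) (L-sym : ∀ u v → Edge G u v → L u v ≡ L v u)
    (L-size : ∀ u v → Edge G u v → Unique (L u v) × length (L u v) ≡ k) (B : ℕ) (room : Δ + D + (B + B) + (D + D) < k) (seed : Colouring.Threshold.Seed G D L B) where

    open Graph G renaming (sym to Adj-sym)
    open Colouring G
    open Threshold D

    open Seed seed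

    Partial : Set
    Partial = V → V → Maybe ℕ

    light : V → V → Bool
    light u v = low u ∨ low v

    record Good (pc : Partial) : Set where
      field
        symm   : ∀ u v → pc u v ≡ pc v u
        edges  : ∀ {u v x} → pc u v ≡ just x → Edge G u v
        listed : ∀ {u v x} → pc u v ≡ just x → x ∈ L u v
        proper : ∀ {u v w x} → pc u v ≡ just x → pc u w ≡ just x → v ≡ w
        avoids : ∀ {u v x} → pc u v ≡ just x → light u v ≡ true → Z u x ≡ false
        heavy  : ∀ u v → H u v ≡ true → pc u v ≡ just (c u v)
        apart  : ∀ a b → handled a b ≡ true → (∀ w → Edge G a w → w ≢ b → pc a w ≢ nothing) → (∀ w → Edge G b w → w ≢ a → pc b w ≢ nothing) →
                 (∃ λ x → (∃ λ w → w ≢ b × pc a w ≡ just x) × (∀ w → w ≢ a → pc b w ≢ just x)) ⊎ (∃ λ x → (∃ λ w → w ≢ a × pc b w ≡ just x) × (∀ w → w ≢ b → pc a w ≢ just x))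

    used : Partial → V → List ℕ
    used pc u = mapMaybe (pc u) (nbrs u)

    ∈-mapMaybe : ∀ {A B : Set} (f : A → Maybe B) {x y xs} → x ∈ xs → f x ≡ just y → y ∈ mapMaybe f xs
    ∈-mapMaybe f {x} (here refl) e rewrite e = here refl
    ∈-mapMaybe f {xs = z ∷ xs} (there x∈) e with f z
    ... | just _ = there (∈-mapMaybe f x∈ e)
    ... | nothing = ∈-mapMaybe f x∈ e

    mapMaybe-∈ : ∀ {A B : Set} (f : A → Maybe B) {y} xs → y ∈ mapMaybe f xs → ∃ λ x → x ∈ xs × f x ≡ just y
    mapMaybe-∈ f (z ∷ xs) h with f z in e
    mapMaybe-∈ f (z ∷ xs) (here refl) | just _ = z , here refl , e
    mapMaybe-∈ f (z ∷ xs) (there h) | just _ = let x , x∈ , k = mapMaybe-∈ f xs h in x , there x∈ , k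
    mapMaybe-∈ f (z ∷ xs) h | nothing = let x , x∈ , k = mapMaybe-∈ f xs h in x , there x∈ , k

    open Eq ℕ._≟_

    head′ : List ℕ → List ℕ
    head′ [] = []
    head′ (x ∷ _) = x ∷ []

    fresh : Partial → V → V → List ℕ
    fresh pc a b = head′ (filterᵇ (λ x → not (x ∈ᵇ used pc a)) (used pc b))

    fresh-size : ∀ pc a b → length (fresh pc a b) ≤ 1
    fresh-size pc a b with filterᵇ (λ x → not (x ∈ᵇ used pc a)) (used pc b)
    ... | [] = ℕ.z≤n
    ... | _ ∷ _ = ℕ.s≤s ℕ.z≤n

    fresh-spec : ∀ pc a b → (∃ λ y → y ∈ fresh pc a b × y ∈ used pc b × ¬ y ∈ used pc a) ⊎ (∀ y → y ∈ used pc b → y ∈ used pc a)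
    fresh-spec pc a b with filterᵇ (λ x → not (x ∈ᵇ used pc a)) (used pc b) in eq
    ... | y ∷ ys = inj₁ (y , here refl , let p , q = ∈-filterᵇ⁻ (λ x → not (x ∈ᵇ used pc a)) (used pc b) (subst (y ∈_) (sym eq) (here refl)) in p , ∉ᵇ (used pc a) (not-elim q))
    ... | [] = inj₂ λ y y∈ → inside y y∈ (bool-case (y ∈ᵇ used pc a))
      where
      none : ∀ y → ¬ y ∈ []
      none y ()
      inside : ∀ y → y ∈ used pc b → y ∈ᵇ used pc a ≡ true ⊎ y ∈ᵇ used pc a ≡ false → y ∈ used pc a
      inside y y∈ (inj₁ e) = ∈ᵇ⁻ (used pc a) e
      inside y y∈ (inj₂ e) = ⊥-elim (none y (subst (y ∈_) eq (∈-filterᵇ⁺ (λ x → not (x ∈ᵇ used pc a)) y∈ (not-true e))))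

    forbidden : Partial → V → V → List ℕ
    forbidden pc u v = (used pc u ++ used pc v) ++ ((filterᵇ (Z u) (L u v) ++ filterᵇ (Z v) (L u v)) ++ (concatMap (fresh pc u) (partners u) ++ concatMap (fresh pc v) (partners v)))

    forbidden-size : ∀ pc u v → Edge G u v → light u v ≡ true → length (forbidden pc u v) < k
    forbidden-size pc u v e l = ℕₚ.≤-<-trans (subst (_≤ Δ + D + (B + B) + (D + D)) (sym size) total) room
      where
      U W : ℕ
      U = length (used pc u)
      W = length (used pc v)
      size : length (forbidden pc u v) ≡ (U + W) + (# (Z u) (L u v) + # (Z v) (L u v)) + (length (concatMap (fresh pc u) (partners u)) + length (concatMap (fresh pc v) (partners v)))
      size = trans (length-++ (used pc u ++ used pc v)) (trans (cong₂ _+_ (length-++ (used pc u)) (trans (length-++ (filterᵇ (Z u) (L u v) ++ filterᵇ (Z v) (L u v))) (cong₂ _+_ (length-++ (filterᵇ (Z u) (L u v))) (length-++ (concatMap (fresh pc u) (partners u))))))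
         (sym (ℕₚ.+-assoc (U + W) _ _)))
      used≤ : ∀ w → length (used pc w) ≤ degree G w
      used≤ w = length-mapMaybe (pc w) (nbrs w)
      both : low u ≡ true ⊎ low v ≡ true → U + W ≤ Δ + D
      both (inj₁ h) = subst (_≤ Δ + D) (ℕₚ.+-comm W U) (ℕₚ.+-mono-≤ (ℕₚ.≤-trans (used≤ v) (deg≤ v)) (ℕₚ.≤-trans (used≤ u) (low⁻ h)))
      both (inj₂ h) = ℕₚ.+-mono-≤ (ℕₚ.≤-trans (used≤ u) (deg≤ u)) (ℕₚ.≤-trans (used≤ v) (low⁻ h))
      part : ∀ a → length (concatMap (fresh pc a) (partners a)) ≤ D
      part a = ℕₚ.≤-trans (concatMap-length (fresh pc a) (partners a) λ b _ → fresh-size pc a b) (subst (_≤ D) (sym (ℕₚ.*-identityʳ _)) (partners-few a))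
      total : (U + W) + (# (Z u) (L u v) + # (Z v) (L u v)) + (length (concatMap (fresh pc u) (partners u)) + length (concatMap (fresh pc v) (partners v))) ≤ Δ + D + (B + B) + (D + D)
      total = ℕₚ.+-mono-≤ (ℕₚ.+-mono-≤ (both (∨-case {low u} l)) (ℕₚ.+-mono-≤ (Z-few u v e) (subst (λ l → # (Z v) l ≤ B) (sym (L-sym u v e)) (Z-few v u (edge-sym e))))) (ℕₚ.+-mono-≤ (part u) (part v))

    choose : ∀ pc u v → Edge G u v → light u v ≡ true → ∃ λ x → x ∈ L u v × ¬ x ∈ forbidden pc u v
    choose pc u v e l with bool-case (any (λ x → not (x ∈ᵇ forbidden pc u v)) (L u v))
    ... | inj₁ h = let x , x∈ , b = any⁻ (λ x → not (x ∈ᵇ forbidden pc u v)) (L u v) h in x , x∈ , ∉ᵇ (forbidden pc u v) (not-elim b)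
    ... | inj₂ h = ⊥-elim (ℕₚ.<⇒≱ (forbidden-size pc u v e l) (subst (_≤ length (forbidden pc u v)) (proj₂ (L-size u v e))
          (unique-length (proj₁ (L-size u v e)) λ x x∈ → inside x x∈ (bool-case (x ∈ᵇ forbidden pc u v)))))
      where
      inside : ∀ x → x ∈ L u v → x ∈ᵇ forbidden pc u v ≡ true ⊎ x ∈ᵇ forbidden pc u v ≡ false → x ∈ forbidden pc u v
      inside x x∈ (inj₁ q) = ∈ᵇ⁻ (forbidden pc u v) q
      inside x x∈ (inj₂ q) = ⊥-elim (true≢false (any⁺ (λ x → not (x ∈ᵇ forbidden pc u v)) x∈ (not-true q)) h)

    open Eq (Finₚ._≟_ {n}) using () renaming (_==_ to _==ⱽ_; ==-refl to ==ⱽ-refl; ==-true to ==ⱽ-true; ==-false to ==ⱽ-false)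

    hit : V → V → V → V → Bool
    hit u v a b = ((a ==ⱽ u) ∧ (b ==ⱽ v)) ∨ ((a ==ⱽ v) ∧ (b ==ⱽ u))

    assign : Partial → V → V → ℕ → Partial
    assign pc u v x a b = if hit u v a b then just x else pc a b

    hit-case : ∀ {u v a b} → hit u v a b ≡ true → (a ≡ u × b ≡ v) ⊎ (a ≡ v × b ≡ u)
    hit-case {u} {v} {a} {b} h with ∨-case {(a ==ⱽ u) ∧ (b ==ⱽ v)} h
    ... | inj₁ k = inj₁ (==ⱽ-true (∧-left k) , ==ⱽ-true (∧-right {a ==ⱽ u} k))
    ... | inj₂ k = inj₂ (==ⱽ-true (∧-left k) , ==ⱽ-true (∧-right {a ==ⱽ v} k))

    hit-sym : ∀ u v a b → hit u v a b ≡ hit u v b a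
    hit-sym u v a b = bool-ext (go a b) (go b a)
      where
      go : ∀ a b → hit u v a b ≡ true → hit u v b a ≡ true
      go a b h with ∨-case {(a ==ⱽ u) ∧ (b ==ⱽ v)} h
      ... | inj₁ k = ∨-right {(b ==ⱽ u) ∧ (a ==ⱽ v)} (∧-intro (∧-right {a ==ⱽ u} k) (∧-left k))
      ... | inj₂ k = ∨-left (∧-intro (∧-right {a ==ⱽ v} k) (∧-left k))

    assign-hit : ∀ pc {u v x a b} → hit u v a b ≡ true → assign pc u v x a b ≡ just x
    assign-hit pc h rewrite h = refl

    assign-miss : ∀ pc {u v x a b} → hit u v a b ≡ false → assign pc u v x a b ≡ pc a b
    assign-miss pc h rewrite h = refl

    hit-here : ∀ u v → hit u v u v ≡ true
    hit-here u v = ∨-left (∧-intro (==ⱽ-refl u) (==ⱽ-refl v))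

    hit-there : ∀ u v → hit u v v u ≡ true
    hit-there u v = trans (hit-sym u v v u) (hit-here u v)

    assign-cases : ∀ pc {u v x a b y} → assign pc u v x a b ≡ just y → (x ≡ y × ((a ≡ u × b ≡ v) ⊎ (a ≡ v × b ≡ u))) ⊎ pc a b ≡ just y
    assign-cases pc {u} {v} {x} {a} {b} e with bool-case (hit u v a b)
    ... | inj₁ h = inj₁ (just-injective (trans (sym (assign-hit pc h)) e) , hit-case h)
    ... | inj₂ h = inj₂ (trans (sym (assign-miss pc h)) e)

    module Step {pc : Partial} (good : Good pc) (u v : V) (e : Edge G u v) (l : light u v ≡ true) (new : pc u v ≡ nothing) where

      open Good good

      x : ℕ
      x = proj₁ (choose pc u v e l)

      x∈ : x ∈ L u v
      x∈ = proj₁ (proj₂ (choose pc u v e l))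

      x∉ : ¬ x ∈ forbidden pc u v
      x∉ = proj₂ (proj₂ (choose pc u v e l))

      pc′ : Partial
      pc′ = assign pc u v x

      used⁺ : ∀ {a b y} → pc a b ≡ just y → y ∈ used pc a
      used⁺ {a} q = ∈-mapMaybe (pc a) (∈-nbrs (edges q)) q

      used⁻ : ∀ {a y} → y ∈ used pc a → ∃ λ b → pc a b ≡ just y
      used⁻ {a} h = let b , _ , q = mapMaybe-∈ (pc a) (nbrs a) h in b , q

      not-used : ∀ {a} → a ≡ u ⊎ a ≡ v → ¬ x ∈ used pc a
      not-used (inj₁ refl) h = x∉ (∈-++⁺ˡ (∈-++⁺ˡ h))
      not-used (inj₂ refl) h = x∉ (∈-++⁺ˡ (∈-++⁺ʳ (used pc u) h))

      not-Z : ∀ {a} → a ≡ u ⊎ a ≡ v → Z a x ≡ false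
      not-Z (inj₁ refl) = ¬true⇒false λ q → x∉ (∈-++⁺ʳ (used pc u ++ used pc v) (∈-++⁺ˡ (∈-++⁺ˡ (∈-filterᵇ⁺ (Z u) x∈ q))))
      not-Z (inj₂ refl) = ¬true⇒false λ q → x∉ (∈-++⁺ʳ (used pc u ++ used pc v) (∈-++⁺ˡ (∈-++⁺ʳ (filterᵇ (Z u) (L u v)) (∈-filterᵇ⁺ (Z v) x∈ q))))

      not-fresh : ∀ {a b} → a ≡ u ⊎ a ≡ v → handled a b ≡ true → ¬ x ∈ fresh pc a b
      not-fresh {b = b} (inj₁ refl) h q = x∉ (∈-++⁺ʳ (used pc u ++ used pc v) (∈-++⁺ʳ (filterᵇ (Z u) (L u v) ++ filterᵇ (Z v) (L u v)) (∈-++⁺ˡ (∈-concatMap (fresh pc u) (∈-filterᵇ⁺ (handled u) (∈-allFin b) h) q))))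
      not-fresh {b = b} (inj₂ refl) h q = x∉ (∈-++⁺ʳ (used pc u ++ used pc v) (∈-++⁺ʳ (filterᵇ (Z u) (L u v) ++ filterᵇ (Z v) (L u v)) (∈-++⁺ʳ (concatMap (fresh pc u) (partners u)) (∈-concatMap (fresh pc v) (∈-filterᵇ⁺ (handled v) (∈-allFin b) h) q))))

      pc⊆ : ∀ {a b y} → pc a b ≡ just y → pc′ a b ≡ just y
      pc⊆ {a} {b} {y} q with bool-case (hit u v a b)
      ... | inj₂ h = trans (assign-miss pc h) q
      ... | inj₁ h = ⊥-elim (go (hit-case h))
        where
        clash : just y ≡ nothing → ⊥
        clash ()
        go : (a ≡ u × b ≡ v) ⊎ (a ≡ v × b ≡ u) → ⊥
        go (inj₁ (refl , refl)) = clash (trans (sym q) new)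
        go (inj₂ (refl , refl)) = clash (trans (sym q) (trans (symm v u) new))

      separated : ∀ a a′ b → (a ≡ u × a′ ≡ v) ⊎ (a ≡ v × a′ ≡ u) → handled a b ≡ true → b ≢ a′ → b ≢ a →
                  (∃ λ y → (∃ λ w → w ≢ b × pc′ a w ≡ just y) × (∀ w → w ≢ a → pc′ b w ≢ just y)) ⊎ (∃ λ y → (∃ λ w → w ≢ a × pc′ b w ≡ just y) × (∀ w → w ≢ b → pc′ a w ≢ just y))
      separated a a′ b p h b≢a′ b≢a with fresh-spec pc a b
      ... | inj₁ (y , y∈ , yb , ya) = let w , q = used⁻ {b} yb in
          inj₂ (y , (w , (λ { refl → ya (used⁺ {a} {b} (trans (symm a b) q)) }) , pc⊆ q) , λ z _ k → go z (assign-cases pc k))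
        where
        go : ∀ z → (x ≡ y × ((a ≡ u × z ≡ v) ⊎ (a ≡ v × z ≡ u))) ⊎ pc a z ≡ just y → ⊥
        go z (inj₁ (refl , _)) = not-fresh (side p) h y∈
          where
          side : (a ≡ u × a′ ≡ v) ⊎ (a ≡ v × a′ ≡ u) → a ≡ u ⊎ a ≡ v
          side (inj₁ (s , _)) = inj₁ s
          side (inj₂ (s , _)) = inj₂ s
        go z (inj₂ k) = ya (used⁺ k)
      ... | inj₂ sub = inj₁ (x , (a′ , (λ s → b≢a′ (sym s)) , new-colour p) , λ w _ k → go w (assign-cases pc k))
        where
        new-colour : (a ≡ u × a′ ≡ v) ⊎ (a ≡ v × a′ ≡ u) → pc′ a a′ ≡ just x
        new-colour (inj₁ (refl , refl)) = assign-hit pc (hit-here u v)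
        new-colour (inj₂ (refl , refl)) = assign-hit pc (hit-there u v)
        ends : (a ≡ u × a′ ≡ v) ⊎ (a ≡ v × a′ ≡ u) → b ≡ u ⊎ b ≡ v → ⊥
        ends (inj₁ (refl , refl)) (inj₁ s) = b≢a s
        ends (inj₁ (refl , refl)) (inj₂ s) = b≢a′ s
        ends (inj₂ (refl , refl)) (inj₁ s) = b≢a′ s
        ends (inj₂ (refl , refl)) (inj₂ s) = b≢a s
        at : (a ≡ u × a′ ≡ v) ⊎ (a ≡ v × a′ ≡ u) → a ≡ u ⊎ a ≡ v
        at (inj₁ (s , _)) = inj₁ s
        at (inj₂ (s , _)) = inj₂ s
        go : ∀ w → (x ≡ x × ((b ≡ u × w ≡ v) ⊎ (b ≡ v × w ≡ u))) ⊎ pc b w ≡ just x → ⊥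
        go w (inj₁ (_ , inj₁ (s , _))) = ends p (inj₁ s)
        go w (inj₁ (_ , inj₂ (s , _))) = ends p (inj₂ s)
        go w (inj₂ k) = not-used (at p) (sub x (used⁺ k))

      swap⊎ : ∀ {A B : Set} → A ⊎ B → B ⊎ A
      swap⊎ (inj₁ a) = inj₂ a
      swap⊎ (inj₂ b) = inj₁ b

      -- The edge between a and b plays no role in whether the pair is separated.
      off : ∀ {a b w} → (a ≡ u × b ≡ v) ⊎ (a ≡ v × b ≡ u) → w ≢ b → pc′ a w ≡ pc a w
      off {a} {b} {w} p n = assign-miss pc (¬true⇒false λ h → go p (hit-case h))
        where
        go : (a ≡ u × b ≡ v) ⊎ (a ≡ v × b ≡ u) → (a ≡ u × w ≡ v) ⊎ (a ≡ v × w ≡ u) → ⊥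
        go (inj₁ (refl , refl)) (inj₁ (_ , refl)) = n refl
        go (inj₁ (refl , refl)) (inj₂ (s , _)) = loopless e s
        go (inj₂ (refl , refl)) (inj₁ (s , _)) = loopless e (sym s)
        go (inj₂ (refl , refl)) (inj₂ (_ , refl)) = n refl

      elsewhere : ∀ {a} → a ≢ u → a ≢ v → ∀ w → pc′ a w ≡ pc a w
      elsewhere n m w = assign-miss pc (¬true⇒false λ h → [ (λ s → n (proj₁ s)) , (λ s → m (proj₁ s)) ]′ (hit-case h))

      transfer : ∀ a b → handled a b ≡ true → (∀ w → w ≢ b → pc′ a w ≡ pc a w) → (∀ w → w ≢ a → pc′ b w ≡ pc b w) →
                 (∀ w → Edge G a w → w ≢ b → pc′ a w ≢ nothing) → (∀ w → Edge G b w → w ≢ a → pc′ b w ≢ nothing) →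
                 (∃ λ y → (∃ λ w → w ≢ b × pc′ a w ≡ just y) × (∀ w → w ≢ a → pc′ b w ≢ just y)) ⊎ (∃ λ y → (∃ λ w → w ≢ a × pc′ b w ≡ just y) × (∀ w → w ≢ b → pc′ a w ≢ just y))
      transfer a b h ea eb fa fb with apart a b h (λ w k n q → fa w k n (trans (ea w n) q)) (λ w k n q → fb w k n (trans (eb w n) q))
      ... | inj₁ (y , (w , n , q) , r) = inj₁ (y , (w , n , trans (ea w n) q) , λ z m s → r z m (trans (sym (eb z m)) s))
      ... | inj₂ (y , (w , n , q) , r) = inj₂ (y , (w , n , trans (eb w n) q) , λ z m s → r z m (trans (sym (ea z m)) s))

      good′ : Good pc′
      good′ = record
        { symm = λ a b → cong₂ (λ h m → if h then just x else m) (hit-sym u v a b) (symm a b)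
        ; edges = λ q → [ (λ { (_ , inj₁ (refl , refl)) → e ; (_ , inj₂ (refl , refl)) → edge-sym e }) , edges ]′ (assign-cases pc q)
        ; listed = λ q → [ (λ { (refl , inj₁ (refl , refl)) → x∈ ; (refl , inj₂ (refl , refl)) → subst (x ∈_) (L-sym u v e) x∈ }) , listed ]′ (assign-cases pc q)
        ; proper = λ q r → prop (assign-cases pc q) (assign-cases pc r)
        ; avoids = λ q k → [ (λ { (refl , inj₁ (refl , refl)) → not-Z (inj₁ refl) ; (refl , inj₂ (refl , refl)) → not-Z (inj₂ refl) }) , (λ s → avoids s k) ]′ (assign-cases pc q)
        ; heavy = λ a b h → pc⊆ (heavy a b h)
        ; apart = λ a b h fa fb → separate′ a b h fa fb (a Finₚ.≟ u) (a Finₚ.≟ v) (b Finₚ.≟ u) (b Finₚ.≟ v)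
        }
        where
        prop : ∀ {a b d y} → (x ≡ y × ((a ≡ u × b ≡ v) ⊎ (a ≡ v × b ≡ u))) ⊎ pc a b ≡ just y → (x ≡ y × ((a ≡ u × d ≡ v) ⊎ (a ≡ v × d ≡ u))) ⊎ pc a d ≡ just y → b ≡ d
        prop (inj₁ (_ , inj₁ (refl , refl))) (inj₁ (_ , inj₁ (_ , refl))) = refl
        prop (inj₁ (_ , inj₁ (refl , refl))) (inj₁ (_ , inj₂ (s , _))) = ⊥-elim (loopless e s)
        prop (inj₁ (_ , inj₂ (refl , refl))) (inj₁ (_ , inj₁ (s , _))) = ⊥-elim (loopless e (sym s))
        prop (inj₁ (_ , inj₂ (refl , refl))) (inj₁ (_ , inj₂ (_ , refl))) = refl
        prop (inj₁ (refl , inj₁ (refl , refl))) (inj₂ q) = ⊥-elim (not-used (inj₁ refl) (used⁺ q))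
        prop (inj₁ (refl , inj₂ (refl , refl))) (inj₂ q) = ⊥-elim (not-used (inj₂ refl) (used⁺ q))
        prop (inj₂ q) (inj₁ (refl , inj₁ (refl , refl))) = ⊥-elim (not-used (inj₁ refl) (used⁺ q))
        prop (inj₂ q) (inj₁ (refl , inj₂ (refl , refl))) = ⊥-elim (not-used (inj₂ refl) (used⁺ q))
        prop (inj₂ q) (inj₂ r) = proper q r
        separate′ : ∀ a b → handled a b ≡ true → (∀ w → Edge G a w → w ≢ b → pc′ a w ≢ nothing) → (∀ w → Edge G b w → w ≢ a → pc′ b w ≢ nothing) →
                 Dec (a ≡ u) → Dec (a ≡ v) → Dec (b ≡ u) → Dec (b ≡ v) →
                 (∃ λ y → (∃ λ w → w ≢ b × pc′ a w ≡ just y) × (∀ w → w ≢ a → pc′ b w ≢ just y)) ⊎ (∃ λ y → (∃ λ w → w ≢ a × pc′ b w ≡ just y) × (∀ w → w ≢ b → pc′ a w ≢ just y))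
        separate′ a b h fa fb (yes refl) _ (yes s) _ = ⊥-elim (loopless (∧-left h) (sym s))
        separate′ a b h fa fb (yes refl) _ (no _) (yes refl) = transfer a b h (λ w → off (inj₁ (refl , refl))) (λ w → off (inj₂ (refl , refl))) fa fb
        separate′ a b h fa fb (yes refl) _ (no p) (no m) = separated u v b (inj₁ (refl , refl)) h m p
        separate′ a b h fa fb (no _) (yes refl) (yes refl) _ = transfer a b h (λ w → off (inj₂ (refl , refl))) (λ w → off (inj₁ (refl , refl))) fa fb
        separate′ a b h fa fb (no _) (yes refl) (no _) (yes s) = ⊥-elim (loopless (∧-left h) (sym s))
        separate′ a b h fa fb (no _) (yes refl) (no p) (no m) = separated v u b (inj₂ (refl , refl)) h p m
        separate′ a b h fa fb (no p) (no m) (yes refl) _ = swap⊎ (separated u v a (inj₁ (refl , refl)) (handled-sym {a} {b} h) m p)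
        separate′ a b h fa fb (no p) (no m) (no _) (yes refl) = swap⊎ (separated v u a (inj₂ (refl , refl)) (handled-sym {a} {b} h) p m)
        separate′ a b h fa fb (no p) (no m) (no p′) (no m′) = transfer a b h (λ w _ → elsewhere p m w) (λ w _ → elsewhere p′ m′ w) fa fb

    start : Partial
    start u v = if H u v then just (c u v) else nothing

    start-just : ∀ {u v x} → start u v ≡ just x → H u v ≡ true × c u v ≡ x
    start-just {u} {v} q with H u v
    ... | true = refl , just-injective q

    start-heavy : ∀ u v → H u v ≡ true → start u v ≡ just (c u v)
    start-heavy u v h rewrite h = refl

    start-none : ∀ {u v} → H u v ≡ false → start u v ≡ nothing
    start-none h rewrite h = refl

    low⇒¬H : ∀ {a w} → low a ≡ true → H a w ≡ false
    low⇒¬H {a} {w} l = ¬true⇒false λ h → true≢false l (not-elim (∧-left (∧-right {Adj a w} h)))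

    light⇒¬H : ∀ {u v} → light u v ≡ true → H u v ≡ false
    light⇒¬H {u} {v} l with ∨-case {low u} l
    ... | inj₁ h = low⇒¬H h
    ... | inj₂ h = ¬true⇒false λ k → true≢false h (not-elim (∧-right {high u} (∧-right {Adj u v} k)))

    start-good : Good start
    start-good = record
      { symm = λ u v → symm u v (bool-case (H u v)) (bool-case (H v u))
      ; edges = λ q → H-edge (proj₁ (start-just q))
      ; listed = λ {u} {v} q → let h , e = start-just q in subst (_∈ L u v) e (c-list u v h)
      ; proper = λ {u} {v} {w} q r → let h , e = start-just q ; h′ , e′ = start-just r in c-proper u v w h h′ (trans e (sym e′))
      ; avoids = λ q l → ⊥-elim (true≢false (proj₁ (start-just q)) (light⇒¬H l))
      ; heavy = start-heavy
      ; apart = λ a b h fa fb → ⊥-elim (incomplete a b (∧-left h) fa fb (∨-case {low a ∧ low b} (∧-right {Adj a b} h)))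
      }
      where
      symm : ∀ u v → H u v ≡ true ⊎ H u v ≡ false → H v u ≡ true ⊎ H v u ≡ false → start u v ≡ start v u
      symm u v (inj₁ h) _ = trans (start-heavy u v h) (trans (cong just (c-sym u v h)) (sym (start-heavy v u (H-sym h))))
      symm u v (inj₂ h) (inj₁ k) = ⊥-elim (true≢false (H-sym k) h)
      symm u v (inj₂ h) (inj₂ k) = trans (start-none h) (sym (start-none k))
      incomplete : ∀ a b → Edge G a b → (∀ w → Edge G a w → w ≢ b → start a w ≢ nothing) → (∀ w → Edge G b w → w ≢ a → start b w ≢ nothing) →
                   low a ∧ low b ≡ true ⊎ H a b ∧ (poor a ∧ poor b) ≡ true → ⊥
      incomplete a b e fa fb (inj₁ l) = isolated a b e (single a b e (∧-left l) fa , single b a (edge-sym e) (∧-right {low a} l) fb)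
        where
        single : ∀ a b → Edge G a b → low a ≡ true → (∀ w → Edge G a w → w ≢ b → start a w ≢ nothing) → degree G a ≡ 1
        single a b e l f = ℕₚ.≤-antisym (unique-length (nbrs-unique a) λ w w∈ → only w (nbrs-edge w∈) (w Finₚ.≟ b)) (nonempty (∈-nbrs e))
          where
          only : ∀ w → Edge G a w → Dec (w ≡ b) → w ∈ b ∷ []
          only w k (yes refl) = here refl
          only w k (no m) = ⊥-elim (f w k m (start-none (low⇒¬H l)))
          nonempty : ∀ {xs} → b ∈ xs → 1 ≤ length xs
          nonempty (here _) = ℕ.s≤s ℕ.z≤n
          nonempty (there _) = ℕ.s≤s ℕ.z≤n
      incomplete a b e fa fb (inj₂ k) with bool-case (any (λ w → Adj a w ∧ not (H a w)) (allFin n))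
      ... | inj₁ y = let w , _ , m = any⁻ (λ w → Adj a w ∧ not (H a w)) (allFin n) y in
            fa w (∧-left m) (λ { refl → true≢false (∧-left k) (not-elim (∧-right {Adj a w} m)) }) (start-none (not-elim (∧-right {Adj a w} m)))
      ... | inj₂ z = true≢false (low⁺ (ℕₚ.≤-trans (#-mono (Adj a) (H a) (allFin n) λ w w∈ q → heavy-nbr w q (bool-case (H a w)))
              (ℕₚ.≤ᵇ⇒≤ (dH a) D (subst T (sym (∧-left {poor a} (∧-right {H a b} k))) _)))) (not-elim (∧-left (∧-right {Adj a b} (∧-left k))))
        where
        heavy-nbr : ∀ w → Adj a w ≡ true → H a w ≡ true ⊎ H a w ≡ false → H a w ≡ true
        heavy-nbr w q (inj₁ h) = h
        heavy-nbr w q (inj₂ h) = ⊥-elim (true≢false (any⁺ (λ w → Adj a w ∧ not (H a w)) (∈-allFin w) (∧-intro q (not-true h))) z)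

    Done : Partial → Partial → List (V × V) → Set
    Done pc pc′ es = (∀ a b → pc a b ≢ nothing → pc′ a b ≢ nothing) × (∀ u v → (u , v) ∈ es → Edge G u v → light u v ≡ true → pc′ u v ≢ nothing)

    run : ∀ es pc → Good pc → ∃ λ pc′ → Good pc′ × Done pc pc′ es
    run [] pc g = pc , g , (λ _ _ h → h) , λ _ _ ()
    run ((u , v) ∷ es) pc g with pc u v in eq | bool-case (Adj u v ∧ light u v)
    ... | just x | _ = let pc′ , g′ , m , d = run es pc g in pc′ , g′ , m ,
          λ { _ _ (here refl) _ _ → m u v (λ q → nope (trans (sym eq) q)) ; a b (there h) e l → d a b h e l }
      where
      nope : just x ≡ nothing → ⊥
      nope ()
    ... | nothing | inj₂ h = let pc′ , g′ , m , d = run es pc g in pc′ , g′ , m ,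
          λ { _ _ (here refl) e l → ⊥-elim (true≢false (∧-intro e l) h) ; a b (there k) e l → d a b k e l }
    ... | nothing | inj₁ h = let pc′ , g′ , m , d = run es (assign pc u v S.x) S.good′ in pc′ , g′ , (λ a b q → m a b (keeps a b q)) ,
          λ { _ _ (here refl) e l → m u v (λ q → nope (trans (sym (assign-hit pc (hit-here u v))) q)) ; a b (there k) e l → d a b k e l }
      where
      module S = Step g u v (∧-left h) (∧-right {Adj u v} h) eq
      nope : ∀ {x : ℕ} → just x ≡ nothing → ⊥
      nope ()
      keeps : ∀ a b → pc a b ≢ nothing → assign pc u v S.x a b ≢ nothing
      keeps a b q with hit u v a b
      ... | true = λ ()
      ... | false = q

    private
      final : ∃ λ pc → Good pc × Done start pc (cartesianProduct (allFin n) (allFin n))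
      final = run (cartesianProduct (allFin n) (allFin n)) start start-good

      from-final : (∃ λ pc → Good pc × Done start pc (cartesianProduct (allFin n) (allFin n))) →
                   Σ (EdgeColouring G) λ χ → (∀ u v → Edge G u v → Σ.proj₁ χ u v ∈ L u v) × AVD G (Σ.proj₁ χ)
      from-final (pc , g , m , d) = (colour , (λ u v → cong value (symm u v))) , (λ u v e → listed (coloured u v e)) , proper-colour , distinct
        where
        open Good g
        value : Maybe ℕ → ℕ
        value (just x) = x
        value nothing = 0
        colour : V → V → ℕ
        colour u v = value (pc u v)
        some : ∀ u v → Edge G u v → pc u v ≢ nothing
        some u v e with bool-case (H u v)
        ... | inj₁ h = λ q → nope (trans (sym (heavy u v h)) q)
          where
          nope : ∀ {x : ℕ} → just x ≡ nothing → ⊥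
          nope ()
        ... | inj₂ h = d u v (∈-cartesianProduct⁺ (∈-allFin u) (∈-allFin v)) e (light-edge (bool-case (low u)) (bool-case (low v)))
          where
          light-edge : low u ≡ true ⊎ low u ≡ false → low v ≡ true ⊎ low v ≡ false → light u v ≡ true
          light-edge (inj₁ l) _ = ∨-left l
          light-edge (inj₂ _) (inj₁ l) = ∨-right {low u} l
          light-edge (inj₂ l) (inj₂ l′) = ⊥-elim (true≢false (∧-intro e (∧-intro (not-true l) (not-true l′))) h)
        coloured : ∀ u v → Edge G u v → pc u v ≡ just (colour u v)
        coloured u v e with pc u v | some u v e
        ... | just x | _ = refl
        ... | nothing | q = ⊥-elim (q refl)
        proper-colour : Proper G colour
        proper-colour u v w e e′ v≢w eq = v≢w (proper (coloured u v e) (trans (coloured u w e′) (cong just (sym eq))))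
        distinct : ∀ u v → Edge G u v → ¬ SamePalette G colour u v
        distinct u v e same = by-degree (ℕₚ.≤-antisym (same-palette-degree colour proper-colour u v same) (same-palette-degree colour proper-colour v u (λ x → proj₂ (same x) , proj₁ (same x))))
          where
          pair-apart : ∀ a b → Edge G a b → handled a b ≡ true → SamePalette G colour a b → ⊥
          pair-apart a b e h same with apart a b h (λ w k _ → some a w k) (λ w k _ → some b w k)
          ... | inj₁ (x , (w , n , q) , r) = contradict a b e w n q r (proj₁ (same x))
            where
            contradict : ∀ a b → Edge G a b → ∀ w → w ≢ b → pc a w ≡ just x → (∀ z → z ≢ a → pc b z ≢ just x) → (InPalette G colour a x → InPalette G colour b x) → ⊥
            contradict a b e w n q r f with f (w , edges q , cong value q)
            ... | z , k , eq with z Finₚ.≟ a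
            ...   | no m = r z m (trans (coloured b z k) (cong just eq))
            ...   | yes refl = n (proper q (trans (symm a b) (trans (coloured b a k) (cong just eq))))
          ... | inj₂ (x , (w , n , q) , r) = contradict b a (edge-sym e) w n q r (proj₂ (same x))
            where
            contradict : ∀ a b → Edge G a b → ∀ w → w ≢ b → pc a w ≡ just x → (∀ z → z ≢ a → pc b z ≢ just x) → (InPalette G colour a x → InPalette G colour b x) → ⊥
            contradict a b e w n q r f with f (w , edges q , cong value q)
            ... | z , k , eq with z Finₚ.≟ a
            ...   | no m = r z m (trans (coloured b z k) (cong just eq))
            ...   | yes refl = n (proper q (trans (symm a b) (trans (coloured b a k) (cong just eq))))
          rich-apart : ∀ a b → H a b ≡ true → poor b ≡ false → (∀ x → InPalette G colour b x → InPalette G colour a x) → ⊥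
          rich-apart a b h p f with separate a b h p
          ... | w , hw , z , no-H with f (c b w) (w , H-edge hw , cong value (heavy b w hw))
          ...   | y , k , eq with bool-case (H a y)
          ...     | inj₁ hy = no-H y hy (trans (sym (cong value (heavy a y hy))) eq)
          ...     | inj₂ ny = true≢false z (avoids (trans (coloured a y k) (cong just eq)) (light-edge (bool-case (low a)) (bool-case (low y))))
            where
            light-edge : low a ≡ true ⊎ low a ≡ false → low y ≡ true ⊎ low y ≡ false → light a y ≡ true
            light-edge (inj₁ l) _ = ∨-left l
            light-edge (inj₂ _) (inj₁ l) = ∨-right {low a} l
            light-edge (inj₂ l) (inj₂ l′) = ⊥-elim (true≢false (∧-intro k (∧-intro (not-true l) (not-true l′))) ny)
          by-degree : degree G u ≡ degree G v → ⊥
          by-degree deq with bool-case (low u)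
          ... | inj₁ l = pair-apart u v e (∧-intro e (∨-left (∧-intro l (trans (cong (_≤ᵇ D) (sym deq)) l)))) same
          ... | inj₂ l = by-wealth (bool-case (poor u)) (bool-case (poor v))
            where
            h : H u v ≡ true
            h = ∧-intro e (∧-intro (not-true l) (not-true (trans (cong (_≤ᵇ D) (sym deq)) l)))
            by-wealth : poor u ≡ true ⊎ poor u ≡ false → poor v ≡ true ⊎ poor v ≡ false → ⊥
            by-wealth _ (inj₂ p) = rich-apart u v h p λ x → proj₂ (same x)
            by-wealth (inj₂ p) _ = rich-apart v u (H-sym h) p λ x → proj₁ (same x)
            by-wealth (inj₁ p) (inj₁ p′) = pair-apart u v e (∧-intro e (∨-right {low u ∧ low v} (∧-intro h (∧-intro p p′)))) same

    colouring : Σ (EdgeColouring G) λ χ → (∀ u v → Edge G u v → Σ.proj₁ χ u v ∈ L u v) × AVD G (Σ.proj₁ χ)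
    colouring = from-final final

module Numbers where

  open import Data.Nat using (_+_; _*_; _∸_; _^_; _≤_; _<_; z≤n; s≤s; ⌈_/2⌉; ⌊_/2⌋; NonZero)
  open import Data.Nat.Induction using (<-rec)
  open import Data.Nat.Logarithm using (⌈log₂_⌉; ⌈log₂⌉-mono-≤; ⌈log₂⌈n/2⌉⌉≡⌈log₂n⌉∸1)
  open import Data.Nat.Properties

  open +-*-Solver using (solve; con; _:+_; _:*_; _:=_)
  open ≤-Reasoning

  n≤2^⌈log₂n⌉ : ∀ n → n ≤ 2 ^ ⌈log₂ n ⌉
  n≤2^⌈log₂n⌉ = <-rec (λ n → n ≤ 2 ^ ⌈log₂ n ⌉) step
    where
    step : ∀ n → (∀ {m} → m < n → m ≤ 2 ^ ⌈log₂ m ⌉) → n ≤ 2 ^ ⌈log₂ n ⌉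
    step 0 _ = z≤n
    step 1 _ = ≤-refl
    step n@(suc (suc m)) rec = begin
      n                             ≡⟨ ⌊n/2⌋+⌈n/2⌉≡n n ⟨
      ⌊ n /2⌋ + ⌈ n /2⌉             ≤⟨ +-monoˡ-≤ ⌈ n /2⌉ (⌊n/2⌋≤⌈n/2⌉ n) ⟩
      ⌈ n /2⌉ + ⌈ n /2⌉             ≤⟨ +-mono-≤ half half ⟩
      2 ^ (l ∸ 1) + 2 ^ (l ∸ 1)     ≡⟨ cong (2 ^ (l ∸ 1) +_) (+-identityʳ (2 ^ (l ∸ 1))) ⟨
      2 ^ suc (l ∸ 1)               ≡⟨ cong (2 ^_) (m+[n∸m]≡n {1} {l} (⌈log₂⌉-mono-≤ {2} {n} (s≤s (s≤s z≤n)))) ⟩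
      2 ^ l                         ∎
      where
      l = ⌈log₂ n ⌉
      half : ⌈ n /2⌉ ≤ 2 ^ (l ∸ 1)
      half = subst (λ e → ⌈ n /2⌉ ≤ 2 ^ e) (⌈log₂⌈n/2⌉⌉≡⌈log₂n⌉∸1 n) (rec (⌈n/2⌉<n m))

  isqrt : ∀ n → ∃ λ r → r * r ≤ n × n < suc r * suc r
  isqrt zero = 0 , z≤n , s≤s z≤n
  isqrt (suc n) with isqrt n
  ... | r , a , b with suc r * suc r ≤? suc n
  ...   | yes h = suc r , h , <-≤-trans (s≤s b) (*-mono-< {suc r} (n<1+n (suc r)) (n<1+n (suc r)))
  ...   | no h = r , m≤n⇒m≤1+n a , ≰⇒> h

  *-^-distrib : ∀ x y n → (x * y) ^ n ≡ x ^ n * y ^ n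
  *-^-distrib x y zero = refl
  *-^-distrib x y (suc n) = trans (cong (x * y *_) (*-^-distrib x y n)) (solve 4 (λ a b c d → a :* b :* (c :* d) := a :* c :* (b :* d)) refl x y (x ^ n) (y ^ n))

  -- Bernoulli's inequality for 1 + 1/a, cleared of denominators.
  bernoulli-suc : ∀ a m → a ^ m * (a + m) ≤ suc a ^ m * a
  bernoulli-suc a zero = ≤-reflexive (cong (1 *_) (+-identityʳ a))
  bernoulli-suc a (suc m) = begin
    a * a ^ m * (a + suc m)          ≤⟨ m≤m+n _ (a ^ m * m) ⟩
    a * a ^ m * (a + suc m) + a ^ m * m ≡⟨ solve 3 (λ a m p → a :* p :* (a :+ (con 1 :+ m)) :+ p :* m := (con 1 :+ a) :* (p :* (a :+ m))) refl a m (a ^ m) ⟩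
    suc a * (a ^ m * (a + m))        ≤⟨ *-monoʳ-≤ (suc a) (bernoulli-suc a m) ⟩
    suc a * (suc a ^ m * a)          ≡⟨ *-assoc (suc a) (suc a ^ m) a ⟨
    suc a * suc a ^ m * a            ∎

  outgrows : ∀ a .{{_ : NonZero a}} e {s} → s ≤ 2 ^ e → a ^ (a * e) * s ≤ suc a ^ (a * e)
  outgrows a e {s} h = begin
    a ^ (a * e) * s        ≤⟨ *-monoʳ-≤ (a ^ (a * e)) h ⟩
    a ^ (a * e) * 2 ^ e    ≡⟨ cong (_* 2 ^ e) (^-*-assoc a a e) ⟨
    (a ^ a) ^ e * 2 ^ e    ≡⟨ *-^-distrib (a ^ a) 2 e ⟨
    (a ^ a * 2) ^ e        ≤⟨ ^-monoˡ-≤ e doubled ⟩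
    (suc a ^ a) ^ e        ≡⟨ ^-*-assoc (suc a) a e ⟩
    suc a ^ (a * e)        ∎
    where
    doubled : a ^ a * 2 ≤ suc a ^ a
    doubled = *-cancelʳ-≤ (a ^ a * 2) (suc a ^ a) a (subst (_≤ suc a ^ a * a) (solve 2 (λ p a → p :* (a :+ a) := p :* con 2 :* a) refl (a ^ a) a) (bernoulli-suc a a))

  record Parameters (C Δ : ℕ) : Set where
    field
      Θ r₁ f D : ℕ

    k : ℕ
    k = Δ + 8 * D

    m₀ : ℕ
    m₀ = r₁ * (suc (2 * Θ) * suc (2 * Θ))

    field
      1≤Θ     : 1 ≤ Θ
      1≤r₁    : 1 ≤ r₁
      k≤9r²   : D < Δ → k ≤ 9 * (r₁ * r₁)
      gap     : Δ + (340 * f + 760) * (Θ * (3 * r₁)) ≤ k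
      big     : D < Δ → 24 * (27 * (k * k) + 9 * (k * (4 * Δ))) * (2 * k * k * (3 * k)) ≤ 2 ^ Θ
      big′    : 7 ≤ 2 ^ Θ
      big″    : D < Δ → 24 * (Δ + Δ) * k ≤ 2 ^ Θ
      D-large : 512 * (m₀ + 1 + 68 * (Θ * (3 * r₁))) ≤ D
      fuel    : 1023 ^ f * (3 * r₁) ≤ 1024 ^ f
      within  : WithinBound C Δ k

  constant : (c₁ c₂ c₃ c₄ c₅ : ℕ) → ℕ
  constant c₁ c₂ c₃ c₄ c₅ = c₂ * (suc (2 * c₁) * suc (2 * c₁) + 1 + c₃ * (c₁ * 3)) + (340 * c₄ + c₅) * (c₁ * 3)

  -- The numeral constants are kept as variables so that they are not expanded.
  module Size (Λ r₁ c₁ c₂ c₃ c₄ c₅ : ℕ) (1≤Λ : 1 ≤ Λ) (1≤r₁ : 1 ≤ r₁) where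

    E m : ℕ
    E = constant c₁ c₂ c₃ c₄ c₅
    m = r₁ * (suc (2 * (c₁ * Λ)) * suc (2 * (c₁ * Λ)))

    size : c₂ * (m + 1 + c₃ * (c₁ * Λ * (3 * r₁))) + (340 * (c₄ * Λ) + c₅) * (c₁ * Λ * (3 * r₁)) ≤ E * (r₁ * (Λ * Λ))
    size = begin
      c₂ * (m + 1 + c₃ * (c₁ * Λ * (3 * r₁))) + (340 * (c₄ * Λ) + c₅) * (c₁ * Λ * (3 * r₁))
        ≤⟨ +-mono-≤ (*-monoʳ-≤ c₂ (+-mono-≤ (+-mono-≤ (*-monoʳ-≤ r₁ (*-mono-≤ w w)) one) (*-monoʳ-≤ c₃ (*-monoˡ-≤ (3 * r₁) (*-monoʳ-≤ c₁ square)))))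
                    (*-monoˡ-≤ (c₁ * Λ * (3 * r₁)) (+-monoʳ-≤ (340 * (c₄ * Λ)) (≤-trans (≤-reflexive (sym (*-identityʳ c₅))) (*-monoʳ-≤ c₅ 1≤Λ)))) ⟩
      c₂ * (r₁ * (suc (2 * c₁) * Λ * (suc (2 * c₁) * Λ)) + r₁ * (Λ * Λ) + c₃ * (c₁ * (Λ * Λ) * (3 * r₁))) + (340 * (c₄ * Λ) + c₅ * Λ) * (c₁ * Λ * (3 * r₁))
        ≡⟨ solve 8 (λ a b c d e n l r → b :* (r :* ((con 1 :+ con 2 :* a) :* l :* ((con 1 :+ con 2 :* a) :* l)) :+ r :* (l :* l) :+ c :* (a :* (l :* l) :* (con 3 :* r))) :+ (n :* (d :* l) :+ e :* l) :* (a :* l :* (con 3 :* r))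
             := (b :* ((con 1 :+ con 2 :* a) :* (con 1 :+ con 2 :* a) :+ con 1 :+ c :* (a :* con 3)) :+ (n :* d :+ e) :* (a :* con 3)) :* (r :* (l :* l))) refl c₁ c₂ c₃ c₄ c₅ 340 Λ r₁ ⟩
      E * (r₁ * (Λ * Λ)) ∎
      where
      w : suc (2 * (c₁ * Λ)) ≤ suc (2 * c₁) * Λ
      w = ≤-trans (+-monoˡ-≤ (2 * (c₁ * Λ)) 1≤Λ) (≤-reflexive (solve 2 (λ c l → l :+ con 2 :* (c :* l) := (con 1 :+ con 2 :* c) :* l) refl c₁ Λ))
      one : 1 ≤ r₁ * (Λ * Λ)
      one = *-mono-≤ 1≤r₁ (*-mono-≤ 1≤Λ 1≤Λ)
      square : Λ ≤ Λ * Λ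
      square = ≤-trans (≤-reflexive (sym (*-identityˡ Λ))) (*-monoˡ-≤ Λ 1≤Λ)

  within-bound : ∀ {D E r₁ Δ} → D ≤ E * (r₁ * (⌈log₂ Δ ⌉ * ⌈log₂ Δ ⌉)) → 1 ≤ ⌈log₂ Δ ⌉ → r₁ * r₁ ≤ 4 * Δ → WithinBound (16 * E) Δ (Δ + 8 * D)
  within-bound {D} {E} {r₁} {Δ} h 1≤Λ r²≤ = begin
    (Δ + 8 * D ∸ Δ) ^ 2                    ≡⟨ cong (_^ 2) (m+n∸m≡n Δ (8 * D)) ⟩
    (8 * D) ^ 2                            ≤⟨ ^-monoˡ-≤ 2 (*-monoʳ-≤ 8 h) ⟩
    (8 * (E * (r₁ * (Λ * Λ)))) ^ 2         ≡⟨ solve 3 (λ e r l → (con 8 :* (e :* (r :* (l :* l)))) :* ((con 8 :* (e :* (r :* (l :* l)))) :* con 1) := con 64 :* (e :* e) :* (r :* r) :* (l :* (l :* (l :* l)))) refl E r₁ Λ ⟩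
    64 * (E * E) * (r₁ * r₁) * (Λ * (Λ * (Λ * Λ))) ≤⟨ *-mono-≤ (*-monoʳ-≤ (64 * (E * E)) r²≤) (*-monoʳ-≤ Λ (*-monoʳ-≤ Λ (*-monoʳ-≤ Λ (≤-trans (≤-reflexive (sym (*-identityʳ Λ))) (*-monoʳ-≤ Λ one))))) ⟩
    64 * (E * E) * (4 * Δ) * (Λ * (Λ * (Λ * (Λ * (Λ * (Λ * (Λ * (Λ * 1))))))))
        ≡⟨ cong (_* (Λ ^ 8)) (solve 2 (λ e d → con 64 :* (e :* e) :* (con 4 :* d) := (con 16 :* e) :* ((con 16 :* e) :* con 1) :* d) refl E Δ) ⟩
    (16 * E) ^ 2 * Δ * Λ ^ 8               ∎
    where
    Λ = ⌈log₂ Δ ⌉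
    one : 1 ≤ Λ * (Λ * (Λ * (Λ * 1)))
    one = ^-monoˡ-≤ 4 1≤Λ

  module Powers (Λ : ℕ) (1≤Λ : 1 ≤ Λ) where

    pow-* : ∀ a b → 2 ^ (a * Λ) * 2 ^ (b * Λ) ≡ 2 ^ ((a + b) * Λ)
    pow-* a b = trans (sym (^-distribˡ-+-* 2 (a * Λ) (b * Λ))) (cong (2 ^_) (sym (*-distribʳ-+ Λ a b)))

    pow-≤ : ∀ {a b} → a ≤ b → 2 ^ (a * Λ) ≤ 2 ^ (b * Λ)
    pow-≤ h = ^-monoʳ-≤ 2 (*-monoˡ-≤ Λ h)

    const-≤ : ∀ a → 2 ^ a ≤ 2 ^ (a * Λ)
    const-≤ a = ^-monoʳ-≤ 2 (≤-trans (≤-reflexive (sym (*-identityʳ a))) (*-monoʳ-≤ a 1≤Λ))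

    scaled : ∀ {c a x} b → c ≤ 2 ^ a → x ≤ 2 ^ (b * Λ) → c * x ≤ 2 ^ ((a + b) * Λ)
    scaled {a = a} b h h′ = ≤-trans (*-mono-≤ (≤-trans h (const-≤ a)) h′) (≤-reflexive (pow-* a b))

  private
    fits : ∀ {Δ D} → D < Δ → Δ + 8 * D ≤ 9 * Δ
    fits {Δ} {D} h = ≤-trans (+-monoʳ-≤ Δ (*-monoʳ-≤ 8 (<⇒≤ h))) (≤-reflexive (solve 1 (λ d → d :+ con 8 :* d := con 9 :* d) refl Δ))

    big-from : ∀ {k Δ q t} → k ≤ q → Δ ≤ q → 9072 * (q * (q * (q * (q * q)))) ≤ t → 24 * (27 * (k * k) + 9 * (k * (4 * Δ))) * (2 * k * k * (3 * k)) ≤ t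
    big-from {k} {Δ} {q} {t} h h′ b = begin
      24 * (27 * (k * k) + 9 * (k * (4 * Δ))) * (2 * k * k * (3 * k))
        ≤⟨ *-mono-≤ (*-monoʳ-≤ 24 (+-mono-≤ (*-monoʳ-≤ 27 (*-mono-≤ h h)) (*-monoʳ-≤ 9 (*-mono-≤ h (*-monoʳ-≤ 4 h′))))) (*-mono-≤ (*-mono-≤ (*-monoʳ-≤ 2 h) h) (*-monoʳ-≤ 3 h)) ⟩
      24 * (27 * (q * q) + 9 * (q * (4 * q))) * (2 * q * q * (3 * q))
        ≡⟨ solve 1 (λ q → con 24 :* (con 27 :* (q :* q) :+ con 9 :* (q :* (con 4 :* q))) :* (con 2 :* q :* q :* (con 3 :* q)) := con 9072 :* (q :* (q :* (q :* (q :* q))))) refl q ⟩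
      9072 * (q * (q * (q * (q * q)))) ≤⟨ b ⟩
      t ∎

    root-pos : ∀ r {Δ} → 2 ≤ Δ → Δ < suc r * suc r → 1 ≤ r
    root-pos zero 2≤Δ h with ≤-trans (s≤s 2≤Δ) h
    ... | s≤s ()
    root-pos (suc r) _ _ = s≤s z≤n

    choose : ∀ Δ {Θ f E} → 2 ≤ Δ → Θ ≡ 60 * ⌈log₂ Δ ⌉ → f ≡ 4092 * ⌈log₂ Δ ⌉ → E ≡ constant 60 512 68 4092 760 → (∃ λ r → r * r ≤ Δ × Δ < suc r * suc r) → Parameters (16 * E) Δ
    choose Δ {Θ} {f} {E} 2≤Δ Θ≡ f≡ E≡ (r , r²≤Δ , Δ<) = record
      { Θ = Θ ; r₁ = r₁ ; f = f ; D = D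
      ; 1≤Θ = ≤-trans (≤-trans 1≤Λ (≤-trans (≤-reflexive (sym (*-identityˡ Λ))) (*-monoˡ-≤ Λ (≤ᵇ⇒≤ 1 60 _)))) (≤-reflexive (sym Θ≡))
      ; 1≤r₁ = s≤s z≤n
      ; k≤9r² = λ h → ≤-trans (fits h) (*-monoʳ-≤ 9 (<⇒≤ Δ<))
      ; gap = +-monoʳ-≤ Δ (≤-trans (m≤n+m gapped (512 * large)) (≤-trans (≤-reflexive (sym (*-identityˡ D))) (*-monoˡ-≤ D (≤ᵇ⇒≤ 1 8 _))))
      ; big = λ h → big-from {Δ + 8 * D} {Δ} {2 ^ (5 * Λ)} (k≤ h) (≤-trans Δ≤¹ (pow-≤ {1} {5} (s≤s z≤n))) (≤-trans (scaled {a = 14} 25 (≤ᵇ⇒≤ 9072 16384 _) (≤-reflexive fifth)) (to-Θ (≤ᵇ⇒≤ 39 60 _)))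
      ; big′ = ≤-trans (≤ᵇ⇒≤ 7 8 _) (≤-trans (const-≤ 3) (to-Θ (≤ᵇ⇒≤ 3 60 _)))
      ; big″ = λ h → begin
          24 * (Δ + Δ) * (Δ + 8 * D)         ≡⟨ solve 2 (λ d k → con 24 :* (d :+ d) :* k := con 48 :* (d :* k)) refl Δ (Δ + 8 * D) ⟩
          48 * (Δ * (Δ + 8 * D))             ≤⟨ scaled {a = 6} 6 (≤ᵇ⇒≤ 48 64 _) (≤-trans (*-mono-≤ Δ≤¹ (k≤ h)) (≤-reflexive (pow-* 1 5))) ⟩
          2 ^ (12 * Λ)                       ≤⟨ to-Θ (≤ᵇ⇒≤ 12 60 _) ⟩
          2 ^ Θ                              ∎
      ; D-large = m≤m+n (512 * large) gapped
      ; fuel = subst (λ f → 1023 ^ f * (3 * r₁) ≤ 1024 ^ f) (trans (sym (*-assoc 1023 4 Λ)) (sym f≡)) (outgrows 1023 (4 * Λ) 3r₁≤)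
      ; within = within-bound {D} {E} {r₁} {Δ} D≤ 1≤Λ r₁²≤
      }
      where
      Λ = ⌈log₂ Δ ⌉
      1≤Λ : 1 ≤ Λ
      1≤Λ = ⌈log₂⌉-mono-≤ {2} {Δ} 2≤Δ
      open Powers Λ 1≤Λ
      r₁ = suc r
      large = r₁ * (suc (2 * Θ) * suc (2 * Θ)) + 1 + 68 * (Θ * (3 * r₁))
      gapped = (340 * f + 760) * (Θ * (3 * r₁))
      D = 512 * large + gapped
      D≤ : D ≤ E * (r₁ * (Λ * Λ))
      D≤ = from Θ≡ f≡ E≡ (Size.size Λ r₁ 60 512 68 4092 760 1≤Λ (s≤s z≤n))
        where
        from : ∀ {Θ′ f′ E′} → Θ ≡ Θ′ → f ≡ f′ → E ≡ E′ → 512 * (r₁ * (suc (2 * Θ′) * suc (2 * Θ′)) + 1 + 68 * (Θ′ * (3 * r₁))) + (340 * f′ + 760) * (Θ′ * (3 * r₁)) ≤ E′ * (r₁ * (Λ * Λ)) → D ≤ E * (r₁ * (Λ * Λ))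
        from refl refl refl h = h
      to-Θ : ∀ {a} → a ≤ 60 → 2 ^ (a * Λ) ≤ 2 ^ Θ
      to-Θ {a} h = ≤-trans (pow-≤ {a} {60} h) (≤-reflexive (cong (2 ^_) (sym Θ≡)))
      Δ≤¹ : Δ ≤ 2 ^ (1 * Λ)
      Δ≤¹ = ≤-trans (n≤2^⌈log₂n⌉ Δ) (≤-reflexive (cong (2 ^_) (sym (*-identityˡ Λ))))
      1≤r : 1 ≤ r
      1≤r = root-pos r 2≤Δ Δ<
      r₁≤2r : r₁ ≤ 2 * r
      r₁≤2r = +-mono-≤ 1≤r (≤-reflexive (sym (+-identityʳ r)))
      r₁²≤ : r₁ * r₁ ≤ 4 * Δ
      r₁²≤ = ≤-trans (*-mono-≤ r₁≤2r r₁≤2r) (≤-trans (≤-reflexive (solve 1 (λ r → con 2 :* r :* (con 2 :* r) := con 4 :* (r :* r)) refl r)) (*-monoʳ-≤ 4 r²≤Δ))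
      k≤ : D < Δ → Δ + 8 * D ≤ 2 ^ (5 * Λ)
      k≤ h = ≤-trans (fits h) (scaled {a = 4} 1 (≤ᵇ⇒≤ 9 16 _) Δ≤¹)
      fifth : 2 ^ (5 * Λ) * (2 ^ (5 * Λ) * (2 ^ (5 * Λ) * (2 ^ (5 * Λ) * 2 ^ (5 * Λ)))) ≡ 2 ^ (25 * Λ)
      fifth = trans (cong (q *_) (trans (cong (q *_) (trans (cong (q *_) (pow-* 5 5)) (pow-* 5 10))) (pow-* 5 15))) (pow-* 5 20)
        where
        q = 2 ^ (5 * Λ)
      3r₁≤ : 3 * r₁ ≤ 2 ^ (4 * Λ)
      3r₁≤ = ≤-trans (*-monoʳ-≤ 3 (≤-trans r₁≤2r (*-monoʳ-≤ 2 (≤-trans (≤-trans (≤-reflexive (sym (*-identityˡ r))) (*-monoˡ-≤ r 1≤r)) r²≤Δ))))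
        (≤-trans (≤-reflexive (solve 1 (λ d → con 3 :* (con 2 :* d) := con 6 :* d) refl Δ)) (scaled {a = 3} 1 (≤ᵇ⇒≤ 6 8 _) Δ≤¹))

  parameters : ∃ λ C → ∀ Δ → 2 ≤ Δ → Parameters C Δ
  parameters = 16 * constant 60 512 68 4092 760 , λ Δ 2≤Δ → choose Δ 2≤Δ refl refl refl (isqrt Δ)

open import Data.Rational using (ℚ; 0ℚ; 1ℚ; _+_; _*_; _-_; -_; _≤_; _<_)
open Num
open Sum

2≡1+1 : ι 2 ≡ 1ℚ + 1ℚ
2≡1+1 = trans (ι-suc 1) (cong (1ℚ +_) ι1)

private
  halves : ∀ n → 6 ℕ.≤ n → ∃ λ h → (h ℕ.+ h ℕ.≤ n) × (3 ℕ.* n ℕ.≤ 7 ℕ.* h)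
  halves n 6≤n = h n , le n , big n 6≤n
    where
    h : ℕ → ℕ
    h (suc (suc n)) = suc (h n)
    h _ = 0
    le : ∀ n → h n ℕ.+ h n ℕ.≤ n
    le 0 = ℕ.z≤n
    le 1 = ℕ.z≤n
    le (suc (suc n)) = ℕ.s≤s (subst (ℕ._≤ suc n) (sym (ℕₚ.+-suc (h n) (h n))) (ℕ.s≤s (le n)))
    almost : ∀ n → n ℕ.≤ suc (h n ℕ.+ h n)
    almost 0 = ℕ.z≤n
    almost 1 = ℕ.s≤s ℕ.z≤n
    almost (suc (suc n)) = ℕ.s≤s (subst (suc n ℕ.≤_) (sym (cong suc (ℕₚ.+-suc (h n) (h n)))) (ℕ.s≤s (almost n)))
    mono : ∀ n → 3 ℕ.≤ h (6 ℕ.+ n)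
    mono n = ℕ.s≤s (ℕ.s≤s (ℕ.s≤s ℕ.z≤n))
    big : ∀ n → 6 ℕ.≤ n → 3 ℕ.* n ℕ.≤ 7 ℕ.* h n
    big n 6≤n = ℕₚ.≤-trans (ℕₚ.*-monoʳ-≤ 3 (almost n)) (ℕₚ.≤-trans (ℕₚ.≤-reflexive (l (h n))) (ℕₚ.≤-trans (ℕₚ.+-monoˡ-≤ (6 ℕ.* h n) (subst (λ n → 3 ℕ.≤ h n) (ℕₚ.m+[n∸m]≡n 6≤n) (mono (n ℕ.∸ 6)))) (ℕₚ.≤-reflexive (l₂ (h n)))))
      where
      open +-*-Solver
      l : ∀ x → 3 ℕ.* (1 ℕ.+ (x ℕ.+ x)) ≡ 3 ℕ.+ 6 ℕ.* x
      l = solve 1 (λ x → con 3 :* (con 1 :+ (x :+ x)) := con 3 :+ con 6 :* x) refl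
      l₂ : ∀ x → x ℕ.+ 6 ℕ.* x ≡ 7 ℕ.* x
      l₂ = solve 1 (λ x → x :+ con 6 :* x := con 7 :* x) refl

κ-lower : ∀ {p ℓ M} → 0ℚ ≤ p → p * ι ℓ ≡ 1ℚ → 6 ℕ.≤ ℓ → M ℕ.≤ 3 ℕ.* ℓ → 1ℚ ≤ ι 128 * (1ℚ - p) ^ M
κ-lower {p} {ℓ} {M} 0≤p pℓ 6≤ℓ M≤ = ≤-trans (≤-trans (≤-trans (≤-reflexive (sym (1^ 7))) (^-mono 0≤1 half 7)) (≤-reflexive (trans (*-^ (ι 2) (q ^ h) 7) (cong₂ _*_ (sym (ι-^ 2 7)) (sym (^-* q 7 h))))))
      (*-monoʳ (0≤ι 128) (^-antitone 0≤q q≤1 (ℕₚ.≤-trans M≤ (proj₂ (proj₂ (halves ℓ 6≤ℓ))))))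
  where
  q = 1ℚ - p
  h = proj₁ (halves ℓ 6≤ℓ)
  p≤1 : p ≤ 1ℚ
  p≤1 = ≤-trans (≤-reflexive (sym (ℚₚ.*-identityʳ p))) (≤-trans (*-monoʳ 0≤p (1≤ι (ℕₚ.≤-trans (ℕ.s≤s ℕ.z≤n) 6≤ℓ))) (≤-reflexive pℓ))
  0≤q : 0ℚ ≤ q
  0≤q = diff p≤1
  q≤1 : q ≤ 1ℚ
  q≤1 = by-gap 0≤p (l p)
    where
    l : ∀ p → 1ℚ ≡ 1ℚ - p + p
    l = solve-∀ ℚ-ring
  half : 1ℚ ≤ ι 2 * q ^ h
  half = ≤-trans (by-gap (diff hp) (trans (cong (λ z → z * (1ℚ + ι h * - p)) 2≡1+1) (l (ι h) p))) (*-monoʳ (0≤ι 2) (bernoulli {x = - p} 0≤q h))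
    where
    hp : (ι h + ι h) * p ≤ 1ℚ
    hp = ≤-trans (*-monoˡ 0≤p (≤-trans (≤-reflexive (sym (ι-+ h h))) (ι-mono (proj₁ (proj₂ (halves ℓ 6≤ℓ)))))) (≤-reflexive (trans (ℚₚ.*-comm (ι ℓ) p) pℓ))
    l : ∀ h p → (1ℚ + 1ℚ) * (1ℚ + h * - p) ≡ 1ℚ + (1ℚ - (h + h) * p)
    l = solve-∀ ℚ-ring

κ-upper : ∀ {p ℓ M} → 0ℚ ≤ p → p * ι ℓ ≡ 1ℚ → 2 ℕ.≤ ℓ → ℓ ℕ.∸ 1 ℕ.≤ M → ι 2 * (1ℚ - p) ^ M ≤ 1ℚ
κ-upper {p} {suc (suc n)} {M} 0≤p pℓ (ℕ.s≤s (ℕ.s≤s ℕ.z≤n)) M≥ =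
    ≤-trans (*-monoʳ (0≤ι 2) (^-antitone 0≤q q≤1 M≥)) (≤-trans (*-monoˡ (0≤^ 0≤q m) two) (≤-reflexive (trans (sym (*-^ (1ℚ + y) q m)) (trans (cong (_^ m) qy) (1^ m)))))
  where
  m = suc n
  q = 1ℚ - p
  y : ℚ
  y = proj₁ (inverse (ι-pos n))
  my : ι m * y ≡ 1ℚ
  my = proj₁ (proj₂ (inverse (ι-pos n)))
  0≤y = ℚₚ.<⇒≤ (proj₂ (proj₂ (inverse (ι-pos n))))
  p≤1 : p ≤ 1ℚ
  p≤1 = ≤-trans (≤-reflexive (sym (ℚₚ.*-identityʳ p))) (≤-trans (*-monoʳ 0≤p (1≤ι {suc m} (ℕ.s≤s ℕ.z≤n))) (≤-reflexive pℓ))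
  0≤q : 0ℚ ≤ q
  0≤q = diff p≤1
  q≤1 : q ≤ 1ℚ
  q≤1 = by-gap 0≤p (l p)
    where
    l : ∀ p → 1ℚ ≡ 1ℚ - p + p
    l = solve-∀ ℚ-ring
  two : ι 2 ≤ (1ℚ + y) ^ m
  two = ≤-trans (≤-reflexive (trans 2≡1+1 (cong (1ℚ +_) (sym my)))) (bernoulli (0≤+ 0≤1 0≤y) m)
  qy : (1ℚ + y) * q ≡ 1ℚ
  qy = trans (l y p) (trans (cong (λ z → 1ℚ + z - p - y * p) y≡) (l₃ y p))
    where
    l : ∀ y p → (1ℚ + y) * (1ℚ - p) ≡ 1ℚ + y - p - y * p
    l = solve-∀ ℚ-ring
    l₂ : ∀ y p m → y * (p * (1ℚ + m)) ≡ p * y + p * (m * y)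
    l₂ = solve-∀ ℚ-ring
    l₃ : ∀ y p → 1ℚ + (p * y + p * 1ℚ) - p - y * p ≡ 1ℚ
    l₃ = solve-∀ ℚ-ring
    y≡ : y ≡ p * y + p * 1ℚ
    y≡ = trans (sym (ℚₚ.*-identityʳ y)) (trans (cong (y *_) (trans (sym pℓ) (cong (p *_) (ι-suc m)))) (trans (l₂ y p (ι m)) (cong (λ z → p * y + p * z) my)))

gap-identity : ∀ {ℓ t κ ρ} → ℓ * ρ ≡ t * κ → ℓ * ((1ℚ - ρ) * (1ℚ - ρ)) ≡ t * ((1ℚ - κ) * (1ℚ - ρ)) + (1ℚ - ρ) * (ℓ - t)
gap-identity {ℓ} {t} {κ} {ρ} e = trans (l ℓ ρ) (trans (cong (λ z → (1ℚ - ρ) * (ℓ - z)) e) (l₂ ℓ t κ ρ))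
  where
  l : ∀ ℓ ρ → ℓ * ((1ℚ - ρ) * (1ℚ - ρ)) ≡ (1ℚ - ρ) * (ℓ - ℓ * ρ)
  l = solve-∀ ℚ-ring
  l₂ : ∀ ℓ t κ ρ → (1ℚ - ρ) * (ℓ - t * κ) ≡ t * ((1ℚ - κ) * (1ℚ - ρ)) + (1ℚ - ρ) * (ℓ - t)
  l₂ = solve-∀ ℚ-ring

≤1-from : ∀ {p ℓ} → 0ℚ ≤ p → p * ι ℓ ≡ 1ℚ → 1 ℕ.≤ ℓ → p ≤ 1ℚ
≤1-from {p} 0≤p pℓ 1≤ℓ = ≤-trans (≤-reflexive (sym (ℚₚ.*-identityʳ p))) (≤-trans (*-monoʳ 0≤p (1≤ι 1≤ℓ)) (≤-reflexive pℓ))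

-- Bookkeeping of one round: X is the error scale, g the gap coefficient before the round.
gap-step : ∀ {ℓQQ tKQ Q ℓ t X a ℓ′ t′ g} → ℓQQ ≡ tKQ + Q * (ℓ - t) → ℓQQ - ι 4 - a ≤ 1ℚ + ℓ′ → t′ ≤ 1ℚ + (tKQ + ι 19 + a) →
           t + (ι 340 + g) * X ≤ ℓ → a ≡ ι 68 * X → 1ℚ ≤ X → 1ℚ ≤ ι 2 * Q → 0ℚ ≤ Q → t′ + g * (Q * X) ≤ ℓ′
gap-step {ℓQQ} {tKQ} {Q} {ℓ} {t} {X} {a} {ℓ′} {t′} {g} eq hℓ ht gap refl 1≤X 1≤2Q 0≤Q =
  by-gap (0≤+ (0≤+ (diff hℓ) (diff ht)) (0≤+ (0≤* 0≤Q (diff gap)) (0≤+ (0≤* (0≤* (0≤ι 170) 0≤X) (diff 1≤2Q)) (≤-trans (0≤* (0≤ι 25) (diff 1≤X)) (by-gap (0≤* (0≤ι 9) 0≤X) numbers)))))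
    (trans (l ℓQQ tKQ Q ℓ t X (ι 68) ℓ′ t′ g (ι 340) (ι 4) (ι 19) (ι 170) (ι 2) (ι 25) (ι 9))
      (trans (cong₂ (λ u w → t′ + g * (Q * X) + (1ℚ + ℓ′ - (ℓQQ - ι 4 - ι 68 * X) + (1ℚ + (tKQ + ι 19 + ι 68 * X) - t′) + (Q * (ℓ - (t + (ι 340 + g) * X)) + (ι 170 * X * (ι 2 * Q - 1ℚ) + (ι 170 * X - ι 68 * X - ι 68 * X - ι 25))) + u + w)) zero₁ zero₂)
        (l₂ (t′ + g * (Q * X)) _)))
  where
  0≤X : 0ℚ ≤ X
  0≤X = ≤-trans 0≤1 1≤X
  numbers : ι 170 * X - ι 68 * X - ι 68 * X - ι 25 ≡ ι 25 * (X - 1ℚ) + ι 9 * X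
  numbers = trans (cong (λ c → c * X - ι 68 * X - ι 68 * X - ι 25) 170≡) (l₃ (ι 68) (ι 25) (ι 9) X)
    where
    170≡ : ι 170 ≡ ι 68 + (ι 68 + (ι 25 + ι 9))
    170≡ = trans (ι-+ 68 102) (cong (ι 68 +_) (trans (ι-+ 68 34) (cong (ι 68 +_) (ι-+ 25 9))))
    l₃ : ∀ a b c X → (a + (a + (b + c))) * X - a * X - a * X - b ≡ b * (X - 1ℚ) + c * X
    l₃ = solve-∀ ℚ-ring
  zero₁ : ℓQQ - (tKQ + Q * (ℓ - t)) ≡ 0ℚ
  zero₁ = trans (cong (_- (tKQ + Q * (ℓ - t))) eq) (ℚₚ.+-inverseʳ (tKQ + Q * (ℓ - t)))
  zero₂ : (ι 340 - ι 170 * ι 2) * (Q * X) + (ι 25 - ι 4 - ι 19 - 1ℚ - 1ℚ) ≡ 0ℚ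
  zero₂ = trans (cong₂ (λ u w → (u - ι 170 * ι 2) * (Q * X) + (w - ι 4 - ι 19 - 1ℚ - 1ℚ)) (ι-* 170 2) (trans (ι-suc 24) (cong (1ℚ +_) (trans (ι-suc 23) (cong (1ℚ +_) (ι-+ 4 19)))))) (l₄ (ι 170 * ι 2) (Q * X) (ι 4) (ι 19))
    where
    l₄ : ∀ a x b c → (a - a) * x + (1ℚ + (1ℚ + (b + c)) - b - c - 1ℚ - 1ℚ) ≡ 0ℚ
    l₄ = solve-∀ ℚ-ring
  l₂ : ∀ a b → a + (b + 0ℚ + 0ℚ) ≡ a + b
  l₂ = solve-∀ ℚ-ring
  l : ∀ A B Q ℓ t X c ℓ′ t′ g d e f h w n m → ℓ′ ≡ t′ + g * (Q * X) + (1ℚ + ℓ′ - (A - e - c * X) + (1ℚ + (B + f + c * X) - t′) + (Q * (ℓ - (t + (d + g) * X)) + (h * X * (w * Q - 1ℚ) + (h * X - c * X - c * X - n))) + (A - (B + Q * (ℓ - t))) + ((d - h * w) * (Q * X) + (n - e - f - 1ℚ - 1ℚ)))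
  l = solve-∀ ℚ-ring

module Params {Θ ℓ : ℕ} {s gap : ℚ} {t : ℕ} (1≤Θ : 1 ℕ.≤ Θ) (0<s : 0ℚ < s) (ℓ≤s² : ι ℓ ≤ s * s) (0≤gap : 0ℚ ≤ gap)
  (bound : ι t + (gap + ι 400) * (ι Θ * s) ≤ ι ℓ) where

  X : ℚ
  X = ι Θ * s

  0<X : 0ℚ < X
  0<X = *-pos (ι-pos′ 1≤Θ) 0<s

  0≤X : 0ℚ ≤ X
  0≤X = ℚₚ.<⇒≤ 0<X

  0≤s : 0ℚ ≤ s
  0≤s = ℚₚ.<⇒≤ 0<s

  400X : ι 400 * X ≤ ι ℓ
  400X = ≤-trans (by-gap (0≤+ (0≤ι t) (0≤* 0≤gap 0≤X)) (l (ι t) gap (ι 400) X)) bound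
    where
    l : ∀ t a b x → t + (a + b) * x ≡ b * x + (t + a * x)
    l = solve-∀ ℚ-ring

  1≤ℓ : 1 ℕ.≤ ℓ
  1≤ℓ = go ℓ 400X
    where
    go : ∀ n → ι 400 * X ≤ ι n → 1 ℕ.≤ n
    go zero h = ⊥-elim (<⇒≱ (*-pos (ι-pos 399) 0<X) (≤-trans h (≤-reflexive ι0)))
    go (suc n) _ = ℕ.s≤s ℕ.z≤n

  1≤s : 1ℚ ≤ s
  1≤s with ≤-dec 1ℚ s
  ... | inj₁ h = h
  ... | inj₂ h = ⊥-elim (<⇒≱ h (≤-trans (≤-trans (1≤ι 1≤ℓ) ℓ≤s²) (≤-trans (*-monoˡ 0≤s (ℚₚ.<⇒≤ h)) (≤-reflexive (ℚₚ.*-identityˡ s)))))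

  1≤X : 1ℚ ≤ X
  1≤X = ≤-trans (≤-reflexive (sym (ℚₚ.*-identityˡ 1ℚ))) (*-mono 0≤1 0≤s (1≤ι 1≤Θ) 1≤s)

  400≤ℓ : 400 ℕ.≤ ℓ
  400≤ℓ = ι-cancel (≤-trans (≤-trans (≤-reflexive (sym (ℚₚ.*-identityʳ (ι 400)))) (*-monoʳ (0≤ι 400) 1≤X)) 400X)

  t≤ℓ : t ℕ.≤ ℓ
  t≤ℓ = ι-cancel (≤-trans (by-gap (0≤* (0≤+ 0≤gap (0≤ι 400)) 0≤X) refl) bound)

  σ a : ℚ
  σ = ι 68 * s
  a = ι Θ * σ

  0<σ : 0ℚ < σ
  0<σ = *-pos (ι-pos 67) 0<s

  24≤σ : ι 2 * ι 12 ≤ σ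
  24≤σ = ≤-trans (≤-reflexive (trans (sym (ι-* 2 12)) (sym (ℚₚ.*-identityʳ (ι 24))))) (*-mono (0≤ι 24) 0≤s (ι-mono (ℕₚ.m≤m+n 24 44)) 1≤s)

  σ² : ι 4608 * ι ℓ ≤ σ * σ
  σ² = ≤-trans (*-monoʳ (0≤ι 4608) ℓ≤s²) (≤-trans (*-monoˡ (0≤* 0≤s 0≤s) 4608≤) (≤-reflexive (l (ι 68) s)))
    where
    4608≤ : ι 4608 ≤ ι 68 * ι 68
    4608≤ = ≤-trans (ι-mono (ℕₚ.m≤m+n 4608 16)) (≤-reflexive (ι-* 68 68))
    l : ∀ c s → c * c * (s * s) ≡ c * s * (c * s)
    l = solve-∀ ℚ-ring

  aX : a ≡ ι 68 * X
  aX = l (ι Θ) (ι 68) s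
    where
    l : ∀ a b c → a * (b * c) ≡ b * (a * c)
    l = solve-∀ ℚ-ring

  0≤a : 0ℚ ≤ a
  0≤a = 0≤* (0≤ι Θ) (0≤* (0≤ι 68) 0≤s)

  module Rates {p κ ρ : ℚ} (0≤p : 0ℚ ≤ p) (pℓ : p * ι ℓ ≡ 1ℚ) (ρ≡ : ρ ≡ ι t * (p * κ)) (1≤128κ : 1ℚ ≤ ι 128 * κ) (2κ≤1 : ι 2 * κ ≤ 1ℚ) where

    Q x y : ℚ
    Q = 1ℚ - ρ
    x = ι ℓ * (Q * Q) - ι 4 - a
    y = ι t * ((1ℚ - κ) * Q) + ι 19 + a

    0≤κ : 0ℚ ≤ κ
    0≤κ = cancel-* (ι-pos 127) (≤-trans (≤-reflexive (ℚₚ.*-zeroʳ (ι 128))) (≤-trans 0≤1 1≤128κ))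

    κ≤1 : κ ≤ 1ℚ
    κ≤1 = ≤-trans (≤-trans (≤-reflexive (sym (ℚₚ.*-identityˡ κ))) (*-monoˡ 0≤κ (1≤ι {2} (ℕ.s≤s ℕ.z≤n)))) 2κ≤1

    ℓpκ : ι ℓ * (p * κ) ≡ κ
    ℓpκ = trans (l (ι ℓ) p κ) (trans (cong (_* κ) pℓ) (ℚₚ.*-identityˡ κ))
      where
      l : ∀ a b c → a * (b * c) ≡ b * a * c
      l = solve-∀ ℚ-ring

    ℓρ : ι ℓ * ρ ≡ ι t * κ
    ℓρ = trans (cong (ι ℓ *_) ρ≡) (trans (l (ι ℓ) (ι t) (p * κ)) (cong (ι t *_) ℓpκ))
      where
      l : ∀ a b c → a * (b * c) ≡ b * (a * c)
      l = solve-∀ ℚ-ring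

    ρ≤κ : ρ ≤ κ
    ρ≤κ = ≤-trans (≤-reflexive ρ≡) (≤-trans (*-monoˡ (0≤* 0≤p 0≤κ) (ι-mono t≤ℓ)) (≤-reflexive ℓpκ))

    0≤ρ : 0ℚ ≤ ρ
    0≤ρ = ≤-trans (0≤* (0≤ι t) (0≤* 0≤p 0≤κ)) (≤-reflexive (sym ρ≡))

    1≤2Q : 1ℚ ≤ ι 2 * Q
    1≤2Q = by-gap (diff (≤-trans (*-monoʳ (0≤ι 2) ρ≤κ) 2κ≤1)) (trans (cong (_* Q) 2≡1+1) (trans (l ρ) (cong (λ z → 1ℚ + (1ℚ - z * ρ)) (sym 2≡1+1))))
      where
      l : ∀ r → (1ℚ + 1ℚ) * (1ℚ - r) ≡ 1ℚ + (1ℚ - (1ℚ + 1ℚ) * r)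
      l = solve-∀ ℚ-ring

    0<Q : 0ℚ < Q
    0<Q with ≤-dec Q 0ℚ
    ... | inj₂ h = h
    ... | inj₁ h = ⊥-elim (<⇒≱ (ℚₚ.positive⁻¹ 1ℚ) (≤-trans 1≤2Q (≤-trans (*-monoʳ (0≤ι 2) h) (≤-reflexive (ℚₚ.*-zeroʳ (ι 2))))))

    0≤Q : 0ℚ ≤ Q
    0≤Q = ℚₚ.<⇒≤ 0<Q

    Q≤1 : Q ≤ 1ℚ
    Q≤1 = by-gap 0≤ρ (l ρ)
      where
      l : ∀ r → 1ℚ ≡ 1ℚ - r + r
      l = solve-∀ ℚ-ring

    1024Q : ℓ ℕ.≤ 8 ℕ.* t → ι 1024 * Q ≤ ι 1023
    1024Q ℓ≤8t = by-gap (diff 1≤1024ρ) (trans (l (ι 1023) ρ) (cong₂ (λ z w → z * (1ℚ - ρ) + (w * ρ - 1ℚ)) (sym (ι-suc 1023)) (sym (ι-suc 1023))))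
      where
      l : ∀ n r → n ≡ (1ℚ + n) * (1ℚ - r) + ((1ℚ + n) * r - 1ℚ)
      l = solve-∀ ℚ-ring
      κ≤8ρ : κ ≤ ι 8 * ρ
      κ≤8ρ = ≤-trans (≤-reflexive (sym ℓpκ)) (≤-trans (*-monoˡ (0≤* 0≤p 0≤κ) (ι-mono ℓ≤8t)) (≤-reflexive (trans (cong (_* (p * κ)) (ι-* 8 t)) (trans (ℚₚ.*-assoc (ι 8) (ι t) (p * κ)) (cong (ι 8 *_) (sym ρ≡))))))
      1≤1024ρ : 1ℚ ≤ ι 1024 * ρ
      1≤1024ρ = ≤-trans 1≤128κ (≤-trans (*-monoʳ (0≤ι 128) κ≤8ρ) (≤-reflexive (trans (sym (ℚₚ.*-assoc (ι 128) (ι 8) ρ)) (cong (_* ρ) (sym (ι-* 128 8))))))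

    0≤y : 0ℚ ≤ y
    0≤y = 0≤+ (0≤+ (0≤* (0≤ι t) (0≤* (diff κ≤1) 0≤Q)) (0≤ι 19)) 0≤a

    x≤ : x ≤ ι ℓ * (Q * Q)
    x≤ = by-gap (0≤+ (0≤ι 4) 0≤a) (l (ι ℓ * (Q * Q)) (ι 4) a)
      where
      l : ∀ x b a → x ≡ x - b - a + (b + a)
      l = solve-∀ ℚ-ring

    0≤x : 0ℚ ≤ x
    0≤x = cancel-* (ι-pos 3) (≤-trans (≤-reflexive (ℚₚ.*-zeroʳ (ι 4))) (≤-trans (0≤+ (0≤+ (0≤* (0≤ι ℓ) (diff 1≤4QQ)) (diff 400X)) (0≤+ (0≤* (0≤ι 16) (diff 1≤X)) (0≤* (0≤ι 112) 0≤X))) (≤-reflexive eq)))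
      where
      1≤4QQ : 1ℚ ≤ ι 4 * (Q * Q)
      1≤4QQ = ≤-trans (*-mono 0≤1 (0≤* (0≤ι 2) 0≤Q) 1≤2Q 1≤2Q) (≤-reflexive (trans (l₁ (ι 2) Q) (cong (_* (Q * Q)) (sym (ι-* 2 2)))))
        where
        l₁ : ∀ c q → c * q * (c * q) ≡ c * c * (q * q)
        l₁ = solve-∀ ℚ-ring
      split : ι 400 ≡ ι 4 * ι 4 + (ι 112 + ι 4 * ι 68)
      split = trans (ι-+ 16 384) (cong₂ _+_ (ι-* 4 4) (trans (ι-+ 112 272) (cong (ι 112 +_) (ι-* 4 68))))
      l : ∀ n q X b d e → n * (b * q - 1ℚ) + (n - (b * b + (d + b * e)) * X) + (b * b * (X - 1ℚ) + d * X) ≡ b * (n * q - b - e * X)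
      l = solve-∀ ℚ-ring
      eq : ι ℓ * (ι 4 * (Q * Q) - 1ℚ) + (ι ℓ - ι 400 * X) + (ι 16 * (X - 1ℚ) + ι 112 * X) ≡ ι 4 * x
      eq = trans (cong₂ (λ u w → ι ℓ * (ι 4 * (Q * Q) - 1ℚ) + (ι ℓ - u * X) + (w * (X - 1ℚ) + ι 112 * X)) split (ι-* 4 4))
         (trans (l (ι ℓ) (Q * Q) X (ι 4) (ι 112) (ι 68)) (cong (λ z → ι 4 * (ι ℓ * (Q * Q) - ι 4 - z)) (sym aX)))

    gap-after : ∀ {ℓ′ t′ g} → x ≤ 1ℚ + ι ℓ′ → ι t′ ≤ 1ℚ + y → ι t + (ι 340 + g) * X ≤ ι ℓ → ι t′ + g * (ι Θ * (Q * s)) ≤ ι ℓ′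
    gap-after {ℓ′} {t′} {g} h h′ k = ≤-trans (≤-reflexive (cong (λ z → ι t′ + g * z) (l (ι Θ) Q s))) (gap-step {ℓQQ = ι ℓ * (Q * Q)} {ι t * ((1ℚ - κ) * Q)} {Q} {ι ℓ} {ι t} {X} {a} {ι ℓ′} {ι t′} {g} (gap-identity {ι ℓ} {ι t} {κ} {ρ} ℓρ) h h′ k aX 1≤X 1≤2Q 0≤Q)
      where
      l : ∀ a q s → a * (q * s) ≡ q * (a * s)
      l = solve-∀ ℚ-ring

    scale-after : ∀ {ℓ′} → ι ℓ′ ≤ x → ι ℓ′ ≤ Q * s * (Q * s)
    scale-after h = ≤-trans h (≤-trans x≤ (≤-trans (*-monoˡ (sq≥0 Q) ℓ≤s²) (≤-reflexive (l Q s))))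
      where
      l : ∀ q s → s * s * (q * q) ≡ q * s * (q * s)
      l = solve-∀ ℚ-ring

    size-after : ∀ {ℓ′} → ι ℓ′ ≤ x → ℓ′ ℕ.≤ ℓ
    size-after h = ι-cancel (≤-trans h (≤-trans x≤ (≤-trans (*-monoʳ (0≤ι ℓ) (*-mono 0≤Q 0≤1 Q≤1 Q≤1)) (≤-reflexive (trans (cong (ι ℓ *_) (ℚₚ.*-identityˡ 1ℚ)) (ℚₚ.*-identityʳ (ι ℓ)))))))

    fuel-after : ∀ f → ℓ ℕ.≤ 8 ℕ.* t → ι 1023 ^ suc f * s ≤ ι 1024 ^ suc f → ι 1023 ^ f * (Q * s) ≤ ι 1024 ^ f
    fuel-after f h fuel = cancel-* (ι-pos 1023) (≤-trans (≤-reflexive (l (ι 1024) (ι 1023 ^ f) Q s)) (≤-trans (*-monoˡ (0≤* (0≤^ (0≤ι 1023) f) 0≤s) (1024Q h)) (≤-trans (≤-reflexive (sym (ℚₚ.*-assoc (ι 1023) (ι 1023 ^ f) s))) fuel)))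
      where
      l : ∀ c b q s → c * (b * (q * s)) ≡ c * q * (b * s)
      l = solve-∀ ℚ-ring

module Random {O : Set} (_≟_ : DecidableEquality O) (p : ℚ) (0≤p : 0ℚ ≤ p) (p≤1 : p ≤ 1ℚ) where

  open Eq _≟_

  Outcome : Set
  Outcome = O → Bool

  q : ℚ
  q = 1ℚ - p

  0≤q : 0ℚ ≤ q
  0≤q = diff p≤1

  ∅ : Outcome
  ∅ _ = false

  upd : O → Outcome → Outcome
  upd o ω z = (z == o) ∨ ω z

  -- Expectation when the members of the list are selected independently with probability p.
  E : List O → (Outcome → ℚ) → ℚ
  E [] f = f ∅
  E (o ∷ os) f = q * E os f + p * E os (λ ω → f (upd o ω))

  Supp : List O → Outcome → Set
  Supp os ω = ∀ z → ω z ≡ true → z ∈ os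

  Supp-∷ : ∀ {o os ω} → Supp os ω → Supp (o ∷ os) ω
  Supp-∷ s z e = there (s z e)

  Supp-upd : ∀ {o os ω} → Supp os ω → Supp (o ∷ os) (upd o ω)
  Supp-upd s z e with ∨-case {z == _} e
  ... | inj₁ h = here (==-true h)
  ... | inj₂ h = there (s z h)

  upd-same : ∀ o ω → upd o ω o ≡ true
  upd-same o ω = ∨-left (==-refl o)

  upd-other : ∀ {o z} ω → z ≢ o → upd o ω z ≡ ω z
  upd-other ω h rewrite ==-false h = refl

  E-mono : ∀ os {f g} → (∀ ω → Supp os ω → f ω ≤ g ω) → E os f ≤ E os g
  E-mono [] h = h ∅ λ _ ()
  E-mono (o ∷ os) h = +-mono (*-monoʳ 0≤q (E-mono os λ ω s → h ω (Supp-∷ s)))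
                             (*-monoʳ 0≤p (E-mono os λ ω s → h (upd o ω) (Supp-upd s)))

  E-cong : ∀ os {f g} → (∀ ω → Supp os ω → f ω ≡ g ω) → E os f ≡ E os g
  E-cong [] h = h ∅ λ _ ()
  E-cong (o ∷ os) h = cong₂ _+_ (cong (q *_) (E-cong os λ ω s → h ω (Supp-∷ s)))
                                (cong (p *_) (E-cong os λ ω s → h (upd o ω) (Supp-upd s)))

  private
    convex : ∀ p c → (1ℚ - p) * c + p * c ≡ c
    convex = solve-∀ ℚ-ring

    mix-+ : ∀ p a b c d → (1ℚ - p) * (a + b) + p * (c + d) ≡ ((1ℚ - p) * a + p * c) + ((1ℚ - p) * b + p * d)
    mix-+ = solve-∀ ℚ-ring

    mix-* : ∀ p c a b → (1ℚ - p) * (c * a) + p * (c * b) ≡ c * ((1ℚ - p) * a + p * b)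
    mix-* = solve-∀ ℚ-ring

  E-const : ∀ os c → E os (λ _ → c) ≡ c
  E-const [] c = refl
  E-const (o ∷ os) c rewrite E-const os c = convex p c

  E-+ : ∀ os f g → E os (λ ω → f ω + g ω) ≡ E os f + E os g
  E-+ [] f g = refl
  E-+ (o ∷ os) f g rewrite E-+ os f g | E-+ os (λ ω → f (upd o ω)) (λ ω → g (upd o ω)) = mix-+ p _ _ _ _

  E-* : ∀ os c f → E os (λ ω → c * f ω) ≡ c * E os f
  E-* [] c f = refl
  E-* (o ∷ os) c f rewrite E-* os c f | E-* os c (λ ω → f (upd o ω)) = mix-* p c _ _

  E-- : ∀ os f g → E os (λ ω → f ω - g ω) ≡ E os f - E os g
  E-- os f g = trans (E-cong os λ ω _ → lemma₁ (f ω) (g ω)) (trans (E-+ os f (λ ω → - 1ℚ * g ω)) (trans (cong (E os f +_) (E-* os (- 1ℚ) g)) (sym (lemma₁ (E os f) (E os g)))))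
    where
    lemma₁ : ∀ a b → a - b ≡ a + - 1ℚ * b
    lemma₁ = solve-∀ ℚ-ring

  E-∑ : ∀ {X : Set} os (xs : List X) (f : X → Outcome → ℚ) → E os (λ ω → ∑ xs (λ x → f x ω)) ≡ ∑ xs (λ x → E os (f x))
  E-∑ os [] f = E-const os 0ℚ
  E-∑ os (x ∷ xs) f = trans (E-+ os (f x) (λ ω → ∑ xs (λ x → f x ω))) (cong (E os (f x) +_) (E-∑ os xs f))

  E-≥0 : ∀ os {f} → (∀ ω → Supp os ω → 0ℚ ≤ f ω) → 0ℚ ≤ E os f
  E-≥0 os {f} h = subst (_≤ E os f) (E-const os 0ℚ) (E-mono os h)

  E-witness : ∀ os {f} → 0ℚ < E os f → ∃ λ ω → Supp os ω × (0ℚ < f ω)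
  E-witness [] h = ∅ , (λ _ ()) , h
  E-witness (o ∷ os) {f} h with ≤-dec (E os f) 0ℚ
  ... | inj₂ h₁ = let ω , s , k = E-witness os h₁ in ω , Supp-∷ s , k
  ... | inj₁ h₁ with ≤-dec (E os (λ ω → f (upd o ω))) 0ℚ
  ...   | inj₂ h₂ = let ω , s , k = E-witness os h₂ in upd o ω , Supp-upd s , k
  ...   | inj₁ h₂ = ⊥-elim (<⇒≱ h (≤-trans (+-mono (*-monoʳ 0≤q h₁) (*-monoʳ 0≤p h₂)) (≤-reflexive (lemma q p))))
    where
    lemma : ∀ q p → q * 0ℚ + p * 0ℚ ≡ 0ℚ
    lemma = solve-∀ ℚ-ring

  Local : ∀ {X : Set} → (O → Bool) → (Outcome → X) → Set
  Local V f = ∀ ω ω′ → (∀ z → V z ≡ true → ω z ≡ ω′ z) → f ω ≡ f ω′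

  Ext : ∀ {X : Set} → (Outcome → X) → Set
  Ext f = ∀ ω ω′ → (∀ z → ω z ≡ ω′ z) → f ω ≡ f ω′

  Local⇒Ext : ∀ {X : Set} {V} {f : Outcome → X} → Local V f → Ext f
  Local⇒Ext l ω ω′ h = l ω ω′ λ z _ → h z

  upd-cong : ∀ o {ω ω′ z} → ω z ≡ ω′ z → upd o ω z ≡ upd o ω′ z
  upd-cong o {z = z} h = cong ((z == o) ∨_) h

  Local-upd : ∀ {X : Set} {V} {f : Outcome → X} o → Local V f → Local V (λ ω → f (upd o ω))
  Local-upd o l ω ω′ h = l (upd o ω) (upd o ω′) λ z v → upd-cong o {ω} {ω′} {z} (h z v)

  Local-ignore : ∀ {X : Set} {V} {f : Outcome → X} {o} → Local V f → V o ≡ false → ∀ ω → f (upd o ω) ≡ f ω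
  Local-ignore {o = o} l v ω = l (upd o ω) ω λ z vz → upd-other ω λ { refl → true≢false vz v }

  E-indep : ∀ os {V W : O → Bool} {f g} → (∀ z → V z ≡ true → W z ≡ true → ⊥) → Local V f → Local W g →
            E os (λ ω → f ω * g ω) ≡ E os f * E os g
  E-indep [] disj lf lg = refl
  E-indep (o ∷ os) {V} {W} {f} {g} disj lf lg with bool-case (V o)
  ... | inj₁ v = trans (cong₂ _+_ (cong (q *_) (E-indep os disj lf lg))
          (cong (p *_) (trans (E-indep os disj (Local-upd o lf) (Local-upd o lg)) (cong (E os (λ ω → f (upd o ω)) *_) eq))))
          (trans (lemma q p (E os f) (E os (λ ω → f (upd o ω))) (E os g)) (cong ((q * E os f + p * E os (λ ω → f (upd o ω))) *_)
          (sym (trans (cong (λ z → q * E os g + p * z) eq) (convex p (E os g))))))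
    where
    eq : E os (λ ω → g (upd o ω)) ≡ E os g
    eq = E-cong os λ ω _ → Local-ignore lg (¬true⇒false λ w → disj o v w) ω
    lemma : ∀ q p a b g → q * (a * g) + p * (b * g) ≡ (q * a + p * b) * g
    lemma = solve-∀ ℚ-ring
  ... | inj₂ v = trans (cong₂ _+_ (cong (q *_) (E-indep os disj lf lg))
          (cong (p *_) (trans (E-indep os disj (Local-upd o lf) (Local-upd o lg)) (cong (_* E os (λ ω → g (upd o ω))) eq))))
          (trans (lemma q p (E os f) (E os g) (E os (λ ω → g (upd o ω)))) (cong (_* (q * E os g + p * E os (λ ω → g (upd o ω))))
          (sym (trans (cong (λ z → q * E os f + p * z) eq) (convex p (E os f))))))
    where
    eq : E os (λ ω → f (upd o ω)) ≡ E os f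
    eq = E-cong os λ ω _ → Local-ignore lf v ω
    lemma : ∀ q p f a b → q * (f * a) + p * (f * b) ≡ f * (q * a + p * b)
    lemma = solve-∀ ℚ-ring

  E-↭ : ∀ {xs ys} → xs ↭ ys → ∀ {f : Outcome → ℚ} → Ext f → E xs f ≡ E ys f
  E-↭ ↭.refl e = refl
  E-↭ (↭.prep o h) e = cong₂ _+_ (cong (q *_) (E-↭ h e)) (cong (p *_) (E-↭ h (λ ω ω′ k → e _ _ λ z → upd-cong o {ω} {ω′} {z} (k z))))
  E-↭ {x ∷ y ∷ xs} {y ∷ x ∷ ys} (↭.swap x y h) {f} e =
    trans (lemma p (E xs f) (E xs (λ ω → f (upd y ω))) (E xs (λ ω → f (upd x ω))) (E xs (λ ω → f (upd x (upd y ω)))))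
      (cong₂ _+_ (cong (q *_) (cong₂ _+_ (cong (q *_) (E-↭ h e)) (cong (p *_) (E-↭ h λ ω ω′ k → e _ _ λ z → upd-cong x {ω} {ω′} {z} (k z)))))
        (cong (p *_) (cong₂ _+_ (cong (q *_) (E-↭ h λ ω ω′ k → e _ _ λ z → upd-cong y {ω} {ω′} {z} (k z)))
          (cong (p *_) (trans (E-cong xs λ ω _ → e _ _ (comm ω)) (E-↭ h λ ω ω′ k → e _ _ λ z → upd-cong y {upd x ω} {upd x ω′} {z} (upd-cong x {ω} {ω′} {z} (k z))))))))
    where
    lemma : ∀ p a b c d → (1ℚ - p) * ((1ℚ - p) * a + p * b) + p * ((1ℚ - p) * c + p * d)
          ≡ (1ℚ - p) * ((1ℚ - p) * a + p * c) + p * ((1ℚ - p) * b + p * d)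
    lemma = solve-∀ ℚ-ring
    comm : ∀ ω z → upd x (upd y ω) z ≡ upd y (upd x ω) z
    comm ω z with z == x | z == y
    ... | true | true = refl
    ... | true | false = refl
    ... | false | true = refl
    ... | false | false = refl
  E-↭ (↭.trans h k) e = trans (E-↭ h e) (E-↭ k e)

  ∏ : List O → (O → ℚ) → ℚ
  ∏ [] f = 1ℚ
  ∏ (x ∷ xs) f = f x * ∏ xs f

  ∏-cong : ∀ xs {f g : O → ℚ} → (∀ x → x ∈ xs → f x ≡ g x) → ∏ xs f ≡ ∏ xs g
  ∏-cong [] h = refl
  ∏-cong (x ∷ xs) h = cong₂ _*_ (h x (here refl)) (∏-cong xs λ y y∈ → h y (there y∈))

  E-∏ : ∀ os → Unique os → (w : O → Bool → ℚ) → E os (λ ω → ∏ os (λ z → w z (ω z))) ≡ ∏ os (λ z → q * w z false + p * w z true)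
  E-∏ [] _ w = refl
  E-∏ (o ∷ os) (o∉ ∷ u) w =
    trans (cong₂ _+_ (cong (q *_) (trans (E-cong os λ ω s → cong (λ b → w o b * ∏ os (λ z → w z (ω z))) (¬true⇒false λ e → All.lookup o∉ (s o e) refl)) (E-* os (w o false) _)))
                       (cong (p *_) (trans (E-cong os λ ω s → cong₂ _*_ (cong (w o) (upd-same o ω)) (∏-cong os λ z z∈ → cong (w z) (upd-other ω λ { refl → All.lookup o∉ z∈ refl }))) (E-* os (w o true) _))))
      (trans (lemma q p (w o false) (w o true) (E os (λ ω → ∏ os (λ z → w z (ω z))))) (cong ((q * w o false + p * w o true) *_) (E-∏ os u w)))
    where
    lemma : ∀ q p a b e → q * (a * e) + p * (b * e) ≡ (q * a + p * b) * e
    lemma = solve-∀ ℚ-ring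

  markov : ∀ os {f : Outcome → ℚ} {bad : Outcome → Bool} {c} → (∀ ω → Supp os ω → 0ℚ ≤ f ω) → (∀ ω → Supp os ω → bad ω ≡ true → c ≤ f ω) →
           c * E os (λ ω → 𝟙 (bad ω)) ≤ E os f
  markov os {f} {bad} {c} h k = subst (_≤ E os f) (E-* os c _) (E-mono os λ ω s → go ω s (bool-case (bad ω)))
    where
    go : ∀ ω → Supp os ω → bad ω ≡ true ⊎ bad ω ≡ false → c * 𝟙 (bad ω) ≤ f ω
    go ω s (inj₁ e) rewrite e = ≤-trans (≤-reflexive (ℚₚ.*-identityʳ c)) (k ω s e)
    go ω s (inj₂ e) rewrite e = ≤-trans (≤-reflexive (ℚₚ.*-zeroʳ c)) (h ω s)

  -- A decision-tree bound on the influence of the variables: along every branch at most b queried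
  -- variables can change the function, each by at most c.
  data Budget (c : ℚ) : List O → (Outcome → ℚ) → ℕ → Set where
    done : ∀ {f b} → Budget c [] f b
    skip : ∀ {o os f b} → (∀ ω → Supp os ω → f (upd o ω) ≡ f ω) → Budget c os f b → Budget c (o ∷ os) f b
    pay  : ∀ {o os f b} → (∀ ω → Supp os ω → (f (upd o ω) ≤ f ω + c) × (f ω ≤ f (upd o ω) + c)) →
           Budget c os f b → Budget c os (λ ω → f (upd o ω)) b → Budget c (o ∷ os) f (suc b)

  Budget-affine : ∀ {c os f b} μ ν d → (d ≡ μ ⊎ d ≡ - μ) → 0ℚ ≤ d → Budget c os f b → Budget (d * c) os (λ ω → ν + μ * f ω) b
  Budget-affine μ ν d sg 0≤d done = done
  Budget-affine μ ν d sg 0≤d (skip h B) = skip (λ ω s → cong (λ z → ν + μ * z) (h ω s)) (Budget-affine μ ν d sg 0≤d B)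
  Budget-affine {c} {f = f} μ ν d sg 0≤d (pay {o = o} h B B′) = pay (λ ω s → step sg (proj₁ (h ω s)) (proj₂ (h ω s)))
      (Budget-affine μ ν d sg 0≤d B) (Budget-affine μ ν d sg 0≤d B′)
    where
    step : ∀ {x y} → (d ≡ μ ⊎ d ≡ - μ) → x ≤ y + c → y ≤ x + c → (ν + μ * x ≤ ν + μ * y + d * c) × (ν + μ * y ≤ ν + μ * x + d * c)
    step {x} {y} (inj₁ refl) h₁ h₂ = by-gap (0≤* 0≤d (diff h₁)) (l d ν c x y) , by-gap (0≤* 0≤d (diff h₂)) (l d ν c y x)
      where
      l : ∀ d ν c x y → ν + d * y + d * c ≡ ν + d * x + d * (y + c - x)
      l = solve-∀ ℚ-ring
    step {x} {y} (inj₂ refl) h₁ h₂ = by-gap (0≤* 0≤d (diff h₂)) (l μ ν c x y) , by-gap (0≤* 0≤d (diff h₁)) (l μ ν c y x)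
      where
      l : ∀ μ ν c x y → ν + μ * y + - μ * c ≡ ν + μ * x + - μ * (x + c - y)
      l = solve-∀ ℚ-ring

  E-lower : ∀ os {f c} → (∀ ω → Supp os ω → c ≤ f ω) → c ≤ E os f
  E-lower os {f} {c} h = subst (_≤ E os f) (E-const os c) (E-mono os h)

  -- One step of the supermartingale: the mean of two M-th powers against the M-th power of the mean.
  power-step : ∀ M {G₀ G₁ δ} → 1ℚ ≤ ι 2 * G₀ → 1ℚ ≤ ι 2 * G₁ → 0ℚ ≤ δ → G₁ ≤ G₀ + δ → G₀ ≤ G₁ + δ → ι 2 * (ι M * δ) ≤ 1ℚ →
               q * G₀ ^ M + p * G₁ ^ M ≤ (q * G₀ + p * G₁) ^ M * (1ℚ + p * (ι 2 * (ι M * δ)) * (ι 2 * (ι M * δ)))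
  power-step M {G₀} {G₁} {δ} h₀ h₁ 0≤δ u₁ u₂ small = ≤-trans
      (≤-reflexive (trans (cong₂ _+_ (cong (q *_) (trans (cong (_^ M) e₀) (*-^ A (1ℚ + z₀) M))) (cong (p *_) (trans (cong (_^ M) e₁) (*-^ A (1ℚ + z₁) M))))
         (lemma-c q p (A ^ M) ((1ℚ + z₀) ^ M) ((1ℚ + z₁) ^ M))))
      (*-monoʳ (0≤^ 0≤A M) (≤-trans (+-mono (*-monoʳ 0≤q (pow-quadratic 0≤1+z₀ M m₀)) (*-monoʳ 0≤p (pow-quadratic 0≤1+z₁ M m₁)))
        (≤-trans (≤-reflexive (lemma-d p (ι M) D B)) (by-gap (0≤* 0≤p gap) (lemma-e p (ι M * D * B) (ι 2 * (ι M * δ)))))))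
    where
    A D : ℚ
    A = q * G₀ + p * G₁
    D = G₁ - G₀
    ½ : ∀ p {a b} → 1ℚ ≤ ι 2 * a → 1ℚ ≤ ι 2 * b → 0ℚ ≤ 1ℚ - p → 0ℚ ≤ p → 1ℚ ≤ ι 2 * ((1ℚ - p) * a + p * b)
    ½ p {a} {b} h k x y = by-gap (0≤+ (0≤* x (diff h)) (0≤* y (diff k))) (l p a b (ι 2))
      where
      l : ∀ p a b t → t * ((1ℚ - p) * a + p * b) ≡ 1ℚ + ((1ℚ - p) * (t * a - 1ℚ) + p * (t * b - 1ℚ))
      l = solve-∀ ℚ-ring
    1≤2A : 1ℚ ≤ ι 2 * A
    1≤2A = ½ p h₀ h₁ 0≤q 0≤p
    0<2A : 0ℚ < ι 2 * A
    0<2A = ℚₚ.<-≤-trans (ℚₚ.positive⁻¹ 1ℚ) 1≤2A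
    0<A : 0ℚ < A
    0<A with ≤-dec A 0ℚ
    ... | inj₂ h = h
    ... | inj₁ h = ⊥-elim (<⇒≱ 0<2A (≤-trans (*-monoʳ (0≤ι 2) h) (≤-reflexive (ℚₚ.*-zeroʳ (ι 2)))))
    0≤A = ℚₚ.<⇒≤ 0<A
    B : ℚ
    B = proj₁ (inverse 0<A)
    AB : A * B ≡ 1ℚ
    AB = proj₁ (proj₂ (inverse 0<A))
    0≤B = ℚₚ.<⇒≤ (proj₂ (proj₂ (inverse 0<A)))
    B≤2 : B ≤ ι 2
    B≤2 = by-gap (0≤* 0≤B (diff 1≤2A)) (trans (sym (ℚₚ.*-identityʳ (ι 2))) (trans (cong (ι 2 *_) (sym AB)) (l (ι 2) A B)))
      where
      l : ∀ t a b → t * (a * b) ≡ b + b * (t * a - 1ℚ)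
      l = solve-∀ ℚ-ring
    z₀ z₁ : ℚ
    z₀ = - (p * D) * B
    z₁ = q * D * B
    e₀ : G₀ ≡ A * (1ℚ + z₀)
    e₀ = trans (l p G₀ G₁) (trans (cong (λ z → A - p * D * z) (sym AB)) (l₂ A p D B))
      where
      l : ∀ p a b → a ≡ ((1ℚ - p) * a + p * b) - p * (b - a) * 1ℚ
      l = solve-∀ ℚ-ring
      l₂ : ∀ A p D B → A - p * D * (A * B) ≡ A * (1ℚ + - (p * D) * B)
      l₂ = solve-∀ ℚ-ring
    e₁ : G₁ ≡ A * (1ℚ + z₁)
    e₁ = trans (l p G₀ G₁) (trans (cong (λ z → A + q * D * z) (sym AB)) (l₂ A q D B))
      where
      l : ∀ p a b → b ≡ ((1ℚ - p) * a + p * b) + (1ℚ - p) * (b - a) * 1ℚ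
      l = solve-∀ ℚ-ring
      l₂ : ∀ A q D B → A + q * D * (A * B) ≡ A * (1ℚ + q * D * B)
      l₂ = solve-∀ ℚ-ring
    nonneg : ∀ {G z} → 1ℚ ≤ ι 2 * G → G ≡ A * (1ℚ + z) → 0ℚ ≤ 1ℚ + z
    nonneg {G} {z} h e = cancel-* 0<A (≤-trans (≤-reflexive (ℚₚ.*-zeroʳ A)) (≤-trans (cancel-* (ι-pos 1) (≤-trans (≤-reflexive (ℚₚ.*-zeroʳ (ι 2))) (≤-trans 0≤1 h))) (≤-reflexive e)))
    0≤1+z₀ = nonneg {z = z₀} h₀ e₀
    0≤1+z₁ = nonneg {z = z₁} h₁ e₁
    D≤δ : D ≤ δ
    D≤δ = by-gap (diff u₁) (l G₀ G₁ δ)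
      where
      l : ∀ a b d → d ≡ b - a + (a + d - b)
      l = solve-∀ ℚ-ring
    -D≤δ : - D ≤ δ
    -D≤δ = by-gap (diff u₂) (l G₀ G₁ δ)
      where
      l : ∀ a b d → d ≡ - (b - a) + (b + d - a)
      l = solve-∀ ℚ-ring
    bound : ∀ {r x} → 0ℚ ≤ r → r ≤ 1ℚ → x ≤ δ → ι M * (r * x * B) ≤ 1ℚ
    bound {r} {x} 0≤r r≤1 x≤δ = ≤-trans (≤-trans (*-monoʳ (0≤ι M) (≤-trans (*-monoˡ 0≤B (≤-trans (*-monoʳ 0≤r x≤δ) (≤-trans (*-monoˡ 0≤δ r≤1) (≤-reflexive (ℚₚ.*-identityˡ δ))))) (*-monoʳ 0≤δ B≤2)))
       (≤-reflexive (l (ι M) δ (ι 2)))) small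
      where
      l : ∀ M d t → M * (d * t) ≡ t * (M * d)
      l = solve-∀ ℚ-ring
    m₀ : ι M * z₀ ≤ 1ℚ
    m₀ = ≤-trans (≤-reflexive (cong (ι M *_) (l p D B))) (bound 0≤p p≤1 -D≤δ)
      where
      l : ∀ p D B → - (p * D) * B ≡ p * - D * B
      l = solve-∀ ℚ-ring
    m₁ : ι M * z₁ ≤ 1ℚ
    m₁ = bound 0≤q (by-gap 0≤p (l p)) D≤δ
      where
      l : ∀ p → 1ℚ ≡ 1ℚ - p + p
      l = solve-∀ ℚ-ring
    lemma-c : ∀ q p a x y → q * (a * x) + p * (a * y) ≡ a * (q * x + p * y)
    lemma-c = solve-∀ ℚ-ring
    lemma-d : ∀ p M D B → (1ℚ - p) * (1ℚ + M * (- (p * D) * B) + M * (- (p * D) * B) * (M * (- (p * D) * B)))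
               + p * (1ℚ + M * ((1ℚ - p) * D * B) + M * ((1ℚ - p) * D * B) * (M * ((1ℚ - p) * D * B)))
            ≡ 1ℚ + p * (1ℚ - p) * (M * D * B * (M * D * B))
    lemma-d = solve-∀ ℚ-ring
    lemma-e : ∀ p x y → 1ℚ + p * y * y ≡ 1ℚ + p * (1ℚ - p) * (x * x) + p * ((y - x) * (y + x) + p * (x * x))
    lemma-e = solve-∀ ℚ-ring
    MDB≤ : ∀ {x} → x ≤ δ → ι M * x * B ≤ ι 2 * (ι M * δ)
    MDB≤ {x} h = ≤-trans (*-monoˡ 0≤B (*-monoʳ (0≤ι M) h)) (≤-trans (*-monoʳ (0≤* (0≤ι M) 0≤δ) B≤2) (≤-reflexive (ℚₚ.*-comm (ι M * δ) (ι 2))))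
    gap : 0ℚ ≤ (ι 2 * (ι M * δ) - ι M * D * B) * (ι 2 * (ι M * δ) + ι M * D * B) + p * (ι M * D * B * (ι M * D * B))
    gap = 0≤+ (0≤* (diff (MDB≤ D≤δ)) (≤-trans (diff (MDB≤ -D≤δ)) (≤-reflexive (l (ι 2 * (ι M * δ)) (ι M) D B)))) (0≤* 0≤p (sq≥0 (ι M * D * B)))
      where
      l : ∀ a M D B → a - M * - D * B ≡ a + M * D * B
      l = solve-∀ ℚ-ring

  E-close : ∀ os {f g : Outcome → ℚ} {c} → (∀ ω → Supp os ω → f ω ≤ g ω + c) → E os f ≤ E os g + c
  E-close os {f} {g} {c} h = ≤-trans (E-mono os h) (≤-reflexive (trans (E-+ os g (λ _ → c)) (cong (E os g +_) (E-const os c))))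

  moment : ∀ M {δ} → 0ℚ ≤ δ → ι 2 * (ι M * δ) ≤ 1ℚ → ∀ {os f b} → Budget δ os f b → (∀ ω → Supp os ω → 1ℚ ≤ ι 2 * f ω) →
           E os (λ ω → f ω ^ M) ≤ E os f ^ M * (1ℚ + p * (ι 2 * (ι M * δ)) * (ι 2 * (ι M * δ))) ^ b
  moment M {δ} 0≤δ small {f = f} {b} done h = ≤-trans (≤-reflexive (sym (ℚₚ.*-identityʳ (f ∅ ^ M)))) (*-monoʳ (0≤^ 0≤f M) (1≤^ 1≤r b))
    where
    0≤f : 0ℚ ≤ f ∅
    0≤f = cancel-* (ι-pos 1) (≤-trans (≤-reflexive (ℚₚ.*-zeroʳ (ι 2))) (≤-trans 0≤1 (h ∅ λ _ ())))
    1≤r : 1ℚ ≤ 1ℚ + p * (ι 2 * (ι M * δ)) * (ι 2 * (ι M * δ))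
    1≤r = by-gap (0≤* (0≤* 0≤p y) y) refl
      where y = 0≤* (0≤ι 2) (0≤* (0≤ι M) 0≤δ)
  moment M {δ} 0≤δ small {o ∷ os} {f} {b} (skip e B) h = subst (λ z → E (o ∷ os) (λ ω → f ω ^ M) ≤ z ^ M * r ^ b) (sym e₂) (≤-trans (≤-reflexive e₁) (moment M 0≤δ small B λ ω s → h ω (Supp-∷ s)))
    where
    r = 1ℚ + p * (ι 2 * (ι M * δ)) * (ι 2 * (ι M * δ))
    e₁ : E (o ∷ os) (λ ω → f ω ^ M) ≡ E os (λ ω → f ω ^ M)
    e₁ = trans (cong (λ z → q * E os (λ ω → f ω ^ M) + p * z) (E-cong os λ ω s → cong (_^ M) (e ω s))) (convex p _)
    e₂ : E (o ∷ os) f ≡ E os f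
    e₂ = trans (cong (λ z → q * E os f + p * z) (E-cong os e)) (convex p _)
  moment M {δ} 0≤δ small {o ∷ os} {f} {suc b} (pay e B B′) h = ≤-trans
      (+-mono (*-monoʳ 0≤q (moment M 0≤δ small B λ ω s → h ω (Supp-∷ s))) (*-monoʳ 0≤p (moment M 0≤δ small B′ λ ω s → h (upd o ω) (Supp-upd s))))
      (≤-trans (≤-reflexive (lemma q p (G₀ ^ M) (G₁ ^ M) (r ^ b)))
        (≤-trans (*-monoˡ (0≤^ 0≤r b) (power-step M (avg λ ω s → h ω (Supp-∷ s)) (avg λ ω s → h (upd o ω) (Supp-upd s)) 0≤δ
           (E-close os λ ω s → proj₁ (e ω s)) (E-close os λ ω s → proj₂ (e ω s)) small))
         (≤-reflexive (ℚₚ.*-assoc (E (o ∷ os) f ^ M) r (r ^ b)))))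
    where
    G₀ = E os f
    G₁ = E os (λ ω → f (upd o ω))
    r = 1ℚ + p * (ι 2 * (ι M * δ)) * (ι 2 * (ι M * δ))
    0≤r : 0ℚ ≤ r
    0≤r = 0≤+ 0≤1 (0≤* (0≤* 0≤p y) y)
      where y = 0≤* (0≤ι 2) (0≤* (0≤ι M) 0≤δ)
    avg : ∀ {g} → (∀ ω → Supp os ω → 1ℚ ≤ ι 2 * g ω) → 1ℚ ≤ ι 2 * E os g
    avg {g} k = ≤-trans (E-lower os k) (≤-reflexive (E-* os (ι 2) g))
    lemma : ∀ q p a b r → q * (a * r) + p * (b * r) ≡ (q * a + p * b) * r
    lemma = solve-∀ ℚ-ring

  private
    sign-scale : ∀ {e d} → e ≡ 1ℚ ⊎ e ≡ - 1ℚ → d ≡ e * d ⊎ d ≡ - (e * d)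
    sign-scale {d = d} (inj₁ refl) = inj₁ (sym (ℚₚ.*-identityˡ d))
    sign-scale {d = d} (inj₂ refl) = inj₂ (l d)
      where
      l : ∀ d → d ≡ - (- 1ℚ * d)
      l = solve-∀ ℚ-ring

    sign-range : ∀ {e f μ R} → e ≡ 1ℚ ⊎ e ≡ - 1ℚ → 0ℚ ≤ f → f ≤ R → 0ℚ ≤ μ → μ ≤ R → - R ≤ e * (f - μ)
    sign-range {f = f} {μ} {R} (inj₁ refl) 0≤f f≤R 0≤μ μ≤R = by-gap (0≤+ 0≤f (diff μ≤R)) (l f μ R)
      where
      l : ∀ f μ R → 1ℚ * (f - μ) ≡ - R + (f + (R - μ))
      l = solve-∀ ℚ-ring
    sign-range {f = f} {μ} {R} (inj₂ refl) 0≤f f≤R 0≤μ μ≤R = by-gap (0≤+ 0≤μ (diff f≤R)) (l f μ R)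
      where
      l : ∀ f μ R → - 1ℚ * (f - μ) ≡ - R + (μ + (R - f))
      l = solve-∀ ℚ-ring

  tail : ∀ {os f b c R σ} (Θ : ℕ) (e : ℚ) → e ≡ 1ℚ ⊎ e ≡ - 1ℚ → 1 ℕ.≤ Θ → 0ℚ ≤ c → 0ℚ < σ → ι 2 * c ≤ σ →
         ι b * p * (ι 2 * c) * (ι 2 * c) ≤ σ * σ → Budget c os f b → (∀ ω → (0ℚ ≤ f ω) × (f ω ≤ R)) →
         (bad : Outcome → Bool) → (∀ ω → bad ω ≡ true → ι Θ * σ ≤ e * (f ω - E os f)) →
         ι 2 ^ Θ * E os (λ ω → 𝟙 (bad ω)) ≤ ι 3
  tail {os} {f} {b} {c} {R} {σ} Θ e sg 1≤Θ 0≤c 0<σ 2c≤σ var B rng bad hb = ≤-trans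
      (markov os (λ ω s → 0≤^ (0≤g ω) M) (λ ω s β → ≤-trans growth (^-mono 0≤1+1/m (far ω β) M)))
      (≤-trans (moment M 0≤δ small (Budget-affine (e * d) ν d sgn 0≤d B) (λ ω _ → g≥½ ω))
        (≤-trans (≤-reflexive (trans (cong (λ z → z ^ M * r ^ b) Eg) (trans (cong (_* r ^ b) (1^ M)) (ℚₚ.*-identityˡ (r ^ b)))))
          (≤-trans (pow-quadratic (0≤+ 0≤1 0≤y) b by≤1) (≤-trans (+-mono (+-mono (≤-refl {1ℚ}) by≤1) (*-mono 0≤by 0≤1 by≤1 by≤1)) (≤-reflexive three)))))
    where
    λ′ : ℚ
    λ′ = proj₁ (inverse 0<σ)
    σλ : σ * λ′ ≡ 1ℚ
    σλ = proj₁ (proj₂ (inverse 0<σ))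
    0≤λ : 0ℚ ≤ λ′
    0≤λ = ℚₚ.<⇒≤ (proj₂ (proj₂ (inverse 0<σ)))
    m : ℕ
    m = suc (proj₁ (archimedean (ι 2 * (R * λ′))))
    m-big : ι 2 * (R * λ′) ≤ ι m
    m-big = ≤-trans (proj₂ (archimedean (ι 2 * (R * λ′)))) (ι-mono (ℕₚ.n≤1+n _))
    M : ℕ
    M = Θ ℕ.* m
    0<M : 0ℚ < ι M
    0<M = subst (0ℚ <_) (sym (ι-* Θ m)) (*-pos (ι-pos′ 1≤Θ) (ι-pos _))
    m≤M : ι m ≤ ι M
    m≤M = ι-mono (subst (ℕ._≤ M) (ℕₚ.*-identityˡ m) (ℕₚ.*-monoˡ-≤ m 1≤Θ))
    v : ℚ
    v = proj₁ (inverse 0<M)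
    Mv : ι M * v ≡ 1ℚ
    Mv = proj₁ (proj₂ (inverse 0<M))
    0≤v = ℚₚ.<⇒≤ (proj₂ (proj₂ (inverse 0<M)))
    d μ ν : ℚ
    d = λ′ * v
    0≤d : 0ℚ ≤ d
    0≤d = 0≤* 0≤λ 0≤v
    μ = E os f
    ν = 1ℚ - e * d * μ
    g : Outcome → ℚ
    g ω = ν + e * d * f ω
    sgn : d ≡ e * d ⊎ d ≡ - (e * d)
    sgn = sign-scale sg
    g-eq : ∀ ω → g ω ≡ 1ℚ + d * (e * (f ω - μ))
    g-eq ω = l e d μ (f ω)
      where
      l : ∀ e d μ f → 1ℚ - e * d * μ + e * d * f ≡ 1ℚ + d * (e * (f - μ))
      l = solve-∀ ℚ-ring
    0≤μ : 0ℚ ≤ μ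
    0≤μ = E-lower os λ ω _ → proj₁ (rng ω)
    μ≤R : μ ≤ R
    μ≤R = ≤-trans (E-mono os λ ω _ → proj₂ (rng ω)) (≤-reflexive (E-const os R))
    dev : ∀ ω → - R ≤ e * (f ω - μ)
    dev ω = sign-range sg (proj₁ (rng ω)) (proj₂ (rng ω)) 0≤μ μ≤R
    dR : ι 2 * (d * R) ≤ 1ℚ
    dR = ≤-trans (≤-reflexive (l λ′ v R (ι 2))) (≤-trans (*-monoˡ 0≤v (≤-trans m-big m≤M)) (≤-reflexive Mv))
      where
      l : ∀ a v R t → t * (a * v * R) ≡ t * (R * a) * v
      l = solve-∀ ℚ-ring
    g≥½ : ∀ ω → 1ℚ ≤ ι 2 * g ω
    g≥½ ω = by-gap (0≤+ (diff dR) (0≤* (0≤* (0≤ι 2) 0≤d) (diff (dev ω)))) (trans (cong (ι 2 *_) (g-eq ω)) (trans (cong (_* (1ℚ + d * (e * (f ω - μ)))) 2≡) (trans (l d R (e * (f ω - μ))) (cong (λ t → 1ℚ + (1ℚ - t * (d * R) + t * d * (e * (f ω - μ) - - R))) (sym 2≡)))))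
      where
      2≡ : ι 2 ≡ 1ℚ + 1ℚ
      2≡ = trans (ι-suc 1) (cong (1ℚ +_) ι1)
      l : ∀ d R x → (1ℚ + 1ℚ) * (1ℚ + d * x) ≡ 1ℚ + (1ℚ - (1ℚ + 1ℚ) * (d * R) + (1ℚ + 1ℚ) * d * (x - - R))
      l = solve-∀ ℚ-ring
    0≤g : ∀ ω → 0ℚ ≤ g ω
    0≤g ω = cancel-* (ι-pos 1) (≤-trans (≤-reflexive (ℚₚ.*-zeroʳ (ι 2))) (≤-trans 0≤1 (g≥½ ω)))
    Eg : E os g ≡ 1ℚ
    Eg = trans (E-+ os (λ _ → ν) (λ ω → e * d * f ω)) (trans (cong₂ _+_ (E-const os ν) (E-* os (e * d) f)) (l (e * d * μ)))
      where
      l : ∀ x → 1ℚ - x + x ≡ 1ℚ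
      l = solve-∀ ℚ-ring
    1/m : ℚ
    1/m = proj₁ (inverse (ι-pos (proj₁ (archimedean (ι 2 * (R * λ′))))))
    m·1/m : ι m * 1/m ≡ 1ℚ
    m·1/m = proj₁ (proj₂ (inverse (ι-pos (proj₁ (archimedean (ι 2 * (R * λ′)))))))
    0≤1+1/m : 0ℚ ≤ 1ℚ + 1/m
    0≤1+1/m = 0≤+ 0≤1 (ℚₚ.<⇒≤ (proj₂ (proj₂ (inverse (ι-pos (proj₁ (archimedean (ι 2 * (R * λ′)))))))))
    growth : ι 2 ^ Θ ≤ (1ℚ + 1/m) ^ M
    growth = ≤-trans (^-mono (0≤ι 2) (≤-trans (≤-reflexive (trans (ι-suc 1) (cong (1ℚ +_) (trans ι1 (sym m·1/m))))) (bernoulli 0≤1+1/m m)) Θ)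
                     (≤-reflexive (sym (^-* (1ℚ + 1/m) Θ m)))
    dΘσ : d * (ι Θ * σ) ≡ 1/m
    dΘσ = trans (l λ′ v (ι Θ) σ 1/m) (trans (cong₂ (λ x y → x * (v * (ι Θ * y))) σλ (sym m·1/m))
          (trans (l₂ v (ι Θ) (ι m) 1/m) (trans (cong (λ z → z * v * 1/m) (sym (ι-* Θ m))) (trans (cong (_* 1/m) Mv) (ℚₚ.*-identityˡ 1/m)))))
      where
      l : ∀ a v Θ σ k → a * v * (Θ * σ) ≡ σ * a * (v * (Θ * 1ℚ))
      l = solve-∀ ℚ-ring
      l₂ : ∀ v Θ m k → 1ℚ * (v * (Θ * (m * k))) ≡ Θ * m * v * k
      l₂ = solve-∀ ℚ-ring
    far : ∀ ω → bad ω ≡ true → 1ℚ + 1/m ≤ g ω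
    far ω β = ≤-trans (+-mono (≤-refl {1ℚ}) (≤-trans (≤-reflexive (sym dΘσ)) (*-monoʳ 0≤d (hb ω β)))) (≤-reflexive (sym (g-eq ω)))
    δ : ℚ
    δ = d * c
    0≤δ : 0ℚ ≤ δ
    0≤δ = 0≤* 0≤d 0≤c
    Mδ : ι M * δ ≡ λ′ * c
    Mδ = trans (l (ι M) λ′ v c) (trans (cong (λ z → z * (λ′ * c)) Mv) (ℚₚ.*-identityˡ (λ′ * c)))
      where
      l : ∀ M a v c → M * (a * v * c) ≡ M * v * (a * c)
      l = solve-∀ ℚ-ring
    small : ι 2 * (ι M * δ) ≤ 1ℚ
    small = ≤-trans (≤-reflexive (trans (cong (ι 2 *_) Mδ) (l (ι 2) λ′ c))) (≤-trans (*-monoˡ 0≤λ 2c≤σ) (≤-reflexive σλ))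
      where
      l : ∀ t a c → t * (a * c) ≡ t * c * a
      l = solve-∀ ℚ-ring
    y r : ℚ
    y = p * (ι 2 * (ι M * δ)) * (ι 2 * (ι M * δ))
    r = 1ℚ + y
    0≤y : 0ℚ ≤ y
    0≤y = 0≤* (0≤* 0≤p z) z
      where z = 0≤* (0≤ι 2) (0≤* (0≤ι M) 0≤δ)
    0≤by = 0≤* (0≤ι b) 0≤y
    by≤1 : ι b * y ≤ 1ℚ
    by≤1 = ≤-trans (≤-reflexive (trans (cong (λ z → ι b * (p * (ι 2 * z) * (ι 2 * z))) Mδ) (l (ι b) p (ι 2) λ′ c)))
       (≤-trans (*-monoˡ (0≤* 0≤λ 0≤λ) var) (≤-reflexive (trans (l₂ σ λ′) (trans (cong₂ _*_ σλ σλ) (ℚₚ.*-identityˡ 1ℚ)))))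
      where
      l : ∀ b p t a c → b * (p * (t * (a * c)) * (t * (a * c))) ≡ b * p * (t * c) * (t * c) * (a * a)
      l = solve-∀ ℚ-ring
      l₂ : ∀ s a → s * s * (a * a) ≡ s * a * (s * a)
      l₂ = solve-∀ ℚ-ring
    three : 1ℚ + 1ℚ + 1ℚ * 1ℚ ≡ ι 3
    three = sym (trans (ι-suc 2) (trans (cong (1ℚ +_) (trans (ι-suc 1) (cong (1ℚ +_) ι1))) refl))

  -- Rosenfeld-style counting in place of the local lemma: adding one variable at a time, the probability
  -- that no bad event has occurred drops by a factor of at least 1 - ε.
  module Avoid {X : Set} (os : List O) (evs : List X) (bad : X → Outcome → Bool) (V : X → List O)
    (V-unique : ∀ x → x ∈ evs → Unique (V x)) (V-local : ∀ x → x ∈ evs → Local (_∈ᵇ V x) (bad x))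
    (k d : ℕ) (V-size : ∀ x → x ∈ evs → length (V x) ℕ.≤ k) (V-deg : ∀ o → # (λ x → o ∈ᵇ V x) evs ℕ.≤ d)
    (P : ℚ) (0≤P : 0ℚ ≤ P) (rare : ∀ x → x ∈ evs → E os (λ ω → 𝟙 (bad x ω)) ≤ P)
    (P<1 : P < 1ℚ) (small : ι (4 ℕ.* d ℕ.* k) * P ≤ 1ℚ) where

    inside : List O → List O → Bool
    inside vs ys = not (any (λ o → not (o ∈ᵇ ys)) vs)

    inside⁺ : ∀ vs {ys} → (∀ o → o ∈ vs → o ∈ ys) → inside vs ys ≡ true
    inside⁺ vs {ys} h = not-true (¬true⇒false λ e → let o , o∈ , n = any⁻ _ vs e in ∉ᵇ ys (not-elim n) (h o o∈))

    inside⁻ : ∀ vs {ys} → inside vs ys ≡ true → ∀ o → o ∈ vs → o ∈ ys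
    inside⁻ vs {ys} h o o∈ with bool-case (o ∈ᵇ ys)
    ... | inj₁ e = ∈ᵇ⁻ ys e
    ... | inj₂ e = ⊥-elim (true≢false (any⁺ (λ o → not (o ∈ᵇ ys)) o∈ (not-true e)) (not-elim h))

    bad-in : List O → Outcome → X → Bool
    bad-in ys ω x = inside (V x) ys ∧ bad x ω

    good : List O → Outcome → Bool
    good ys ω = not (any (bad-in ys ω) evs)

    W : List O → ℚ
    W ys = E os (λ ω → 𝟙 (good ys ω))

    good-antitone : ∀ {ys zs} ω → (∀ o → o ∈ ys → o ∈ zs) → good zs ω ≡ true → good ys ω ≡ true
    good-antitone {ys} {zs} ω h g = not-true (¬true⇒false λ e → let x , x∈ , b = any⁻ (bad-in ys ω) evs e in
      true≢false (any⁺ (bad-in zs ω) x∈ (∧-intro (inside⁺ (V x) λ o o∈ → h o (inside⁻ (V x) (∧-left b) o o∈)) (∧-right {inside (V x) ys} b))) (not-elim g))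

    W-antitone : ∀ {ys zs} → (∀ o → o ∈ ys → o ∈ zs) → W zs ≤ W ys
    W-antitone h = E-mono os λ ω _ → 𝟙-mono (good-antitone ω h)

    0≤W : ∀ ys → 0ℚ ≤ W ys
    0≤W ys = E-≥0 os λ ω _ → 0≤𝟙 (good ys ω)

    rest : List O → X → List O
    rest ys x = filterᵇ (λ o → not (o ∈ᵇ V x)) ys

    cover : ∀ v ys ω → 𝟙 (good ys ω) ≤ 𝟙 (good (v ∷ ys) ω) + ∑ evs (λ x → 𝟙 (v ∈ᵇ V x) * (𝟙 (bad x ω) * 𝟙 (good (rest ys x) ω)))
    cover v ys ω with bool-case (good ys ω) | bool-case (good (v ∷ ys) ω)
    ... | inj₂ e | _ rewrite e = 0≤+ (0≤𝟙 (good (v ∷ ys) ω)) (∑-≥0 evs λ x _ → 0≤* (0≤𝟙 (v ∈ᵇ V x)) (0≤* (0≤𝟙 (bad x ω)) (0≤𝟙 (good (rest ys x) ω))))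
    ... | inj₁ _ | inj₁ e rewrite e = ≤-trans (𝟙≤1 (good ys ω)) (by-gap (∑-≥0 evs λ x _ → 0≤* (0≤𝟙 (v ∈ᵇ V x)) (0≤* (0≤𝟙 (bad x ω)) (0≤𝟙 (good (rest ys x) ω)))) refl)
    ... | inj₁ g | inj₂ e with any⁻ (bad-in (v ∷ ys) ω) evs (flip-not e)
      where
      flip-not : ∀ {a} → not a ≡ false → a ≡ true
      flip-not {true} _ = refl
    ...   | x , x∈ , b = ≤-trans (≤-reflexive (cong 𝟙 g)) (≤-trans (≤-trans (≤-reflexive (sym all-one)) (term≤∑ evs x∈))
              (by-gap (0≤𝟙 (good (v ∷ ys) ω)) (ℚₚ.+-comm (𝟙 (good (v ∷ ys) ω)) (∑ evs F))))
      where
      F : X → ℚ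
      F x = 𝟙 (v ∈ᵇ V x) * (𝟙 (bad x ω) * 𝟙 (good (rest ys x) ω))
      term≤∑ : ∀ zs → x ∈ zs → F x ≤ ∑ zs F
      term≤∑ (z ∷ zs) (here refl) = by-gap (∑-≥0 zs λ w _ → 0≤* (0≤𝟙 (v ∈ᵇ V w)) (0≤* (0≤𝟙 (bad w ω)) (0≤𝟙 (good (rest ys w) ω)))) refl
      term≤∑ (z ∷ zs) (there h) = ≤-trans (term≤∑ zs h) (by-gap (0≤* (0≤𝟙 (v ∈ᵇ V z)) (0≤* (0≤𝟙 (bad z ω)) (0≤𝟙 (good (rest ys z) ω)))) (ℚₚ.+-comm (F z) (∑ zs F)))
      bx : bad x ω ≡ true
      bx = ∧-right {inside (V x) (v ∷ ys)} b
      v∈ : v ∈ᵇ V x ≡ true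
      v∈ with bool-case (v ∈ᵇ V x)
      ... | inj₁ h = h
      ... | inj₂ h = ⊥-elim (true≢false (any⁺ (bad-in ys ω) x∈ (∧-intro (inside⁺ (V x) λ o o∈ → go o o∈ (inside⁻ (V x) (∧-left b) o o∈)) bx)) (not-elim g))
        where
        go : ∀ o → o ∈ V x → o ∈ v ∷ ys → o ∈ ys
        go o o∈ (here refl) = ⊥-elim (∉ᵇ (V x) h o∈)
        go o o∈ (there h) = h
      all-one : F x ≡ 1ℚ
      all-one rewrite v∈ | bx | good-antitone {rest ys x} {ys} ω (λ o o∈ → proj₁ (∈-filterᵇ⁻ _ ys o∈)) g = refl

    ε : ℚ
    ε = ι 2 * ι d * P

    0≤ε : 0ℚ ≤ ε
    0≤ε = 0≤* (0≤* (0≤ι 2) (0≤ι d)) 0≤P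

    kε : ι 2 * (ι k * ε) ≤ 1ℚ
    kε = ≤-trans (≤-reflexive (trans (l (ι 2) (ι k) (ι d) P) (cong (_* P) (trans (cong₂ _*_ (trans (cong (_* ι d) (sym (ι-* 2 2))) (sym (ι-* 4 d))) refl) (sym (ι-* (4 ℕ.* d) k)))))) small
      where
      l : ∀ t k d P → t * (k * (t * d * P)) ≡ t * t * d * k * P
      l = solve-∀ ℚ-ring

    half : ∀ {n} → n ℕ.≤ k → 1ℚ ≤ ι 2 * (1ℚ - ι n * ε)
    half {n} n≤k = by-gap (diff (≤-trans (*-monoʳ (0≤ι 2) (*-monoˡ 0≤ε (ι-mono n≤k))) kε)) (trans (cong (_* (1ℚ - ι n * ε)) 2≡) (trans (l (ι n * ε)) (cong (λ z → 1ℚ + (1ℚ - z * (ι n * ε))) (sym 2≡))))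
      where
      2≡ : ι 2 ≡ 1ℚ + 1ℚ
      2≡ = trans (ι-suc 1) (cong (1ℚ +_) ι1)
      l : ∀ x → (1ℚ + 1ℚ) * (1ℚ - x) ≡ 1ℚ + (1ℚ - (1ℚ + 1ℚ) * x)
      l = solve-∀ ℚ-ring

    step : ∀ n ys → length ys ℕ.≤ n → ∀ v → W ys * (1ℚ - ε) ≤ W (v ∷ ys)
    grow : ∀ n as zs → length as ℕ.+ length zs ℕ.≤ n → 0ℚ ≤ 1ℚ - ε → W zs * (1ℚ - ε) ^ length as ≤ W (as ++ zs)

    grow n [] zs h _ = ≤-reflexive (ℚₚ.*-identityʳ (W zs))
    grow (suc n) (a ∷ as) zs (ℕ.s≤s h) 0≤1-ε = ≤-trans (≤-reflexive (l (W zs) (1ℚ - ε) ((1ℚ - ε) ^ length as)))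
        (≤-trans (*-monoˡ 0≤1-ε (grow n as zs h 0≤1-ε)) (step n (as ++ zs) (subst (ℕ._≤ n) (sym (length-++ as)) h) a))
      where
      l : ∀ w x y → w * (x * y) ≡ w * y * x
      l = solve-∀ ℚ-ring

    step n ys len v = ≤-trans (by-gap (diff key) (l (W ys) (W (v ∷ ys)) ε)) ≤-refl
      where
      l : ∀ a b e → b ≡ a * (1ℚ - e) + (b + e * a - a)
      l = solve-∀ ℚ-ring
      2W : ∀ x → x ∈ evs → v ∈ V x → ¬ v ∈ ys → W (rest ys x) ≤ ι 2 * W ys
      2W x x∈ v∈ v∉ = ≤-trans (≤-trans (≤-reflexive (sym (ℚₚ.*-identityʳ (W Y)))) (≤-trans (*-monoʳ (0≤W Y) (half A≤k)) (≤-reflexive (m (W Y) (ι 2) (1ℚ - ι (length A) * ε)))))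
          (*-monoʳ (0≤ι 2) (≤-trans (*-monoʳ (0≤W Y) (≤-trans (≤-reflexive (m₂ (ι (length A)) ε)) (bernoulli {x = - ε} 0≤1-ε (length A))))
            (≤-trans (grow n A Y A+Y 0≤1-ε) (W-antitone λ o o∈ → cover-ys o o∈))))
        where
        Y A : List O
        Y = rest ys x
        A = filterᵇ (_∈ᵇ ys) (V x)
        m : ∀ w t z → w * (t * z) ≡ t * (w * z)
        m = solve-∀ ℚ-ring
        m₂ : ∀ a e → 1ℚ - a * e ≡ 1ℚ + a * - e
        m₂ = solve-∀ ℚ-ring
        A≤k : length A ℕ.≤ k
        A≤k = ℕₚ.≤-trans (#≤length (_∈ᵇ ys) (V x)) (V-size x x∈)
        1≤k : 1 ℕ.≤ k
        1≤k = ℕₚ.≤-trans (nonempty v∈) (V-size x x∈)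
          where
          nonempty : ∀ {zs} → v ∈ zs → 1 ℕ.≤ length zs
          nonempty (here _) = ℕ.s≤s ℕ.z≤n
          nonempty (there _) = ℕ.s≤s ℕ.z≤n
        0≤1-ε : 0ℚ ≤ 1ℚ - ε
        0≤1-ε = cancel-* (ι-pos 1) (≤-trans (≤-reflexive (ℚₚ.*-zeroʳ (ι 2))) (≤-trans 0≤1 (≤-trans (half 1≤k) (≤-reflexive (cong (λ z → ι 2 * (1ℚ - z)) (trans (cong (_* ε) ι1) (ℚₚ.*-identityˡ ε)))))))
        A+Y : length A ℕ.+ length Y ℕ.≤ n
        A+Y = ℕₚ.≤-trans (ℕₚ.+-monoˡ-≤ (length Y) (unique-length (filterᵇ-unique (_∈ᵇ ys) (V-unique x x∈))
                λ o o∈ → let a , b = ∈-filterᵇ⁻ (_∈ᵇ ys) (V x) o∈ in ∈-filterᵇ⁺ (_∈ᵇ V x) (∈ᵇ⁻ ys b) (∈ᵇ⁺ a)))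
                (ℕₚ.≤-trans (ℕₚ.≤-reflexive (split ys)) len)
          where
          split : ∀ zs → # (_∈ᵇ V x) zs ℕ.+ length (rest zs x) ≡ length zs
          split [] = refl
          split (z ∷ zs) with z ∈ᵇ V x
          ... | true = cong suc (split zs)
          ... | false = trans (ℕₚ.+-suc (# (_∈ᵇ V x) zs) (length (rest zs x))) (cong suc (split zs))
        cover-ys : ∀ o → o ∈ ys → o ∈ A ++ Y
        cover-ys o o∈ with bool-case (o ∈ᵇ V x)
        ... | inj₁ e = ∈-++⁺ˡ (∈-filterᵇ⁺ (_∈ᵇ ys) (∈ᵇ⁻ (V x) e) (∈ᵇ⁺ o∈))
        ... | inj₂ e = ∈-++⁺ʳ A (∈-filterᵇ⁺ (λ o → not (o ∈ᵇ V x)) o∈ (not-true e))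
      indep : ∀ x → x ∈ evs → E os (λ ω → 𝟙 (bad x ω) * 𝟙 (good (rest ys x) ω)) ≡ E os (λ ω → 𝟙 (bad x ω)) * W (rest ys x)
      indep x x∈ = E-indep os {V = _∈ᵇ V x} {W = λ o → not (o ∈ᵇ V x)} (λ z a b → true≢false a (not-elim b))
        (λ ω ω′ h → cong 𝟙 (V-local x x∈ ω ω′ h))
        (λ ω ω′ h → cong (λ b → 𝟙 (not b)) (any-cong evs λ x′ x′∈ → bool-ext (tr ω ω′ h x′ x′∈) (tr ω′ ω (λ z c → sym (h z c)) x′ x′∈)))
        where
        tr : ∀ ω ω′ → (∀ z → not (z ∈ᵇ V x) ≡ true → ω z ≡ ω′ z) → ∀ x′ → x′ ∈ evs → bad-in (rest ys x) ω x′ ≡ true → bad-in (rest ys x) ω′ x′ ≡ true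
        tr ω ω′ h x′ x′∈ b = ∧-intro (∧-left b) (trans (sym (V-local x′ x′∈ ω ω′ λ z z∈ → h z (proj₂ (∈-filterᵇ⁻ (λ o → not (o ∈ᵇ V x)) ys (inside⁻ (V x′) (∧-left b) z (∈ᵇ⁻ (V x′) z∈)))))) (∧-right {inside (V x′) (rest ys x)} b))
      key : W ys ≤ W (v ∷ ys) + ε * W ys
      key with bool-case (v ∈ᵇ ys)
      ... | inj₁ e = ≤-trans (W-antitone λ { o (here refl) → ∈ᵇ⁻ ys e ; o (there h) → h }) (by-gap (0≤* 0≤ε (0≤W ys)) refl)
      ... | inj₂ v∉ = ≤-trans (E-mono os λ ω _ → cover v ys ω)
          (≤-trans (≤-reflexive (trans (E-+ os _ _) (cong (W (v ∷ ys) +_) (trans (E-∑ os evs _) (∑-cong evs λ x x∈ → trans (E-* os (𝟙 (v ∈ᵇ V x)) _) (cong (𝟙 (v ∈ᵇ V x) *_) (indep x x∈)))))))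
          (+-mono (≤-refl {W (v ∷ ys)}) (≤-trans (∑-mono evs λ x x∈ → term x x∈ (bool-case (v ∈ᵇ V x)))
            (≤-trans (≤-reflexive (trans (∑-*ʳ (P * (ι 2 * W ys)) evs (λ x → 𝟙 (v ∈ᵇ V x))) (cong (_* (P * (ι 2 * W ys))) (sym (ι# (λ x → v ∈ᵇ V x) evs)))))
              (≤-trans (*-monoˡ (0≤* 0≤P (0≤* (0≤ι 2) (0≤W ys))) (ι-mono (V-deg v))) (≤-reflexive (m (ι d) P (ι 2) (W ys))))))))
        where
        m : ∀ d P t w → d * (P * (t * w)) ≡ t * d * P * w
        m = solve-∀ ℚ-ring
        term : ∀ x → x ∈ evs → v ∈ᵇ V x ≡ true ⊎ v ∈ᵇ V x ≡ false →
               𝟙 (v ∈ᵇ V x) * (E os (λ ω → 𝟙 (bad x ω)) * W (rest ys x)) ≤ 𝟙 (v ∈ᵇ V x) * (P * (ι 2 * W ys))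
        term x x∈ (inj₂ e) rewrite e = ≤-reflexive (trans (ℚₚ.*-zeroˡ (E os (λ ω → 𝟙 (bad x ω)) * W (rest ys x))) (sym (ℚₚ.*-zeroˡ (P * (ι 2 * W ys)))))
        term x x∈ (inj₁ e) = *-monoʳ (0≤𝟙 (v ∈ᵇ V x)) (*-mono (E-≥0 os λ ω _ → 0≤𝟙 (bad x ω)) (0≤* (0≤ι 2) (0≤W ys)) (rare x x∈) (2W x x∈ (∈ᵇ⁻ (V x) e) (∉ᵇ ys v∉)))

    avoid : ∃ λ ω → Supp os ω × (∀ x → x ∈ evs → bad x ω ≡ false)
    avoid with E-witness os positive-W
      where
      all-vars : List O
      all-vars = concatMap V evs
      W[]≡1 : W [] ≡ 1ℚ
      W[]≡1 = trans (E-cong os λ ω _ → cong (λ b → 𝟙 (not b)) (¬true⇒false λ e → let x , x∈ , b = any⁻ (bad-in [] ω) evs e in impossible x x∈ ω b)) (E-const os 1ℚ)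
        where
        impossible : ∀ x → x ∈ evs → ∀ ω → bad-in [] ω x ≡ true → ⊥
        impossible x x∈ ω b = <⇒≱ P<1 (≤-trans (≤-reflexive (sym (E-const os 1ℚ))) (≤-trans (E-mono os λ ω′ _ → ≤-reflexive (sym (cong 𝟙 (trans (V-local x x∈ ω′ ω λ z z∈ → ⊥-elim (no-vars z (inside⁻ (V x) (∧-left b) z (∈ᵇ⁻ (V x) z∈)))) (∧-right {inside (V x) []} b))))) (rare x x∈)))
          where
          no-vars : ∀ (z : O) → z ∈ [] → ⊥
          no-vars z ()
      positive : ∀ ys → 0ℚ < W ys
      positive [] = subst (0ℚ <_) (sym W[]≡1) (ℚₚ.positive⁻¹ 1ℚ)
      positive (y ∷ ys) with any (λ x → y ∈ᵇ V x) evs in eq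
      ... | false = ℚₚ.<-≤-trans (positive ys) (E-mono os λ ω _ → 𝟙-mono λ g → not-true (¬true⇒false λ e → let x , x∈ , b = any⁻ (bad-in (y ∷ ys) ω) evs e in
                      true≢false (any⁺ (bad-in ys ω) x∈ (∧-intro (inside⁺ (V x) λ o o∈ → drop x x∈ o o∈ (inside⁻ (V x) (∧-left b) o o∈)) (∧-right {inside (V x) (y ∷ ys)} b))) (not-elim g)))
        where
        drop : ∀ x → x ∈ evs → ∀ o → o ∈ V x → o ∈ y ∷ ys → o ∈ ys
        drop x x∈ o o∈ (here refl) = ⊥-elim (true≢false (any⁺ (λ x → y ∈ᵇ V x) x∈ (∈ᵇ⁺ o∈)) eq)
        drop x x∈ o o∈ (there h) = h
      ... | true = let x , x∈ , y∈ = any⁻ (λ x → y ∈ᵇ V x) evs eq in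
            ℚₚ.<-≤-trans (*-pos (positive ys) (pos1-ε (ℕₚ.≤-trans (nonempty (∈ᵇ⁻ (V x) y∈)) (V-size x x∈)))) (step (length ys) ys ℕₚ.≤-refl y)
        where
        nonempty : ∀ {zs} → y ∈ zs → 1 ℕ.≤ length zs
        nonempty (here _) = ℕ.s≤s ℕ.z≤n
        nonempty (there _) = ℕ.s≤s ℕ.z≤n
        pos1-ε : 1 ℕ.≤ k → 0ℚ < 1ℚ - ε
        pos1-ε 1≤k with ≤-dec (1ℚ - ε) 0ℚ
        ... | inj₂ h = h
        ... | inj₁ h = ⊥-elim (<⇒≱ (ℚₚ.positive⁻¹ 1ℚ) (≤-trans (≤-trans (half 1≤k) (≤-reflexive (cong (λ z → ι 2 * (1ℚ - z)) (trans (cong (_* ε) ι1) (ℚₚ.*-identityˡ ε))))) (≤-trans (*-monoʳ (0≤ι 2) h) (≤-reflexive (ℚₚ.*-zeroʳ (ι 2))))))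
      positive-W : 0ℚ < E os (λ ω → 𝟙 (good all-vars ω))
      positive-W = positive all-vars
    ... | ω , s , h = ω , s , λ x x∈ → ¬true⇒false λ b → true≢false (any⁺ (bad-in (concatMap V evs) ω) x∈ (∧-intro (inside⁺ (V x) λ o o∈ → ∈-concatMap V x∈ o∈) b)) (all-good h)
      where
      all-good : 0ℚ < 𝟙 (good (concatMap V evs) ω) → any (bad-in (concatMap V evs) ω) evs ≡ false
      all-good h with any (bad-in (concatMap V evs) ω) evs
      ... | true = ⊥-elim (<-irrefl h)
      ... | false = refl

  record Concentrated (vars : List O) (Θ k : ℕ) (f : Outcome → ℚ) (σ : ℚ) : Set where
    field
      support  : List O
      unique   : Unique support
      size     : length support ℕ.≤ k
      local    : Local (_∈ᵇ support) f
      order    : List O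
      reorder  : vars ↭ order
      c R      : ℚ
      b        : ℕ
      0≤c      : 0ℚ ≤ c
      tree     : Budget c order f b
      range    : ∀ ω → (0ℚ ≤ f ω) × (f ω ≤ R)
      0<σ      : 0ℚ < σ
      2c≤σ     : ι 2 * c ≤ σ
      variance : ι b * p * (ι 2 * c) * (ι 2 * c) ≤ σ * σ

  abstract
    _≤ᵇ_ : ℚ → ℚ → Bool
    x ≤ᵇ y = ⌊ x ℚₚ.≤? y ⌋

    ≤ᵇ-true : ∀ {x y} → x ≤ᵇ y ≡ true → x ≤ y
    ≤ᵇ-true {x} {y} h with x ℚₚ.≤? y
    ... | yes e = e

    ≤ᵇ-false : ∀ {x y} → x ≤ᵇ y ≡ false → y ≤ x
    ≤ᵇ-false {x} {y} h with x ℚₚ.≤? y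
    ... | no e = ℚₚ.<⇒≤ (ℚₚ.≰⇒> e)

  module _ {X : Set} (vars : List O) (xs : List X) (f : X → Outcome → ℚ) (σ : X → ℚ) (Θ k d : ℕ)
    (conc : ∀ x → x ∈ xs → Concentrated vars Θ k (f x) (σ x)) (1≤Θ : 1 ℕ.≤ Θ) (supp : X → List O)
    (supp≡ : ∀ x (x∈ : x ∈ xs) → Concentrated.support (conc x x∈) ≡ supp x)
    (deg : ∀ o → # (λ x → o ∈ᵇ supp x) xs ℕ.≤ d) (big : 24 ℕ.* d ℕ.* k ℕ.≤ 2 ℕ.^ Θ) (big′ : 7 ℕ.≤ 2 ℕ.^ Θ) where

    open Concentrated

    high low deviates : X → Outcome → Bool
    high x ω = (ι Θ * σ x) ≤ᵇ (1ℚ * (f x ω - E vars (f x)))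
    low x ω = (ι Θ * σ x) ≤ᵇ (- 1ℚ * (f x ω - E vars (f x)))
    deviates x ω = high x ω ∨ low x ω

    0<2^ : 0ℚ < ι 2 ^ Θ
    0<2^ = 0<^ (ι-pos 1) Θ

    P : ℚ
    P = ι 6 * proj₁ (inverse 0<2^)

    2^P : ι 2 ^ Θ * P ≡ ι 6
    2^P = trans (l (ι 2 ^ Θ) (ι 6) (proj₁ (inverse 0<2^))) (trans (cong (ι 6 *_) (proj₁ (proj₂ (inverse 0<2^)))) (ℚₚ.*-identityʳ (ι 6)))
      where
      l : ∀ a b c → a * (b * c) ≡ b * (a * c)
      l = solve-∀ ℚ-ring

    0≤P : 0ℚ ≤ P
    0≤P = 0≤* (0≤ι 6) (ℚₚ.<⇒≤ (proj₂ (proj₂ (inverse 0<2^))))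

    2^≡ : ι (2 ℕ.^ Θ) ≡ ι 2 ^ Θ
    2^≡ = ι-^ 2 Θ

    P<1 : P < 1ℚ
    P<1 with ≤-dec 1ℚ P
    ... | inj₂ h = h
    ... | inj₁ h = ⊥-elim (ℕₚ.<⇒≱ (ℕₚ.n<1+n 6) (ι-cancel (≤-trans (ι-mono big′) (≤-trans (≤-reflexive (trans 2^≡ (sym (ℚₚ.*-identityʳ (ι 2 ^ Θ))))) (≤-trans (*-monoʳ (ℚₚ.<⇒≤ 0<2^) h) (≤-reflexive 2^P))))))

    small : ι (4 ℕ.* d ℕ.* k) * P ≤ 1ℚ
    small = cancel-* 0<2^ (≤-trans (≤-reflexive (trans (l (ι 2 ^ Θ) (ι (4 ℕ.* d ℕ.* k)) P) (trans (cong (ι (4 ℕ.* d ℕ.* k) *_) 2^P) (trans (sym (ι-* (4 ℕ.* d ℕ.* k) 6)) (cong ι (nat d k))))))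
              (≤-trans (ι-mono big) (≤-reflexive (trans 2^≡ (sym (ℚₚ.*-identityʳ (ι 2 ^ Θ)))))))
      where
      l : ∀ a b c → a * (b * c) ≡ b * (a * c)
      l = solve-∀ ℚ-ring
      nat : ∀ d k → 4 ℕ.* d ℕ.* k ℕ.* 6 ≡ 24 ℕ.* d ℕ.* k
      nat d k = trans (ℕₚ.*-comm (4 ℕ.* d ℕ.* k) 6) (trans (sym (ℕₚ.*-assoc 6 (4 ℕ.* d) k)) (cong (ℕ._* k) (sym (ℕₚ.*-assoc 6 4 d))))

    rare : ∀ x → x ∈ xs → E vars (λ ω → 𝟙 (deviates x ω)) ≤ P
    rare x x∈ = cancel-* 0<2^ (≤-trans (*-monoʳ (ℚₚ.<⇒≤ 0<2^) (≤-trans (E-mono vars λ ω _ → split (high x ω) (low x ω)) (≤-reflexive (E-+ vars (λ ω → 𝟙 (high x ω)) (λ ω → 𝟙 (low x ω))))))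
          (≤-trans (≤-reflexive (ℚₚ.*-distribˡ-+ (ι 2 ^ Θ) (E vars (λ ω → 𝟙 (high x ω))) (E vars (λ ω → 𝟙 (low x ω)))))
            (≤-trans (+-mono (part 1ℚ (inj₁ refl) (high x) (λ ω e → e)) (part (- 1ℚ) (inj₂ refl) (low x) (λ ω e → e))) (≤-reflexive (trans (sym (ι-+ 3 3)) (sym 2^P))))))
      where
      C = conc x x∈
      split : ∀ a b → 𝟙 (a ∨ b) ≤ 𝟙 a + 𝟙 b
      split true b = by-gap (0≤𝟙 b) refl
      split false b = ≤-reflexive (sym (ℚₚ.+-identityˡ (𝟙 b)))
      part : ∀ e → e ≡ 1ℚ ⊎ e ≡ - 1ℚ → (bad : Outcome → Bool) → (∀ ω → bad ω ≡ true → (ι Θ * σ x) ≤ᵇ (e * (f x ω - E vars (f x))) ≡ true) →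
             ι 2 ^ Θ * E vars (λ ω → 𝟙 (bad ω)) ≤ ι 3
      part e sg bad hb = ≤-trans (≤-trans (*-monoʳ (ℚₚ.<⇒≤ 0<2^) (E-mono vars λ ω _ → 𝟙-mono (hb ω))) (≤-reflexive (cong (ι 2 ^ Θ *_) (E-↭ (reorder C) ext))))
         (tail Θ e sg 1≤Θ (0≤c C) (0<σ C) (2c≤σ C) (variance C) (tree C) (range C) (λ ω → (ι Θ * σ x) ≤ᵇ (e * (f x ω - E vars (f x)))) λ ω β → ≤-trans (≤ᵇ-true β)
           (≤-reflexive (cong (λ z → e * (f x ω - z)) (E-↭ (reorder C) (Local⇒Ext (local C))))))
        where
        ext : Ext (λ ω → 𝟙 ((ι Θ * σ x) ≤ᵇ (e * (f x ω - E vars (f x)))))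
        ext ω ω′ h = cong (λ z → 𝟙 ((ι Θ * σ x) ≤ᵇ (e * (z - E vars (f x))))) (Local⇒Ext (local C) ω ω′ h)

    private
      bounds : ∀ μ a y → (a ≤ᵇ (1ℚ * (y - μ))) ∨ (a ≤ᵇ (- 1ℚ * (y - μ))) ≡ false → (μ - a ≤ y) × (y ≤ μ + a)
      bounds μ a y e = by-gap (diff (≤ᵇ-false (right {a ≤ᵇ (1ℚ * (y - μ))} e))) (l₁ μ a y) , by-gap (diff (≤ᵇ-false (left {a ≤ᵇ (1ℚ * (y - μ))} e))) (l₂ μ a y)
        where
        left : ∀ {a b} → a ∨ b ≡ false → a ≡ false
        left {false} _ = refl
        right : ∀ {a b} → a ∨ b ≡ false → b ≡ false
        right {false} h = h
        l₁ : ∀ μ a y → y ≡ μ - a + (a - - 1ℚ * (y - μ))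
        l₁ = solve-∀ ℚ-ring
        l₂ : ∀ μ a y → μ + a ≡ y + (a - 1ℚ * (y - μ))
        l₂ = solve-∀ ℚ-ring

      dev-local : ∀ x → x ∈ xs → Local (_∈ᵇ supp x) (deviates x)
      dev-local x x∈ ω ω′ h = cong (λ z → ((ι Θ * σ x) ≤ᵇ (1ℚ * (z - E vars (f x)))) ∨ ((ι Θ * σ x) ≤ᵇ (- 1ℚ * (z - E vars (f x)))))
           (local (conc x x∈) ω ω′ λ z z∈ → h z (subst (λ s → z ∈ᵇ s ≡ true) (supp≡ x x∈) z∈))

      supp-unique : ∀ x → x ∈ xs → Unique (supp x)
      supp-unique x x∈ = subst Unique (supp≡ x x∈) (unique (conc x x∈))

      supp-size : ∀ x → x ∈ xs → length (supp x) ℕ.≤ k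
      supp-size x x∈ = subst (λ s → length s ℕ.≤ k) (supp≡ x x∈) (size (conc x x∈))

      outcome : ∃ λ ω → Supp vars ω × (∀ x → x ∈ xs → deviates x ω ≡ false)
      outcome = Avoid.avoid vars xs deviates supp supp-unique dev-local k d supp-size deg P 0≤P rare P<1 small

    simultaneous : ∃ λ ω → Supp vars ω × (∀ x → x ∈ xs → (E vars (f x) - ι Θ * σ x ≤ f x ω) × (f x ω ≤ E vars (f x) + ι Θ * σ x))
    simultaneous = proj₁ outcome , proj₁ (proj₂ outcome) , λ x x∈ → bounds (E vars (f x)) (ι Θ * σ x) (f x (proj₁ outcome)) (proj₂ (proj₂ outcome) x x∈)

  E-var : ∀ {os z} → Unique os → z ∈ os → E os (λ ω → 𝟙 (ω z)) ≡ p
  E-var {o ∷ os} (o∉ ∷ u) (here refl) = trans (cong₂ (λ a b → q * a + p * b)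
      (trans (E-cong os λ ω s → cong 𝟙 (¬true⇒false λ e → All.lookup o∉ (s o e) refl)) (E-const os 0ℚ))
      (trans (E-cong os λ ω _ → cong 𝟙 (upd-same o ω)) (E-const os 1ℚ))) (l q p)
    where
    l : ∀ q p → q * 0ℚ + p * 1ℚ ≡ p
    l = solve-∀ ℚ-ring
  E-var {o ∷ os} {z} (o∉ ∷ u) (there z∈) = trans (cong₂ (λ a b → q * a + p * b) (E-var u z∈)
      (trans (E-cong os λ ω _ → cong 𝟙 (upd-other ω λ { refl → All.lookup o∉ z∈ refl })) (E-var u z∈))) (l p)
    where
    l : ∀ p → (1ℚ - p) * p + p * p ≡ p
    l = solve-∀ ℚ-ring

  module _ (vars : List O) (vars-unique : Unique vars) where

    chosen : List O → Outcome → ℚ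
    chosen W ω = ∑ W (λ z → 𝟙 (ω z))

    private
      split : ∀ (f : O → Bool) xs → xs ↭ filterᵇ f xs ++ filterᵇ (λ x → not (f x)) xs
      split f [] = ↭.refl
      split f (x ∷ xs) with f x
      ... | true = ↭.prep x (split f xs)
      ... | false = ↭.trans (↭.prep x (split f xs)) (↭-sym (shift x (filterᵇ f xs) (filterᵇ (λ x → not (f x)) xs)))

      upd-comm : ∀ a o ω z → upd a (upd o ω) z ≡ upd o (upd a ω) z
      upd-comm a o ω z with z == a | z == o
      ... | true | true = refl
      ... | true | false = refl
      ... | false | true = refl
      ... | false | false = refl

      tree-for : ∀ (W : List O) (g : Outcome → ℚ) → Ext g → (∀ o ω → (g (upd o ω) ≤ g ω + 1ℚ) × (g ω ≤ g (upd o ω) + 1ℚ)) →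
                 (∀ o ω → o ∈ᵇ W ≡ false → g (upd o ω) ≡ g ω) → ∀ as bs → (∀ {o} → o ∈ bs → o ∈ᵇ W ≡ false) → Budget 1ℚ (as ++ bs) g (length as)
      tree-for W g ext lip ign [] [] h = done
      tree-for W g ext lip ign [] (b ∷ bs) h = skip (λ ω _ → ign b ω (h (here refl))) (tree-for W g ext lip ign [] bs λ k → h (there k))
      tree-for W g ext lip ign (a ∷ as) bs h = pay (λ ω _ → lip a ω) (tree-for W g ext lip ign as bs h)
          (tree-for W (λ ω → g (upd a ω)) (λ ω ω′ k → ext _ _ λ z → upd-cong a {ω} {ω′} {z} (k z))
            (λ o ω → subst (λ v → (v ≤ g (upd a ω) + 1ℚ) × (g (upd a ω) ≤ v + 1ℚ)) (sym (ext _ _ (upd-comm a o ω))) (lip o (upd a ω)))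
            (λ o ω k → trans (ext _ _ (upd-comm a o ω)) (ign o (upd a ω) k)) as bs h)

      chosen-local : ∀ W → Local (_∈ᵇ W) (chosen W)
      chosen-local W ω ω′ h = ∑-cong W λ z z∈ → cong 𝟙 (h z (∈ᵇ⁺ z∈))

      at-most-one : ∀ {W} o → Unique W → ∑ W (λ z → 𝟙 (z == o)) ≤ 1ℚ
      at-most-one {W} o u with bool-case (o ∈ᵇ W)
      ... | inj₁ e = ≤-reflexive (trans (∑-cong W λ z _ → sym (ℚₚ.*-identityʳ (𝟙 (z == o)))) (∑-single u (∈ᵇ⁻ W e) (λ _ → 1ℚ)))
      ... | inj₂ e = ≤-trans (≤-reflexive (trans (∑-cong W λ z z∈ → cong 𝟙 (==-false {z} {o} λ { refl → ∉ᵇ W e z∈ })) (∑-0 W))) 0≤1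

      chosen-lip : ∀ {W} → Unique W → ∀ o ω → (chosen W (upd o ω) ≤ chosen W ω + 1ℚ) × (chosen W ω ≤ chosen W (upd o ω) + 1ℚ)
      chosen-lip {W} u o ω = ≤-trans (∑-mono W λ z _ → up (ω z) (z == o)) (≤-trans (≤-reflexive (∑-+ W (λ z → 𝟙 (ω z)) (λ z → 𝟙 (z == o)))) (+-mono (≤-refl {chosen W ω}) (at-most-one o u)))
         , ≤-trans (∑-mono W λ z _ → 𝟙-mono {ω z} {(z == o) ∨ ω z} (∨-right {z == o})) (by-gap 0≤1 refl)
        where
        up : ∀ a b → 𝟙 (b ∨ a) ≤ 𝟙 a + 𝟙 b
        up a true = ≤-trans (by-gap (0≤𝟙 a) refl) (≤-reflexive (ℚₚ.+-comm 1ℚ (𝟙 a)))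
        up a false = ≤-reflexive (sym (ℚₚ.+-identityʳ (𝟙 a)))

    conc : ∀ {Θ k W σ} → Unique W → length W ℕ.≤ k → 0ℚ < σ → ι 2 * 1ℚ ≤ σ → ι (length W) * p * (ι 2 * 1ℚ) * (ι 2 * 1ℚ) ≤ σ * σ →
           Concentrated vars Θ k (chosen W) σ
    conc {W = W} {σ} u h 0<σ 2≤σ var = record
      { support = W ; unique = u ; size = h ; local = chosen-local W ; order = L₁ ++ L₂ ; reorder = split (_∈ᵇ W) vars ; c = 1ℚ ; R = ι (length W) ; b = length L₁
      ; 0≤c = 0≤1
      ; tree = tree-for W (chosen W) (Local⇒Ext (chosen-local W)) (chosen-lip u)
          (λ o ω e → ∑-cong W λ z z∈ → cong 𝟙 (upd-other ω λ { refl → ∉ᵇ W e z∈ })) L₁ L₂ (λ k → not-elim (proj₂ (∈-filterᵇ⁻ (λ z → not (z ∈ᵇ W)) vars k)))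
      ; range = λ ω → ∑-≥0 W (λ z _ → 0≤𝟙 (ω z)) , ≤-trans (∑-mono W {g = λ _ → 1ℚ} λ z _ → 𝟙≤1 (ω z)) (≤-reflexive (trans (∑-const 1ℚ W) (ℚₚ.*-identityʳ (ι (length W)))))
      ; 0<σ = 0<σ ; 2c≤σ = 2≤σ
      ; variance = ≤-trans (*-monoˡ 0≤2 (*-monoˡ 0≤2 (*-monoˡ 0≤p (ι-mono (unique-length (filterᵇ-unique (_∈ᵇ W) vars-unique) λ z z∈ → ∈ᵇ⁻ W (proj₂ (∈-filterᵇ⁻ (_∈ᵇ W) vars z∈))))))) var
      }
      where
      0≤2 = 0≤* (0≤ι 2) 0≤1
      L₁ = filterᵇ (_∈ᵇ W) vars
      L₂ = filterᵇ (λ z → not (z ∈ᵇ W)) vars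

    E-chosen : ∀ W → (∀ z → z ∈ W → z ∈ vars) → E vars (chosen W) ≡ ι (length W) * p
    E-chosen W s = trans (E-∑ vars W (λ z ω → 𝟙 (ω z))) (trans (∑-cong W λ z z∈ → E-var vars-unique (s z z∈)) (∑-const p W))

    select : ∀ {X : Set} (xs : List X) (W : X → List O) (σ : X → ℚ) (Θ k d : ℕ) →
             (∀ x → x ∈ xs → Unique (W x)) → (∀ x → x ∈ xs → ∀ z → z ∈ W x → z ∈ vars) → (∀ x → x ∈ xs → length (W x) ℕ.≤ k) →
             (∀ x → x ∈ xs → 0ℚ < σ x) → (∀ x → x ∈ xs → ι 2 * 1ℚ ≤ σ x) → (∀ x → x ∈ xs → ι (length (W x)) * p * (ι 2 * 1ℚ) * (ι 2 * 1ℚ) ≤ σ x * σ x) →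
             (∀ o → # (λ x → o ∈ᵇ W x) xs ℕ.≤ d) → 1 ℕ.≤ Θ → 24 ℕ.* d ℕ.* k ℕ.≤ 2 ℕ.^ Θ → 7 ℕ.≤ 2 ℕ.^ Θ →
             ∃ λ ω → ∀ x → x ∈ xs → (ι (length (W x)) * p - ι Θ * σ x ≤ ι (# ω (W x))) × (ι (# ω (W x)) ≤ ι (length (W x)) * p + ι Θ * σ x)
    select xs W σ Θ k d u s h 0<σ 2≤σ var deg 1≤Θ big big′ = let ω , _ , r = result in ω , λ x x∈ →
         ≤-trans (≤-reflexive (cong (_- ι Θ * σ x) (sym (E-chosen (W x) (s x x∈))))) (≤-trans (proj₁ (r x x∈)) (≤-reflexive (sym (ι# ω (W x)))))
       , ≤-trans (≤-reflexive (ι# ω (W x))) (≤-trans (proj₂ (r x x∈)) (≤-reflexive (cong (_+ ι Θ * σ x) (E-chosen (W x) (s x x∈)))))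
      where
      result = simultaneous vars xs (λ x → chosen (W x)) σ Θ k d (λ x x∈ → conc (u x x∈) (h x x∈) (0<σ x x∈) (2≤σ x x∈) (var x x∈)) 1≤Θ W (λ _ _ → refl) deg big big′

  module Conflict
    (vars : List O) (vars-unique : Unique vars)
    (adj : O → O → Bool) (adj-sym : ∀ o z → adj o z ≡ adj z o) (adj-irr : ∀ o → adj o o ≡ false)
    (good : O → Bool) (M : ℕ) (deg-good : ∀ o → o ∈ vars → good o ≡ true → # (adj o) vars ≡ M)
    (side : O → O → ℕ)
    (side<3 : ∀ z o → good o ≡ true → adj z o ≡ true → side z o ℕ.< 3)
    (claw : ∀ z o o′ → good o ≡ true → good o′ ≡ true → adj z o ≡ true → adj z o′ ≡ true → side z o ≡ side z o′ → o ≡ o′ ⊎ adj o o′ ≡ true)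
    where

    Ret : Outcome → O → Bool
    Ret ω o = ω o ∧ not (any (λ z → adj o z ∧ ω z) vars)

    Ret-sel : ∀ {ω o} → Ret ω o ≡ true → ω o ≡ true
    Ret-sel = ∧-left

    Ret-free : ∀ {ω o z} → Ret ω o ≡ true → z ∈ vars → adj o z ≡ true → ω z ≡ false
    Ret-free {ω} {o} {z} r z∈ a = ¬true⇒false λ e → true≢false (any⁺ (λ z → adj o z ∧ ω z) z∈ (∧-intro a e)) (not-elim (∧-right {ω o} r))

    Ret-intro : ∀ {ω o} → ω o ≡ true → (∀ z → z ∈ vars → adj o z ≡ true → ω z ≡ false) → Ret ω o ≡ true
    Ret-intro {ω} {o} e h = ∧-intro e (not-true (¬true⇒false λ t → let z , z∈ , b = any⁻ (λ z → adj o z ∧ ω z) vars t in true≢false (∧-right {adj o z} b) (h z z∈ (∧-left b))))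

    Ret-indep : ∀ {ω o o′} → o′ ∈ vars → Ret ω o ≡ true → Ret ω o′ ≡ true → adj o o′ ≡ false
    Ret-indep o′∈ r r′ = ¬true⇒false λ a → true≢false (Ret-sel r′) (Ret-free r o′∈ a)

    private
      pattern-bad : (O → Bool) → (O → Bool) → Outcome → O → Bool
      pattern-bad In Out ω z = (In z ∧ not (ω z)) ∨ (not (In z) ∧ (Out z ∧ ω z))

      𝟙-none : ∀ (f : O → Bool) xs → 𝟙 (not (any f xs)) ≡ ∏ xs (λ z → 𝟙 (not (f z)))
      𝟙-none f [] = refl
      𝟙-none f (x ∷ xs) with f x
      ... | true = sym (ℚₚ.*-zeroˡ (∏ xs (λ z → 𝟙 (not (f z)))))
      ... | false = trans (𝟙-none f xs) (sym (ℚₚ.*-identityˡ _))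

      ∏-count : ∀ (In Out : O → Bool) xs → ∏ xs (λ z → q * 𝟙 (not ((In z ∧ true) ∨ (not (In z) ∧ (Out z ∧ false)))) + p * 𝟙 (not ((In z ∧ false) ∨ (not (In z) ∧ (Out z ∧ true)))))
              ≡ p ^ # In xs * q ^ # (λ z → not (In z) ∧ Out z) xs
      ∏-count In Out [] = refl
      ∏-count In Out (x ∷ xs) with In x | Out x
      ... | true | b = trans (cong ((q * 0ℚ + p * 1ℚ) *_) (∏-count In Out xs)) (l q p (p ^ # In xs) (q ^ # (λ z → not (In z) ∧ Out z) xs))
        where
        l : ∀ q p a b → (q * 0ℚ + p * 1ℚ) * (a * b) ≡ p * a * b
        l = solve-∀ ℚ-ring
      ... | false | true = trans (cong ((q * 1ℚ + p * 0ℚ) *_) (∏-count In Out xs)) (l q p (p ^ # In xs) (q ^ # (λ z → not (In z) ∧ Out z) xs))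
        where
        l : ∀ q p a b → (q * 1ℚ + p * 0ℚ) * (a * b) ≡ a * (q * b)
        l = solve-∀ ℚ-ring
      ... | false | false = trans (cong ((q * 1ℚ + p * 1ℚ) *_) (∏-count In Out xs)) (l p (p ^ # In xs) (q ^ # (λ z → not (In z) ∧ Out z) xs))
        where
        l : ∀ p a b → ((1ℚ - p) * 1ℚ + p * 1ℚ) * (a * b) ≡ a * b
        l = solve-∀ ℚ-ring

      E-pattern : ∀ (In Out : O → Bool) → E vars (λ ω → 𝟙 (not (any (pattern-bad In Out ω) vars))) ≡ p ^ # In vars * q ^ # (λ z → not (In z) ∧ Out z) vars
      E-pattern In Out = trans (E-cong vars λ ω _ → 𝟙-none (pattern-bad In Out ω) vars)
        (trans (E-∏ vars vars-unique (λ z b → 𝟙 (not ((In z ∧ not b) ∨ (not (In z) ∧ (Out z ∧ b)))))) (∏-count In Out vars))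

      #-single : ∀ {o} → o ∈ vars → ι (# (_== o) vars) ≡ 1ℚ
      #-single {o} o∈ = trans (ι# (_== o) vars) (trans (∑-cong vars λ z _ → sym (ℚₚ.*-identityʳ (𝟙 (z == o)))) (∑-single vars-unique o∈ (λ _ → 1ℚ)))

    κ : ℚ
    κ = q ^ M

    0≤κ : 0ℚ ≤ κ
    0≤κ = 0≤^ 0≤q M

    ι-inj : ∀ {m n} → ι m ≡ ι n → m ≡ n
    ι-inj e = ℕₚ.≤-antisym (ι-cancel (≤-reflexive e)) (ι-cancel (≤-reflexive (sym e)))

    E-Ret : ∀ o → o ∈ vars → good o ≡ true → E vars (λ ω → 𝟙 (Ret ω o)) ≡ p * κ
    E-Ret o o∈ g = trans (E-cong vars λ ω s → cong 𝟙 (bool-ext (to ω) (from ω))) (trans (E-pattern In (adj o)) (cong₂ _*_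
        (trans (cong (p ^_) (ι-inj (trans (#-single o∈) (sym ι1)))) (ℚₚ.*-identityʳ p))
        (cong (q ^_) (trans (cong length (filter-same vars)) (deg-good o o∈ g)))))
      where
      In : O → Bool
      In = _== o
      filter-same : ∀ xs → filterᵇ (λ z → not (In z) ∧ adj o z) xs ≡ filterᵇ (adj o) xs
      filter-same [] = refl
      filter-same (x ∷ xs) with bool-case (x == o)
      ... | inj₁ e with ==-true e
      ...   | refl rewrite e | adj-irr o = filter-same xs
      filter-same (x ∷ xs) | inj₂ e rewrite e with adj o x
      ...   | true = cong (x ∷_) (filter-same xs)
      ...   | false = filter-same xs
      to : ∀ ω → Ret ω o ≡ true → not (any (pattern-bad In (adj o) ω) vars) ≡ true
      to ω r = not-true (¬true⇒false λ e → let z , z∈ , b = any⁻ (pattern-bad In (adj o) ω) vars e in go z z∈ (∨-case b))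
        where
        go : ∀ z → z ∈ vars → In z ∧ not (ω z) ≡ true ⊎ not (In z) ∧ (adj o z ∧ ω z) ≡ true → ⊥
        go z z∈ (inj₁ b) = true≢false (Ret-sel r) (subst (λ x → ω x ≡ false) (==-true (∧-left b)) (not-elim (∧-right {In z} b)))
        go z z∈ (inj₂ b) = let c = ∧-right {not (In z)} b in true≢false (∧-right {adj o z} c) (Ret-free r z∈ (∧-left c))
      from : ∀ ω → not (any (pattern-bad In (adj o) ω) vars) ≡ true → Ret ω o ≡ true
      from ω n = Ret-intro (flip (any-false (pattern-bad In (adj o) ω) vars (not-elim n) o∈)) λ z z∈ a → ¬true⇒false λ e →
          true≢false (any⁺ (pattern-bad In (adj o) ω) z∈ (∨-right {In z ∧ not (ω z)} (∧-intro (not-true (==-false λ { refl → true≢false a (adj-irr o) })) (∧-intro a e)))) (not-elim n)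
        where
        flip : pattern-bad In (adj o) ω o ≡ false → ω o ≡ true
        flip h with ω o
        ... | true = refl
        ... | false rewrite ==-refl o = ⊥-elim (true≢false refl h)

    module Pair (o₁ o₂ : O) (o₁∈ : o₁ ∈ vars) (o₂∈ : o₂ ∈ vars) (g₁ : good o₁ ≡ true) (g₂ : good o₂ ≡ true) where

      both : Outcome → ℚ
      both ω = 𝟙 (Ret ω o₁) * 𝟙 (Ret ω o₂)

      E-adj : adj o₁ o₂ ≡ true → E vars both ≡ 0ℚ
      E-adj a = trans (E-cong vars λ ω _ → trans (sym (𝟙-∧ (Ret ω o₁) (Ret ω o₂))) (cong 𝟙 (¬true⇒false λ e → true≢false a (Ret-indep {ω} o₂∈ (∧-left e) (∧-right {Ret ω o₁} e))))) (E-const vars 0ℚ)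

      module _ (o₁≢o₂ : o₁ ≢ o₂) (na : adj o₁ o₂ ≡ false) where

        private
          In Out Both : O → Bool
          In z = (z == o₁) ∨ (z == o₂)
          Out z = adj o₁ z ∨ adj o₂ z
          Both z = adj o₁ z ∧ adj o₂ z

        E-both : E vars both ≡ p * p * q ^ # Out vars
        E-both = trans (E-cong vars λ ω _ → trans (sym (𝟙-∧ (Ret ω o₁) (Ret ω o₂))) (cong 𝟙 (bool-ext (to ω) (from ω)))) (trans (E-pattern In Out) (cong₂ _*_
            (trans (cong (p ^_) (ι-inj #In)) (l p)) (cong (λ xs → q ^ length xs) (filter-same vars))))
          where
          l : ∀ p → p * (p * 1ℚ) ≡ p * p
          l = solve-∀ ℚ-ring
          #In : ι (# In vars) ≡ ι 2
          #In = trans (ι# In vars) (trans (∑-cong vars λ z _ → disjoint z) (trans (∑-+ vars (λ z → 𝟙 (z == o₁)) (λ z → 𝟙 (z == o₂)))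
                  (trans (cong₂ _+_ (trans (sym (ι# (_== o₁) vars)) (#-single o₁∈)) (trans (sym (ι# (_== o₂) vars)) (#-single o₂∈))) (sym (trans (ι-suc 1) (cong (1ℚ +_) ι1))))))
            where
            disjoint : ∀ z → 𝟙 (In z) ≡ 𝟙 (z == o₁) + 𝟙 (z == o₂)
            disjoint z with bool-case (z == o₁)
            ... | inj₂ e rewrite e = sym (ℚₚ.+-identityˡ (𝟙 (z == o₂)))
            ... | inj₁ e rewrite e | ==-false {z} {o₂} (λ { refl → o₁≢o₂ (sym (==-true e)) }) = refl
          out : ∀ x → (x == o₁) ≡ true ⊎ (x == o₂) ≡ true → Out x ≡ false
          out x (inj₁ h) rewrite ==-true h | adj-irr o₁ = trans (adj-sym o₂ o₁) na
          out x (inj₂ h) rewrite ==-true h | adj-irr o₂ | na = refl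
          filter-same : ∀ xs → filterᵇ (λ z → not (In z) ∧ Out z) xs ≡ filterᵇ Out xs
          filter-same [] = refl
          filter-same (x ∷ xs) with bool-case (In x)
          ... | inj₂ e rewrite e with Out x
          ...   | true = cong (x ∷_) (filter-same xs)
          ...   | false = filter-same xs
          filter-same (x ∷ xs) | inj₁ e rewrite e | out x (∨-case {x == o₁} e) = filter-same xs
          to : ∀ ω → Ret ω o₁ ∧ Ret ω o₂ ≡ true → not (any (pattern-bad In Out ω) vars) ≡ true
          to ω r = not-true (¬true⇒false λ e → let z , z∈ , b = any⁻ (pattern-bad In Out ω) vars e in go z z∈ (∨-case b))
            where
            r₁ = ∧-left {Ret ω o₁} r
            r₂ = ∧-right {Ret ω o₁} r
            go : ∀ z → z ∈ vars → In z ∧ not (ω z) ≡ true ⊎ not (In z) ∧ (Out z ∧ ω z) ≡ true → ⊥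
            go z z∈ (inj₁ b) with ∨-case {z == o₁} (∧-left {In z} b)
            ... | inj₁ h = true≢false (Ret-sel r₁) (subst (λ x → ω x ≡ false) (==-true h) (not-elim (∧-right {In z} b)))
            ... | inj₂ h = true≢false (Ret-sel r₂) (subst (λ x → ω x ≡ false) (==-true h) (not-elim (∧-right {In z} b)))
            go z z∈ (inj₂ b) with ∨-case {adj o₁ z} (∧-left {Out z} (∧-right {not (In z)} b))
            ... | inj₁ h = true≢false (∧-right {Out z} (∧-right {not (In z)} b)) (Ret-free r₁ z∈ h)
            ... | inj₂ h = true≢false (∧-right {Out z} (∧-right {not (In z)} b)) (Ret-free r₂ z∈ h)
          from : ∀ ω → not (any (pattern-bad In Out ω) vars) ≡ true → Ret ω o₁ ∧ Ret ω o₂ ≡ true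
          from ω n = ∧-intro (Ret-intro (sel o₁ o₁∈ (∨-left (==-refl o₁))) λ z z∈ a → free z z∈ (∨-left a))
                             (Ret-intro (sel o₂ o₂∈ (∨-right {o₂ == o₁} (==-refl o₂))) λ z z∈ a → free z z∈ (∨-right {adj o₁ z} a))
            where
            none : ∀ z → z ∈ vars → pattern-bad In Out ω z ≡ true → ⊥
            none z z∈ h = true≢false (any⁺ (pattern-bad In Out ω) z∈ h) (not-elim n)
            sel : ∀ o → o ∈ vars → In o ≡ true → ω o ≡ true
            sel o o∈ i with bool-case (ω o)
            ... | inj₁ h = h
            ... | inj₂ h = ⊥-elim (none o o∈ (∨-left (∧-intro i (not-true h))))
            free : ∀ z → z ∈ vars → Out z ≡ true → ω z ≡ false
            free z z∈ out = ¬true⇒false λ e → go (bool-case (In z)) e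
              where
              go : In z ≡ true ⊎ In z ≡ false → ω z ≡ true → ⊥
              go (inj₂ i) e = none z z∈ (∨-right {In z ∧ not (ω z)} (∧-intro (not-true i) (∧-intro out e)))
              go (inj₁ i) e with ∨-case {z == o₁} i
              ... | inj₁ h with ==-true h
              ...   | refl rewrite adj-irr o₁ | adj-sym o₂ o₁ = true≢false out na
              go (inj₁ i) e | inj₂ h with ==-true h
              ...   | refl rewrite adj-irr o₂ | na = true≢false out refl

        #Out : # Out vars ℕ.+ # Both vars ≡ M ℕ.+ M
        #Out = ι-inj (trans (ι-+ (# Out vars) (# Both vars)) (trans (cong₂ _+_ (ι# Out vars) (ι# Both vars)) (trans (sym (∑-+ vars (λ z → 𝟙 (Out z)) (λ z → 𝟙 (Both z))))
            (trans (∑-cong vars λ z _ → incl-excl (adj o₁ z) (adj o₂ z)) (trans (∑-+ vars (λ z → 𝟙 (adj o₁ z)) (λ z → 𝟙 (adj o₂ z)))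
              (trans (cong₂ _+_ (trans (sym (ι# (adj o₁) vars)) (cong ι (deg-good o₁ o₁∈ g₁))) (trans (sym (ι# (adj o₂) vars)) (cong ι (deg-good o₂ o₂∈ g₂)))) (sym (ι-+ M M))))))))
          where
          incl-excl : ∀ a b → 𝟙 (a ∨ b) + 𝟙 (a ∧ b) ≡ 𝟙 a + 𝟙 b
          incl-excl true true = refl
          incl-excl true false = refl
          incl-excl false true = refl
          incl-excl false false = refl

        E-both≥ : p * κ * (p * κ) ≤ E vars both
        E-both≥ = ≤-trans (≤-reflexive (trans (l p κ) (cong (p * p *_) (sym (^-+ q M M))))) (≤-trans (*-monoʳ (0≤* 0≤p 0≤p)
            (^-antitone 0≤q q≤1 (ℕₚ.m+n≤o⇒m≤o (# Out vars) (ℕₚ.≤-reflexive #Out)))) (≤-reflexive (sym E-both)))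
          where
          l : ∀ p k → p * k * (p * k) ≡ p * p * (k * k)
          l = solve-∀ ℚ-ring
          q≤1 : q ≤ 1ℚ
          q≤1 = by-gap 0≤p (l₂ p)
            where
            l₂ : ∀ p → 1ℚ ≡ 1ℚ - p + p
            l₂ = solve-∀ ℚ-ring

        E-both≤ : ∀ {n} → # Both vars ℕ.≤ n → q ^ n * E vars both ≤ p * κ * (p * κ)
        E-both≤ {n} h = ≤-trans (*-monoˡ (E-≥0 vars λ ω _ → 0≤* (0≤𝟙 (Ret ω o₁)) (0≤𝟙 (Ret ω o₂))) (^-antitone 0≤q q≤1 h))
           (≤-reflexive (trans (cong (q ^ # Both vars *_) E-both) (trans (l (q ^ # Both vars) p (q ^ # Out vars)) (trans (cong (p * p *_) (trans (sym (^-+ q (# Out vars) (# Both vars))) (trans (cong (q ^_) #Out) (^-+ q M M)))) (l₁ p κ)))))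
          where
          l : ∀ b p o → b * (p * p * o) ≡ p * p * (o * b)
          l = solve-∀ ℚ-ring
          l₁ : ∀ p k → p * p * (k * k) ≡ p * k * (p * k)
          l₁ = solve-∀ ℚ-ring
          q≤1 : q ≤ 1ℚ
          q≤1 = by-gap 0≤p (l₂ p)
            where
            l₂ : ∀ p → 1ℚ ≡ 1ℚ - p + p
            l₂ = solve-∀ ℚ-ring

    upds : List O → Outcome → Outcome
    upds [] ω = ω
    upds (o ∷ T) ω = upds T (upd o ω)

    upds-eq : ∀ T ω z → upds T ω z ≡ (z ∈ᵇ T) ∨ ω z
    upds-eq [] ω z = refl
    upds-eq (o ∷ T) ω z = trans (upds-eq T (upd o ω) z) (l (z ∈ᵇ T) (z == o) (ω z))
      where
      l : ∀ a b c → a ∨ (b ∨ c) ≡ (b ∨ a) ∨ c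
      l true true c = refl
      l true false c = refl
      l false true c = refl
      l false false c = refl

    upds-upd : ∀ T z ω x → upds T (upd z ω) x ≡ upd z (upds T ω) x
    upds-upd T z ω x rewrite upds-eq T (upd z ω) x | upds-eq T ω x with x ∈ᵇ T | x == z
    ... | true | true = refl
    ... | true | false = refl
    ... | false | true = refl
    ... | false | false = refl

    filter-↭ : ∀ (f : O → Bool) xs → xs ↭ filterᵇ f xs ++ filterᵇ (λ x → not (f x)) xs
    filter-↭ f [] = ↭.refl
    filter-↭ f (x ∷ xs) with f x
    ... | true = ↭.prep x (filter-↭ f xs)
    ... | false = ↭.trans (↭.prep x (filter-↭ f xs)) (↭-sym (shift x (filterᵇ f xs) (filterᵇ (λ x → not (f x)) xs)))

    -- A sum of [0,1]-valued terms, each a function of which conflict-free options touching it are retained. All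
    -- touching options pass through few hubs, and the options through one hub conflict pairwise.
    record Observable (I : Set) (H : Set) : Set where
      field
        J : List I
        ψ : I → (O → Bool) → ℚ
        touch : I → O → Bool
        ψ-range : ∀ i R → (0ℚ ≤ ψ i R) × (ψ i R ≤ 1ℚ)
        ψ-local : ∀ i → i ∈ J → ∀ R R′ → (∀ o → o ∈ vars → touch i o ≡ true → R o ≡ R′ o) → ψ i R ≡ ψ i R′
        touch-good : ∀ i o → i ∈ J → touch i o ≡ true → good o ≡ true
        touch-few : ∀ o → # (λ i → touch i o) J ℕ.≤ 3
        hubs : List H
        thru : H → O → Bool
        thru-clique : ∀ h o o′ → o ∈ vars → o′ ∈ vars → thru h o ≡ true → thru h o′ ≡ true → o ≡ o′ ⊎ adj o o′ ≡ true
        touch-thru : ∀ i o → i ∈ J → o ∈ vars → touch i o ≡ true → ∃ λ h → h ∈ hubs × thru h o ≡ true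
        thru-good : ∀ h o → thru h o ≡ true → good o ≡ true

      value : Outcome → ℚ
      value ω = ∑ J (λ i → ψ i (Ret ω))

      level : O → Bool
      level o = any (λ h → thru h o) hubs

      ball : List O
      ball = filterᵇ (λ z → level z ∨ any (λ o → level o ∧ adj o z) vars) vars

    module _ {I H : Set} (B : Observable I H) where
      open Observable B

      private
        L₁ L₂ : List O
        L₁ = filterᵇ level vars
        L₂ = filterᵇ (λ z → not (level z)) vars

        L₁⊆ : ∀ {z} → z ∈ L₁ → z ∈ vars
        L₁⊆ z∈ = proj₁ (∈-filterᵇ⁻ level vars z∈)

        L₂⊆ : ∀ {z} → z ∈ L₂ → z ∈ vars
        L₂⊆ z∈ = proj₁ (∈-filterᵇ⁻ (λ z → not (level z)) vars z∈)

        level⁺ : ∀ i o → i ∈ J → o ∈ vars → touch i o ≡ true → level o ≡ true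
        level⁺ i o i∈ o∈ t = let h , h∈ , e = touch-thru i o i∈ o∈ t in any⁺ (λ h → thru h o) h∈ e

        level-good : ∀ o → level o ≡ true → good o ≡ true
        level-good o l = let h , _ , e = any⁻ (λ h → thru h o) hubs l in thru-good h o e

      Ret-cong : ∀ {ω ω′ o} → ω o ≡ ω′ o → (∀ z → z ∈ vars → adj o z ≡ true → ω z ≡ ω′ z) → Ret ω o ≡ Ret ω′ o
      Ret-cong {ω} {ω′} {o} e h = cong₂ _∧_ e (cong not (any-cong vars λ z z∈ → bool-ext
         (λ b → ∧-intro (∧-left b) (trans (sym (h z z∈ (∧-left b))) (∧-right {adj o z} b)))
         (λ b → ∧-intro (∧-left b) (trans (h z z∈ (∧-left b)) (∧-right {adj o z} b)))))

      value-local : Local (_∈ᵇ ball) value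
      value-local ω ω′ h = ∑-cong J λ i i∈ → ψ-local i i∈ _ _ λ o o∈ t → Ret-cong {ω} {ω′}
          (h o (∈ᵇ⁺ (∈-filterᵇ⁺ _ o∈ (∨-left (level⁺ i o i∈ o∈ t)))))
          λ z z∈ a → h z (∈ᵇ⁺ (∈-filterᵇ⁺ _ z∈ (∨-right {level z} (any⁺ (λ o → level o ∧ adj o z) o∈ (∧-intro (level⁺ i o i∈ o∈ t) a)))))

      value-ext : Ext value
      value-ext = Local⇒Ext value-local

      L₁-size : ∀ {N} → (∀ h → h ∈ hubs → # (thru h) vars ℕ.≤ N) → length L₁ ℕ.≤ length hubs ℕ.* N
      L₁-size {N} hN = ℕₚ.≤-trans (#-≤ level {ys = concatMap (λ h → filterᵇ (thru h) vars) hubs} vars-unique λ z z∈ l → let h , h∈ , e = any⁻ (λ h → thru h z) hubs l in ∈-concatMap _ h∈ (∈-filterᵇ⁺ (thru h) z∈ e))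
                     (concatMap-length (λ h → filterᵇ (thru h) vars) hubs hN)

      ball-size : length ball ℕ.≤ length L₁ ℕ.* suc M
      ball-size = ℕₚ.≤-trans (#-≤ (λ z → level z ∨ any (λ o → level o ∧ adj o z) vars) {ys = concatMap (λ o → o ∷ filterᵇ (adj o) vars) L₁} vars-unique λ z z∈ e → go z z∈ (∨-case {level z} e))
          (concatMap-length (λ o → o ∷ filterᵇ (adj o) vars) L₁ λ o o∈ → ℕ.s≤s (ℕₚ.≤-reflexive (deg-good o (L₁⊆ o∈) (level-good o (proj₂ (∈-filterᵇ⁻ level vars o∈))))))
        where
        go : ∀ z → z ∈ vars → level z ≡ true ⊎ any (λ o → level o ∧ adj o z) vars ≡ true → z ∈ concatMap (λ o → o ∷ filterᵇ (adj o) vars) L₁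
        go z z∈ (inj₁ l) = ∈-concatMap (λ o → o ∷ filterᵇ (adj o) vars) (∈-filterᵇ⁺ level z∈ l) (here refl)
        go z z∈ (inj₂ e) = let o , o∈ , b = any⁻ _ vars e in ∈-concatMap (λ o → o ∷ filterᵇ (adj o) vars) (∈-filterᵇ⁺ level o∈ (∧-left b)) (there (∈-filterᵇ⁺ (adj o) z∈ (∧-right {level o} b)))

      lipschitz : ∀ z ω ω′ → z ∈ vars → Supp vars ω → (∀ x → ω′ x ≡ upd z ω x) → (value ω′ ≤ value ω + ι 12) × (value ω ≤ value ω′ + ι 12)
      lipschitz z ω ω′ z∈ s e = bound (λ i i∈ → proj₁ (termwise i i∈)) , bound (λ i i∈ → proj₂ (termwise i i∈))
        where
        C : List O
        C = filterᵇ (λ o → good o ∧ (Ret ω o ∧ adj z o)) vars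
        C-unique : Unique C
        C-unique = filterᵇ-unique _ vars-unique
        C-spec : ∀ {o} → o ∈ C → o ∈ vars × good o ≡ true × Ret ω o ≡ true × adj z o ≡ true
        C-spec {o} o∈ = let a , b = ∈-filterᵇ⁻ (λ o → good o ∧ (Ret ω o ∧ adj z o)) vars o∈ in a , ∧-left b , ∧-left (∧-right {good o} b) , ∧-right {Ret ω o} (∧-right {good o} b)
        C≤3 : length C ℕ.≤ 3
        C≤3 = inj-length (side z) {ys = 0 ∷ 1 ∷ 2 ∷ []} C-unique
           (λ x y x∈ y∈ eq → let x∈v , gx , rx , ax = C-spec x∈ ; y∈v , gy , ry , ay = C-spec y∈ in
              [ (λ h → h) , (λ a → ⊥-elim (true≢false a (Ret-indep {ω} y∈v rx ry))) ]′ (claw z x y gx gy ax ay eq))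
           (λ x x∈ → let _ , gx , _ , ax = C-spec x∈ in three (side<3 z x gx ax))
          where
          three : ∀ {n} → n ℕ.< 3 → n ∈ 0 ∷ 1 ∷ 2 ∷ []
          three {0} _ = here refl
          three {1} _ = there (here refl)
          three {2} _ = there (there (here refl))
          three {suc (suc (suc _))} (ℕ.s≤s (ℕ.s≤s (ℕ.s≤s ())))
        weight : I → ℚ
        weight i = ∑ (z ∷ C) (λ o → 𝟙 (touch i o))
        total : ∑ J weight ≤ ι 12
        total = ≤-trans (≤-reflexive (∑-swap J (z ∷ C) (λ i o → 𝟙 (touch i o)))) (≤-trans (∑-mono (z ∷ C) {g = λ _ → ι 3} λ o _ → ≤-trans (≤-reflexive (sym (ι# (λ i → touch i o) J))) (ι-mono (touch-few o)))
           (≤-trans (≤-reflexive (trans (∑-const (ι 3) (z ∷ C)) (sym (ι-* (suc (length C)) 3)))) (ι-mono (ℕₚ.*-monoˡ-≤ 3 (ℕ.s≤s C≤3)))))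
        bound : ∀ {f g : I → ℚ} → (∀ i → i ∈ J → f i ≤ g i + weight i) → ∑ J f ≤ ∑ J g + ι 12
        bound {f} {g} h = ≤-trans (∑-mono J h) (≤-trans (≤-reflexive (∑-+ J g weight)) (+-mono (≤-refl {∑ J g}) total))
        same : ∀ o → o ∈ vars → good o ≡ true → ¬ o ∈ z ∷ C → Ret ω o ≡ Ret ω′ o
        same o o∈ g o∉ = bool-ext
          (λ r → Ret-intro (trans (e o) (∨-right {o == z} (Ret-sel r))) λ x x∈ a → trans (e x) (trans (upd-other ω λ { refl → o∉ (there (∈-filterᵇ⁺ _ o∈ (∧-intro g (∧-intro r (trans (adj-sym z o) a))))) }) (Ret-free r x∈ a)))
          (λ r → Ret-intro (trans (sym (trans (e o) (upd-other ω λ { refl → o∉ (here refl) }))) (Ret-sel r)) λ x x∈ a → ¬true⇒false λ h → true≢false (trans (e x) (∨-right {x == z} h)) (Ret-free r x∈ a))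
        termwise : ∀ i → i ∈ J → (ψ i (Ret ω′) ≤ ψ i (Ret ω) + weight i) × (ψ i (Ret ω) ≤ ψ i (Ret ω′) + weight i)
        termwise i i∈ with bool-case (any (touch i) (z ∷ C))
        ... | inj₂ n = le (sym eq) , le eq
          where
          eq : ψ i (Ret ω) ≡ ψ i (Ret ω′)
          eq = ψ-local i i∈ _ _ λ o o∈ t → same o o∈ (touch-good i o i∈ t) λ o∈C → true≢false t (any-false (touch i) (z ∷ C) n o∈C)
          le : ∀ {a b} → a ≡ b → a ≤ b + weight i
          le refl = by-gap (∑-≥0 (z ∷ C) λ o _ → 0≤𝟙 (touch i o)) refl
        ... | inj₁ y = le (proj₂ (ψ-range i _)) (proj₁ (ψ-range i _)) , le (proj₂ (ψ-range i _)) (proj₁ (ψ-range i _))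
          where
          1≤w : 1ℚ ≤ weight i
          1≤w = ≤-trans (≤-reflexive (sym (cong 𝟙 y))) (𝟙-any≤ (touch i) (z ∷ C))
          le : ∀ {a b} → a ≤ 1ℚ → 0ℚ ≤ b → a ≤ b + weight i
          le {a} {b} h k = ≤-trans h (≤-trans 1≤w (≤-trans (≤-reflexive (sym (ℚₚ.+-identityˡ (weight i)))) (+-mono k (≤-refl {weight i}))))

      private
        rel : List O → O → Bool
        rel T o = (o ∈ᵇ T) ∧ not (any (adj o) T)

        D : List O → O → Bool
        D T z = any (λ h → any (λ o → thru h o ∧ (rel T o ∧ adj o z)) vars) hubs

        #D : ∀ T → (∀ {o} → o ∈ T → o ∈ L₁) → # (D T) L₂ ℕ.≤ length hubs ℕ.* M
        #D T T⊆ = ℕₚ.≤-trans (#-≤ (D T) {ys = concatMap near hubs} (filterᵇ-unique _ vars-unique) cover)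
            (concatMap-length near hubs λ h h∈ → ℕₚ.≤-trans (concatMap-length (λ o → filterᵇ (adj o) vars) (at h) λ o o∈ →
               ℕₚ.≤-reflexive (deg-good o (proj₁ (∈-filterᵇ⁻ _ vars o∈)) (thru-good h o (∧-left (proj₂ (∈-filterᵇ⁻ (λ o → thru h o ∧ rel T o) vars o∈))))))
                 (subst (length (at h) ℕ.* M ℕ.≤_) (ℕₚ.+-identityʳ M) (ℕₚ.*-monoˡ-≤ M (at≤1 h))))
          where
          at : H → List O
          at h = filterᵇ (λ o → thru h o ∧ rel T o) vars
          near : H → List O
          near h = concatMap (λ o → filterᵇ (adj o) vars) (at h)
          at≤1 : ∀ h → length (at h) ℕ.≤ 1
          at≤1 h = inj-length (λ _ → 0) {ys = 0 ∷ []} (filterᵇ-unique _ vars-unique)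
            (λ x y x∈ y∈ _ → let x∈v , a = ∈-filterᵇ⁻ (λ o → thru h o ∧ rel T o) vars x∈ ; y∈v , b = ∈-filterᵇ⁻ (λ o → thru h o ∧ rel T o) vars y∈ in
              [ (λ e → e) , (λ k → ⊥-elim (true≢false (any⁺ (adj x) (∈ᵇ⁻ T (∧-left (∧-right {thru h y} b))) k) (not-elim (∧-right {x ∈ᵇ T} (∧-right {thru h x} a))))) ]′
                (thru-clique h x y x∈v y∈v (∧-left a) (∧-left b)))
            (λ _ _ → here refl)
          cover : ∀ z → z ∈ L₂ → D T z ≡ true → z ∈ concatMap near hubs
          cover z z∈ d = let h , h∈ , e = any⁻ _ hubs d ; o , o∈ , b = any⁻ _ vars e in
            ∈-concatMap near h∈ (∈-concatMap (λ o → filterᵇ (adj o) vars) (∈-filterᵇ⁺ (λ o → thru h o ∧ rel T o) o∈ (∧-intro {thru h o} {rel T o} (∧-left b) (∧-left {rel T o} (∧-right {thru h o} b))))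
              (∈-filterᵇ⁺ (adj o) (L₂⊆ z∈) (∧-right {rel T o} (∧-right {thru h o} b))))

        second : ∀ (f : Outcome → ℚ) (d : O → Bool) → Ext f →
                 (∀ z ω → z ∈ L₂ → d z ≡ false → Supp L₂ ω → f (upd z ω) ≡ f ω) →
                 (∀ z ω → z ∈ L₂ → Supp L₂ ω → (f (upd z ω) ≤ f ω + ι 12) × (f ω ≤ f (upd z ω) + ι 12)) →
                 ∀ zs b → (∀ {z} → z ∈ zs → z ∈ L₂) → # d zs ℕ.≤ b → Budget (ι 12) zs f b
        second f d ext ign lip [] b sub h = done
        second f d ext ign lip (z ∷ zs) b sub h with d z in eq
        ... | false = skip (λ ω s → ign z ω (sub (here refl)) eq λ x e → sub (there (s x e))) (second f d ext ign lip zs b (λ x → sub (there x)) h)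
        second f d ext ign lip (z ∷ zs) (suc b) sub (ℕ.s≤s h) | true = pay (λ ω s → lip z ω z∈ λ x e → sub (there (s x e))) (second f d ext ign lip zs b (λ x → sub (there x)) h)
            (second (λ ω → f (upd z ω)) d (λ ω ω′ k → ext _ _ λ x → upd-cong z {ω} {ω′} {x} (k x))
              (λ y ω y∈ dy s → trans (ext _ _ (upds-upd (z ∷ []) y ω)) (ign y (upd z ω) y∈ dy (supp z ω z∈ s)))
              (λ y ω y∈ s → subst (λ v → (v ≤ f (upd z ω) + ι 12) × (f (upd z ω) ≤ v + ι 12)) (sym (ext _ _ (upds-upd (z ∷ []) y ω))) (lip y (upd z ω) y∈ (supp z ω z∈ s)))
              zs b (λ x → sub (there x)) h)
          where
          z∈ = sub (here refl)
          supp : ∀ z ω → z ∈ L₂ → Supp L₂ ω → Supp L₂ (upd z ω)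
          supp z ω z∈ s x e with ∨-case {x == z} e
          ... | inj₁ h = subst (_∈ L₂) (sym (==-true h)) z∈
          ... | inj₂ h = s x h

        Supp-upds : ∀ T ω → (∀ {o} → o ∈ T → o ∈ L₁) → Supp vars ω → Supp vars (upds T ω)
        Supp-upds T ω T⊆ s x e with ∨-case {x ∈ᵇ T} (trans (sym (upds-eq T ω x)) e)
        ... | inj₁ h = L₁⊆ (T⊆ (∈ᵇ⁻ T h))
        ... | inj₂ h = s x h

        lip-upds : ∀ T z ω → (∀ {o} → o ∈ T → o ∈ L₁) → z ∈ vars → Supp vars ω →
                   (value (upds T (upd z ω)) ≤ value (upds T ω) + ι 12) × (value (upds T ω) ≤ value (upds T (upd z ω)) + ι 12)
        lip-upds T z ω T⊆ z∈ s = lipschitz z (upds T ω) (upds T (upd z ω)) z∈ (Supp-upds T ω T⊆ s) (upds-upd T z ω)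

        ext-upds : ∀ T → Ext (λ ω → value (upds T ω))
        ext-upds T ω ω′ h = value-ext _ _ λ x → trans (upds-eq T ω x) (trans (cong ((x ∈ᵇ T) ∨_) (h x)) (sym (upds-eq T ω′ x)))

        ignore : ∀ T → (∀ {o} → o ∈ T → o ∈ L₁) → ∀ z ω → z ∈ L₂ → D T z ≡ false → Supp L₂ ω → value (upds T (upd z ω)) ≡ value (upds T ω)
        ignore T T⊆ z ω z∈ d s = ∑-cong J λ i i∈ → ψ-local i i∈ _ _ λ o o∈ t → same o o∈ (level⁺ i o i∈ o∈ t) (touch-thru i o i∈ o∈ t)
          where
          ω₁ = upds T ω
          ω₂ = upds T (upd z ω)
          unlevel : ∀ {x} → x ∈ L₂ → level x ≡ false
          unlevel x∈ = not-elim (proj₂ (∈-filterᵇ⁻ (λ z → not (level z)) vars x∈))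
          differ : ∀ x → x ≢ z → ω₂ x ≡ ω₁ x
          differ x n = trans (upds-upd T z ω x) (upd-other (upds T ω) n)
          same : ∀ o → o ∈ vars → level o ≡ true → (∃ λ h → h ∈ hubs × thru h o ≡ true) → Ret ω₂ o ≡ Ret ω₁ o
          same o o∈ lo (h , h∈ , th) with bool-case (rel T o)
          ... | inj₁ r = Ret-cong (differ o λ { refl → true≢false lo (unlevel z∈) }) λ x x∈ a → differ x λ { refl →
                  true≢false (any⁺ (λ h → any (λ o → thru h o ∧ (rel T o ∧ adj o z)) vars) h∈ (any⁺ (λ o → thru h o ∧ (rel T o ∧ adj o z)) o∈ (∧-intro th (∧-intro r a)))) d }
          ... | inj₂ r = trans (lost ω₂ (λ x h → trans (upds-eq T (upd z ω) x) (∨-left h)) selected₂) (sym (lost ω₁ (λ x h → trans (upds-eq T ω x) (∨-left h)) selected₁))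
            where
            selected₁ : ω₁ o ≡ true → o ∈ᵇ T ≡ true
            selected₁ e with ∨-case {o ∈ᵇ T} (trans (sym (upds-eq T ω o)) e)
            ... | inj₁ k = k
            ... | inj₂ k = ⊥-elim (true≢false lo (unlevel (s o k)))
            selected₂ : ω₂ o ≡ true → o ∈ᵇ T ≡ true
            selected₂ e = selected₁ (trans (sym (differ o λ { refl → true≢false lo (unlevel z∈) })) e)
            lost : ∀ ω′ → (∀ x → x ∈ᵇ T ≡ true → ω′ x ≡ true) → (ω′ o ≡ true → o ∈ᵇ T ≡ true) → Ret ω′ o ≡ false
            lost ω′ T⊆ω′ sel = ¬true⇒false λ k → let o∈T = sel (Ret-sel k) in
              go k (bool-case (any (adj o) T)) o∈T
              where
              go : Ret ω′ o ≡ true → any (adj o) T ≡ true ⊎ any (adj o) T ≡ false → o ∈ᵇ T ≡ true → ⊥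
              go k (inj₂ n) o∈T = true≢false (∧-intro o∈T (not-true n)) r
              go k (inj₁ y) o∈T = let x , x∈ , a = any⁻ (adj o) T y in true≢false (T⊆ω′ x (∈ᵇ⁺ x∈)) (Ret-free {ω′} k (L₁⊆ (T⊆ x∈)) a)

        first : ∀ T zs → (∀ {o} → o ∈ T → o ∈ L₁) → (∀ {z} → z ∈ zs → z ∈ L₁) →
                Budget (ι 12) (zs ++ L₂) (λ ω → value (upds T ω)) (length zs ℕ.+ length hubs ℕ.* M)
        first T [] T⊆ _ = second (λ ω → value (upds T ω)) (D T) (ext-upds T) (λ z ω z∈ d s → ignore T T⊆ z ω z∈ d s)
            (λ z ω z∈ s → lip-upds T z ω T⊆ (L₂⊆ z∈) λ x e → L₂⊆ (s x e)) L₂ (length hubs ℕ.* M) (λ x → x) (#D T T⊆)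
        first T (z ∷ zs) T⊆ zs⊆ = pay (λ ω s → lip-upds T z ω T⊆ (L₁⊆ (zs⊆ (here refl))) λ x e → [ (λ h → L₁⊆ (zs⊆ (there h))) , L₂⊆ ]′ (∈-++⁻ zs (s x e)))
            (first T zs T⊆ λ x → zs⊆ (there x)) (first (z ∷ T) zs (λ { (here refl) → zs⊆ (here refl) ; (there x) → T⊆ x }) λ x → zs⊆ (there x))

      concentrated : ∀ {Θ k σ N} → (∀ h → h ∈ hubs → # (thru h) vars ℕ.≤ N) → length hubs ℕ.* N ℕ.* suc M ℕ.≤ k →
                     0ℚ < σ → ι 2 * ι 12 ≤ σ → ι (length hubs ℕ.* N ℕ.+ length hubs ℕ.* M) * p * (ι 2 * ι 12) * (ι 2 * ι 12) ≤ σ * σ →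
                     Σ (Concentrated vars Θ k value σ) λ c → Concentrated.support c ≡ ball
      concentrated {σ = σ} hN hk 0<σ hσ var = record
        { support = ball ; unique = filterᵇ-unique _ vars-unique ; size = ℕₚ.≤-trans ball-size (ℕₚ.≤-trans (ℕₚ.*-monoˡ-≤ (suc M) (L₁-size hN)) hk)
        ; local = value-local ; order = L₁ ++ L₂ ; reorder = filter-↭ level vars ; c = ι 12 ; R = ι (length J) ; b = length L₁ ℕ.+ length hubs ℕ.* M
        ; 0≤c = 0≤ι 12 ; tree = first [] L₁ (λ ()) (λ x → x)
        ; range = λ ω → ∑-≥0 J (λ i _ → proj₁ (ψ-range i (Ret ω))) , ≤-trans (∑-mono J {g = λ _ → 1ℚ} λ i _ → proj₂ (ψ-range i (Ret ω))) (≤-reflexive (trans (∑-const 1ℚ J) (ℚₚ.*-identityʳ (ι (length J)))))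
        ; 0<σ = 0<σ ; 2c≤σ = hσ ; variance = ≤-trans (*-monoˡ 0≤24 (*-monoˡ 0≤24 (*-monoˡ 0≤p (ι-mono (ℕₚ.+-monoˡ-≤ (length hubs ℕ.* M) (L₁-size hN)))))) var
        } , refl
        where
        0≤24 = 0≤* (0≤ι 2) (0≤ι 12)

module Hypergraph {I R : Set} (_≟I_ : DecidableEquality I) (_≟R_ : DecidableEquality R) where

  Opt : Set
  Opt = I × R × R

  Point : Set
  Point = I ⊎ R

  _≟P_ : DecidableEquality Point
  _≟P_ = Sumₚ.≡-dec _≟I_ _≟R_

  _≟O_ : DecidableEquality Opt
  _≟O_ = Prodₚ.≡-dec _≟I_ (Prodₚ.≡-dec _≟R_ _≟R_)

  open Eq _≟P_ public using () renaming (_∈ᵇ_ to _∈ᴾ_; ∈ᵇ⁺ to ∈ᴾ⁺; ∈ᵇ⁻ to ∈ᴾ⁻)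

  pts : Opt → List Point
  pts (i , a , b) = inj₁ i ∷ inj₂ a ∷ inj₂ b ∷ []

  on : Point → Opt → Bool
  on x o = x ∈ᴾ pts o

  record Linear (os : List Opt) : Set where
    field
      unique   : Unique os
      distinct : ∀ {i a b} → (i , a , b) ∈ os → a ≢ b
      linear   : ∀ {o o′ x y} → o ∈ os → o′ ∈ os → x ≢ y → x ∈ pts o → y ∈ pts o → x ∈ pts o′ → y ∈ pts o′ → o ≡ o′

  Linear-⊆ : ∀ {os} (f : Opt → Bool) → Linear os → Linear (filterᵇ f os)
  Linear-⊆ {os} f L = record
    { unique = filterᵇ-unique f unique
    ; distinct = λ o∈ → distinct (sub o∈)
    ; linear = λ o∈ o′∈ → linear (sub o∈) (sub o′∈)
    }
    where
    open Linear L
    sub : ∀ {o} → o ∈ filterᵇ f os → o ∈ os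
    sub o∈ = proj₁ (∈-filterᵇ⁻ f os o∈)

  record Test (os : List Opt) (ℓ : ℕ) : Set where
    field
      pairs    : List (R × R)
      hub      : List I
      few      : ∀ o → # (λ ab → on (inj₂ (proj₁ ab)) o ∨ on (inj₂ (proj₂ ab)) o) pairs ℕ.≤ 3
      thru-hub : ∀ {o ab} → o ∈ os → ab ∈ pairs → on (inj₂ (proj₁ ab)) o ∨ on (inj₂ (proj₂ ab)) o ≡ true → ∃ λ i → i ∈ hub × on (inj₁ i) o ≡ true
      hub-size : length hub ℕ.≤ 2 ℕ.* ℓ

  Disjoint : Opt → Opt → Set
  Disjoint o o′ = ∀ x → x ∈ pts o → x ∈ pts o′ → ⊥

  -- What one round achieves: the options kept form a partial matching, and the options left over avoid it.
  record Summary (os : List Opt) (ℓ t : ℕ) (its : List I) (a : ℚ) {T : Set} (ts : List T) (τ : T → Test os ℓ) : Set where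
    field
      p κ ρ   : ℚ
      0≤p     : 0ℚ ≤ p
      pℓ      : p * ι ℓ ≡ 1ℚ
      ρ≡      : ρ ≡ ι t * (p * κ)
      1≤128κ  : 1ℚ ≤ ι 128 * κ
      2κ≤1    : ι 2 * κ ≤ 1ℚ
      kept left : List Opt
      kept-in : ∀ {o} → o ∈ kept → o ∈ os
      left-in : ∀ {o} → o ∈ left → o ∈ os
      left-linear : Linear left
      kept-apart : ∀ {o o′} → o ∈ kept → o′ ∈ kept → o ≢ o′ → Disjoint o o′
      left-apart : ∀ {o o′} → o ∈ kept → o′ ∈ left → Disjoint o o′
      item-after : ∀ i → i ∈ its → (∃ λ o → o ∈ kept × on (inj₁ i) o ≡ true) ⊎ (ι ℓ * ((1ℚ - ρ) * (1ℚ - ρ)) - ι 4 - a ≤ ι (# (on (inj₁ i)) left))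
      res-after : ∀ r → ι (# (on (inj₂ r)) left) ≤ ι t * ((1ℚ - κ) * (1ℚ - ρ)) + ι 19 + a
      test-after : ∀ x → x ∈ ts → p * κ * (1ℚ - κ * (1ℚ + ι 18 * p)) * ∑ (Test.pairs (τ x)) (λ ab → ι (# (on (inj₂ (proj₁ ab))) os))
                     - p * κ * ∑ (Test.pairs (τ x)) (λ ab → ι (# (λ o → on (inj₂ (proj₁ ab)) o ∧ on (inj₂ (proj₂ ab)) o) os)) - a
                   ≤ ι (# (λ ab → any (on (inj₂ (proj₁ ab))) kept ∧ not (any (on (inj₂ (proj₂ ab))) kept)) (Test.pairs (τ x)))

  record Matching (os : List Opt) (its : List I) : Set where
    field
      edges   : List Opt
      within  : ∀ {o} → o ∈ edges → o ∈ os
      apart   : ∀ {o o′} → o ∈ edges → o′ ∈ edges → o ≢ o′ → Disjoint o o′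
      covers  : ∀ i → i ∈ its → ∃ λ o → o ∈ edges × on (inj₁ i) o ≡ true

  ends₂ : Opt → List R
  ends₂ (_ , a , b) = a ∷ b ∷ []

  resources : List Opt → List R
  resources os = deduplicate _≟R_ (concatMap ends₂ os)

  resources-unique : ∀ os → Unique (resources os)
  resources-unique os = UniqueDec.deduplicate-! _≟R_ (concatMap ends₂ os)

  resources-all : ∀ {os o r} → o ∈ os → inj₂ r ∈ pts o → r ∈ resources os
  resources-all {os} {o} {r} o∈ r∈ = ∈-deduplicate⁺ _≟R_ (∈-concatMap ends₂ o∈ (go r∈))
    where
    go : inj₂ r ∈ pts o → r ∈ ends₂ o
    go (there (here refl)) = here refl
    go (there (there (here refl))) = there (here refl)

  item-of : ∀ {i o} → inj₁ i ∈ pts o → proj₁ o ≡ i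
  item-of (here refl) = refl
  item-of (there (here ()))
  item-of (there (there (here ())))

  on-item : ∀ i o → on (inj₁ i) o ≡ true → proj₁ o ≡ i
  on-item i o e = item-of {i} {o} (∈ᴾ⁻ (pts o) e)

module Final {I C : Set} (_≟I_ : DecidableEquality I) (_≟C_ : DecidableEquality C)
  (its : List I) (its-unique : Unique its) (opts : I → List C) (opts-unique : ∀ i → i ∈ its → Unique (opts i))
  (ℓ : ℕ) (1≤ℓ : 1 ℕ.≤ ℓ) (opts-size : ∀ i → i ∈ its → length (opts i) ≡ ℓ)
  (clash : C → C → Bool) (clash-sym : ∀ c c′ → clash c c′ ≡ true → clash c′ c ≡ true)
  (t : ℕ) (few : ∀ i c → i ∈ its → c ∈ opts i → ∑ its (λ j → ι (# (clash c) (opts j))) ≤ ι (2 ℕ.* t)) (8t≤ℓ : 8 ℕ.* t ℕ.≤ ℓ)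
  (c₀ : C) where

    open Eq _≟I_
    open Eq _≟C_ using () renaming (_==_ to _==ᶜ_; ==-refl to ==ᶜ-refl; ==-true to ==ᶜ-true)

    private
      p : ℚ
      p = proj₁ (inverse (ι-pos′ 1≤ℓ))
      ℓp : ι ℓ * p ≡ 1ℚ
      ℓp = proj₁ (proj₂ (inverse (ι-pos′ 1≤ℓ)))
      0≤p : 0ℚ ≤ p
      0≤p = ℚₚ.<⇒≤ (proj₂ (proj₂ (inverse (ι-pos′ 1≤ℓ))))

    Choice : Set
    Choice = I → C

    set : I → C → Choice → Choice
    set i c a j = if j == i then c else a j

    set-same : ∀ i c a → set i c a i ≡ c
    set-same i c a rewrite ==-refl i = refl

    set-other : ∀ {i j} c a → j ≢ i → set i c a j ≡ a j
    set-other {i} {j} c a n rewrite ==-false {j} {i} n = refl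

    A : List I → (Choice → ℚ) → ℚ
    A [] g = g (λ _ → c₀)
    A (i ∷ is) g = p * ∑ (opts i) (λ c → A is (λ a → g (set i c a)))

    Valid : List I → Choice → Set
    Valid is a = ∀ i → i ∈ is → a i ∈ opts i

    Valid-set : ∀ {i c is a} → ¬ i ∈ is → c ∈ opts i → Valid is a → Valid (i ∷ is) (set i c a)
    Valid-set {i} {c} {a = a} i∉ c∈ v j (here refl) = subst (_∈ opts i) (sym (set-same i c a)) c∈
    Valid-set {i} {c} {a = a} i∉ c∈ v j (there j∈) = subst (_∈ opts j) (sym (set-other c a λ { refl → i∉ j∈ })) (v j j∈)

    head∉ : ∀ {i : I} {is} → Unique (i ∷ is) → ¬ i ∈ is
    head∉ (h ∷ _) i∈ = All.lookup h i∈ refl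

    tail! : ∀ {i : I} {is} → Unique (i ∷ is) → Unique is
    tail! (_ ∷ u) = u

    A-mono : ∀ is → Unique is → ∀ {f g} → (∀ a → Valid is a → f a ≤ g a) → A is f ≤ A is g
    A-mono [] u h = h (λ _ → c₀) λ _ ()
    A-mono (i ∷ is) u h = *-monoʳ 0≤p (∑-mono (opts i) λ c c∈ → A-mono is (tail! u) λ a v → h (set i c a) (Valid-set (head∉ u) c∈ v))

    A-0 : ∀ is → A is (λ _ → 0ℚ) ≡ 0ℚ
    A-0 [] = refl
    A-0 (i ∷ is) = trans (cong (p *_) (trans (∑-cong (opts i) λ _ _ → A-0 is) (∑-0 (opts i)))) (ℚₚ.*-zeroʳ p)

    A-+ : ∀ is f g → A is (λ a → f a + g a) ≡ A is f + A is g
    A-+ [] f g = refl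
    A-+ (i ∷ is) f g = trans (cong (p *_) (trans (∑-cong (opts i) λ c _ → A-+ is (λ a → f (set i c a)) (λ a → g (set i c a))) (∑-+ (opts i) _ _))) (ℚₚ.*-distribˡ-+ p _ _)

    A-∑ : ∀ {X : Set} is (xs : List X) (f : X → Choice → ℚ) → A is (λ a → ∑ xs (λ x → f x a)) ≡ ∑ xs (λ x → A is (f x))
    A-∑ is [] f = A-0 is
    A-∑ is (x ∷ xs) f = trans (A-+ is (f x) (λ a → ∑ xs (λ x → f x a))) (cong (A is (f x) +_) (A-∑ is xs f))

    A-cong : ∀ is {f g} → (∀ a → f a ≡ g a) → A is f ≡ A is g
    A-cong [] h = h _
    A-cong (i ∷ is) h = cong (p *_) (∑-cong (opts i) λ c _ → A-cong is λ a → h (set i c a))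

    A-* : ∀ is b f → A is (λ a → b * f a) ≡ b * A is f
    A-* [] b f = refl
    A-* (i ∷ is) b f = trans (cong (p *_) (trans (∑-cong (opts i) λ c _ → A-* is b (λ a → f (set i c a))) (∑-* b (opts i) _))) (l p b _)
      where
      l : ∀ p b x → p * (b * x) ≡ b * (p * x)
      l = solve-∀ ℚ-ring

    A-1 : ∀ is → (∀ i → i ∈ is → i ∈ its) → A is (λ _ → 1ℚ) ≡ 1ℚ
    A-1 [] h = refl
    A-1 (i ∷ is) h = trans (cong (p *_) (trans (∑-cong (opts i) λ _ _ → A-1 is λ j j∈ → h j (there j∈)) (trans (∑-const 1ℚ (opts i)) (trans (ℚₚ.*-identityʳ (ι (length (opts i)))) (cong ι (opts-size i (h i (here refl)))))))) (trans (ℚₚ.*-comm p (ι ℓ)) ℓp)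

    A-witness : ∀ is → Unique is → ∀ {f} → 0ℚ < A is f → ∃ λ a → Valid is a × (0ℚ < f a)
    A-witness [] u h = (λ _ → c₀) , (λ _ ()) , h
    A-witness (i ∷ is) u {f} h with pick (opts i) (λ c c∈ → c∈)
      where
      pick : ∀ cs → (∀ c → c ∈ cs → c ∈ opts i) → (∃ λ c → c ∈ opts i × (0ℚ < A is (λ a → f (set i c a)))) ⊎ (∑ cs (λ c → A is (λ a → f (set i c a))) ≤ 0ℚ)
      pick [] _ = inj₂ ≤-refl
      pick (c ∷ cs) s with ≤-dec (A is (λ a → f (set i c a))) 0ℚ
      ... | inj₂ k = inj₁ (c , s c (here refl) , k)
      ... | inj₁ k with pick cs (λ d d∈ → s d (there d∈))
      ...   | inj₁ w = inj₁ w
      ...   | inj₂ w = inj₂ (+-mono k w)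
    ... | inj₂ w = ⊥-elim (<⇒≱ h (≤-trans (*-monoʳ 0≤p w) (≤-reflexive (ℚₚ.*-zeroʳ p))))
    ... | inj₁ (c , c∈ , k) = let a , v , w = A-witness is (tail! u) k in set i c a , Valid-set (head∉ u) c∈ v , w

    Off : I → (Choice → ℚ) → Set
    Off i g = ∀ a b → (∀ j → j ≢ i → a j ≡ b j) → g a ≡ g b

    A-pick : ∀ is → Unique is → (∀ j → j ∈ is → j ∈ its) → ∀ {i c} → i ∈ is → c ∈ opts i → ∀ {g} → Off i g → A is (λ a → 𝟙 (a i ==ᶜ c) * g a) ≡ p * A is g
    A-pick (i ∷ is) u s {.i} {c} (here refl) c∈ {g} off = cong (p *_) (trans (∑-cong (opts i) λ d _ → trans (A-cong is λ a → cong₂ _*_ (cong (λ x → 𝟙 (x ==ᶜ c)) (set-same i d a)) (off (set i d a) (set i c a) λ j n → trans (set-other d a n) (sym (set-other c a n))))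
          (A-* is (𝟙 (d ==ᶜ c)) (λ a → g (set i c a)))) (trans (Eq.∑-single _≟C_ (opts-unique i (s i (here refl))) c∈ (λ _ → A is (λ a → g (set i c a))))
        (trans (sym (ℚₚ.*-identityˡ _)) (trans (cong (_* A is (λ a → g (set i c a))) (trans (sym ℓp) (ℚₚ.*-comm (ι ℓ) p))) (trans (ℚₚ.*-assoc p (ι ℓ) _) (cong (p *_) (trans (cong (λ n → ι n * A is (λ a → g (set i c a))) (sym (opts-size i (s i (here refl)))))
          (trans (sym (∑-const (A is (λ a → g (set i c a))) (opts i))) (∑-cong (opts i) λ d _ → A-cong is λ a → off (set i c a) (set i d a) λ j n → trans (set-other c a n) (sym (set-other d a n)))))))))))
    A-pick (k ∷ is) u s {i} {c} (there i∈) c∈ {g} off = cong (p *_) (trans (∑-cong (opts k) λ d _ → trans (A-cong is λ a → cong (λ x → 𝟙 (x ==ᶜ c) * g (set k d a)) (set-other d a i≢k))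
        (A-pick is (tail! u) (λ j j∈ → s j (there j∈)) i∈ c∈ λ a b h → off (set k d a) (set k d b) λ j n → upd-eq d a b h j n)) (∑-* p (opts k) _))
      where
      i≢k : i ≢ k
      i≢k refl = head∉ u i∈
      upd-eq : ∀ d a b → (∀ j → j ≢ i → a j ≡ b j) → ∀ j → j ≢ i → set k d a j ≡ set k d b j
      upd-eq d a b h j n = cong (λ x → if j == k then d else x) (h j n)

    conflict : List I → Choice → I → Bool
    conflict X a i = any (λ j → not (i == j) ∧ clash (a i) (a j)) X

    ok : List I → Choice → Bool
    ok X a = not (any (conflict X a) X)

    ok⁻ : ∀ {X a i j} → ok X a ≡ true → i ∈ X → j ∈ X → i ≢ j → clash (a i) (a j) ≡ false
    ok⁻ {X} {a} {i} {j} h i∈ j∈ n = ¬true⇒false λ e → true≢false (any⁺ (conflict X a) i∈ (any⁺ (λ j → not (i == j) ∧ clash (a i) (a j)) j∈ (∧-intro (not-true (==-false n)) e))) (not-elim h)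

    ok⁺ : ∀ {X a} → (∀ i j → i ∈ X → j ∈ X → i ≢ j → clash (a i) (a j) ≡ false) → ok X a ≡ true
    ok⁺ {X} {a} h = not-true (¬true⇒false λ e → let i , i∈ , f = any⁻ (conflict X a) X e ; j , j∈ , b = any⁻ (λ j → not (i == j) ∧ clash (a i) (a j)) X f in
      true≢false (∧-right {not (i == j)} b) (h i j i∈ j∈ (==-≢ (not-elim (∧-left b)))))

    W : List I → ℚ
    W X = A its (λ a → 𝟙 (ok X a))

    W-antitone : ∀ {X Y} → (∀ i → i ∈ X → i ∈ Y) → W Y ≤ W X
    W-antitone {X} {Y} h = A-mono its its-unique λ a _ → 𝟙-mono {ok Y a} {ok X a} λ e → ok⁺ {X} {a} λ i j i∈ j∈ → ok⁻ {Y} {a} e (h i i∈) (h j j∈)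

    0≤W : ∀ X → 0ℚ ≤ W X
    0≤W X = subst (_≤ W X) (A-0 its) (A-mono its its-unique λ a _ → 0≤𝟙 (ok X a))

    without : List I → I → List I
    without X j = filterᵇ (λ k → not (k == j)) X

    term : I → List I → C → I → C → Choice → ℚ
    term i X c j d a = 𝟙 (a i ==ᶜ c) * (𝟙 (a j ==ᶜ d) * 𝟙 (ok (without X j) a))

    bad-mass : I → List I → Choice → ℚ
    bad-mass i X a = ∑ (opts i) (λ c → ∑ X (λ j → ∑ (filterᵇ (clash c) (opts j)) (λ d → term i X c j d a)))

    0≤term : ∀ i X c j d a → 0ℚ ≤ term i X c j d a
    0≤term i X c j d a = 0≤* (0≤𝟙 (a i ==ᶜ c)) (0≤* (0≤𝟙 (a j ==ᶜ d)) (0≤𝟙 (ok (without X j) a)))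

    private
      one : ∀ {Y : Set} {f : Y → ℚ} {y} ys → y ∈ ys → (∀ z → 0ℚ ≤ f z) → f y ≤ ∑ ys f
      one {f = f} (z ∷ ys) (here refl) h = by-gap (∑-≥0 ys λ w _ → h w) refl
      one {f = f} (z ∷ ys) (there y∈) h = ≤-trans (one ys y∈ h) (by-gap (h z) (ℚₚ.+-comm (f z) (∑ ys f)))

    cover : ∀ i X a → i ∈ its → ¬ i ∈ X → (∀ j → j ∈ X → j ∈ its) → Valid its a → 𝟙 (ok X a) ≤ 𝟙 (ok (i ∷ X) a) + bad-mass i X a
    cover i X a i∈ i∉ X⊆ v = go (bool-case (ok X a)) (bool-case (any (λ j → clash (a i) (a j)) X))
      where
      0≤bad : 0ℚ ≤ bad-mass i X a
      0≤bad = ∑-≥0 (opts i) λ c _ → ∑-≥0 X λ j _ → ∑-≥0 (filterᵇ (clash c) (opts j)) λ d _ → 0≤term i X c j d a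
      go : ok X a ≡ true ⊎ ok X a ≡ false → any (λ j → clash (a i) (a j)) X ≡ true ⊎ any (λ j → clash (a i) (a j)) X ≡ false → 𝟙 (ok X a) ≤ 𝟙 (ok (i ∷ X) a) + bad-mass i X a
      go (inj₂ e) _ = ≤-trans (≤-reflexive (cong 𝟙 e)) (0≤+ (0≤𝟙 (ok (i ∷ X) a)) 0≤bad)
      go (inj₁ e) (inj₂ n) = ≤-trans (𝟙≤1 (ok X a)) (by-gap 0≤bad (cong (λ b → 𝟙 b + bad-mass i X a) (ok⁺ {i ∷ X} {a} pairwise)))
        where
        pairwise : ∀ j k → j ∈ i ∷ X → k ∈ i ∷ X → j ≢ k → clash (a j) (a k) ≡ false
        pairwise j k (here refl) (here refl) n = ⊥-elim (n refl)
        pairwise j k (here refl) (there k∈) _ = any-false (λ j → clash (a i) (a j)) X n k∈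
        pairwise j k (there j∈) (here refl) _ = ¬true⇒false λ h → true≢false (clash-sym (a j) (a k) h) (any-false (λ j → clash (a i) (a j)) X n j∈)
        pairwise j k (there j∈) (there k∈) m = ok⁻ {X} {a} e j∈ k∈ m
      go (inj₁ e) (inj₁ y) = let j , j∈ , h = any⁻ (λ j → clash (a i) (a j)) X y in
        ≤-trans (𝟙≤1 (ok X a)) (≤-trans (≤-reflexive (sym (is-one j))) (≤-trans (one {f = λ d → term i X (a i) j d a} (filterᵇ (clash (a i)) (opts j)) (∈-filterᵇ⁺ (clash (a i)) (v j (X⊆ j j∈)) h) (λ d → 0≤term i X (a i) j d a))
          (≤-trans (one {f = λ j → ∑ (filterᵇ (clash (a i)) (opts j)) (λ d → term i X (a i) j d a)} X j∈ λ j → ∑-≥0 (filterᵇ (clash (a i)) (opts j)) λ d _ → 0≤term i X (a i) j d a)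
            (≤-trans (one {f = λ c → ∑ X (λ j → ∑ (filterᵇ (clash c) (opts j)) (λ d → term i X c j d a))} (opts i) (v i i∈) λ c → ∑-≥0 X λ j _ → ∑-≥0 (filterᵇ (clash c) (opts j)) λ d _ → 0≤term i X c j d a)
              (by-gap (0≤𝟙 (ok (i ∷ X) a)) (ℚₚ.+-comm (𝟙 (ok (i ∷ X) a)) (bad-mass i X a)))))))
        where
        is-one : ∀ j → term i X (a i) j (a j) a ≡ 1ℚ
        is-one j = cong₂ _*_ (cong 𝟙 (==ᶜ-refl (a i))) (trans (cong₂ _*_ (cong 𝟙 (==ᶜ-refl (a j))) (cong 𝟙 (ok⁺ {without X j} {a} λ k l k∈ l∈ → ok⁻ {X} {a} e (proj₁ (∈-filterᵇ⁻ _ X k∈)) (proj₁ (∈-filterᵇ⁻ _ X l∈))))) (ℚₚ.*-identityˡ 1ℚ))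

    W-off : ∀ {X i} → ¬ i ∈ X → Off i (λ a → 𝟙 (ok X a))
    W-off {X} {i} i∉ a b h = cong (λ x → 𝟙 (not x)) (any-cong X λ j j∈ → any-cong X λ k k∈ → cong (not (j == k) ∧_) (cong₂ clash (h j λ { refl → i∉ j∈ }) (h k λ { refl → i∉ k∈ })))

    step : ∀ n X → Unique X → length X ℕ.≤ n → (∀ j → j ∈ X → j ∈ its) → ∀ i → i ∈ its → W X ≤ ι 2 * W (i ∷ X)
    step n X u len X⊆ i i∈ with bool-case (i ∈ᵇ X)
    ... | inj₁ e = ≤-trans (W-antitone {i ∷ X} {X} λ { j (here refl) → ∈ᵇ⁻ X e ; j (there h) → h }) (≤-trans (≤-reflexive (sym (ℚₚ.*-identityˡ (W (i ∷ X))))) (*-monoˡ (0≤W (i ∷ X)) (1≤ι {2} (ℕ.s≤s ℕ.z≤n))))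
    ... | inj₂ e = by-gap (diff key) (trans (cong (_* W (i ∷ X)) 2≡) (l (W X) (W (i ∷ X))) |> λ q → trans q (cong (λ z → W X + ((1ℚ + 1ℚ) * W (i ∷ X) + z - (W X + z))) refl))
      where
      infixl 1 _|>_
      _|>_ : ∀ {A B : Set} → A → (A → B) → B
      x |> f = f x
      2≡ : ι 2 ≡ 1ℚ + 1ℚ
      2≡ = trans (ι-suc 1) (cong (1ℚ +_) ι1)
      i∉ : ¬ i ∈ X
      i∉ = ∉ᵇ X e
      l : ∀ a b → (1ℚ + 1ℚ) * b ≡ a + ((1ℚ + 1ℚ) * b + a - (a + a))
      l = solve-∀ ℚ-ring
      half : ∀ n X → Unique X → length X ℕ.≤ n → (∀ j → j ∈ X → j ∈ its) → ∀ j → j ∈ X → W (without X j) ≤ ι 2 * W X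
      half (suc n) X u len X⊆ j j∈ = ≤-trans (step n (without X j) (filterᵇ-unique _ u) (ℕₚ.≤-pred (ℕₚ.≤-trans (shorter X j∈) len)) (λ k k∈ → X⊆ k (proj₁ (∈-filterᵇ⁻ _ X k∈))) j (X⊆ j j∈))
          (*-monoʳ (0≤ι 2) (W-antitone {X} {j ∷ without X j} λ k k∈ → restore k k∈ (bool-case (k == j))))
        where
        restore : ∀ k → k ∈ X → (k == j) ≡ true ⊎ (k == j) ≡ false → k ∈ j ∷ without X j
        restore k k∈ (inj₁ e) = here (==-true e)
        restore k k∈ (inj₂ e) = there (∈-filterᵇ⁺ (λ k → not (k == j)) k∈ (not-true e))
        shorter : ∀ Y → j ∈ Y → length (without Y j) ℕ.< length Y
        shorter (y ∷ Y) (here refl) rewrite ==-refl y = ℕ.s≤s (#≤length (λ k → not (k == y)) Y)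
        shorter (y ∷ Y) (there h) with y == j
        ... | true = ℕₚ.m≤n⇒m≤1+n (shorter Y h)
        ... | false = ℕ.s≤s (shorter Y h)
      half zero (_ ∷ _) _ () _ _ _
      half zero [] _ _ _ _ ()
      mass : ∀ c → c ∈ opts i → ∀ j → j ∈ X → ∀ d → d ∈ opts j → A its (term i X c j d) ≤ p * (p * (ι 2 * W X))
      mass c c∈ j j∈ d d∈ = ≤-trans (≤-reflexive (trans (A-pick its its-unique (λ _ h → h) i∈ c∈ offᵢ) (cong (p *_) (A-pick its its-unique (λ _ h → h) (X⊆ j j∈) d∈ (W-off λ h → true≢false (==-refl j) (not-elim (proj₂ (∈-filterᵇ⁻ (λ k → not (k == j)) X h))))))))
           (*-monoʳ 0≤p (*-monoʳ 0≤p (half n X u len X⊆ j j∈)))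
        where
        offᵢ : Off i (λ a → 𝟙 (a j ==ᶜ d) * 𝟙 (ok (without X j) a))
        offᵢ a b h = cong₂ _*_ (cong (λ x → 𝟙 (x ==ᶜ d)) (h j λ { refl → i∉ j∈ })) (W-off {without X j} {i} (λ k → i∉ (proj₁ (∈-filterᵇ⁻ _ X k))) a b h)
      V : ℚ
      V = p * (p * (ι 2 * W X))
      0≤V : 0ℚ ≤ V
      0≤V = 0≤* 0≤p (0≤* 0≤p (0≤* (0≤ι 2) (0≤W X)))
      E-bad : A its (bad-mass i X) ≤ ι ℓ * (ι (2 ℕ.* t) * V)
      E-bad = ≤-trans (≤-reflexive (trans (A-∑ its (opts i) _) (∑-cong (opts i) λ c _ → trans (A-∑ its X _) (∑-cong X λ j _ → A-∑ its (filterᵇ (clash c) (opts j)) (λ d → term i X c j d)))))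
        (≤-trans (∑-mono (opts i) {g = λ _ → ι (2 ℕ.* t) * V} λ c c∈ → ≤-trans (∑-mono X {g = λ j → ι (# (clash c) (opts j)) * V} λ j j∈ → ≤-trans (∑-mono (filterᵇ (clash c) (opts j)) {g = λ _ → V} λ d d∈ → mass c c∈ j j∈ d (proj₁ (∈-filterᵇ⁻ (clash c) (opts j) d∈)))
             (≤-reflexive (∑-const V (filterᵇ (clash c) (opts j))))) (≤-trans (≤-reflexive (∑-*ʳ V X (λ j → ι (# (clash c) (opts j))))) (*-monoˡ 0≤V (≤-trans (within c) (few i c i∈ c∈)))))
          (≤-reflexive (trans (∑-const (ι (2 ℕ.* t) * V) (opts i)) (cong (λ n → ι n * (ι (2 ℕ.* t) * V)) (opts-size i i∈)))))
        where
        within : ∀ c → ∑ X (λ j → ι (# (clash c) (opts j))) ≤ ∑ its (λ j → ι (# (clash c) (opts j)))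
        within c = ∑-⊆ u X⊆ λ j → 0≤ι (# (clash c) (opts j))
      B : ℚ
      B = A its (bad-mass i X)
      2B≤W : B + B ≤ W X
      2B≤W = ≤-trans (+-mono E-bad E-bad) (≤-trans (≤-reflexive (trans (cong (λ z → ι ℓ * (z * V) + ι ℓ * (z * V)) (ι-* 2 t)) (trans (m (ι ℓ) (ι 2) (ι t) p (W X)) (trans (cong (λ z → z * (ι 2 * ι t * ι 2 * p + ι 2 * ι t * ι 2 * p) * W X) ℓp) (m₂ (ι 2) (ι t) p (W X))))))
          (≤-trans (*-monoˡ (0≤W X) (≤-trans (≤-reflexive eight) (≤-trans (*-monoˡ 0≤p (ι-mono 8t≤ℓ)) (≤-reflexive ℓp)))) (≤-reflexive (ℚₚ.*-identityˡ (W X)))))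
        where
        m : ∀ ℓ c t p w → ℓ * (c * t * (p * (p * (c * w)))) + ℓ * (c * t * (p * (p * (c * w)))) ≡ ℓ * p * (c * t * c * p + c * t * c * p) * w
        m = solve-∀ ℚ-ring
        m₂ : ∀ c t p w → 1ℚ * (c * t * c * p + c * t * c * p) * w ≡ (c * c * (1ℚ + 1ℚ)) * t * p * w
        m₂ = solve-∀ ℚ-ring
        eight : ι 2 * ι 2 * (1ℚ + 1ℚ) * ι t * p ≡ ι (8 ℕ.* t) * p
        eight = cong (_* p) (trans (cong (_* ι t) (trans (cong (ι 2 * ι 2 *_) (sym 2≡)) (trans (cong (_* ι 2) (sym (ι-* 2 2))) (sym (ι-* 4 2))))) (sym (ι-* 8 t)))
      key : W X + W X ≤ (1ℚ + 1ℚ) * W (i ∷ X) + W X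
      key = ≤-trans (+-mono cov cov) (≤-trans (≤-reflexive (m (W (i ∷ X)) B)) (+-mono (≤-refl {(1ℚ + 1ℚ) * W (i ∷ X)}) 2B≤W))
        where
        m : ∀ w b → w + b + (w + b) ≡ (1ℚ + 1ℚ) * w + (b + b)
        m = solve-∀ ℚ-ring
        cov : W X ≤ W (i ∷ X) + B
        cov = ≤-trans (A-mono its its-unique λ a v → cover i X a i∈ i∉ X⊆ v) (≤-reflexive (A-+ its (λ a → 𝟙 (ok (i ∷ X) a)) (bad-mass i X)))

    private
      0<1 : 0ℚ < 1ℚ
      0<1 = ℚₚ.positive⁻¹ 1ℚ

      positive : ∀ X → Unique X → (∀ j → j ∈ X → j ∈ its) → 0ℚ < W X
      positive [] _ _ = subst (0ℚ <_) (sym (trans (A-cong its λ _ → refl) (A-1 its λ _ h → h))) 0<1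
      positive (i ∷ X) u X⊆ with ≤-dec (W (i ∷ X)) 0ℚ
      ... | inj₂ h = h
      ... | inj₁ h = ⊥-elim (<⇒≱ (positive X (tail! u) λ j j∈ → X⊆ j (there j∈)) (≤-trans (step (length X) X (tail! u) ℕₚ.≤-refl (λ j j∈ → X⊆ j (there j∈)) i (X⊆ i (here refl))) (≤-trans (*-monoʳ (0≤ι 2) h) (≤-reflexive (ℚₚ.*-zeroʳ (ι 2))))))

      𝟙-pos : ∀ {b} → 0ℚ < 𝟙 b → b ≡ true
      𝟙-pos {true} _ = refl
      𝟙-pos {false} h = ⊥-elim (<-irrefl h)

    transversal : ∃ λ a → (∀ i → i ∈ its → a i ∈ opts i) × (∀ i j → i ∈ its → j ∈ its → i ≢ j → clash (a i) (a j) ≡ false)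
    transversal = let a , v , h = A-witness its its-unique (positive its its-unique λ _ h → h) in a , v , λ i j i∈ j∈ n → ok⁻ {its} {a} (𝟙-pos h) i∈ j∈ n

module Nibbling {I R : Set} (_≟I_ : DecidableEquality I) (_≟R_ : DecidableEquality R) where

  open Hypergraph _≟I_ _≟R_

  M-bounds : ∀ ℓ t → 1 ℕ.≤ t → t ℕ.≤ ℓ → ((ℓ ℕ.∸ 1) ℕ.+ ((t ℕ.∸ 1) ℕ.+ (t ℕ.∸ 1)) ℕ.≤ 3 ℕ.* ℓ) × (ℓ ℕ.∸ 1 ℕ.≤ (ℓ ℕ.∸ 1) ℕ.+ ((t ℕ.∸ 1) ℕ.+ (t ℕ.∸ 1)))
  M-bounds ℓ t _ t≤ℓ = ℕₚ.≤-trans (ℕₚ.+-mono-≤ (ℕₚ.m∸n≤m ℓ 1) (ℕₚ.+-mono-≤ (ℕₚ.≤-trans (ℕₚ.m∸n≤m t 1) t≤ℓ) (ℕₚ.≤-trans (ℕₚ.m∸n≤m t 1) t≤ℓ))) (ℕₚ.≤-reflexive (cong (λ z → ℓ ℕ.+ (ℓ ℕ.+ z)) (sym (ℕₚ.+-identityʳ ℓ))))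
    , ℕₚ.m≤m+n (ℓ ℕ.∸ 1) _

  Ph : Set
  Ph = R × ℕ

  Var : Set
  Var = Opt ⊎ (Ph ⊎ (Ph × ℕ))

  pattern real o = inj₁ o
  pattern ph a = inj₂ (inj₁ a)
  pattern coin c = inj₂ (inj₂ c)

  _≟H_ : DecidableEquality Ph
  _≟H_ = Prodₚ.≡-dec _≟R_ ℕ._≟_

  _≟_ : DecidableEquality Var
  _≟_ = Sumₚ.≡-dec _≟O_ (Sumₚ.≡-dec _≟H_ (Prodₚ.≡-dec _≟H_ ℕ._≟_))

  module _ (p : ℚ) (0≤p : 0ℚ ≤ p) (p≤1 : p ≤ 1ℚ) where

    open Random _≟_ p 0≤p p≤1 hiding (∏; ∏-cong)

    -- The regularised system: every item has exactly ℓ options and every resource exactly t, the missing ones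
    -- being phantoms; the coins attached to a phantom bring its number of conflicts up to the common value M.
    module Regular (os : List Opt) (lin : Linear os) (ℓ t : ℕ) (1≤t : 1 ℕ.≤ t) (t≤ℓ : t ℕ.≤ ℓ)
      (rs : List R) (rs-unique : Unique rs) (rs-all : ∀ {o r} → o ∈ os → inj₂ r ∈ pts o → r ∈ rs)
      (item-deg : ∀ {o i} → o ∈ os → inj₁ i ∈ pts o → # (on (inj₁ i)) os ≡ ℓ)
      (res-deg : ∀ r → # (on (inj₂ r)) os ℕ.≤ t) where

      open Linear lin
      open Eq _≟P_ using () renaming (==-refl to ==ᴾ-refl; ==-true to ==ᴾ-true; ==-sym to ==ᴾ-sym; ==-false to ==ᴾ-false; _==_ to _==ᴾ_)

      open Eq _≟_
      open Eq _≟H_ using () renaming (_==_ to _==ᴴ_; ==-refl to ==ᴴ-refl; ==-true to ==ᴴ-true; ==-sym to ==ᴴ-sym)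

      M : ℕ
      M = (ℓ ℕ.∸ 1) ℕ.+ ((t ℕ.∸ 1) ℕ.+ (t ℕ.∸ 1))

      deg : Point → ℕ
      deg x = # (on x) os

      phs : List Ph
      phs = concatMap (λ r → map (r ,_) (upTo (t ℕ.∸ deg (inj₂ r)))) rs

      coins-of : Ph → List (Ph × ℕ)
      coins-of a = map (a ,_) (upTo (M ℕ.∸ (t ℕ.∸ 1)))

      vars : List Var
      vars = map real os ++ (map ph phs ++ map coin (concatMap coins-of phs))

      phs-unique : Unique phs
      phs-unique = concatMap-unique _ proj₁ rs-unique (λ r _ → Uniqueₚ.map⁺ (cong proj₂) (Uniqueₚ.upTo⁺ _)) λ r y _ y∈ → let _ , _ , e = ∈-map⁻ (r ,_) y∈ in cong proj₁ e

      vars-unique : Unique vars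
      vars-unique = Uniqueₚ.++⁺ (Uniqueₚ.map⁺ Sumₚ.inj₁-injective unique)
        (Uniqueₚ.++⁺ (Uniqueₚ.map⁺ (λ { refl → refl }) phs-unique)
           (Uniqueₚ.map⁺ (λ { refl → refl }) (concatMap-unique coins-of proj₁ phs-unique (λ a _ → Uniqueₚ.map⁺ (cong proj₂) (Uniqueₚ.upTo⁺ _)) λ a y _ y∈ → let _ , _ , e = ∈-map⁻ (a ,_) y∈ in cong proj₁ e))
           (λ { (x , y) → let _ , _ , e = ∈-map⁻ ph x ; _ , _ , e′ = ∈-map⁻ coin y in ph≢coin (trans (sym e) e′) }))
        (λ { (x , y) → let _ , _ , e = ∈-map⁻ real x in [ (λ h → let _ , _ , e′ = ∈-map⁻ ph h in r≢p (trans (sym e) e′)) , (λ h → let _ , _ , e′ = ∈-map⁻ coin h in r≢c (trans (sym e) e′)) ]′ (∈-++⁻ (map ph phs) y) })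
        where
        ph≢coin : ∀ {a c} → _≡_ {A = Var} (ph a) (coin c) → ⊥
        ph≢coin ()
        r≢p : ∀ {a c} → _≡_ {A = Var} (real a) (ph c) → ⊥
        r≢p ()
        r≢c : ∀ {a c} → _≡_ {A = Var} (real a) (coin c) → ⊥
        r≢c ()

      real⁺ : ∀ {o} → o ∈ os → real o ∈ vars
      real⁺ o∈ = ∈-++⁺ˡ (∈-map⁺ real o∈)

      real⁻ : ∀ {o} → real o ∈ vars → o ∈ os
      real⁻ = three₁⁻ os phs (concatMap coins-of phs)

      ph⁻ : ∀ {a} → ph a ∈ vars → a ∈ phs
      ph⁻ = three₂⁻ os phs (concatMap coins-of phs)

      ends : Var → List Point
      ends (real o) = pts o
      ends (ph (r , _)) = inj₂ r ∷ []
      ends (coin _) = []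

      inc : Point → Var → Bool
      inc x v = x ∈ᴾ ends v

      linked : Var → Var → Bool
      linked (ph a) (coin (b , _)) = a ==ᴴ b
      linked (coin (b , _)) (ph a) = a ==ᴴ b
      linked _ _ = false

      shares : Var → Var → Bool
      shares v w = any (λ x → inc x w) (ends v)

      adj : Var → Var → Bool
      adj v w = not (v == w) ∧ (shares v w ∨ linked v w)

      shares-sym : ∀ v w → shares v w ≡ shares w v
      shares-sym v w = bool-ext (flip v w) (flip w v)
        where
        flip : ∀ v w → shares v w ≡ true → shares w v ≡ true
        flip v w e = let x , x∈ , h = any⁻ (λ x → inc x w) (ends v) e in any⁺ (λ x → inc x v) (∈ᴾ⁻ (ends w) h) (∈ᴾ⁺ x∈)

      linked-sym : ∀ v w → linked v w ≡ linked w v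
      linked-sym (real _) (real _) = refl
      linked-sym (real _) (ph _) = refl
      linked-sym (real _) (coin _) = refl
      linked-sym (ph _) (real _) = refl
      linked-sym (ph _) (ph _) = refl
      linked-sym (ph a) (coin _) = refl
      linked-sym (coin _) (real _) = refl
      linked-sym (coin _) (ph _) = refl
      linked-sym (coin _) (coin _) = refl

      adj-sym : ∀ v w → adj v w ≡ adj w v
      adj-sym v w = cong₂ _∧_ (cong not (==-sym v w)) (cong₂ _∨_ (shares-sym v w) (linked-sym v w))

      adj-irr : ∀ v → adj v v ≡ false
      adj-irr v rewrite ==-refl v = refl

      good : Var → Bool
      good (coin _) = false
      good _ = true

      inc-good : ∀ x v → inc x v ≡ true → good v ≡ true
      inc-good x (real _) _ = refl
      inc-good x (ph _) _ = refl

      linked-bad : ∀ z v w → good v ≡ true → good w ≡ true → linked z v ≡ true → linked z w ≡ true → v ≡ w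
      linked-bad (real _) _ _ _ _ () _
      linked-bad (ph _) (real _) _ _ _ () _
      linked-bad (ph _) (ph _) _ _ _ () _
      linked-bad (coin _) (real _) _ _ _ () _
      linked-bad (coin _) (ph _) (real _) _ _ _ ()
      linked-bad (coin _) (ph a) (ph b) _ _ h k = cong ph (trans (==ᴴ-true h) (sym (==ᴴ-true k)))

      linear-var : ∀ {v w x y} → v ∈ vars → w ∈ vars → x ≢ y → inc x v ≡ true → inc y v ≡ true → inc x w ≡ true → inc y w ≡ true → v ≡ w
      linear-var {real o} {real o′} v∈ w∈ n a b c d = cong real (linear (real⁻ v∈) (real⁻ w∈) n (∈ᴾ⁻ (pts o) a) (∈ᴾ⁻ (pts o) b) (∈ᴾ⁻ (pts o′) c) (∈ᴾ⁻ (pts o′) d))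
      linear-var {ph (r , j)} v∈ w∈ n a b c d with ∈ᴾ⁻ (inj₂ r ∷ []) a | ∈ᴾ⁻ (inj₂ r ∷ []) b
      ... | here refl | here refl = ⊥-elim (n refl)
      linear-var {real o} {ph (r , j)} v∈ w∈ n a b c d with ∈ᴾ⁻ (inj₂ r ∷ []) c | ∈ᴾ⁻ (inj₂ r ∷ []) d
      ... | here refl | here refl = ⊥-elim (n refl)

      clique : ∀ {x v w} → inc x v ≡ true → inc x w ≡ true → v ≡ w ⊎ adj v w ≡ true
      clique {x} {v} {w} a b with bool-case (v == w)
      ... | inj₁ e = inj₁ (==-true e)
      ... | inj₂ e = inj₂ (∧-intro (not-true e) (∨-left (any⁺ (λ x → inc x w) (∈ᴾ⁻ (ends v) a) b)))

      position : List Point → Var → ℕ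
      position [] w = 0
      position (x ∷ xs) w = if inc x w then 0 else suc (position xs w)

      side : Var → Var → ℕ
      side v w = if shares v w then position (ends v) w else 0

      position<  : ∀ xs w → any (λ x → inc x w) xs ≡ true → position xs w ℕ.< length xs
      position< (x ∷ xs) w e with inc x w
      ... | true = ℕ.s≤s ℕ.z≤n
      ... | false = ℕ.s≤s (position< xs w e)

      position-same : ∀ xs v w → any (λ x → inc x v) xs ≡ true → any (λ x → inc x w) xs ≡ true → position xs v ≡ position xs w →
                      ∃ λ x → x ∈ xs × inc x v ≡ true × inc x w ≡ true
      position-same (x ∷ xs) v w a b e with inc x v in ev | inc x w in ew
      ... | true | true = x , here refl , ev , ew
      ... | true | false = ⊥-elim (case e)
        where
        case : ∀ {n} → 0 ≡ suc n → ⊥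
        case ()
      ... | false | true = ⊥-elim (case e)
        where
        case : ∀ {n} → suc n ≡ 0 → ⊥
        case ()
      ... | false | false = let y , y∈ , h , k = position-same xs v w a b (ℕₚ.suc-injective e) in y , there y∈ , h , k

      ends≤3 : ∀ v → length (ends v) ℕ.≤ 3
      ends≤3 (real _) = ℕₚ.≤-refl
      ends≤3 (ph _) = ℕ.s≤s ℕ.z≤n
      ends≤3 (coin _) = ℕ.z≤n

      side<3 : ∀ z o → good o ≡ true → adj z o ≡ true → side z o ℕ.< 3
      side<3 z o _ a with bool-case (shares z o)
      ... | inj₁ e rewrite e = ℕₚ.<-≤-trans (position< (ends z) o e) (ends≤3 z)
      ... | inj₂ e rewrite e = ℕ.s≤s ℕ.z≤n

      same-side : ∀ z v w → good v ≡ true → good w ≡ true → adj z v ≡ true → adj z w ≡ true → side z v ≡ side z w →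
                  v ≡ w ⊎ ∃ λ x → x ∈ ends z × inc x v ≡ true × inc x w ≡ true
      same-side z v w gv gw a b e = go (bool-case (shares z v)) (bool-case (shares z w)) (∧-right {not (z == v)} a) (∧-right {not (z == w)} b)
        where
        unlinked : ∀ z v → good v ≡ true → shares z v ≡ true → ∀ w → good w ≡ true → linked z w ≡ true → ⊥
        unlinked (coin _) v gv () w gw l
        unlinked (ph _) v gv s (coin _) () l
        go : shares z v ≡ true ⊎ shares z v ≡ false → shares z w ≡ true ⊎ shares z w ≡ false →
             shares z v ∨ linked z v ≡ true → shares z w ∨ linked z w ≡ true → v ≡ w ⊎ ∃ λ x → x ∈ ends z × inc x v ≡ true × inc x w ≡ true
        go (inj₁ s) (inj₁ s′) _ _ = inj₂ (position-same (ends z) v w s s′ (trans (sym (eq s)) (trans e (eq s′))))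
          where
          eq : ∀ {v} → shares z v ≡ true → side z v ≡ position (ends z) v
          eq s rewrite s = refl
        go (inj₁ s) (inj₂ s′) _ k rewrite s′ = ⊥-elim (unlinked z v gv s w gw k)
        go (inj₂ s) (inj₁ s′) h _ rewrite s = ⊥-elim (unlinked z w gw s′ v gv h)
        go (inj₂ s) (inj₂ s′) h k rewrite s | s′ = inj₁ (linked-bad z v w gv gw h k)

      claw : ∀ z o o′ → good o ≡ true → good o′ ≡ true → adj z o ≡ true → adj z o′ ≡ true → side z o ≡ side z o′ → o ≡ o′ ⊎ adj o o′ ≡ true
      claw z v w gv gw a b e with same-side z v w gv gw a b e
      ... | inj₁ h = inj₁ h
      ... | inj₂ (x , _ , h , k) = clique {x} h k

      private
        #vars : ∀ (f : Var → Bool) → # f vars ≡ # (λ o → f (real o)) os ℕ.+ (# (λ a → f (ph a)) phs ℕ.+ # (λ c → f (coin c)) (concatMap coins-of phs))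
        #vars f = trans (#-++ f (map real os) _) (cong₂ ℕ._+_ (#-map f real os) (trans (#-++ f (map ph phs) _) (cong₂ ℕ._+_ (#-map f ph phs) (#-map f coin (concatMap coins-of phs)))))

      #-item : ∀ i → # (inc (inj₁ i)) vars ≡ deg (inj₁ i)
      #-item i = trans (#vars (inc (inj₁ i))) (trans (cong (deg (inj₁ i) ℕ.+_) (cong₂ ℕ._+_ (#0 (λ a → inc (inj₁ i) (ph a)) phs λ _ _ → refl) (#0 (λ c → inc (inj₁ i) (coin c)) (concatMap coins-of phs) λ _ _ → refl))) (ℕₚ.+-identityʳ _))

      #-res : ∀ r → r ∈ rs → # (inc (inj₂ r)) vars ≡ t
      #-res r r∈ = trans (#vars (inc (inj₂ r))) (trans (cong (deg (inj₂ r) ℕ.+_) (trans (cong₂ ℕ._+_ phantoms (#0 (λ c → inc (inj₂ r) (coin c)) (concatMap coins-of phs) λ _ _ → refl)) (ℕₚ.+-identityʳ _))) (ℕₚ.m+[n∸m]≡n (res-deg r)))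
        where
        phantoms : # (λ a → inc (inj₂ r) (ph a)) phs ≡ t ℕ.∸ deg (inj₂ r)
        phantoms = trans (#-inside (λ r → map (r ,_) (upTo (t ℕ.∸ deg (inj₂ r)))) proj₁ (λ a → inc (inj₂ r) (ph a)) rs-unique r∈
           (λ r y _ y∈ → let _ , _ , e = ∈-map⁻ (r ,_) y∈ in cong proj₁ e)
           (λ y e → at y (∈ᴾ⁻ (inj₂ (proj₁ y) ∷ []) e))
           (λ y y∈ → let _ , _ , e = ∈-map⁻ (r ,_) y∈ in ∈ᴾ⁺ {inj₂ r} {inj₂ (proj₁ y) ∷ []} (here (cong (λ a → inj₂ (proj₁ a)) (sym e)))))
           (trans (length-map (r ,_) (upTo (t ℕ.∸ deg (inj₂ r)))) (length-upTo (t ℕ.∸ deg (inj₂ r))))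
          where
          at : ∀ y → inj₂ r ∈ (inj₂ (proj₁ y) ∷ []) → proj₁ y ≡ r
          at y (here refl) = refl

      count : Point → ℕ
      count (inj₁ _) = ℓ
      count (inj₂ _) = t

      #-point : ∀ {v x} → v ∈ vars → x ∈ ends v → # (inc x) vars ≡ count x
      #-point {real o} {inj₁ i} v∈ x∈ = trans (#-item i) (item-deg (real⁻ v∈) x∈)
      #-point {real o} {inj₂ r} v∈ x∈ = #-res r (rs-all (real⁻ v∈) x∈)
      #-point {ph (r , j)} v∈ (here refl) = #-res r (let r′ , r∈ , e = ∈-concatMap⁻ _ rs (ph⁻ v∈) ; _ , _ , e′ = ∈-map⁻ (r′ ,_) e in subst (_∈ rs) (sym (cong proj₁ e′)) r∈)

      pts-unique : ∀ {o} → o ∈ os → Unique (pts o)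
      pts-unique o∈ = ((λ ()) ∷ (λ ()) ∷ []) ∷ ((λ { refl → distinct o∈ refl }) ∷ []) ∷ [] ∷ []

      ends-unique : ∀ {v} → v ∈ vars → Unique (ends v)
      ends-unique {real o} v∈ = pts-unique (real⁻ v∈)
      ends-unique {ph _} v∈ = [] ∷ []
      ends-unique {coin _} v∈ = []

      #-shares : ∀ {v} → v ∈ vars → ι (# (λ w → not (v == w) ∧ shares v w) vars) ≡ ∑ (ends v) (λ x → ι (count x ℕ.∸ 1))
      #-shares {v} v∈ = trans (ι# _ vars) (trans (∑-cong vars λ w w∈ → trans (𝟙-∧ (not (v == w)) (shares v w)) (split w w∈ (bool-case (v == w))))
         (trans (∑-swap vars (ends v) (λ w x → 𝟙 (not (v == w)) * 𝟙 (inc x w))) (∑-cong (ends v) λ x x∈ → per x x∈)))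
        where
        any-sum : ∀ xs w → Unique xs → (∀ x y → x ∈ xs → y ∈ xs → inc x w ≡ true → inc y w ≡ true → x ≡ y) → 𝟙 (any (λ x → inc x w) xs) ≡ ∑ xs (λ x → 𝟙 (inc x w))
        any-sum [] w _ _ = refl
        any-sum (x ∷ xs) w (x∉ ∷ u) h with inc x w in e
        ... | false = trans (any-sum xs w u λ a b a∈ b∈ → h a b (there a∈) (there b∈)) (sym (ℚₚ.+-identityˡ _))
        ... | true = sym (trans (cong (1ℚ +_) (trans (∑-cong xs λ y y∈ → cong 𝟙 (¬true⇒false λ k → All.lookup x∉ y∈ (h x y (here refl) (there y∈) e k))) (∑-0 xs))) (ℚₚ.+-identityʳ 1ℚ))
        split : ∀ w → w ∈ vars → (v == w) ≡ true ⊎ (v == w) ≡ false → 𝟙 (not (v == w)) * 𝟙 (shares v w) ≡ ∑ (ends v) (λ x → 𝟙 (not (v == w)) * 𝟙 (inc x w))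
        split w w∈ (inj₁ e) rewrite e = trans (ℚₚ.*-zeroˡ (𝟙 (shares v w))) (sym (trans (∑-cong (ends v) λ x _ → ℚₚ.*-zeroˡ (𝟙 (inc x w))) (∑-0 (ends v))))
        split w w∈ (inj₂ e) = trans (cong (𝟙 (not (v == w)) *_) (any-sum (ends v) w (ends-unique v∈) λ x y x∈ y∈ h k → one x y x∈ y∈ h k (x ≟P y))) (sym (∑-* (𝟙 (not (v == w))) (ends v) (λ x → 𝟙 (inc x w))))
          where
          one : ∀ x y → x ∈ ends v → y ∈ ends v → inc x w ≡ true → inc y w ≡ true → Dec (x ≡ y) → x ≡ y
          one x y x∈ y∈ h k (yes q) = q
          one x y x∈ y∈ h k (no n) = ⊥-elim (true≢false (subst (λ z → (v == z) ≡ true) (linear-var v∈ w∈ n (∈ᴾ⁺ x∈) (∈ᴾ⁺ y∈) h k) (==-refl v)) e)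
        per : ∀ x → x ∈ ends v → ∑ vars (λ w → 𝟙 (not (v == w)) * 𝟙 (inc x w)) ≡ ι (count x ℕ.∸ 1)
        per x x∈ = trans (∑-cong vars λ w _ → trans (cong (_* 𝟙 (inc x w)) (trans (𝟙-not (v == w)) (cong (λ b → 1ℚ - 𝟙 b) (==-sym v w)))) (l (𝟙 (w == v)) (𝟙 (inc x w))))
            (trans (∑-- vars (λ w → 𝟙 (inc x w)) (λ w → 𝟙 (w == v) * 𝟙 (inc x w))) (trans (cong₂ _-_ (trans (sym (ι# (inc x) vars)) (cong ι (#-point v∈ x∈))) (trans (∑-single vars-unique v∈ (λ w → 𝟙 (inc x w))) (cong 𝟙 (∈ᴾ⁺ x∈))))
              (trans (cong (λ z → ι (count x) - z) (sym ι1)) (sym (ι-∸ (1≤count x))))))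
          where
          l : ∀ a b → (1ℚ - a) * b ≡ b - a * b
          l = solve-∀ ℚ-ring
          1≤count : ∀ x → 1 ℕ.≤ count x
          1≤count (inj₁ _) = ℕₚ.≤-trans 1≤t t≤ℓ
          1≤count (inj₂ _) = 1≤t

      ι-inj : ∀ {m n} → ι m ≡ ι n → m ≡ n
      ι-inj e = ℕₚ.≤-antisym (ι-cancel (≤-reflexive e)) (ι-cancel (≤-reflexive (sym e)))

      deg-good : ∀ v → v ∈ vars → good v ≡ true → # (adj v) vars ≡ M
      deg-good (real o) v∈ _ = trans (#-cong vars λ w _ → cong (not (real o == w) ∧_) (∨-false (shares (real o) w) (nl w))) (ι-inj (trans (#-shares v∈)
          (trans (l (ι (ℓ ℕ.∸ 1)) (ι (t ℕ.∸ 1))) (trans (cong (ι (ℓ ℕ.∸ 1) +_) (sym (ι-+ (t ℕ.∸ 1) (t ℕ.∸ 1)))) (sym (ι-+ (ℓ ℕ.∸ 1) _))))))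
        where
        ∨-false : ∀ a {b} → b ≡ false → a ∨ b ≡ a
        ∨-false true _ = refl
        ∨-false false h = h
        nl : ∀ w → linked (real o) w ≡ false
        nl (real _) = refl
        nl (ph _) = refl
        nl (coin _) = refl
        l : ∀ a b → a + (b + (b + 0ℚ)) ≡ a + (b + b)
        l = solve-∀ ℚ-ring
      deg-good (ph a) v∈ _ = trans (ι-inj total) (ℕₚ.m+[n∸m]≡n {t ℕ.∸ 1} {M} (ℕₚ.≤-trans (ℕₚ.m≤m+n (t ℕ.∸ 1) (t ℕ.∸ 1)) (ℕₚ.m≤n+m _ (ℓ ℕ.∸ 1))))
        where
        coins : # (linked (ph a)) vars ≡ M ℕ.∸ (t ℕ.∸ 1)
        coins = trans (#vars (linked (ph a))) (trans (cong₂ ℕ._+_ (#0 (λ o → linked (ph a) (real o)) os λ _ _ → refl) (cong₂ ℕ._+_ (#0 (λ b → linked (ph a) (ph b)) phs λ _ _ → refl)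
            (#-inside coins-of proj₁ (λ c → linked (ph a) (coin c)) phs-unique (ph⁻ v∈) (λ b y _ y∈ → let _ , _ , e = ∈-map⁻ (b ,_) y∈ in cong proj₁ e) (λ y e → sym (==ᴴ-true e))
              (λ y y∈ → let _ , _ , e = ∈-map⁻ (a ,_) y∈ in trans (cong (a ==ᴴ_) (cong proj₁ e)) (==ᴴ-refl a))))) (trans (length-map (a ,_) (upTo (M ℕ.∸ (t ℕ.∸ 1)))) (length-upTo (M ℕ.∸ (t ℕ.∸ 1)))))
        disjoint : ∀ w → 𝟙 (adj (ph a) w) ≡ 𝟙 (not (ph a == w) ∧ shares (ph a) w) + 𝟙 (linked (ph a) w)
        disjoint (real o) = go (not (ph a == real o)) (shares (ph a) (real o))
          where
          go : ∀ b c → 𝟙 (b ∧ (c ∨ false)) ≡ 𝟙 (b ∧ c) + 0ℚ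
          go true true = refl
          go true false = refl
          go false c = refl
        disjoint (ph b) = go (not (ph a == ph b)) (shares (ph a) (ph b))
          where
          go : ∀ b c → 𝟙 (b ∧ (c ∨ false)) ≡ 𝟙 (b ∧ c) + 0ℚ
          go true true = refl
          go true false = refl
          go false c = refl
        disjoint (coin c) = sym (trans (cong (λ b → 𝟙 (not (ph a == coin c) ∧ b) + 𝟙 (a ==ᴴ proj₁ c)) {x = shares (ph a) (coin c)} refl) (ℚₚ.+-identityˡ (𝟙 (a ==ᴴ proj₁ c))))
        total : ι (# (adj (ph a)) vars) ≡ ι ((t ℕ.∸ 1) ℕ.+ (M ℕ.∸ (t ℕ.∸ 1)))
        total = trans (ι# (adj (ph a)) vars) (trans (∑-cong vars λ w _ → disjoint w) (trans (∑-+ vars _ _) (trans (cong₂ _+_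
            (trans (sym (ι# _ vars)) (trans (#-shares v∈) (ℚₚ.+-identityʳ (ι (t ℕ.∸ 1))))) (trans (sym (ι# (linked (ph a)) vars)) (cong ι coins))) (sym (ι-+ (t ℕ.∸ 1) _)))))

      open Conflict vars vars-unique adj adj-sym adj-irr good M deg-good side side<3 claw using (Ret; Ret-sel; Ret-free; Ret-indep; κ; 0≤κ; E-Ret; module Pair; Observable; concentrated; value-local)

      common≤9 : ∀ v w → v ∈ vars → w ∈ vars → good v ≡ true → good w ≡ true → v ≢ w → adj v w ≡ false → # (λ z → adj v z ∧ adj w z) vars ℕ.≤ 9
      common≤9 v w v∈ w∈ gv gw v≢w na = inj-length (λ z → side v z , side w z) {ys = concatMap (λ a → map (a ,_) (0 ∷ 1 ∷ 2 ∷ [])) (0 ∷ 1 ∷ 2 ∷ [])} (filterᵇ-unique _ vars-unique) inj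
          (λ z z∈ → let z∈v , h = spec z∈ in ∈-concatMap (λ a → map (a ,_) (0 ∷ 1 ∷ 2 ∷ [])) (three (side<3 v z (gz z z∈v h) (∧-left h))) (∈-map⁺ (side v z ,_) (three (side<3 w z (gz z z∈v h) (∧-right {adj v z} h)))))
        where
        spec : ∀ {z} → z ∈ filterᵇ (λ z → adj v z ∧ adj w z) vars → z ∈ vars × adj v z ∧ adj w z ≡ true
        spec z∈ = ∈-filterᵇ⁻ (λ z → adj v z ∧ adj w z) vars z∈
        three : ∀ {n} → n ℕ.< 3 → n ∈ 0 ∷ 1 ∷ 2 ∷ []
        three {0} _ = here refl
        three {1} _ = there (here refl)
        three {2} _ = there (there (here refl))
        three {suc (suc (suc _))} (ℕ.s≤s (ℕ.s≤s (ℕ.s≤s ())))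
        gz : ∀ z → z ∈ vars → adj v z ∧ adj w z ≡ true → good z ≡ true
        gz (real _) _ _ = refl
        gz (ph _) _ _ = refl
        gz (coin c) z∈ h = ⊥-elim (v≢w (linked-bad (coin c) v w gv gw (lk v (∧-left {adj v (coin c)} h)) (lk w (∧-right {adj v (coin c)} h))))
          where
          lk : ∀ v → adj v (coin c) ≡ true → linked (coin c) v ≡ true
          lk (ph a) h = ∧-right {not (ph a == coin c)} h
          lk (real o) h = ⊥-elim (true≢false (∧-right {not (real o == coin c)} h) refl)
          lk (coin o) h = ⊥-elim (true≢false (∧-right {not (coin o == coin c)} h) refl)
        inj : ∀ y z → y ∈ filterᵇ (λ z → adj v z ∧ adj w z) vars → z ∈ filterᵇ (λ z → adj v z ∧ adj w z) vars → (side v y , side w y) ≡ (side v z , side w z) → y ≡ z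
        inj y z y∈ z∈ e = go (same-side v y z (gz y y∈v hy) (gz z z∈v hz) (∧-left hy) (∧-left hz) (cong proj₁ e))
                             (same-side w y z (gz y y∈v hy) (gz z z∈v hz) (∧-right {adj v y} hy) (∧-right {adj v z} hz) (cong proj₂ e))
          where
          y∈v = proj₁ (spec y∈)
          hy = proj₂ (spec y∈)
          z∈v = proj₁ (spec z∈)
          hz = proj₂ (spec z∈)
          go : (y ≡ z ⊎ ∃ λ x → x ∈ ends v × inc x y ≡ true × inc x z ≡ true) → (y ≡ z ⊎ ∃ λ x → x ∈ ends w × inc x y ≡ true × inc x z ≡ true) → y ≡ z
          go (inj₁ q) _ = q
          go (inj₂ _) (inj₁ q) = q
          go (inj₂ (x , x∈ , a , b)) (inj₂ (x′ , x′∈ , a′ , b′)) = linear-var y∈v z∈v (λ { refl → [ v≢w , (λ k → true≢false k na) ]′ (clique {x} (∈ᴾ⁺ x∈) (∈ᴾ⁺ x′∈)) }) a a′ b b′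

      Inc : Point → List Var
      Inc x = filterᵇ (inc x) vars

      Inc-spec : ∀ {x v} → v ∈ Inc x → v ∈ vars × inc x v ≡ true
      Inc-spec {x} = ∈-filterᵇ⁻ (inc x) vars

      Reals : Point → List Var
      Reals x = map real (filterᵇ (on x) os)

      record Clique (A : List Var) : Set where
        field
          unique′ : Unique A
          sub     : ∀ {v} → v ∈ A → v ∈ vars
          good′   : ∀ {v} → v ∈ A → good v ≡ true
          conn    : ∀ {v w} → v ∈ A → w ∈ A → v ≡ w ⊎ adj v w ≡ true
      open Clique

      Inc-clique : ∀ x → Clique (Inc x)
      Inc-clique x = record { unique′ = filterᵇ-unique _ vars-unique ; sub = λ h → proj₁ (Inc-spec {x} h) ; good′ = λ {v} h → inc-good x v (proj₂ (Inc-spec {x} h))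
        ; conn = λ h k → clique {x} (proj₂ (Inc-spec {x} h)) (proj₂ (Inc-spec {x} k)) }

      Reals-spec : ∀ {x v} → v ∈ Reals x → ∃ λ o → o ∈ os × on x o ≡ true × v ≡ real o
      Reals-spec {x} h = let o , o∈ , e = ∈-map⁻ real h ; a , b = ∈-filterᵇ⁻ (on x) os o∈ in o , a , b , e

      Reals-clique : ∀ x → Clique (Reals x)
      Reals-clique x = record { unique′ = Uniqueₚ.map⁺ Sumₚ.inj₁-injective (filterᵇ-unique _ unique)
        ; sub = λ h → let _ , o∈ , _ , e = Reals-spec {x} h in subst (_∈ vars) (sym e) (real⁺ o∈)
        ; good′ = λ h → let _ , _ , _ , e = Reals-spec {x} h in subst (λ v → good v ≡ true) (sym e) refl
        ; conn = λ {v} {w} h k → let _ , _ , a , e = Reals-spec {x} h ; _ , _ , b , e′ = Reals-spec {x} k in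
            clique {x} {v} {w} (subst (λ v → inc x v ≡ true) (sym e) a) (subst (λ v → inc x v ≡ true) (sym e′) b) }

      cov-sum : ∀ {A} → Clique A → ∀ ω → 𝟙 (any (Ret ω) A) ≡ ∑ A (λ v → 𝟙 (Ret ω v))
      cov-sum {A} C ω = go A (unique′ C) (λ h → h)
        where
        go : ∀ B → Unique B → (∀ {v} → v ∈ B → v ∈ A) → 𝟙 (any (Ret ω) B) ≡ ∑ B (λ v → 𝟙 (Ret ω v))
        go [] _ _ = refl
        go (v ∷ B) (v∉ ∷ u) s with Ret ω v in e
        ... | false = trans (go B u λ h → s (there h)) (sym (ℚₚ.+-identityˡ _))
        ... | true = sym (trans (cong (1ℚ +_) (trans (∑-cong B λ w w∈ → cong 𝟙 (¬true⇒false λ k → [ (λ q → All.lookup v∉ w∈ q) , (λ a → true≢false a (Ret-indep {ω} (sub C (s (there w∈))) e k)) ]′ (conn C (s (here refl)) (s (there w∈))))) (∑-0 B))) (ℚₚ.+-identityʳ 1ℚ))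

      E-cov : ∀ {A} → Clique A → E vars (λ ω → 𝟙 (any (Ret ω) A)) ≡ ι (length A) * (p * κ)
      E-cov {A} C = trans (E-cong vars λ ω _ → cov-sum C ω) (trans (E-∑ vars A (λ v ω → 𝟙 (Ret ω v))) (trans (∑-cong A λ v v∈ → E-Ret v (sub C v∈) (good′ C v∈)) (∑-const (p * κ) A)))

      module Two {A B : List Var} (CA : Clique A) (CB : Clique B) where

        E₂ : ℚ
        E₂ = E vars (λ ω → 𝟙 (any (Ret ω) A) * 𝟙 (any (Ret ω) B))

        pair : Var → Var → ℚ
        pair v w = E vars (λ ω → 𝟙 (Ret ω v) * 𝟙 (Ret ω w))

        E₂-sum : E₂ ≡ ∑ A (λ v → ∑ B (pair v))
        E₂-sum = trans (E-cong vars λ ω _ → trans (cong₂ _*_ (cov-sum CA ω) (cov-sum CB ω)) (trans (sym (∑-*ʳ (∑ B (λ w → 𝟙 (Ret ω w))) A (λ v → 𝟙 (Ret ω v)))) (∑-cong A λ v _ → sym (∑-* (𝟙 (Ret ω v)) B (λ w → 𝟙 (Ret ω w))))))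
          (trans (E-∑ vars A (λ v ω → ∑ B (λ w → 𝟙 (Ret ω v) * 𝟙 (Ret ω w)))) (∑-cong A λ v _ → E-∑ vars B (λ w ω → 𝟙 (Ret ω v) * 𝟙 (Ret ω w))))

        0≤pair : ∀ v w → 0ℚ ≤ pair v w
        0≤pair v w = E-≥0 vars λ ω _ → 0≤* (0≤𝟙 (Ret ω v)) (0≤𝟙 (Ret ω w))

        private
          K : ℚ
          K = p * κ
          0≤K : 0ℚ ≤ K
          0≤K = 0≤* 0≤p 0≤κ

        lower : ∀ {S} → ∑ A (λ v → ∑ B (λ w → 𝟙 ((v == w) ∨ adj v w))) ≤ S → K * K * (ι (length A) * ι (length B) - S) ≤ E₂
        lower {S} h = ≤-trans (*-monoʳ (0≤* 0≤K 0≤K) (-ʳ-mono (≤-refl {ι (length A) * ι (length B)}) h))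
          (≤-trans (≤-reflexive total) (≤-trans (∑-mono A λ v v∈ → ∑-mono B λ w w∈ → each v w v∈ w∈ (bool-case (v == w)) (bool-case (adj v w))) (≤-reflexive (sym E₂-sum))))
          where
          open Num using (≤-refl)
          bad : Var → Var → Bool
          bad v w = (v == w) ∨ adj v w
          total : K * K * (ι (length A) * ι (length B) - ∑ A (λ v → ∑ B (λ w → 𝟙 (bad v w)))) ≡ ∑ A (λ v → ∑ B (λ w → K * K * (1ℚ - 𝟙 (bad v w))))
          total = sym (trans (∑-cong A λ v _ → trans (∑-* (K * K) B (λ w → 1ℚ - 𝟙 (bad v w))) (cong (K * K *_) (trans (∑-- B (λ _ → 1ℚ) (λ w → 𝟙 (bad v w))) (cong (_- ∑ B (λ w → 𝟙 (bad v w))) (trans (∑-const 1ℚ B) (ℚₚ.*-identityʳ (ι (length B))))))))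
            (trans (∑-* (K * K) A (λ v → ι (length B) - ∑ B (λ w → 𝟙 (bad v w)))) (cong (K * K *_) (trans (∑-- A (λ _ → ι (length B)) (λ v → ∑ B (λ w → 𝟙 (bad v w)))) (cong (_- ∑ A (λ v → ∑ B (λ w → 𝟙 (bad v w)))) (∑-const (ι (length B)) A))))))
          each : ∀ v w → v ∈ A → w ∈ B → (v == w) ≡ true ⊎ (v == w) ≡ false → adj v w ≡ true ⊎ adj v w ≡ false → K * K * (1ℚ - 𝟙 (bad v w)) ≤ pair v w
          each v w v∈ w∈ (inj₂ e) (inj₂ a) = ≤-trans (≤-reflexive (trans (cong (λ b → K * K * (1ℚ - 𝟙 b)) (trans (cong (_∨ adj v w) e) a)) (l K))) (Pair.E-both≥ v w (sub CA v∈) (sub CB w∈) (good′ CA v∈) (good′ CB w∈) (λ { refl → true≢false (==-refl v) e }) a)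
            where
            l : ∀ K → K * K * (1ℚ - 0ℚ) ≡ K * K
            l = solve-∀ ℚ-ring
          each v w v∈ w∈ (inj₁ e) _ = ≤-trans (≤-reflexive (trans (cong (λ b → K * K * (1ℚ - 𝟙 b)) (cong (_∨ adj v w) e)) (ℚₚ.*-zeroʳ (K * K)))) (0≤pair v w)
          each v w v∈ w∈ (inj₂ e) (inj₁ a) = ≤-trans (≤-reflexive (trans (cong (λ b → K * K * (1ℚ - 𝟙 b)) (trans (cong (_∨ adj v w) e) a)) (ℚₚ.*-zeroʳ (K * K)))) (0≤pair v w)

        upper : ∀ {S} → ι 18 * p ≤ 1ℚ → ∑ A (λ v → ∑ B (λ w → 𝟙 (v == w))) ≤ S → E₂ ≤ ι (length A) * ι (length B) * (K * K * (1ℚ + ι 18 * p)) + S * K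
        upper {S} 18p h = ≤-trans (≤-reflexive E₂-sum) (≤-trans (∑-mono A λ v v∈ → ∑-mono B λ w w∈ → each v w v∈ w∈ (bool-case (v == w)) (bool-case (adj v w))) (≤-trans (≤-reflexive total) (+-mono (≤-refl {ι (length A) * ι (length B) * C}) (*-monoˡ 0≤K h))))
          where
          open Num using (≤-refl)
          C : ℚ
          C = K * K * (1ℚ + ι 18 * p)
          0≤C : 0ℚ ≤ C
          0≤C = 0≤* (0≤* 0≤K 0≤K) (0≤+ 0≤1 (0≤* (0≤ι 18) 0≤p))
          total : ∑ A (λ v → ∑ B (λ w → C + 𝟙 (v == w) * K)) ≡ ι (length A) * ι (length B) * C + ∑ A (λ v → ∑ B (λ w → 𝟙 (v == w))) * K
          total = trans (∑-cong A λ v _ → trans (∑-+ B (λ _ → C) (λ w → 𝟙 (v == w) * K)) (cong₂ _+_ (∑-const C B) (∑-*ʳ K B (λ w → 𝟙 (v == w)))))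
            (trans (∑-+ A (λ _ → ι (length B) * C) (λ v → ∑ B (λ w → 𝟙 (v == w)) * K)) (cong₂ _+_ (trans (∑-const (ι (length B) * C) A) (sym (ℚₚ.*-assoc (ι (length A)) (ι (length B)) C))) (∑-*ʳ K A (λ v → ∑ B (λ w → 𝟙 (v == w))))))
          each : ∀ v w → v ∈ A → w ∈ B → (v == w) ≡ true ⊎ (v == w) ≡ false → adj v w ≡ true ⊎ adj v w ≡ false → pair v w ≤ C + 𝟙 (v == w) * K
          each v w v∈ w∈ (inj₁ e) _ = ≤-trans (≤-reflexive (trans (E-cong vars λ ω _ → trans (cong (λ w → 𝟙 (Ret ω v) * 𝟙 (Ret ω w)) (sym (==-true e))) (idem (Ret ω v))) (E-Ret v (sub CA v∈) (good′ CA v∈)))) (by-gap 0≤C (trans (cong (λ b → C + 𝟙 b * K) e) (l C K)))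
            where
            idem : ∀ b → 𝟙 b * 𝟙 b ≡ 𝟙 b
            idem true = refl
            idem false = refl
            l : ∀ C K → C + 1ℚ * K ≡ K + C
            l = solve-∀ ℚ-ring
          each v w v∈ w∈ (inj₂ e) (inj₁ a) = ≤-trans (≤-reflexive (Pair.E-adj v w (sub CA v∈) (sub CB w∈) (good′ CA v∈) (good′ CB w∈) a)) (≤-trans 0≤C (≤-reflexive (trans (l C K) (cong (λ b → C + 𝟙 b * K) (sym e)))))
            where
            l : ∀ C K → C ≡ C + 0ℚ * K
            l = solve-∀ ℚ-ring
          each v w v∈ w∈ (inj₂ e) (inj₂ a) = ≤-trans (≤-trans (≤-reflexive (sym (ℚₚ.*-identityˡ (pair v w)))) (≤-trans (*-monoˡ (0≤pair v w) big) (≤-reflexive (ℚₚ.*-assoc (1ℚ + ι 18 * p) (q ^ 9) (pair v w)))))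
              (≤-trans (*-monoʳ (0≤+ 0≤1 (0≤* (0≤ι 18) 0≤p)) (Pair.E-both≤ v w (sub CA v∈) (sub CB w∈) (good′ CA v∈) (good′ CB w∈) v≢w a (common≤9 v w (sub CA v∈) (sub CB w∈) (good′ CA v∈) (good′ CB w∈) v≢w a))) (≤-reflexive (trans (l C₁ K K) (cong (λ b → C + 𝟙 b * K) (sym e)))))
            where
            C₁ = 1ℚ + ι 18 * p
            v≢w : v ≢ w
            v≢w refl = true≢false (==-refl v) e
            l : ∀ c a b → c * (a * b) ≡ a * b * c + 0ℚ * b
            l = solve-∀ ℚ-ring
            big : 1ℚ ≤ (1ℚ + ι 18 * p) * q ^ 9
            big = ≤-trans (by-gap (0≤* (0≤* (0≤ι 9) 0≤p) (diff 18p)) (trans (cong (λ t → (1ℚ + t * p) * (1ℚ + ι 9 * - p)) 18≡) (trans (l₂ (ι 9) p) (cong (λ t → 1ℚ + ι 9 * p * (1ℚ - t * p)) (sym 18≡)))))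
                  (*-monoʳ (0≤+ 0≤1 (0≤* (0≤ι 18) 0≤p)) (bernoulli {x = - p} 0≤q 9))
              where
              18≡ : ι 18 ≡ ι 9 + ι 9
              18≡ = ι-+ 9 9
              l₂ : ∀ n p → (1ℚ + (n + n) * p) * (1ℚ + n * - p) ≡ 1ℚ + n * p * (1ℚ - (n + n) * p)
              l₂ = solve-∀ ℚ-ring

      near : Var → List Var
      near v = v ∷ filterᵇ (λ o → good o ∧ adj o v) vars

      near-size : ∀ v → v ∈ vars → length (near v) ℕ.≤ suc (suc M)
      near-size v v∈ with bool-case (good v)
      ... | inj₁ g = ℕ.s≤s (ℕₚ.m≤n⇒m≤1+n (ℕₚ.≤-trans (#-mono (λ o → good o ∧ adj o v) (adj v) vars λ o _ e → trans (adj-sym v o) (∧-right {good o} e)) (ℕₚ.≤-reflexive (deg-good v v∈ g))))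
      ... | inj₂ g = ℕ.s≤s (ℕₚ.≤-trans (inj-length (λ _ → 0) {ys = 0 ∷ []} (filterᵇ-unique _ vars-unique) (λ x y x∈ y∈ _ → same v g x y (proj₂ (∈-filterᵇ⁻ (λ o → good o ∧ adj o v) vars x∈)) (proj₂ (∈-filterᵇ⁻ (λ o → good o ∧ adj o v) vars y∈))) λ _ _ → here refl) (ℕ.s≤s ℕ.z≤n))
        where
        same : ∀ v → good v ≡ false → ∀ x y → good x ∧ adj x v ≡ true → good y ∧ adj y v ≡ true → x ≡ y
        same (coin c) _ x y hx hy = linked-bad (coin c) x y (∧-left {good x} hx) (∧-left {good y} hy) (lk x (∧-right {good x} hx)) (lk y (∧-right {good y} hy))
          where
          lk : ∀ x → adj x (coin c) ≡ true → linked (coin c) x ≡ true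
          lk (ph a) h = ∧-right {not (ph a == coin c)} h
          lk (real o) h = ⊥-elim (true≢false (∧-right {not (real o == coin c)} h) refl)
          lk (coin o) h = ⊥-elim (true≢false (∧-right {not (coin o == coin c)} h) refl)

      ball-near : ∀ {A H} (B : Observable A H) v → v ∈ᵇ Observable.ball B ≡ true → v ∈ vars × ∃ λ o → o ∈ near v × o ∈ vars × ∃ λ h → h ∈ Observable.hubs B × Observable.thru B h o ≡ true
      ball-near B v e = let v∈ , h = ∈-filterᵇ⁻ _ vars (∈ᵇ⁻ (Observable.ball B) e) in v∈ , go v∈ (∨-case {Observable.level B v} h)
        where
        open Observable B
        go : v ∈ vars → level v ≡ true ⊎ any (λ o → level o ∧ adj o v) vars ≡ true → ∃ λ o → o ∈ near v × o ∈ vars × ∃ λ h → h ∈ hubs × thru h o ≡ true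
        go v∈ (inj₁ l) = let h , h∈ , t = any⁻ (λ h → thru h v) hubs l in v , here refl , v∈ , h , h∈ , t
        go v∈ (inj₂ k) = let o , o∈ , b = any⁻ _ vars k ; h , h∈ , t = any⁻ (λ h → thru h o) hubs (∧-left b) in
          o , there (∈-filterᵇ⁺ (λ o → good o ∧ adj o v) o∈ (∧-intro (thru-good h o t) (∧-right {level o} b))) , o∈ , h , h∈ , t

      others : Point → Opt → List Point
      others h o = filterᵇ (λ x → not (x ==ᴾ h)) (pts o)

      free : Point → Opt → (Var → Bool) → Bool
      free h o R = not (any (λ x → any R (Inc x)) (others h o))

      others-spec : ∀ {h o x} → x ∈ others h o → x ∈ pts o × x ≢ h
      others-spec {h} {o} x∈ = let a , b = ∈-filterᵇ⁻ (λ x → not (x ==ᴾ h)) (pts o) x∈ in a , λ { refl → true≢false (==ᴾ-refl h) (not-elim b) }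

      others-size : ∀ h o → on h o ≡ true → length (others h o) ℕ.≤ 2
      others-size h o e = ℕₚ.≤-pred (ℕₚ.≤-trans (drop (pts o) (∈ᴾ⁻ (pts o) e)) ℕₚ.≤-refl)
        where
        drop : ∀ xs → h ∈ xs → length (filterᵇ (λ x → not (x ==ᴾ h)) xs) ℕ.< length xs
        drop (x ∷ xs) (here refl) rewrite ==ᴾ-refl x = ℕ.s≤s (#≤length _ xs)
        drop (x ∷ xs) (there h∈) with x ==ᴾ h
        ... | true = ℕₚ.m≤n⇒m≤1+n (drop xs h∈)
        ... | false = ℕ.s≤s (drop xs h∈)

      degree-after : Point → Observable Opt Point
      degree-after h = record
        { J = filterᵇ (on h) os
        ; ψ = λ o R → 𝟙 (free h o R)
        ; touch = λ o v → any (λ x → inc x v) (others h o)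
        ; ψ-range = λ o R → 0≤𝟙 (free h o R) , 𝟙≤1 (free h o R)
        ; ψ-local = λ o _ R R′ e → cong (λ b → 𝟙 (not b)) (any-cong (others h o) λ x x∈ → any-cong (Inc x) λ v v∈ → let v∈v , i = Inc-spec {x} v∈ in e v v∈v (any⁺ (λ x → inc x v) x∈ i))
        ; touch-good = λ o v _ e → let x , _ , i = any⁻ (λ x → inc x v) (others h o) e in inc-good x v i
        ; touch-few = few
        ; hubs = concatMap (others h) (filterᵇ (on h) os)
        ; thru = inc
        ; thru-clique = λ x v w _ _ a b → clique {x} a b
        ; touch-thru = λ o v o∈ _ e → let x , x∈ , i = any⁻ (λ x → inc x v) (others h o) e in x , ∈-concatMap (others h) o∈ x∈ , i
        ; thru-good = inc-good
        }
        where
        few : ∀ v → # (λ o → any (λ x → inc x v) (others h o)) (filterᵇ (on h) os) ℕ.≤ 3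
        few v = ℕₚ.≤-trans (#-≤ (λ o → any (λ x → inc x v) (others h o)) {ys = concatMap at (ends v)} (filterᵇ-unique _ unique) λ o o∈ e →
            let x , x∈ , i = any⁻ (λ x → inc x v) (others h o) e ; o∈os , oh = ∈-filterᵇ⁻ (on h) os o∈ ; x∈o , x≢h = others-spec {h} {o} x∈ in
              ∈-concatMap at (∈ᴾ⁻ (ends v) i) (∈-filterᵇ⁺ (λ o → on h o ∧ (x ∈ᴾ others h o)) o∈os (∧-intro oh (∈ᴾ⁺ x∈))))
            (ℕₚ.≤-trans (concatMap-length at (ends v) λ x _ → at≤1 x) (subst (ℕ._≤ 3) (sym (ℕₚ.*-identityʳ (length (ends v)))) (ends≤3 v)))
          where
          at : Point → List Opt
          at x = filterᵇ (λ o → on h o ∧ (x ∈ᴾ others h o)) os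
          at≤1 : ∀ x → length (at x) ℕ.≤ 1
          at≤1 x = inj-length (λ _ → 0) {ys = 0 ∷ []} (filterᵇ-unique _ unique) (λ o o′ o∈ o′∈ _ →
              let a , b = ∈-filterᵇ⁻ (λ o → on h o ∧ (x ∈ᴾ others h o)) os o∈ ; a′ , b′ = ∈-filterᵇ⁻ (λ o → on h o ∧ (x ∈ᴾ others h o)) os o′∈
                  c , n = others-spec {h} {o} (∈ᴾ⁻ (others h o) (∧-right {on h o} b)) ; c′ , _ = others-spec {h} {o′} (∈ᴾ⁻ (others h o′) (∧-right {on h o′} b′)) in
              linear a a′ n c (∈ᴾ⁻ (pts o) (∧-left b)) c′ (∈ᴾ⁻ (pts o′) (∧-left b′))) λ _ _ → here refl

      module Nibble (pℓ : p * ι ℓ ≡ 1ℚ) (18≤ℓ : 18 ℕ.≤ ℓ) where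

        K ρ : ℚ
        K = p * κ
        ρ = ι t * K

        0≤K : 0ℚ ≤ K
        0≤K = 0≤* 0≤p 0≤κ

        q≤1 : q ≤ 1ℚ
        q≤1 = by-gap 0≤p (l p)
          where
          l : ∀ p → 1ℚ ≡ 1ℚ - p + p
          l = solve-∀ ℚ-ring

        κ≤1 : κ ≤ 1ℚ
        κ≤1 = ^≤1 0≤q q≤1 M

        ℓK : ι ℓ * K ≡ κ
        ℓK = trans (sym (ℚₚ.*-assoc (ι ℓ) p κ)) (trans (cong (_* κ) (trans (ℚₚ.*-comm (ι ℓ) p) pℓ)) (ℚₚ.*-identityˡ κ))

        0≤ρ : 0ℚ ≤ ρ
        0≤ρ = 0≤* (0≤ι t) 0≤K

        ρ≤κ : ρ ≤ κ
        ρ≤κ = ≤-trans (*-monoˡ 0≤K (ι-mono t≤ℓ)) (≤-reflexive ℓK)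

        18p≤1 : ι 18 * p ≤ 1ℚ
        18p≤1 = ≤-trans (*-monoˡ 0≤p (ι-mono 18≤ℓ)) (≤-reflexive (trans (ℚₚ.*-comm (ι ℓ) p) pℓ))

        1≤ℓ : 1 ℕ.≤ ℓ
        1≤ℓ = ℕₚ.≤-trans 1≤t t≤ℓ

        M+2≤ : suc (suc M) ℕ.≤ 3 ℕ.* ℓ
        M+2≤ = bound ℓ t 1≤t t≤ℓ
          where
          bound : ∀ ℓ t → 1 ℕ.≤ t → t ℕ.≤ ℓ → suc (suc ((ℓ ℕ.∸ 1) ℕ.+ ((t ℕ.∸ 1) ℕ.+ (t ℕ.∸ 1)))) ℕ.≤ 3 ℕ.* ℓ
          bound (suc ℓ) (suc t) _ (ℕ.s≤s h) = ℕₚ.≤-trans (ℕ.s≤s (ℕ.s≤s (ℕₚ.+-monoʳ-≤ ℓ (ℕₚ.+-mono-≤ h h))))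
            (ℕₚ.≤-trans (ℕₚ.n≤1+n _) (ℕₚ.≤-reflexive (l ℓ)))
            where
            open +-*-Solver
            l : ∀ ℓ → 3 ℕ.+ (ℓ ℕ.+ (ℓ ℕ.+ ℓ)) ≡ 3 ℕ.* (1 ℕ.+ ℓ)
            l = solve 1 (λ x → con 3 :+ (x :+ (x :+ x)) := con 3 :* (con 1 :+ x)) refl

        deg≤ℓ : ∀ x → # (on x) os ℕ.≤ ℓ
        deg≤ℓ (inj₂ r) = ℕₚ.≤-trans (res-deg r) t≤ℓ
        deg≤ℓ (inj₁ i) = [ (λ e → let o , o∈ , h = any⁻ (on (inj₁ i)) os e in ℕₚ.≤-reflexive (item-deg o∈ (∈ᴾ⁻ (pts o) h))) , (λ e → subst (ℕ._≤ ℓ) (sym (#0 (on (inj₁ i)) os λ o o∈ → any-false (on (inj₁ i)) os e o∈)) ℕ.z≤n) ]′ (bool-case (any (on (inj₁ i)) os))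

        inc≤ℓ : ∀ {o x} → o ∈ os → x ∈ pts o → # (inc x) vars ℕ.≤ ℓ
        inc≤ℓ {x = x} o∈ x∈ = subst (ℕ._≤ ℓ) (sym (#-point (real⁺ o∈) x∈)) (count≤ x)
          where
          count≤ : ∀ x → count x ℕ.≤ ℓ
          count≤ (inj₁ _) = ℕₚ.≤-refl
          count≤ (inj₂ _) = t≤ℓ

        item-inc≤ℓ : ∀ i → # (inc (inj₁ i)) vars ℕ.≤ ℓ
        item-inc≤ℓ i = subst (ℕ._≤ ℓ) (sym (#-item i)) (deg≤ℓ (inj₁ i))

        unlinked : ∀ v w → good v ≡ true → good w ≡ true → linked v w ≡ true → ⊥
        unlinked (real _) (real _) _ _ ()
        unlinked (real _) (ph _) _ _ ()
        unlinked (ph _) (real _) _ _ ()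
        unlinked (ph _) (ph _) _ _ ()

        module Ends {o : Opt} (o∈ : o ∈ os) {a b : Point} (a∈ : a ∈ pts o) (b∈ : b ∈ pts o) (a≢b : a ≢ b) where

          open Two (Inc-clique a) (Inc-clique b)

          size : ∀ {x} → x ∈ pts o → length (Inc x) ≡ count x
          size x∈ = #-point (real⁺ o∈) x∈

          common : ∀ {v} → v ∈ Inc a → v ∈ Inc b → v ≡ real o
          common h k = linear-var (proj₁ (Inc-spec {a} h)) (real⁺ o∈) a≢b (proj₂ (Inc-spec {a} h)) (proj₂ (Inc-spec {b} k)) (∈ᴾ⁺ a∈) (∈ᴾ⁺ b∈)

          inside : ∀ {x} → x ∈ pts o → real o ∈ Inc x
          inside {x} x∈ = ∈-filterᵇ⁺ (inc x) (real⁺ o∈) (∈ᴾ⁺ x∈)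

          once : ∀ {x} → x ∈ pts o → ∑ (Inc x) (λ v → 𝟙 (v == real o)) ≡ 1ℚ
          once {x} x∈ = trans (∑-cong (Inc x) λ v _ → sym (ℚₚ.*-identityʳ (𝟙 (v == real o)))) (∑-single (unique′ (Inc-clique x)) (inside x∈) (λ _ → 1ℚ))

          equal-pairs : ∑ (Inc a) (λ v → ∑ (Inc b) (λ w → 𝟙 (v == w))) ≤ 1ℚ
          equal-pairs = ≤-trans (∑-mono (Inc a) λ v v∈ → row v v∈ (bool-case (v == real o))) (≤-reflexive (once a∈))
            where
            row : ∀ v → v ∈ Inc a → (v == real o) ≡ true ⊎ (v == real o) ≡ false → ∑ (Inc b) (λ w → 𝟙 (v == w)) ≤ 𝟙 (v == real o)
            row v v∈ (inj₁ e) = ≤-reflexive (trans (∑-cong (Inc b) λ w _ → trans (cong 𝟙 (==-sym v w)) (cong (λ v → 𝟙 (w == v)) (==-true e))) (trans (once b∈) (sym (cong 𝟙 e))))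
            row v v∈ (inj₂ e) = ≤-trans (≤-reflexive (trans (∑-cong (Inc b) λ w w∈ → cong 𝟙 (==-false {v} {w} λ { refl → true≢false (trans (cong (_== real o) (common v∈ w∈)) (==-refl (real o))) e })) (∑-0 (Inc b)))) (0≤𝟙 (v == real o))

          bad-pairs : ∑ (Inc a) (λ v → ∑ (Inc b) (λ w → 𝟙 ((v == w) ∨ adj v w))) ≤ ι 4 * ι ℓ
          bad-pairs = ≤-trans (∑-mono (Inc a) λ v v∈ → row v v∈ (bool-case (v == real o)))
            (≤-trans (≤-reflexive (trans (∑-+ (Inc a) (λ _ → ι 3) (λ v → 𝟙 (v == real o) * ι ℓ)) (cong₂ _+_ (∑-const (ι 3) (Inc a)) (trans (∑-*ʳ (ι ℓ) (Inc a) (λ v → 𝟙 (v == real o))) (cong (_* ι ℓ) (once a∈))))))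
             (≤-trans (+-mono (*-monoˡ (0≤ι 3) (ι-mono (inc≤ℓ o∈ a∈))) (≤-refl {1ℚ * ι ℓ})) (≤-reflexive (trans (l (ι ℓ) (ι 3)) (cong (_* ι ℓ) (sym (ι-suc 3)))))))
            where
            l : ∀ n c → n * c + 1ℚ * n ≡ (1ℚ + c) * n
            l = solve-∀ ℚ-ring
            row : ∀ v → v ∈ Inc a → (v == real o) ≡ true ⊎ (v == real o) ≡ false → ∑ (Inc b) (λ w → 𝟙 ((v == w) ∨ adj v w)) ≤ ι 3 + 𝟙 (v == real o) * ι ℓ
            row v v∈ (inj₁ e) = ≤-trans (≤-reflexive (sym (ι# (λ w → (v == w) ∨ adj v w) (Inc b)))) (≤-trans (ι-mono (ℕₚ.≤-trans (#≤length (λ w → (v == w) ∨ adj v w) (Inc b)) (inc≤ℓ o∈ b∈)))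
                 (by-gap (0≤ι 3) (trans (cong (λ z → ι 3 + 𝟙 z * ι ℓ) e) (l₂ (ι 3) (ι ℓ)))))
              where
              l₂ : ∀ c n → c + 1ℚ * n ≡ n + c
              l₂ = solve-∀ ℚ-ring
            row v v∈ (inj₂ e) = ≤-trans (≤-reflexive (sym (ι# (λ w → (v == w) ∨ adj v w) (Inc b)))) (≤-trans (ι-mono few) (by-gap (0≤* (0≤𝟙 (v == real o)) (0≤ι ℓ)) refl))
              where
              v∌b : inc b v ≡ true → ⊥
              v∌b h = true≢false (trans (cong (_== real o) (common v∈ (∈-filterᵇ⁺ (inc b) (proj₁ (Inc-spec {a} v∈)) h))) (==-refl (real o))) e
              at : Point → List Var
              at x = filterᵇ (λ w → inc x w ∧ (inc b w ∧ not (x ==ᴾ b))) vars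
              at≤1 : ∀ x → length (at x) ℕ.≤ 1
              at≤1 x = inj-length (λ _ → 0) {ys = 0 ∷ []} (filterᵇ-unique _ vars-unique) (λ w w′ h h′ _ →
                let w∈ , m = ∈-filterᵇ⁻ (λ w → inc x w ∧ (inc b w ∧ not (x ==ᴾ b))) vars h ; w′∈ , m′ = ∈-filterᵇ⁻ (λ w → inc x w ∧ (inc b w ∧ not (x ==ᴾ b))) vars h′ in
                  linear-var w∈ w′∈ (λ q → true≢false (subst (λ y → (x ==ᴾ y) ≡ true) q (==ᴾ-refl x)) (not-elim (∧-right {inc b w} (∧-right {inc x w} m))))
                    (∧-left m) (∧-left (∧-right {inc x w} m)) (∧-left m′) (∧-left (∧-right {inc x w′} m′))) λ _ _ → here refl
              few : # (λ w → (v == w) ∨ adj v w) (Inc b) ℕ.≤ 3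
              few = ℕₚ.≤-trans (#-≤ (λ w → (v == w) ∨ adj v w) {ys = concatMap at (ends v)} (unique′ (Inc-clique b)) λ w w∈ h → cover w w∈ (∨-case {v == w} h))
                  (ℕₚ.≤-trans (concatMap-length at (ends v) λ x _ → at≤1 x) (subst (ℕ._≤ 3) (sym (ℕₚ.*-identityʳ (length (ends v)))) (ends≤3 v)))
                where
                shared : ∀ w → inc b w ≡ true → adj v w ≡ true → shares v w ≡ true
                shared w bw h with ∨-case {shares v w} (∧-right {not (v == w)} h)
                ... | inj₁ s = s
                ... | inj₂ k = ⊥-elim (unlinked v w (inc-good a v (proj₂ (Inc-spec {a} v∈))) (inc-good b w bw) k)
                cover : ∀ w → w ∈ Inc b → (v == w) ≡ true ⊎ adj v w ≡ true → w ∈ concatMap at (ends v)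
                cover w w∈ (inj₁ h) = ⊥-elim (v∌b (subst (λ z → inc b z ≡ true) (sym (==-true h)) (proj₂ (Inc-spec {b} w∈))))
                cover w w∈ (inj₂ h) = let w∈v , bw = Inc-spec {b} w∈ ; x , x∈ , i = any⁻ (λ x → inc x w) (ends v) (shared w bw h) in
                   ∈-concatMap at x∈ (∈-filterᵇ⁺ (λ w → inc x w ∧ (inc b w ∧ not (x ==ᴾ b))) w∈v (∧-intro i (∧-intro bw (not-true (==ᴾ-false λ q → v∌b (subst (λ y → inc y v ≡ true) q (∈ᴾ⁺ x∈)))))))

          E-uncovered : E vars (λ ω → 𝟙 (not (any (λ x → any (Ret ω) (Inc x)) (a ∷ b ∷ [])))) ≡ 1ℚ - ι (count a) * K - ι (count b) * K + E₂
          E-uncovered = trans (E-cong vars λ ω _ → expand (any (Ret ω) (Inc a)) (any (Ret ω) (Inc b)))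
             (trans (E-+ vars (λ ω → 1ℚ - 𝟙 (any (Ret ω) (Inc a)) - 𝟙 (any (Ret ω) (Inc b))) (λ ω → 𝟙 (any (Ret ω) (Inc a)) * 𝟙 (any (Ret ω) (Inc b))))
               (cong (_+ E₂) (trans (E-- vars (λ ω → 1ℚ - 𝟙 (any (Ret ω) (Inc a))) (λ ω → 𝟙 (any (Ret ω) (Inc b)))) (cong₂ _-_
                  (trans (E-- vars (λ _ → 1ℚ) (λ ω → 𝟙 (any (Ret ω) (Inc a)))) (cong₂ _-_ (E-const vars 1ℚ) (trans (E-cov (Inc-clique a)) (cong (λ n → ι n * K) (size a∈)))))
                  (trans (E-cov (Inc-clique b)) (cong (λ n → ι n * K) (size b∈)))))))
            where
            expand : ∀ a b → 𝟙 (not (a ∨ (b ∨ false))) ≡ 1ℚ - 𝟙 a - 𝟙 b + 𝟙 a * 𝟙 b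
            expand true true = refl
            expand true false = refl
            expand false true = refl
            expand false false = refl

          E₂≥ : K * K * (ι (count a) * ι (count b) - ι 4 * ι ℓ) ≤ E₂
          E₂≥ = ≤-trans (≤-reflexive (cong₂ (λ m n → K * K * (ι m * ι n - ι 4 * ι ℓ)) (sym (size a∈)) (sym (size b∈)))) (lower bad-pairs)

          E₂≤ : E₂ ≤ ι (count a) * ι (count b) * (K * K * (1ℚ + ι 18 * p)) + 1ℚ * K
          E₂≤ = ≤-trans (upper 18p≤1 equal-pairs) (≤-reflexive (cong₂ (λ m n → ι m * ι n * (K * K * (1ℚ + ι 18 * p)) + 1ℚ * K) (size a∈) (size b∈)))

        after : Point → Outcome → ℚ
        after h = Observable.value (degree-after h)

        free-mean : Point → Opt → ℚ
        free-mean h o = E vars (λ ω → 𝟙 (free h o (Ret ω)))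

        E-after : ∀ h → E vars (after h) ≡ ∑ (filterᵇ (on h) os) (free-mean h)
        E-after h = E-∑ vars (filterᵇ (on h) os) (λ o ω → 𝟙 (free h o (Ret ω)))

        free-item : ∀ {o i} → o ∈ os → on (inj₁ i) o ≡ true → (1ℚ - ρ) * (1ℚ - ρ) - ι 4 * ι ℓ * (K * K) ≤ free-mean (inj₁ i) o
        free-item {(i , a , b)} {i′} o∈ h with ∈ᴾ⁻ {inj₁ i′} (pts (i , a , b)) h
        ... | there (here ())
        ... | there (there (here ()))
        ... | here refl rewrite ==ᴾ-refl (inj₁ i) = ≤-trans (by-gap (diff E₂≥) (trans E-uncovered (l (ι t) K (ι 4) (ι ℓ) E₂))) ≤-refl
          where
          a≢b : _≢_ {A = Point} (inj₂ a) (inj₂ b)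
          a≢b refl = distinct o∈ refl
          open Ends o∈ (there (here refl)) (there (there (here refl))) a≢b
          open Two (Inc-clique (inj₂ a)) (Inc-clique (inj₂ b)) using (E₂)
          l : ∀ t K c n e → 1ℚ - t * K - t * K + e ≡ (1ℚ - t * K) * (1ℚ - t * K) - c * n * (K * K) + (e - K * K * (t * t - c * n))
          l = solve-∀ ℚ-ring

        private
          mixed : ∀ {o i r} → o ∈ os → inj₁ i ∈ pts o → inj₂ r ∈ pts o →
                  E vars (λ ω → 𝟙 (not (any (λ x → any (Ret ω) (Inc x)) (inj₁ i ∷ inj₂ r ∷ [])))) ≤ (1ℚ - κ) * (1ℚ - ρ) + ι 19 * p
          mixed {o} {i} {r} o∈ i∈ r∈ = ≤-trans (≤-reflexive E-uncovered) (≤-trans (+-mono (≤-refl {1ℚ - ι ℓ * K - ι t * K}) E₂≤)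
              (by-gap (0≤+ (0≤* (0≤* (0≤ι 18) 0≤p) (diff κρ≤1)) (0≤* 0≤p (diff κ≤1)))
                (trans (cong (λ c → (1ℚ - κ) * (1ℚ - ρ) + c * p) (ι-suc 18)) (trans (l κ ρ (ι 18) p) (cong₂ (λ x y → 1ℚ - x - ρ + (y * (1ℚ + ι 18 * p) + 1ℚ * (p * κ)) + (ι 18 * p * (1ℚ - κ * ρ) + p * (1ℚ - κ))) (sym ℓK) (trans (cong (_* ρ) (sym ℓK)) (l₂ (ι ℓ) (ι t) K (1ℚ + ι 18 * p))))
                  |> λ e → trans e (cong (λ y → 1ℚ - ι ℓ * K - ρ + (y + 1ℚ * K) + (ι 18 * p * (1ℚ - κ * ρ) + p * (1ℚ - κ))) (ℚₚ.*-assoc (ι ℓ * ι t) (K * K) (1ℚ + ι 18 * p)))))))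
            where
            open Ends o∈ i∈ r∈ (λ ())
            infixl 1 _|>_
            _|>_ : ∀ {A B : Set} → A → (A → B) → B
            x |> f = f x
            κρ≤1 : κ * ρ ≤ 1ℚ
            κρ≤1 = *-mono 0≤κ 0≤1 κ≤1 (≤-trans ρ≤κ κ≤1)
            l : ∀ k r c p → (1ℚ - k) * (1ℚ - r) + (1ℚ + c) * p ≡ 1ℚ - k - r + (k * r * (1ℚ + c * p) + 1ℚ * (p * k)) + (c * p * (1ℚ - k * r) + p * (1ℚ - k))
            l = solve-∀ ℚ-ring
            l₂ : ∀ n t K c → n * K * (t * K) ≡ n * t * (K * K)
            l₂ = solve-∀ ℚ-ring

        private
          others-first : ∀ {i a b} → a ≢ b → others (inj₂ a) (i , a , b) ≡ inj₁ i ∷ inj₂ b ∷ []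
          others-first {i} {a} {b} n = trans (filterᵇ-keep f {inj₁ i} (inj₂ a ∷ inj₂ b ∷ []) refl) (cong (inj₁ i ∷_) (trans (filterᵇ-drop f {inj₂ a} (inj₂ b ∷ []) (cong not (==ᴾ-refl (inj₂ a))))
              (filterᵇ-keep f {inj₂ b} [] (cong not (==ᴾ-false {inj₂ b} {inj₂ a} λ { refl → n refl })))))
            where
            f : Point → Bool
            f x = not (x ==ᴾ inj₂ a)

          others-second : ∀ {i a b} → a ≢ b → others (inj₂ b) (i , a , b) ≡ inj₁ i ∷ inj₂ a ∷ []
          others-second {i} {a} {b} n = trans (filterᵇ-keep f {inj₁ i} (inj₂ a ∷ inj₂ b ∷ []) refl) (cong (inj₁ i ∷_) (trans (filterᵇ-keep f {inj₂ a} (inj₂ b ∷ []) (cong not (==ᴾ-false {inj₂ a} {inj₂ b} λ { refl → n refl })))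
              (cong (inj₂ a ∷_) (filterᵇ-drop f {inj₂ b} [] (cong not (==ᴾ-refl (inj₂ b)))))))
            where
            f : Point → Bool
            f x = not (x ==ᴾ inj₂ b)

          free-others : ∀ h o xs → others h o ≡ xs → free-mean h o ≡ E vars (λ ω → 𝟙 (not (any (λ x → any (Ret ω) (Inc x)) xs)))
          free-others h o xs e = cong (λ ys → E vars (λ ω → 𝟙 (not (any (λ x → any (Ret ω) (Inc x)) ys)))) e

        free-res : ∀ {o r} → o ∈ os → on (inj₂ r) o ≡ true → free-mean (inj₂ r) o ≤ (1ℚ - κ) * (1ℚ - ρ) + ι 19 * p
        free-res {(i , a , b)} {r} o∈ h with ∈ᴾ⁻ {inj₂ r} (pts (i , a , b)) h
        ... | here ()
        ... | there (here refl) = ≤-trans (≤-reflexive (free-others (inj₂ a) (i , a , b) _ (others-first (distinct o∈)))) (mixed o∈ (here refl) (there (there (here refl))))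
        ... | there (there (here refl)) = ≤-trans (≤-reflexive (free-others (inj₂ b) (i , a , b) _ (others-second (distinct o∈)))) (mixed o∈ (here refl) (there (here refl)))

        E-item : ∀ i → # (on (inj₁ i)) os ≡ ℓ → ι ℓ * ((1ℚ - ρ) * (1ℚ - ρ)) - ι 4 ≤ E vars (after (inj₁ i))
        E-item i e = ≤-trans (≤-trans (by-gap (0≤* (0≤ι 4) (diff κκ≤1)) (trans (l (ι ℓ) ((1ℚ - ρ) * (1ℚ - ρ)) (ι 4) K) (cong (λ y → ι ℓ * ((1ℚ - ρ) * (1ℚ - ρ)) - ι 4 + ι 4 * (1ℚ - y)) (cong₂ _*_ ℓK ℓK))))
              (≤-reflexive (trans (cong (λ n → ι n * ((1ℚ - ρ) * (1ℚ - ρ) - ι 4 * ι ℓ * (K * K))) (sym e)) (sym (∑-const ((1ℚ - ρ) * (1ℚ - ρ) - ι 4 * ι ℓ * (K * K)) (filterᵇ (on (inj₁ i)) os))))))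
            (≤-trans (∑-mono (filterᵇ (on (inj₁ i)) os) λ o o∈ → let a , b = ∈-filterᵇ⁻ (on (inj₁ i)) os o∈ in free-item a b) (≤-reflexive (sym (E-after (inj₁ i)))))
          where
          κκ≤1 : κ * κ ≤ 1ℚ
          κκ≤1 = *-mono 0≤κ 0≤1 κ≤1 κ≤1
          l : ∀ n s c K → n * (s - c * n * (K * K)) ≡ n * s - c + c * (1ℚ - n * K * (n * K))
          l = solve-∀ ℚ-ring

        E-res : ∀ r → E vars (after (inj₂ r)) ≤ ι t * ((1ℚ - κ) * (1ℚ - ρ)) + ι 19
        E-res r = ≤-trans (≤-reflexive (E-after (inj₂ r))) (≤-trans (∑-mono (filterᵇ (on (inj₂ r)) os) λ o o∈ → let a , b = ∈-filterᵇ⁻ (on (inj₂ r)) os o∈ in free-res a b)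
            (≤-trans (≤-reflexive (∑-const ((1ℚ - κ) * (1ℚ - ρ) + ι 19 * p) (filterᵇ (on (inj₂ r)) os))) (≤-trans (≤-reflexive (ℚₚ.*-distribˡ-+ (ι n) _ _))
              (+-mono (*-monoˡ (0≤* (diff κ≤1) (diff (≤-trans ρ≤κ κ≤1))) (ι-mono (res-deg r)))
                (≤-trans (*-monoˡ (0≤* (0≤ι 19) 0≤p) (ι-mono (deg≤ℓ (inj₂ r)))) (≤-reflexive (trans (l (ι ℓ) (ι 19) p) (trans (cong (ι 19 *_) pℓ) (ℚₚ.*-identityʳ (ι 19))))))))))
          where
          n = # (on (inj₂ r)) os
          l : ∀ n c p → n * (c * p) ≡ c * (p * n)
          l = solve-∀ ℚ-ring

        covered : Point → (Var → Bool) → Bool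
        covered x R = any R (Reals x)

        separation : Test os ℓ → Observable (R × R) Point
        separation τ = record
          { J = pairs
          ; ψ = λ ab R → 𝟙 (covered (inj₂ (proj₁ ab)) R ∧ not (covered (inj₂ (proj₂ ab)) R))
          ; touch = touch′
          ; ψ-range = λ ab R → 0≤𝟙 (covered (inj₂ (proj₁ ab)) R ∧ not (covered (inj₂ (proj₂ ab)) R)) , 𝟙≤1 (covered (inj₂ (proj₁ ab)) R ∧ not (covered (inj₂ (proj₂ ab)) R))
          ; ψ-local = λ ab _ R R′ e → cong 𝟙 (cong₂ _∧_ (same (inj₂ (proj₁ ab)) R R′ λ o o∈ h → e (real o) (real⁺ o∈) (∨-left h))
                                                (cong not (same (inj₂ (proj₂ ab)) R R′ λ o o∈ h → e (real o) (real⁺ o∈) (∨-right {on (inj₂ (proj₁ ab)) o} h))))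
          ; touch-good = λ { ab (real o) _ _ → refl }
          ; touch-few = few′
          ; hubs = map inj₁ hub
          ; thru = inc
          ; thru-clique = λ x v w _ _ a b → clique {x} a b
          ; touch-thru = λ { ab (real o) ab∈ o∈ h → let i , i∈ , k = thru-hub (real⁻ o∈) ab∈ h in inj₁ i , ∈-map⁺ inj₁ i∈ , k }
          ; thru-good = inc-good
          }
          where
          open Test τ
          touch′ : R × R → Var → Bool
          touch′ ab (real o) = on (inj₂ (proj₁ ab)) o ∨ on (inj₂ (proj₂ ab)) o
          touch′ ab _ = false
          few′ : ∀ v → # (λ ab → touch′ ab v) pairs ℕ.≤ 3
          few′ (real o) = few o
          few′ (ph a) = subst (ℕ._≤ 3) (sym (#0 (λ ab → touch′ ab (ph a)) pairs λ _ _ → refl)) ℕ.z≤n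
          few′ (coin a) = subst (ℕ._≤ 3) (sym (#0 (λ ab → touch′ ab (coin a)) pairs λ _ _ → refl)) ℕ.z≤n
          same : ∀ x R R′ → (∀ o → o ∈ os → on x o ≡ true → R (real o) ≡ R′ (real o)) → covered x R ≡ covered x R′
          same x R R′ e = any-cong (Reals x) λ v v∈ → let o , o∈ , h , eq = Reals-spec {x} v∈ in trans (cong R eq) (trans (e o o∈ h) (cong R′ (sym eq)))

        ∑-Reals : ∀ x (f : Var → ℚ) → ∑ (Reals x) f ≡ ∑ os (λ o → 𝟙 (on x o) * f (real o))
        ∑-Reals x f = trans (∑-map (filterᵇ (on x) os)) (∑-filter (on x) os (λ o → f (real o)))
          where
          ∑-map : ∀ xs → ∑ (map real xs) f ≡ ∑ xs (λ o → f (real o))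
          ∑-map [] = refl
          ∑-map (o ∷ xs) = cong (f (real o) +_) (∑-map xs)

        both : R × R → ℕ
        both (a , b) = # (λ o → on (inj₂ a) o ∧ on (inj₂ b) o) os

        E-separation : ∀ τ → K * (1ℚ - κ * (1ℚ + ι 18 * p)) * ∑ (Test.pairs τ) (λ ab → ι (deg (inj₂ (proj₁ ab)))) - K * ∑ (Test.pairs τ) (λ ab → ι (both ab))
                     ≤ E vars (Observable.value (separation τ))
        E-separation τ = ≤-trans (≤-reflexive (trans (cong₂ _-_ (sym (∑-* (K * (1ℚ - κ * (1ℚ + ι 18 * p))) pairs (λ ab → ι (deg (inj₂ (proj₁ ab)))))) (sym (∑-* K pairs (λ ab → ι (both ab)))))
             (sym (∑-- pairs (λ ab → K * (1ℚ - κ * (1ℚ + ι 18 * p)) * ι (deg (inj₂ (proj₁ ab)))) (λ ab → K * ι (both ab))))))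
           (≤-trans (∑-mono pairs λ ab _ → each ab) (≤-reflexive (sym (E-∑ vars pairs (λ ab ω → 𝟙 (covered (inj₂ (proj₁ ab)) (Ret ω) ∧ not (covered (inj₂ (proj₂ ab)) (Ret ω))))))))
          where
          open Test τ using (pairs)
          each : ∀ ab → K * (1ℚ - κ * (1ℚ + ι 18 * p)) * ι (deg (inj₂ (proj₁ ab))) - K * ι (both ab) ≤ E vars (λ ω → 𝟙 (covered (inj₂ (proj₁ ab)) (Ret ω) ∧ not (covered (inj₂ (proj₂ ab)) (Ret ω))))
          each (a , b) = ≤-trans (≤-trans (by-gap (0≤* (0≤* (0≤* (0≤ι da) 0≤K) (0≤+ 0≤1 (0≤* (0≤ι 18) 0≤p))) (diff dbK≤κ)) (l (ι da) (ι db) K κ (1ℚ + ι 18 * p) (ι (both (a , b)))))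
                (-ʳ-mono (≤-reflexive (sym (trans (E-cov CA) (cong (λ n → ι n * K) (length-map real (filterᵇ (on (inj₂ a)) os)))))) (≤-trans (upper 18p≤1 equal) (≤-reflexive (cong₂ (λ m n → ι m * ι n * (K * K * (1ℚ + ι 18 * p)) + ι (both (a , b)) * K) (length-map real (filterᵇ (on (inj₂ a)) os)) (length-map real (filterᵇ (on (inj₂ b)) os)))))))
              (≤-reflexive (sym (trans (E-cong vars λ ω _ → expand (covered (inj₂ a) (Ret ω)) (covered (inj₂ b) (Ret ω))) (E-- vars (λ ω → 𝟙 (covered (inj₂ a) (Ret ω))) (λ ω → 𝟙 (covered (inj₂ a) (Ret ω)) * 𝟙 (covered (inj₂ b) (Ret ω)))))))
            where
            CA = Reals-clique (inj₂ a)
            CB = Reals-clique (inj₂ b)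
            open Two CA CB using (upper; E₂)
            da = deg (inj₂ a)
            db = deg (inj₂ b)
            dbK≤κ : ι db * K ≤ κ
            dbK≤κ = ≤-trans (*-monoˡ 0≤K (ι-mono (deg≤ℓ (inj₂ b)))) (≤-reflexive ℓK)
            l : ∀ d e K k c s → d * K - (d * e * (K * K * c) + s * K) ≡ K * (1ℚ - k * c) * d - K * s + d * K * c * (k - e * K)
            l = solve-∀ ℚ-ring
            expand : ∀ a b → 𝟙 (a ∧ not b) ≡ 𝟙 a - 𝟙 a * 𝟙 b
            expand true true = refl
            expand true false = refl
            expand false b = sym (l₂ (𝟙 b))
              where
              l₂ : ∀ x → 0ℚ - 0ℚ * x ≡ 0ℚ
              l₂ = solve-∀ ℚ-ring
            equal : ∑ (Reals (inj₂ a)) (λ v → ∑ (Reals (inj₂ b)) (λ w → 𝟙 (v == w))) ≤ ι (both (a , b))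
            equal = ≤-trans (∑-mono (Reals (inj₂ a)) λ v v∈ → row v v∈ (bool-case (inc (inj₂ b) v)))
               (≤-reflexive (trans (∑-Reals (inj₂ a) (λ v → 𝟙 (inc (inj₂ b) v))) (trans (∑-cong os λ o _ → sym (𝟙-∧ (on (inj₂ a) o) (on (inj₂ b) o))) (sym (ι# (λ o → on (inj₂ a) o ∧ on (inj₂ b) o) os)))))
              where
              row : ∀ v → v ∈ Reals (inj₂ a) → inc (inj₂ b) v ≡ true ⊎ inc (inj₂ b) v ≡ false → ∑ (Reals (inj₂ b)) (λ w → 𝟙 (v == w)) ≤ 𝟙 (inc (inj₂ b) v)
              row v v∈ (inj₁ e) = let o , o∈ , _ , eq = Reals-spec {inj₂ a} v∈ in
                ≤-reflexive (trans (∑-cong (Reals (inj₂ b)) λ w _ → trans (cong 𝟙 (==-sym v w)) (sym (ℚₚ.*-identityʳ (𝟙 (w == v)))))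
                  (trans (∑-single (unique′ CB) (subst (_∈ Reals (inj₂ b)) (sym eq) (∈-map⁺ real (∈-filterᵇ⁺ (on (inj₂ b)) o∈ (subst (λ v → inc (inj₂ b) v ≡ true) eq e)))) (λ _ → 1ℚ)) (sym (cong 𝟙 e))))
              row v v∈ (inj₂ e) = ≤-trans (≤-reflexive (trans (∑-cong (Reals (inj₂ b)) λ w w∈ → cong 𝟙 (==-false {v} {w} λ { refl → let o , _ , h , eq = Reals-spec {inj₂ b} w∈ in true≢false (subst (λ v → inc (inj₂ b) v ≡ true) (sym eq) h) e })) (∑-0 (Reals (inj₂ b))))) (0≤𝟙 (inc (inj₂ b) v))

        k : ℕ
        k = 2 ℕ.* ℓ ℕ.* ℓ ℕ.* (3 ℕ.* ℓ)

        module _ {σ : ℚ} (0<σ : 0ℚ < σ) (24≤σ : ι 2 * ι 12 ≤ σ) (σ² : ι 4608 * ι ℓ ≤ σ * σ) (Θ : ℕ) where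

          private
            variance : ∀ n → n ℕ.≤ 2 ℕ.* ℓ → ι (n ℕ.* ℓ ℕ.+ n ℕ.* M) * p * (ι 2 * ι 12) * (ι 2 * ι 12) ≤ σ * σ
            variance n h = ≤-trans (*-monoˡ 0≤24 (*-monoˡ 0≤24 (*-monoˡ 0≤p (ι-mono (nat h))))) (≤-trans (≤-reflexive eq) σ²)
              where
              0≤24 = 0≤* (0≤ι 2) (0≤ι 12)
              nat : n ℕ.≤ 2 ℕ.* ℓ → n ℕ.* ℓ ℕ.+ n ℕ.* M ℕ.≤ 8 ℕ.* (ℓ ℕ.* ℓ)
              nat h = ℕₚ.≤-trans (ℕₚ.+-mono-≤ (ℕₚ.*-monoˡ-≤ ℓ h) (ℕₚ.*-mono-≤ h (ℕₚ.≤-trans (ℕₚ.≤-trans (ℕₚ.n≤1+n M) (ℕₚ.n≤1+n (suc M))) M+2≤))) (ℕₚ.≤-reflexive (l ℓ))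
                where
                open +-*-Solver
                l : ∀ ℓ → 2 ℕ.* ℓ ℕ.* ℓ ℕ.+ 2 ℕ.* ℓ ℕ.* (3 ℕ.* ℓ) ≡ 8 ℕ.* (ℓ ℕ.* ℓ)
                l = solve 1 (λ x → con 2 :* x :* x :+ con 2 :* x :* (con 3 :* x) := con 8 :* (x :* x)) refl
              eq : ι (8 ℕ.* (ℓ ℕ.* ℓ)) * p * (ι 2 * ι 12) * (ι 2 * ι 12) ≡ ι 4608 * ι ℓ
              eq = trans (cong₂ (λ x y → x * p * y * y) (trans (ι-* 8 (ℓ ℕ.* ℓ)) (cong (ι 8 *_) (ι-* ℓ ℓ))) (sym (ι-* 2 12)))
                (trans (l (ι 8) (ι ℓ) p (ι 24)) (trans (cong (λ z → ι 8 * ι 24 * ι 24 * ι ℓ * z) pℓ) (trans (ℚₚ.*-identityʳ (ι 8 * ι 24 * ι 24 * ι ℓ)) (cong (_* ι ℓ) (trans (cong (_* ι 24) (sym (ι-* 8 24))) (sym (ι-* 192 24)))))))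
                where
                l : ∀ a n p c → a * (n * n) * p * c * c ≡ a * c * c * n * (p * n)
                l = solve-∀ ℚ-ring

            ball-size≤ : ∀ n → n ℕ.≤ 2 ℕ.* ℓ → n ℕ.* ℓ ℕ.* suc M ℕ.≤ k
            ball-size≤ n h = ℕₚ.*-mono-≤ (ℕₚ.*-monoˡ-≤ ℓ h) (ℕₚ.≤-trans (ℕₚ.n≤1+n (suc M)) M+2≤)

          hub-count : ∀ h → length (Observable.hubs (degree-after h)) ℕ.≤ 2 ℕ.* ℓ
          hub-count h = ℕₚ.≤-trans (concatMap-length (others h) (filterᵇ (on h) os) λ o o∈ → others-size h o (proj₂ (∈-filterᵇ⁻ (on h) os o∈)))
             (subst (ℕ._≤ 2 ℕ.* ℓ) (ℕₚ.*-comm 2 (deg h)) (ℕₚ.*-monoʳ-≤ 2 (deg≤ℓ h)))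

          conc-degree : ∀ h → Σ (Concentrated vars Θ k (after h) σ) λ c → Concentrated.support c ≡ Observable.ball (degree-after h)
          conc-degree h = concentrated (degree-after h) {N = ℓ} (λ x x∈ → let o , o∈ , x∈o = ∈-concatMap⁻ (others h) (filterᵇ (on h) os) x∈ in
              inc≤ℓ (proj₁ (∈-filterᵇ⁻ (on h) os o∈)) (proj₁ (others-spec {h} {o} x∈o))) (ball-size≤ _ (hub-count h)) 0<σ 24≤σ (variance _ (hub-count h))

          conc-test : ∀ τ → Σ (Concentrated vars Θ k (Observable.value (separation τ)) σ) λ c → Concentrated.support c ≡ Observable.ball (separation τ)
          conc-test τ = concentrated (separation τ) {N = ℓ} (λ x x∈ → let i , _ , e = ∈-map⁻ inj₁ x∈ in subst (λ x → # (inc x) vars ℕ.≤ ℓ) (sym e) (item-inc≤ℓ i)) (ball-size≤ _ size) 0<σ 24≤σ (variance _ size)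
            where
            size : length (map (inj₁ {B = R}) (Test.hub τ)) ℕ.≤ 2 ℕ.* ℓ
            size = subst (ℕ._≤ 2 ℕ.* ℓ) (sym (length-map inj₁ (Test.hub τ))) (Test.hub-size τ)

          module _ (hs : List Point) (hs-unique : Unique hs) {T : Set} (ts : List T) (ts-unique : Unique ts) (τ : T → Test os ℓ)
            (c : ℕ) (hub-deg : ∀ i → # (λ x → inj₁ i ∈ᴾ map inj₁ (Test.hub (τ x))) ts ℕ.≤ c)
            (1≤Θ : 1 ℕ.≤ Θ) (big : 24 ℕ.* (27 ℕ.* (ℓ ℕ.* ℓ) ℕ.+ 9 ℕ.* (ℓ ℕ.* c)) ℕ.* k ℕ.≤ 2 ℕ.^ Θ) (big′ : 7 ℕ.≤ 2 ℕ.^ Θ) where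

            private
              Index : Set
              Index = Point ⊎ T

              indices : List Index
              indices = map inj₁ hs ++ map inj₂ ts

              f : Index → Outcome → ℚ
              f (inj₁ h) = after h
              f (inj₂ x) = Observable.value (separation (τ x))

              supp : Index → List Var
              supp (inj₁ h) = Observable.ball (degree-after h)
              supp (inj₂ x) = Observable.ball (separation (τ x))

              concs : ∀ x → Σ (Concentrated vars Θ k (f x) σ) λ c → Concentrated.support c ≡ supp x
              concs (inj₁ h) = conc-degree h
              concs (inj₂ x) = conc-test (τ x)

              3ℓ : ∀ v → v ∈ vars → length (near v) ℕ.≤ 3 ℕ.* ℓ
              3ℓ v v∈ = ℕₚ.≤-trans (near-size v v∈) M+2≤

              point-deg : ∀ v → v ∈ vars → # (λ h → v ∈ᵇ supp (inj₁ h)) hs ℕ.≤ 27 ℕ.* (ℓ ℕ.* ℓ)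
              point-deg v v∈ = ℕₚ.≤-trans (#-≤ (λ h → v ∈ᵇ supp (inj₁ h)) {ys = concatMap via (near v)} hs-unique λ h _ e → cover h e)
                  (ℕₚ.≤-trans (concatMap-length via (near v) {c = 3 ℕ.* (ℓ ℕ.* 3)} λ o _ → ℕₚ.≤-trans (concatMap-length at (ends o) {c = ℓ ℕ.* 3} λ x _ →
                       ℕₚ.≤-trans (concatMap-length pts (filterᵇ (on x) os) λ _ _ → ℕₚ.≤-refl) (ℕₚ.*-monoˡ-≤ 3 (deg≤ℓ x))) (ℕₚ.*-monoˡ-≤ (ℓ ℕ.* 3) (ends≤3 o)))
                    (ℕₚ.≤-trans (ℕₚ.*-monoˡ-≤ (3 ℕ.* (ℓ ℕ.* 3)) (3ℓ v v∈)) (ℕₚ.≤-reflexive (l ℓ))))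
                where
                open +-*-Solver
                l : ∀ ℓ → 3 ℕ.* ℓ ℕ.* (3 ℕ.* (ℓ ℕ.* 3)) ≡ 27 ℕ.* (ℓ ℕ.* ℓ)
                l = solve 1 (λ x → con 3 :* x :* (con 3 :* (x :* con 3)) := con 27 :* (x :* x)) refl
                at : Point → List Point
                at x = concatMap pts (filterᵇ (on x) os)
                via : Var → List Point
                via o = concatMap at (ends o)
                cover : ∀ h → v ∈ᵇ supp (inj₁ h) ≡ true → h ∈ concatMap via (near v)
                cover h e = case ball-near (degree-after h) v e of λ { (_ , o , o∈ , _ , x , x∈ , i) → let o′ , o′∈ , x∈o′ = ∈-concatMap⁻ (others h) (filterᵇ (on h) os) x∈ ; a , b = ∈-filterᵇ⁻ (on h) os o′∈ in
                  ∈-concatMap via o∈ (∈-concatMap at (∈ᴾ⁻ (ends o) i) (∈-concatMap pts (∈-filterᵇ⁺ (on x) a (∈ᴾ⁺ (proj₁ (others-spec {h} {o′} x∈o′)))) (∈ᴾ⁻ (pts o′) b))) }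

              test-deg : ∀ v → v ∈ vars → # (λ x → v ∈ᵇ supp (inj₂ x)) ts ℕ.≤ 9 ℕ.* (ℓ ℕ.* c)
              test-deg v v∈ = ℕₚ.≤-trans (#-≤ (λ x → v ∈ᵇ supp (inj₂ x)) {ys = concatMap via (near v)} ts-unique λ x x∈ e → cover x x∈ e)
                  (ℕₚ.≤-trans (concatMap-length via (near v) {c = 3 ℕ.* c} λ o _ → ℕₚ.≤-trans (concatMap-length at (ends o) {c = c} λ y _ → at≤c y) (ℕₚ.*-monoˡ-≤ c (ends≤3 o)))
                    (ℕₚ.≤-trans (ℕₚ.*-monoˡ-≤ (3 ℕ.* c) (3ℓ v v∈)) (ℕₚ.≤-reflexive (l ℓ c))))
                where
                open +-*-Solver
                l : ∀ ℓ c → 3 ℕ.* ℓ ℕ.* (3 ℕ.* c) ≡ 9 ℕ.* (ℓ ℕ.* c)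
                l = solve 2 (λ x c → con 3 :* x :* (con 3 :* c) := con 9 :* (x :* c)) refl
                at : Point → List T
                at y = filterᵇ (λ x → y ∈ᴾ map inj₁ (Test.hub (τ x))) ts
                at≤c : ∀ y → length (at y) ℕ.≤ c
                at≤c (inj₁ i) = hub-deg i
                at≤c (inj₂ r) = subst (ℕ._≤ c) (sym (#0 (λ x → inj₂ r ∈ᴾ map inj₁ (Test.hub (τ x))) ts λ x _ → ¬true⇒false λ e → let _ , _ , q = ∈-map⁻ inj₁ (∈ᴾ⁻ (map inj₁ (Test.hub (τ x))) e) in r≢i q)) ℕ.z≤n
                  where
                  r≢i : ∀ {r i} → _≡_ {A = Point} (inj₂ r) (inj₁ i) → ⊥
                  r≢i ()
                via : Var → List T
                via o = concatMap at (ends o)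
                cover : ∀ x → x ∈ ts → v ∈ᵇ supp (inj₂ x) ≡ true → x ∈ concatMap via (near v)
                cover x x∈ e = case ball-near (separation (τ x)) v e of λ { (_ , o , o∈ , _ , y , y∈ , i) →
                  ∈-concatMap via o∈ (∈-concatMap at (∈ᴾ⁻ (ends o) i) (∈-filterᵇ⁺ (λ x → y ∈ᴾ map inj₁ (Test.hub (τ x))) x∈ (∈ᴾ⁺ y∈))) }

              total-deg : ∀ v → # (λ x → v ∈ᵇ supp x) indices ℕ.≤ 27 ℕ.* (ℓ ℕ.* ℓ) ℕ.+ 9 ℕ.* (ℓ ℕ.* c)
              total-deg v with bool-case (v ∈ᵇ vars)
              ... | inj₁ e = subst (ℕ._≤ _) (sym (trans (#-++ (λ x → v ∈ᵇ supp x) (map inj₁ hs) (map inj₂ ts)) (cong₂ ℕ._+_ (#-map (λ x → v ∈ᵇ supp x) inj₁ hs) (#-map (λ x → v ∈ᵇ supp x) inj₂ ts))))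
                   (ℕₚ.+-mono-≤ (point-deg v (∈ᵇ⁻ vars e)) (test-deg v (∈ᵇ⁻ vars e)))
              ... | inj₂ e = subst (ℕ._≤ _) (sym (#0 (λ x → v ∈ᵇ supp x) indices λ x _ → ¬true⇒false λ h → ∉ᵇ vars e (inside x h))) ℕ.z≤n
                where
                inside : ∀ x → v ∈ᵇ supp x ≡ true → v ∈ vars
                inside (inj₁ h) e = proj₁ (ball-near (degree-after h) v e)
                inside (inj₂ x) e = proj₁ (ball-near (separation (τ x)) v e)

              result : ∃ λ ω → Supp vars ω × (∀ x → x ∈ indices → (E vars (f x) - ι Θ * σ ≤ f x ω) × (f x ω ≤ E vars (f x) + ι Θ * σ))
              result = simultaneous vars indices f (λ _ → σ) Θ k (27 ℕ.* (ℓ ℕ.* ℓ) ℕ.+ 9 ℕ.* (ℓ ℕ.* c)) (λ x _ → proj₁ (concs x)) 1≤Θ supp (λ x _ → proj₂ (concs x)) total-deg big big′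

            nibble : ∃ λ ω → Supp vars ω × (∀ h → h ∈ hs → (E vars (after h) - ι Θ * σ ≤ after h ω) × (after h ω ≤ E vars (after h) + ι Θ * σ))
                             × (∀ x → x ∈ ts → E vars (Observable.value (separation (τ x))) - ι Θ * σ ≤ Observable.value (separation (τ x)) ω)
            nibble = let ω , s , h = result in ω , s , (λ x x∈ → h (inj₁ x) (∈-++⁺ˡ (∈-map⁺ inj₁ x∈))) , λ x x∈ → proj₁ (h (inj₂ x) (∈-++⁺ʳ (map inj₁ hs) (∈-map⁺ inj₂ x∈)))

        module Extract (ω : Outcome) where

          kept left : List Opt
          kept = filterᵇ (λ o → Ret ω (real o)) os

          cov : Point → Bool
          cov x = any (Ret ω) (Inc x)

          left = filterᵇ (λ o → not (any cov (pts o))) os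

          kept-spec : ∀ {o} → o ∈ kept → o ∈ os × Ret ω (real o) ≡ true
          kept-spec = ∈-filterᵇ⁻ (λ o → Ret ω (real o)) os

          left-spec : ∀ {o} → o ∈ left → o ∈ os × (∀ x → x ∈ pts o → cov x ≡ false)
          left-spec {o} o∈ = let a , b = ∈-filterᵇ⁻ (λ o → not (any cov (pts o))) os o∈ in a , λ x x∈ → any-false cov (pts o) (not-elim b) x∈

          kept-disjoint : ∀ {o o′ x} → o ∈ kept → o′ ∈ kept → o ≢ o′ → x ∈ pts o → x ∈ pts o′ → ⊥
          kept-disjoint {o} {o′} {x} h h′ n x∈ x∈′ = let a , r = kept-spec h ; a′ , r′ = kept-spec h′ in
            [ (λ { refl → n refl }) , (λ k → true≢false k (Ret-indep {ω} (real⁺ a′) r r′)) ]′ (clique {x} {real o} {real o′} (∈ᴾ⁺ x∈) (∈ᴾ⁺ x∈′))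

          kept-left : ∀ {o o′ x} → o ∈ kept → o′ ∈ left → x ∈ pts o → x ∈ pts o′ → ⊥
          kept-left {o} {o′} {x} h h′ x∈ x∈′ = let a , r = kept-spec h in
            true≢false (any⁺ (Ret ω) {real o} (∈-filterᵇ⁺ (inc x) (real⁺ a) (∈ᴾ⁺ x∈)) r) (proj₂ (left-spec h′) x x∈′)

          after-# : ∀ h → after h ω ≡ ι (# (λ o → free h o (Ret ω)) (filterᵇ (on h) os))
          after-# h = sym (ι# (λ o → free h o (Ret ω)) (filterᵇ (on h) os))

          item-left : ∀ i → (∃ λ o → o ∈ kept × on (inj₁ i) o ≡ true) ⊎ (after (inj₁ i) ω ≤ ι (# (on (inj₁ i)) left))
          item-left i = [ (λ e → inj₁ (let v , v∈ , r = any⁻ (Ret ω) (Inc (inj₁ i)) e in go v (proj₁ (Inc-spec {inj₁ i} v∈)) (proj₂ (Inc-spec {inj₁ i} v∈)) r))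
            , (λ e → inj₂ (≤-trans (≤-reflexive (after-# (inj₁ i))) (ι-mono (unique-length (filterᵇ-unique _ (filterᵇ-unique _ unique)) λ o o∈ →
                let a , f = ∈-filterᵇ⁻ (λ o → free (inj₁ i) o (Ret ω)) (filterᵇ (on (inj₁ i)) os) o∈ ; b , h = ∈-filterᵇ⁻ (on (inj₁ i)) os a in
                  ∈-filterᵇ⁺ (on (inj₁ i)) (∈-filterᵇ⁺ (λ o → not (any cov (pts o))) b (not-true (¬true⇒false λ k → let x , x∈ , c = any⁻ cov (pts o) k in clear e o f x x∈ c (x ≟P inj₁ i)))) h)))) ]′ (bool-case (cov (inj₁ i)))
            where
            go : ∀ v → v ∈ vars → inc (inj₁ i) v ≡ true → Ret ω v ≡ true → ∃ λ o → o ∈ kept × on (inj₁ i) o ≡ true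
            go (real o) v∈ h r = o , ∈-filterᵇ⁺ (λ o → Ret ω (real o)) (real⁻ v∈) r , h
            go (ph a) v∈ h r with ∈ᴾ⁻ {inj₁ i} (inj₂ (proj₁ a) ∷ []) h
            ... | here ()
            clear : cov (inj₁ i) ≡ false → ∀ o → free (inj₁ i) o (Ret ω) ≡ true → ∀ x → x ∈ pts o → cov x ≡ true → Dec (x ≡ inj₁ i) → ⊥
            clear e o f x x∈ c (yes refl) = true≢false c e
            clear e o f x x∈ c (no n) = true≢false (any⁺ (λ x → any (Ret ω) (Inc x)) (∈-filterᵇ⁺ (λ x → not (x ==ᴾ inj₁ i)) x∈ (not-true (==ᴾ-false n))) c) (not-elim f)

          res-left : ∀ r → ι (# (on (inj₂ r)) left) ≤ after (inj₂ r) ω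
          res-left r = ≤-trans (ι-mono (unique-length (filterᵇ-unique _ (filterᵇ-unique _ unique)) λ o o∈ →
              let a , h = ∈-filterᵇ⁻ (on (inj₂ r)) left o∈ ; b , f = left-spec a in
                ∈-filterᵇ⁺ (λ o → free (inj₂ r) o (Ret ω)) (∈-filterᵇ⁺ (on (inj₂ r)) b h) (not-true (¬true⇒false λ k → let x , x∈ , c = any⁻ cov (others (inj₂ r) o) k in true≢false c (f x (proj₁ (others-spec {inj₂ r} {o} x∈)))))))
              (≤-reflexive (sym (after-# (inj₂ r))))

          covered-kept : ∀ x → covered x (Ret ω) ≡ true → ∃ λ o → o ∈ kept × x ∈ pts o
          covered-kept x e = let v , v∈ , r = any⁻ (Ret ω) (Reals x) e ; o , o∈ , h , eq = Reals-spec {x} v∈ in o , ∈-filterᵇ⁺ (λ o → Ret ω (real o)) o∈ (subst (λ v → Ret ω v ≡ true) eq r) , ∈ᴾ⁻ (pts o) h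

          kept-covered : ∀ {x o} → o ∈ kept → x ∈ pts o → covered x (Ret ω) ≡ true
          kept-covered {x} {o} o∈ x∈ = let a , r = kept-spec o∈ in any⁺ (Ret ω) (∈-map⁺ real (∈-filterᵇ⁺ (on x) a (∈ᴾ⁺ x∈))) r

        module _ {σ : ℚ} (0<σ : 0ℚ < σ) (24≤σ : ι 2 * ι 12 ≤ σ) (σ² : ι 4608 * ι ℓ ≤ σ * σ) (Θ : ℕ)
          (its : List I) (its-unique : Unique its) (its-deg : ∀ i → i ∈ its → # (on (inj₁ i)) os ≡ ℓ)
          {T : Set} (ts : List T) (ts-unique : Unique ts) (τ : T → Test os ℓ)
          (c : ℕ) (hub-deg : ∀ i → # (λ x → inj₁ i ∈ᴾ map inj₁ (Test.hub (τ x))) ts ℕ.≤ c)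
          (1≤Θ : 1 ℕ.≤ Θ) (big : 24 ℕ.* (27 ℕ.* (ℓ ℕ.* ℓ) ℕ.+ 9 ℕ.* (ℓ ℕ.* c)) ℕ.* k ℕ.≤ 2 ℕ.^ Θ) (big′ : 7 ℕ.≤ 2 ℕ.^ Θ) where

          private
            points : List Point
            points = map inj₁ its ++ map inj₂ rs

            points-unique : Unique points
            points-unique = Uniqueₚ.++⁺ (Uniqueₚ.map⁺ Sumₚ.inj₁-injective its-unique) (Uniqueₚ.map⁺ Sumₚ.inj₂-injective rs-unique)
               λ { (x , y) → let _ , _ , e = ∈-map⁻ inj₁ x ; _ , _ , e′ = ∈-map⁻ inj₂ y in i≢r (trans (sym e) e′) }
              where
              i≢r : ∀ {i r} → _≡_ {A = Point} (inj₁ i) (inj₂ r) → ⊥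
              i≢r ()

            a : ℚ
            a = ι Θ * σ

            summarise : ∀ ω → (∀ h → h ∈ points → (E vars (after h) - a ≤ after h ω) × (after h ω ≤ E vars (after h) + a)) →
                        (∀ x → x ∈ ts → E vars (Observable.value (separation (τ x))) - a ≤ Observable.value (separation (τ x)) ω) → Summary os ℓ t its a ts τ
            summarise ω concs tests = record
              { p = p ; κ = κ ; ρ = ρ ; 0≤p = 0≤p ; pℓ = pℓ ; ρ≡ = refl
              ; 1≤128κ = κ-lower 0≤p pℓ (ℕₚ.≤-trans (ℕₚ.m≤m+n 6 12) 18≤ℓ) (proj₁ (M-bounds ℓ t 1≤t t≤ℓ))
              ; 2κ≤1 = κ-upper 0≤p pℓ (ℕₚ.≤-trans (ℕₚ.m≤m+n 2 16) 18≤ℓ) (proj₂ (M-bounds ℓ t 1≤t t≤ℓ))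
              ; kept = kept ; left = left
              ; kept-in = λ h → proj₁ (kept-spec h)
              ; left-in = λ h → proj₁ (left-spec h)
              ; left-linear = Linear-⊆ _ lin
              ; kept-apart = λ h h′ n x → kept-disjoint {x = x} h h′ n
              ; left-apart = λ h h′ x → kept-left {x = x} h h′
              ; item-after = λ i i∈ → [ inj₁ , (λ h → inj₂ (≤-trans (-ʳ-mono (E-item i (its-deg i i∈)) (≤-refl {a})) (≤-trans (proj₁ (concs (inj₁ i) (∈-++⁺ˡ (∈-map⁺ inj₁ i∈)))) h))) ]′ (item-left i)
              ; res-after = after-res
              ; test-after = λ x x∈ → ≤-trans (-ʳ-mono (E-separation (τ x)) (≤-refl {a})) (≤-trans (tests x x∈) (≤-reflexive (trans (sym (ι# (λ ab → covered (inj₂ (proj₁ ab)) (Ret ω) ∧ not (covered (inj₂ (proj₂ ab)) (Ret ω))) (Test.pairs (τ x))))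
                  (cong ι (#-cong (Test.pairs (τ x)) λ ab _ → cong₂ (λ y z → y ∧ not z) (same (inj₂ (proj₁ ab))) (same (inj₂ (proj₂ ab))))))))
              }
              where
              open Extract ω
              same : ∀ x → covered x (Ret ω) ≡ any (on x) kept
              same x = bool-ext (λ e → let o , o∈ , x∈ = covered-kept x e in any⁺ (on x) o∈ (∈ᴾ⁺ x∈)) (λ e → let o , o∈ , h = any⁻ (on x) kept e in kept-covered {x} {o} o∈ (∈ᴾ⁻ {x} (pts o) h))
              after-res : ∀ r → ι (# (on (inj₂ r)) left) ≤ ι t * ((1ℚ - κ) * (1ℚ - ρ)) + ι 19 + a
              after-res r = [ (λ e → let o , o∈ , h = any⁻ (on (inj₂ r)) os e in
                 ≤-trans (res-left r) (≤-trans (proj₂ (concs (inj₂ r) (∈-++⁺ʳ (map inj₁ its) (∈-map⁺ inj₂ (rs-all {o} o∈ (∈ᴾ⁻ (pts o) h)))))) (+-mono (E-res r) (≤-refl {a}))))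
                 , (λ e → ≤-trans (≤-reflexive (trans (cong ι (#0 (on (inj₂ r)) left λ o o∈ → any-false (on (inj₂ r)) os e (proj₁ (left-spec o∈)))) ι0))
                 (0≤+ (0≤+ (0≤* (0≤ι t) (0≤* (diff κ≤1) (diff (≤-trans ρ≤κ κ≤1)))) (0≤ι 19)) (0≤* (0≤ι Θ) (ℚₚ.<⇒≤ 0<σ)))) ]′ (bool-case (any (on (inj₂ r)) os))

          summary : Summary os ℓ t its a ts τ
          summary = let ω , _ , h , h′ = nibble 0<σ 24≤σ σ² Θ points points-unique ts ts-unique τ c hub-deg 1≤Θ big big′ in summarise ω h h′

  Linear-sub : ∀ {os os′} → Linear os → Unique os′ → (∀ {o} → o ∈ os′ → o ∈ os) → Linear os′
  Linear-sub L u s = record { unique = u ; distinct = λ o∈ → distinct (s o∈) ; linear = λ o∈ o′∈ → linear (s o∈) (s o′∈) }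
    where open Linear L

  module _ (ℓ : ℕ) where

    options : List Opt → I → List Opt
    options os i = take ℓ (filterᵇ (on (inj₁ i)) os)

    trim : List I → List Opt → List Opt
    trim its os = concatMap (options os) its

    options-spec : ∀ {os i o} → o ∈ options os i → o ∈ os × on (inj₁ i) o ≡ true
    options-spec {os} {i} h = ∈-filterᵇ⁻ (on (inj₁ i)) os (∈-take ℓ _ h)

    options-unique : ∀ {os} i → Unique os → Unique (options os i)
    options-unique i u = Uniqueₚ.take⁺ ℓ (filterᵇ-unique (on (inj₁ i)) u)

    options-size : ∀ {os} i → ℓ ℕ.≤ # (on (inj₁ i)) os → length (options os i) ≡ ℓ
    options-size {os} i h = trans (length-take ℓ (filterᵇ (on (inj₁ i)) os)) (ℕₚ.m≤n⇒m⊓n≡m h)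

    trim-spec : ∀ {os} its {o} → o ∈ trim its os → o ∈ os × proj₁ o ∈ its
    trim-spec {os} its {o} h = let i , i∈ , k = ∈-concatMap⁻ (options os) its h ; a , b = options-spec {os} {i} k in a , subst (_∈ its) (sym (on-item i o b)) i∈

    trim-unique : ∀ {os its} → Unique os → Unique its → Unique (trim its os)
    trim-unique {os} u v = concatMap-unique (options os) proj₁ v (λ i _ → options-unique i u) λ i o _ o∈ → on-item i o (proj₂ (options-spec {os} {i} o∈))

    trim-item : ∀ {os its i} → Unique its → (∀ i → i ∈ its → ℓ ℕ.≤ # (on (inj₁ i)) os) → i ∈ its → # (on (inj₁ i)) (trim its os) ≡ ℓ
    trim-item {os} {i ∷ its} (i∉ ∷ u) h (here refl) = trans (#-++ (on (inj₁ i)) (options os i) (trim its os)) (trans (cong₂ ℕ._+_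
        (trans (#-all (options os i) λ o o∈ → proj₂ (options-spec {os} {i} o∈)) (options-size {os} i (h i (here refl))))
        (#0 (on (inj₁ i)) (trim its os) λ o o∈ → ¬true⇒false λ e → All.lookup i∉ (proj₂ (trim-spec {os} its o∈)) (sym (on-item i o e)))) (ℕₚ.+-identityʳ ℓ))
    trim-item {os} {j ∷ its} {i} (j∉ ∷ u) h (there i∈) = trans (#-++ (on (inj₁ i)) (options os j) (trim its os)) (cong₂ ℕ._+_
        (#0 (on (inj₁ i)) (options os j) λ o o∈ → ¬true⇒false λ e → All.lookup j∉ i∈ (trans (sym (on-item j o (proj₂ (options-spec {os} {j} o∈)))) (on-item i o e)))
        (trim-item {os} u (λ k k∈ → h k (there k∈)) i∈))

  #-sub : ∀ (f : Opt → Bool) {os os′} → Unique os′ → (∀ {o} → o ∈ os′ → o ∈ os) → # f os′ ℕ.≤ # f os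
  #-sub f {os} {os′} u s = unique-length (filterᵇ-unique f u) λ o o∈ → let a , b = ∈-filterᵇ⁻ f os′ o∈ in ∈-filterᵇ⁺ f (s a) b

  ∑-concatMap : ∀ {A B : Set} (f : B → Bool) (g : A → List B) xs → ∑ xs (λ x → ι (# f (g x))) ≡ ι (# f (concatMap g xs))
  ∑-concatMap f g [] = sym ι0
  ∑-concatMap f g (x ∷ xs) = trans (cong (ι (# f (g x)) +_) (∑-concatMap f g xs)) (trans (sym (ι-+ (# f (g x)) _)) (cong ι (sym (#-++ f (g x) (concatMap g xs)))))

  private
    res : Opt → List Point
    res (_ , a , b) = inj₂ a ∷ inj₂ b ∷ []

    clash : Opt → Opt → Bool
    clash o o′ = any (λ x → x ∈ᴾ res o′) (res o)

    clash-sym : ∀ o o′ → clash o o′ ≡ true → clash o′ o ≡ true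
    clash-sym o o′ e = let x , x∈ , h = any⁻ (λ x → x ∈ᴾ res o′) (res o) e in any⁺ (λ x → x ∈ᴾ res o) (∈ᴾ⁻ {x} (res o′) h) (∈ᴾ⁺ {x} {res o} x∈)

    apart-points : ∀ o o′ → proj₁ o ≢ proj₁ o′ → clash o o′ ≡ false → Disjoint o o′
    apart-points o o′ n c x (here refl) (here refl) = n refl
    apart-points o o′ n c x (here refl) (there (here ()))
    apart-points o o′ n c x (here refl) (there (there (here ())))
    apart-points o o′ n c x (there h) (there k) = true≢false (any⁺ (λ x → x ∈ᴾ res o′) h (∈ᴾ⁺ {x} {res o′} k)) c
    apart-points o o′ n c x (there (here refl)) (here ())
    apart-points o o′ n c x (there (there (here refl))) (here ())

  finish : ∀ {os its ℓ t} → Linear os → Unique its → 1 ℕ.≤ ℓ → (∀ i → i ∈ its → ℓ ℕ.≤ # (on (inj₁ i)) os) →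
           (∀ r → # (on (inj₂ r)) os ℕ.≤ t) → 8 ℕ.* t ℕ.≤ ℓ → Matching os its
  finish {its = []} _ _ _ _ _ _ = record { edges = [] ; within = λ () ; apart = λ () ; covers = λ _ () }
  finish {os} {i₀ ∷ is} {ℓ} {t} L u 1≤ℓ rich sparse 8t≤ℓ = record
    { edges = map a its
    ; within = λ h → let i , i∈ , e = ∈-map⁻ a h in subst (_∈ os) (sym e) (proj₁ (options-spec ℓ {os} {i} (a∈ i i∈)))
    ; apart = λ h h′ n → let i , i∈ , e = ∈-map⁻ a h ; j , j∈ , e′ = ∈-map⁻ a h′ in go h h′ n i∈ j∈ e e′
    ; covers = λ i i∈ → a i , ∈-map⁺ a i∈ , proj₂ (options-spec ℓ {os} {i} (a∈ i i∈))
    }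
    where
    open Linear L
    its = i₀ ∷ is
    few : ∀ i o → i ∈ its → o ∈ options ℓ os i → ∑ its (λ j → ι (# (clash o) (options ℓ os j))) ≤ ι (2 ℕ.* t)
    few i o@(k , x , y) i∈ o∈ = ≤-trans (≤-reflexive (∑-concatMap (clash o) (options ℓ os) its)) (ι-mono (ℕₚ.≤-trans
       (unique-length {ys = filterᵇ (on (inj₂ x)) os ++ filterᵇ (on (inj₂ y)) os} (filterᵇ-unique (clash o) (trim-unique ℓ unique u)) λ o′ h →
          let b , c = ∈-filterᵇ⁻ (clash o) (trim ℓ its os) h ; z , z∈ , d = any⁻ (λ z → z ∈ᴾ res o′) (res o) c in
            place o′ (proj₁ (trim-spec ℓ {os} its b)) z z∈ (there (∈ᴾ⁻ {z} (res o′) d)))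
       (subst (ℕ._≤ 2 ℕ.* t) (sym (length-++ (filterᵇ (on (inj₂ x)) os))) (subst (# (on (inj₂ x)) os ℕ.+ # (on (inj₂ y)) os ℕ.≤_) (cong (t ℕ.+_) (sym (ℕₚ.+-identityʳ t))) (ℕₚ.+-mono-≤ (sparse x) (sparse y))))))
      where
      place : ∀ o′ → o′ ∈ os → ∀ z → z ∈ res o → z ∈ pts o′ → o′ ∈ filterᵇ (on (inj₂ x)) os ++ filterᵇ (on (inj₂ y)) os
      place o′ b z (here refl) h = ∈-++⁺ˡ (∈-filterᵇ⁺ (on (inj₂ x)) b (∈ᴾ⁺ {inj₂ x} {pts o′} h))
      place o′ b z (there (here refl)) h = ∈-++⁺ʳ (filterᵇ (on (inj₂ x)) os) (∈-filterᵇ⁺ (on (inj₂ y)) b (∈ᴾ⁺ {inj₂ y} {pts o′} h))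
    size : ∀ i → i ∈ its → length (options ℓ os i) ≡ ℓ
    size i i∈ = options-size ℓ {os} i (rich i i∈)
    default : Opt
    default = head (options ℓ os i₀) (subst (1 ℕ.≤_) (sym (size i₀ (here refl))) 1≤ℓ)
      where
      head : ∀ (xs : List Opt) → 1 ℕ.≤ length xs → Opt
      head (x ∷ _) _ = x
    transversal = Final.transversal _≟I_ _≟O_ its u (options ℓ os) (λ i _ → options-unique ℓ {os} i unique) ℓ 1≤ℓ size clash clash-sym t few 8t≤ℓ default
    a = proj₁ transversal
    a∈ : ∀ i → i ∈ its → a i ∈ options ℓ os i
    a∈ = proj₁ (proj₂ transversal)
    item : ∀ i → i ∈ its → proj₁ (a i) ≡ i
    item i i∈ = on-item i (a i) (proj₂ (options-spec ℓ {os} {i} (a∈ i i∈)))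
    go : ∀ {o o′ i j} → o ∈ map a its → o′ ∈ map a its → o ≢ o′ → i ∈ its → j ∈ its → o ≡ a i → o′ ≡ a j → Disjoint o o′
    go {i = i} {j} _ _ n i∈ j∈ refl refl = apart-points (a i) (a j) (λ e → n (cong a (trans (sym (item i i∈)) (trans e (item j j∈)))))
        (proj₂ (proj₂ transversal) i j i∈ j∈ λ { refl → n refl })

  one-round : ∀ {os its ℓ t σ} Θ → Linear os → Unique its → (∀ i → i ∈ its → ℓ ℕ.≤ # (on (inj₁ i)) os) → (∀ r → # (on (inj₂ r)) os ℕ.≤ t) →
              1 ℕ.≤ t → t ℕ.≤ ℓ → 18 ℕ.≤ ℓ → 0ℚ < σ → ι 2 * ι 12 ≤ σ → ι 4608 * ι ℓ ≤ σ * σ →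
              1 ℕ.≤ Θ → 24 ℕ.* (27 ℕ.* (ℓ ℕ.* ℓ) ℕ.+ 9 ℕ.* (ℓ ℕ.* 0)) ℕ.* (2 ℕ.* ℓ ℕ.* ℓ ℕ.* (3 ℕ.* ℓ)) ℕ.≤ 2 ℕ.^ Θ → 7 ℕ.≤ 2 ℕ.^ Θ →
              Summary (trim ℓ its os) ℓ t its (ι Θ * σ) {⊥} [] (λ ())
  one-round {os} {its} {ℓ} {t} {σ} Θ L u rich sparse 1≤t t≤ℓ 18≤ℓ 0<σ 24≤σ σ² 1≤Θ big big′ = from (inverse (ι-pos′ (ℕₚ.≤-trans 1≤t t≤ℓ)))
    where
    os₁ = trim ℓ its os
    lin : Linear os₁
    lin = Linear-sub L (trim-unique ℓ (Linear.unique L) u) λ h → proj₁ (trim-spec ℓ {os} its h)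
    exact : ∀ {i} → i ∈ its → # (on (inj₁ i)) os₁ ≡ ℓ
    exact = trim-item ℓ {os} u rich
    item-deg : ∀ {o i} → o ∈ os₁ → inj₁ i ∈ pts o → # (on (inj₁ i)) os₁ ≡ ℓ
    item-deg {o} o∈ i∈ = exact (subst (_∈ its) (item-of {o = o} i∈) (proj₂ (trim-spec ℓ {os} its o∈)))
    res-deg : ∀ r → # (on (inj₂ r)) os₁ ℕ.≤ t
    res-deg r = ℕₚ.≤-trans (#-sub (on (inj₂ r)) {os} (trim-unique ℓ (Linear.unique L) u) λ h → proj₁ (trim-spec ℓ {os} its h)) (sparse r)
    from : (Σ ℚ λ p → (ι ℓ * p ≡ 1ℚ) × (0ℚ < p)) → Summary os₁ ℓ t its (ι Θ * σ) {⊥} [] (λ ())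
    from (p , ℓp , 0<p) = Regular.Nibble.summary p (ℚₚ.<⇒≤ 0<p) (≤1-from (ℚₚ.<⇒≤ 0<p) pℓ (ℕₚ.≤-trans 1≤t t≤ℓ)) os₁ lin ℓ t 1≤t t≤ℓ (resources os₁) (resources-unique os₁) (λ {o} o∈ → resources-all {os₁} {o} o∈) item-deg res-deg
        pℓ 18≤ℓ 0<σ 24≤σ σ² Θ its u (λ i → exact) [] [] (λ ()) 0 (λ _ → ℕ.z≤n) 1≤Θ big big′
      where
      pℓ : p * ι ℓ ≡ 1ℚ
      pℓ = trans (ℚₚ.*-comm p (ι ℓ)) ℓp

  join : ∀ {os os₁ its a ℓ t} → (∀ {o} → o ∈ os₁ → o ∈ os) → (sm : Summary os₁ ℓ t its a {⊥} [] (λ ())) →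
         Matching (Summary.left sm) (filterᵇ (λ i → not (any (on (inj₁ i)) (Summary.kept sm))) its) → Matching os its
  join {os} {os₁} {its} sub sm next = record
    { edges = kept ++ edges
    ; within = λ h → [ (λ k → sub (kept-in k)) , (λ k → sub (left-in (within k))) ]′ (∈-++⁻ kept h)
    ; apart = λ h h′ n → apart′ n (∈-++⁻ kept h) (∈-++⁻ kept h′)
    ; covers = λ i i∈ → cover i i∈ (bool-case (any (on (inj₁ i)) kept))
    }
    where
    open Summary sm
    open Matching next
    apart′ : ∀ {o o′} → o ≢ o′ → o ∈ kept ⊎ o ∈ edges → o′ ∈ kept ⊎ o′ ∈ edges → Disjoint o o′
    apart′ n (inj₁ h) (inj₁ h′) = kept-apart h h′ n
    apart′ n (inj₁ h) (inj₂ h′) = left-apart h (within h′)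
    apart′ n (inj₂ h) (inj₁ h′) = λ x x∈ x∈′ → left-apart h′ (within h) x x∈′ x∈
    apart′ n (inj₂ h) (inj₂ h′) = apart h h′ n
    cover : ∀ i → i ∈ its → any (on (inj₁ i)) kept ≡ true ⊎ any (on (inj₁ i)) kept ≡ false → ∃ λ o → o ∈ kept ++ edges × on (inj₁ i) o ≡ true
    cover i i∈ (inj₁ e) = let o , o∈ , h = any⁻ (on (inj₁ i)) kept e in o , ∈-++⁺ˡ o∈ , h
    cover i i∈ (inj₂ e) = let o , o∈ , h = covers i (∈-filterᵇ⁺ (λ i → not (any (on (inj₁ i)) kept)) i∈ (not-true e)) in o , ∈-++⁺ʳ kept o∈ , h

  module _ (Θ Lm : ℕ) (1≤Θ : 1 ℕ.≤ Θ) (big : 24 ℕ.* (27 ℕ.* (Lm ℕ.* Lm) ℕ.+ 9 ℕ.* (Lm ℕ.* 0)) ℕ.* (2 ℕ.* Lm ℕ.* Lm ℕ.* (3 ℕ.* Lm)) ℕ.≤ 2 ℕ.^ Θ) (big′ : 7 ℕ.≤ 2 ℕ.^ Θ) where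

    big-mono : ∀ {ℓ} → ℓ ℕ.≤ Lm → 24 ℕ.* (27 ℕ.* (ℓ ℕ.* ℓ) ℕ.+ 9 ℕ.* (ℓ ℕ.* 0)) ℕ.* (2 ℕ.* ℓ ℕ.* ℓ ℕ.* (3 ℕ.* ℓ)) ℕ.≤ 2 ℕ.^ Θ
    big-mono h = ℕₚ.≤-trans (ℕₚ.*-mono-≤ (ℕₚ.*-monoʳ-≤ 24 (ℕₚ.+-mono-≤ (ℕₚ.*-monoʳ-≤ 27 (ℕₚ.*-mono-≤ h h)) (ℕₚ.*-monoʳ-≤ 9 (ℕₚ.*-monoˡ-≤ 0 h)))) (ℕₚ.*-mono-≤ (ℕₚ.*-mono-≤ (ℕₚ.*-monoʳ-≤ 2 h) h) (ℕₚ.*-monoʳ-≤ 3 h))) big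

    Goal : ℕ → Set
    Goal f = ∀ {os its ℓ t s} → Linear os → Unique its → (∀ i → i ∈ its → ℓ ℕ.≤ # (on (inj₁ i)) os) → (∀ r → # (on (inj₂ r)) os ℕ.≤ t) →
              0ℚ < s → ι ℓ ≤ s * s → ι 1023 ^ f * s ≤ ι 1024 ^ f → ι t + (ι 340 * ι f + ι 400) * (ι Θ * s) ≤ ι ℓ → ℓ ℕ.≤ Lm → Matching os its

    private
      advance : ∀ f → Goal f → ∀ {os os₁ its ℓ t s} → (∀ {o} → o ∈ os₁ → o ∈ os) → Unique its →
                0ℚ < s → ι ℓ ≤ s * s → ι 1023 ^ suc f * s ≤ ι 1024 ^ suc f → ι t + (ι 340 * ι (suc f) + ι 400) * (ι Θ * s) ≤ ι ℓ → ℓ ℕ.≤ Lm →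
                ℓ ℕ.≤ 8 ℕ.* t → Summary os₁ ℓ t its (ι Θ * (ι 68 * s)) {⊥} [] (λ ()) → Matching os its
      advance f rec {its = its} {ℓ} {t} {s} sub u 0<s ℓ≤s² fuel gap ℓ≤Lm ℓ≤8t sm = proceed (floor x 0≤x) (floor y 0≤y)
        where
        open Summary sm
        open Params {Θ} {ℓ} {s} {ι 340 * ι (suc f)} {t} 1≤Θ 0<s ℓ≤s² (0≤* (0≤ι 340) (0≤ι (suc f))) gap
        open Rates {p} {κ} {ρ} 0≤p pℓ ρ≡ 1≤128κ 2κ≤1
        more : ι t + (ι 340 + (ι 340 * ι f + ι 400)) * X ≤ ι ℓ
        more = ≤-trans (≤-reflexive (cong (λ z → ι t + z * X) (trans (l (ι 340) (ι f) (ι 400)) (cong (λ z → ι 340 * z + ι 400) (sym (ι-suc f)))))) gap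
          where
          l : ∀ a f c → a + (a * f + c) ≡ a * (1ℚ + f) + c
          l = solve-∀ ℚ-ring
        proceed : (∃ λ n → (ι n ≤ x) × (x ≤ 1ℚ + ι n)) → (∃ λ n → (ι n ≤ y) × (y ≤ 1ℚ + ι n)) → Matching _ its
        proceed (ℓ′ , ℓ′≤x , x≤1+ℓ′) (n , n≤y , y≤1+n) = join sub sm (rec {t = suc n} left-linear (filterᵇ-unique _ u)
           (λ i i∈ → let b , m = ∈-filterᵇ⁻ (λ i → not (any (on (inj₁ i)) kept)) its i∈ in
              [ (λ { (o , o∈ , h) → ⊥-elim (true≢false (any⁺ (on (inj₁ i)) o∈ h) (not-elim m)) }) , (λ h → ι-cancel (≤-trans ℓ′≤x h)) ]′ (item-after i b))
           (λ r → ι-cancel (≤-trans (res-after r) (≤-trans y≤1+n (≤-reflexive (sym (ι-suc n))))))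
           (*-pos 0<Q 0<s) (scale-after {ℓ′} ℓ′≤x) (fuel-after f ℓ≤8t fuel)
           (gap-after {ℓ′} {suc n} {ι 340 * ι f + ι 400} x≤1+ℓ′ (≤-trans (≤-reflexive (ι-suc n)) (+-mono (≤-refl {1ℚ}) n≤y)) more)
           (ℕₚ.≤-trans (size-after {ℓ′} ℓ′≤x) ℓ≤Lm))

    iterate : ∀ f → Goal f
    iterate f {os} {its} {ℓ} {t} {s} L u rich sparse 0<s ℓ≤s² fuel gap ℓ≤Lm with 8 ℕ.* t ℕₚ.≤? ℓ
    ... | yes h = finish L u (Params.1≤ℓ {Θ} {ℓ} {s} {ι 340 * ι f} {t} 1≤Θ 0<s ℓ≤s² (0≤* (0≤ι 340) (0≤ι f)) gap) rich sparse h
    iterate zero {os} {its} {ℓ} {t} {s} L u rich sparse 0<s ℓ≤s² fuel gap ℓ≤Lm | no _ =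
        ⊥-elim (ℕₚ.<⇒≱ (ℕₚ.≤-trans (ℕₚ.m≤m+n 2 398) 400≤ℓ) (ι-cancel (≤-trans ℓ≤s² (≤-trans (*-mono 0≤s 0≤1 s≤1 s≤1) (≤-reflexive (trans (ℚₚ.*-identityˡ 1ℚ) (sym ι1)))))))
      where
      open Params {Θ} {ℓ} {s} {ι 340 * ι 0} {t} 1≤Θ 0<s ℓ≤s² (0≤* (0≤ι 340) (0≤ι 0)) gap
      s≤1 : s ≤ 1ℚ
      s≤1 = ≤-trans (≤-reflexive (sym (ℚₚ.*-identityˡ s))) fuel
    iterate (suc f) {os} {its} {ℓ} {t} {s} L u rich sparse 0<s ℓ≤s² fuel gap ℓ≤Lm | no 8t≰ℓ =
        advance f (iterate f) (λ h → proj₁ (trim-spec ℓ {os} its h)) u 0<s ℓ≤s² fuel gap ℓ≤Lm (ℕₚ.<⇒≤ (ℕₚ.≰⇒> 8t≰ℓ))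
          (one-round Θ L u rich sparse (1≤t t 8t≰ℓ) t≤ℓ (ℕₚ.≤-trans (ℕₚ.m≤m+n 18 382) 400≤ℓ) 0<σ 24≤σ σ² 1≤Θ (big-mono ℓ≤Lm) big′)
      where
      open Params {Θ} {ℓ} {s} {ι 340 * ι (suc f)} {t} 1≤Θ 0<s ℓ≤s² (0≤* (0≤ι 340) (0≤ι (suc f))) gap
      1≤t : ∀ t → ¬ (8 ℕ.* t ℕ.≤ ℓ) → 1 ℕ.≤ t
      1≤t zero h = ⊥-elim (h ℕ.z≤n)
      1≤t (suc _) _ = ℕ.s≤s ℕ.z≤n

open Greedy

module _ {n : ℕ} (G : Graph n) where

  open Colouring G

  module Blocking (k : ℕ) (L : Fin n → Fin n → List ℕ) (L-size : ∀ u v → Edge G u v → Unique (L u v) × length (L u v) ≡ k)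
    {Δ : ℕ} (deg≤ : ∀ v → degree G v ℕ.≤ Δ) (Θ r₁ : ℕ) (1≤Θ : 1 ℕ.≤ Θ) (1≤r₁ : 1 ℕ.≤ r₁) (k≤9r² : k ℕ.≤ 9 ℕ.* (r₁ ℕ.* r₁))
    (m₀≤k : r₁ ℕ.* (suc (2 ℕ.* Θ) ℕ.* suc (2 ℕ.* Θ)) ℕ.≤ k) (big : 24 ℕ.* (Δ ℕ.+ Δ) ℕ.* k ℕ.≤ 2 ℕ.^ Θ) (big′ : 7 ℕ.≤ 2 ℕ.^ Θ)
    (ts : List (Fin n × Fin n)) (ts-unique : Unique ts) (ts-edge : ∀ {u v} → (u , v) ∈ ts → Edge G u v)
    (sep : Fin n → Fin n → List ℕ) (sep-unique : ∀ u v → Unique (sep u v))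
    (sep-many : ∀ {u v} → (u , v) ∈ ts → r₁ ℕ.* (suc (2 ℕ.* Θ) ℕ.* suc (2 ℕ.* Θ)) ℕ.≤ length (sep u v)) where

    w m₀ : ℕ
    w = suc (2 ℕ.* Θ)
    m₀ = r₁ ℕ.* (w ℕ.* w)

    R : Set
    R = V × ℕ

    Observed : Set
    Observed = (V × V) ⊎ (V × V)

    edges : List (V × V)
    edges = filterᵇ (λ e → Graph.Adj G (proj₁ e) (proj₂ e)) (cartesianProduct (allFin n) (allFin n))

    edges-edge : ∀ {e} → e ∈ edges → Edge G (proj₁ e) (proj₂ e)
    edges-edge {e} h = proj₂ (∈-filterᵇ⁻ (λ e → Graph.Adj G (proj₁ e) (proj₂ e)) (cartesianProduct (allFin n) (allFin n)) h)

    xs : List Observed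
    xs = map inj₁ edges ++ map inj₂ ts

    W : Observed → List R
    W (inj₁ (u , v)) = map (u ,_) (L u v)
    W (inj₂ (u , v)) = map (u ,_) (take m₀ (sep u v))

    vars : List R
    vars = deduplicate (Prodₚ.≡-dec Finₚ._≟_ ℕ._≟_) (concatMap W xs)

    σ : Observed → ℚ
    σ (inj₁ _) = ι (6 ℕ.* r₁)
    σ (inj₂ _) = ι (2 ℕ.* w)

    by : ∀ {P : Observed → Set} → (∀ e → e ∈ edges → P (inj₁ e)) → (∀ e → e ∈ ts → P (inj₂ e)) → ∀ x → x ∈ xs → P x
    by {P} f g x x∈ = [ (λ h → let e , e∈ , q = ∈-map⁻ inj₁ h in subst P (sym q) (f e e∈)) , (λ h → let e , e∈ , q = ∈-map⁻ inj₂ h in subst P (sym q) (g e e∈)) ]′ (∈-++⁻ (map inj₁ edges) x∈)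

    L-length : ∀ e → e ∈ edges → length (W (inj₁ e)) ≡ k
    L-length e e∈ = trans (length-map (proj₁ e ,_) (L (proj₁ e) (proj₂ e))) (proj₂ (L-size (proj₁ e) (proj₂ e) (edges-edge e∈)))

    S-length : ∀ e → e ∈ ts → length (W (inj₂ e)) ≡ m₀
    S-length e e∈ = trans (length-map (proj₁ e ,_) (take m₀ (sep (proj₁ e) (proj₂ e)))) (trans (length-take m₀ (sep (proj₁ e) (proj₂ e))) (ℕₚ.m≤n⇒m⊓n≡m (sep-many e∈)))

    xs-unique : Unique xs
    xs-unique = Uniqueₚ.++⁺ (Uniqueₚ.map⁺ Sumₚ.inj₁-injective (filterᵇ-unique _ (Uniqueₚ.cartesianProduct⁺ (Uniqueₚ.allFin⁺ n) (Uniqueₚ.allFin⁺ n)))) (Uniqueₚ.map⁺ Sumₚ.inj₂-injective ts-unique)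
        λ { (x , y) → let _ , _ , e = ∈-map⁻ inj₁ x ; _ , _ , e′ = ∈-map⁻ inj₂ y in clash (trans (sym e) e′) }
      where
      clash : ∀ {a b : V × V} → _≡_ {A = Observed} (inj₁ a) (inj₂ b) → ⊥
      clash ()

    _≟R_ : (a b : R) → Dec (a ≡ b)
    _≟R_ = Prodₚ.≡-dec Finₚ._≟_ ℕ._≟_

    private
      module EqR = Eq _≟R_

    deg : ∀ o → # (λ x → EqR._∈ᵇ_ o (W x)) xs ℕ.≤ Δ ℕ.+ Δ
    deg (u , y) = ℕₚ.≤-trans (#-≤ (λ x → EqR._∈ᵇ_ (u , y) (W x)) {ys = map (λ z → inj₁ (u , z)) (nbrs u) ++ map (λ z → inj₂ (u , z)) (nbrs u)} xs-unique (λ x x∈ h → by {P = λ x → (u , y) ∈ W x → x ∈ _}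
           (λ e e∈ k → let _ , _ , q = ∈-map⁻ (proj₁ e ,_) k in ∈-++⁺ˡ (left e (edges-edge e∈) (cong proj₁ q)))
           (λ e e∈ k → let _ , _ , q = ∈-map⁻ (proj₁ e ,_) k in ∈-++⁺ʳ (map (λ z → inj₁ (u , z)) (nbrs u)) (right e (ts-edge e∈) (cong proj₁ q))) x x∈ (EqR.∈ᵇ⁻ (W x) h)))
        (ℕₚ.≤-trans (ℕₚ.≤-reflexive (trans (length-++ (map (λ z → inj₁ (u , z)) (nbrs u))) (cong₂ ℕ._+_ (length-map _ (nbrs u)) (length-map _ (nbrs u))))) (ℕₚ.+-mono-≤ (deg≤ u) (deg≤ u)))
      where
      left : ∀ e → Edge G (proj₁ e) (proj₂ e) → u ≡ proj₁ e → inj₁ e ∈ map (λ z → inj₁ (u , z)) (nbrs u)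
      left e d refl = ∈-map⁺ (λ z → inj₁ (u , z)) (∈-nbrs d)
      right : ∀ e → Edge G (proj₁ e) (proj₂ e) → u ≡ proj₁ e → inj₂ e ∈ map (λ z → inj₂ (u , z)) (nbrs u)
      right e d refl = ∈-map⁺ (λ z → inj₂ (u , z)) (∈-nbrs d)

    Blocked : Set
    Blocked = Σ (R → Bool) λ Z → (∀ u v → Edge G u v → # (λ x → Z (u , x)) (L u v) ℕ.≤ 15 ℕ.* (Θ ℕ.* r₁)) × (∀ {u v} → (u , v) ∈ ts → ∃ λ x → x ∈ sep u v × Z (u , x) ≡ true)

    private
      module With (p : ℚ) (rp : ι r₁ * p ≡ 1ℚ) (0<p : 0ℚ < p) where

        0≤p = ℚₚ.<⇒≤ 0<p

        kp : ι k * p ≤ ι (9 ℕ.* r₁)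
        kp = ≤-trans (*-monoˡ 0≤p (ι-mono k≤9r²)) (≤-reflexive (trans (cong (_* p) (trans (ι-* 9 (r₁ ℕ.* r₁)) (cong (ι 9 *_) (ι-* r₁ r₁))))
          (trans (l (ι 9) (ι r₁) p) (trans (cong (λ z → ι 9 * ι r₁ * z) rp) (trans (ℚₚ.*-identityʳ (ι 9 * ι r₁)) (sym (ι-* 9 r₁)))))))
          where
          l : ∀ c r p → c * (r * r) * p ≡ c * r * (r * p)
          l = solve-∀ ℚ-ring

        m₀p : ι m₀ * p ≡ ι (w ℕ.* w)
        m₀p = trans (cong (_* p) (ι-* r₁ (w ℕ.* w))) (trans (l (ι r₁) (ι (w ℕ.* w)) p) (trans (cong (ι (w ℕ.* w) *_) rp) (ℚₚ.*-identityʳ (ι (w ℕ.* w)))))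
          where
          l : ∀ r x p → r * x * p ≡ x * (r * p)
          l = solve-∀ ℚ-ring

        p≤1 : p ≤ 1ℚ
        p≤1 = ≤-trans (≤-reflexive (sym (ℚₚ.*-identityˡ p))) (≤-trans (*-monoˡ 0≤p (1≤ι 1≤r₁)) (≤-reflexive rp))

        fours : ∀ x → x * (ι 2 * 1ℚ) * (ι 2 * 1ℚ) ≡ ι 4 * x
        fours x = trans (l (ι 2) x) (cong (_* x) (sym (ι-* 2 2)))
          where
          l : ∀ c x → x * (c * 1ℚ) * (c * 1ℚ) ≡ c * c * x
          l = solve-∀ ℚ-ring

        two : ∀ {m} → 2 ℕ.≤ m → ι 2 * 1ℚ ≤ ι m
        two {m} h = ≤-trans (≤-reflexive (ℚₚ.*-identityʳ (ι 2))) (ι-mono h)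

        2≤6r : 2 ℕ.≤ 6 ℕ.* r₁
        2≤6r = ℕₚ.≤-trans (ℕₚ.m≤m+n 2 4) (ℕₚ.≤-trans (ℕₚ.≤-reflexive (sym (ℕₚ.*-identityʳ 6))) (ℕₚ.*-monoʳ-≤ 6 1≤r₁))

        2≤2w : 2 ℕ.≤ 2 ℕ.* w
        2≤2w = ℕₚ.*-monoʳ-≤ 2 {1} {w} (ℕ.s≤s ℕ.z≤n)

        open +-*-Solver using (solve; con; _:+_; _:*_; _:=_)

        variance₁ : ι k * p * (ι 2 * 1ℚ) * (ι 2 * 1ℚ) ≤ ι (6 ℕ.* r₁) * ι (6 ℕ.* r₁)
        variance₁ = ≤-trans (≤-reflexive (fours (ι k * p))) (≤-trans (*-monoʳ (0≤ι 4) kp) (≤-trans (≤-reflexive (sym (ι-* 4 (9 ℕ.* r₁)))) (≤-trans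
           (ι-mono (ℕₚ.≤-trans (ℕₚ.≤-reflexive (l r₁)) (ℕₚ.≤-trans (ℕₚ.*-monoʳ-≤ 36 (ℕₚ.≤-trans (ℕₚ.≤-reflexive (sym (ℕₚ.*-identityˡ r₁))) (ℕₚ.*-monoˡ-≤ r₁ 1≤r₁))) (ℕₚ.≤-reflexive (l′ r₁))))) (≤-reflexive (ι-* (6 ℕ.* r₁) (6 ℕ.* r₁))))))
          where
          l : ∀ r → 4 ℕ.* (9 ℕ.* r) ≡ 36 ℕ.* r
          l = solve 1 (λ r → con 4 :* (con 9 :* r) := con 36 :* r) refl
          l′ : ∀ r → 36 ℕ.* (r ℕ.* r) ≡ 6 ℕ.* r ℕ.* (6 ℕ.* r)
          l′ = solve 1 (λ r → con 36 :* (r :* r) := con 6 :* r :* (con 6 :* r)) refl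

        variance₂ : ι m₀ * p * (ι 2 * 1ℚ) * (ι 2 * 1ℚ) ≤ ι (2 ℕ.* w) * ι (2 ℕ.* w)
        variance₂ = ≤-reflexive (trans (fours (ι m₀ * p)) (trans (cong (ι 4 *_) m₀p) (trans (sym (ι-* 4 (w ℕ.* w))) (trans (cong ι (l w)) (ι-* (2 ℕ.* w) (2 ℕ.* w))))))
          where
          l : ∀ r → 4 ℕ.* (r ℕ.* r) ≡ 2 ℕ.* r ℕ.* (2 ℕ.* r)
          l = solve 1 (λ r → con 4 :* (r :* r) := con 2 :* r :* (con 2 :* r)) refl

        selected = Random.select _≟R_ p 0≤p p≤1 vars (UniqueDec.deduplicate-! _≟R_ (concatMap W xs)) xs W σ Θ k (Δ ℕ.+ Δ)
          (by {P = λ x → Unique (W x)} (λ e e∈ → Uniqueₚ.map⁺ (cong proj₂) (proj₁ (L-size (proj₁ e) (proj₂ e) (edges-edge e∈)))) (λ e e∈ → Uniqueₚ.map⁺ (cong proj₂) (Uniqueₚ.take⁺ m₀ (sep-unique (proj₁ e) (proj₂ e)))))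
          (λ x x∈ z z∈ → ∈-deduplicate⁺ _≟R_ (∈-concatMap W x∈ z∈))
          (by {P = λ x → length (W x) ℕ.≤ k} (λ e e∈ → ℕₚ.≤-reflexive (L-length e e∈)) (λ e e∈ → ℕₚ.≤-trans (ℕₚ.≤-reflexive (S-length e e∈)) m₀≤k))
          (by {P = λ x → 0ℚ < σ x} (λ _ _ → ι-pos′ (ℕₚ.≤-trans (ℕ.s≤s ℕ.z≤n) 2≤6r)) (λ _ _ → ι-pos′ (ℕₚ.≤-trans (ℕ.s≤s ℕ.z≤n) 2≤2w)))
          (by {P = λ x → ι 2 * 1ℚ ≤ σ x} (λ _ _ → two 2≤6r) (λ _ _ → two 2≤2w))
          (by {P = λ x → ι (length (W x)) * p * (ι 2 * 1ℚ) * (ι 2 * 1ℚ) ≤ σ x * σ x}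
             (λ e e∈ → ≤-trans (≤-reflexive (cong (λ m → ι m * p * (ι 2 * 1ℚ) * (ι 2 * 1ℚ)) (L-length e e∈))) variance₁)
             (λ e e∈ → ≤-trans (≤-reflexive (cong (λ m → ι m * p * (ι 2 * 1ℚ) * (ι 2 * 1ℚ)) (S-length e e∈))) variance₂))
          deg 1≤Θ big big′

        few′ : ∀ (ω : R → Bool) u v → Edge G u v → ι (# ω (W (inj₁ (u , v)))) ≤ ι (length (W (inj₁ (u , v)))) * p + ι Θ * ι (6 ℕ.* r₁) → # (λ x → ω (u , x)) (L u v) ℕ.≤ 15 ℕ.* (Θ ℕ.* r₁)
        few′ ω u v e h = ι-cancel (≤-trans (≤-reflexive (cong ι (sym (#-map ω (u ,_) (L u v))))) (≤-trans h (≤-trans (+-mono (≤-trans (≤-reflexive (cong (λ m → ι m * p) (trans (length-map (u ,_) (L u v)) (proj₂ (L-size u v e))))) kp) (≤-reflexive (sym (ι-* Θ (6 ℕ.* r₁)))))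
            (≤-trans (≤-reflexive (sym (ι-+ (9 ℕ.* r₁) (Θ ℕ.* (6 ℕ.* r₁))))) (ι-mono (ℕₚ.≤-trans (ℕₚ.+-monoˡ-≤ (Θ ℕ.* (6 ℕ.* r₁)) (ℕₚ.*-monoʳ-≤ 9 (ℕₚ.≤-trans (ℕₚ.≤-reflexive (sym (ℕₚ.*-identityˡ r₁))) (ℕₚ.*-monoˡ-≤ r₁ 1≤Θ)))) (ℕₚ.≤-reflexive (l Θ r₁))))))))
          where
          l : ∀ t r → 9 ℕ.* (t ℕ.* r) ℕ.+ t ℕ.* (6 ℕ.* r) ≡ 15 ℕ.* (t ℕ.* r)
          l = solve 2 (λ t r → con 9 :* (t :* r) :+ t :* (con 6 :* r) := con 15 :* (t :* r)) refl

        -- The mean w² exceeds the deviation 2Θw because w = 2Θ + 1.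
        hit′ : ∀ (ω : R → Bool) u v → (u , v) ∈ ts → ι (length (W (inj₂ (u , v)))) * p - ι Θ * ι (2 ℕ.* w) ≤ ι (# ω (W (inj₂ (u , v)))) → ∃ λ x → x ∈ sep u v × ω (u , x) ≡ true
        hit′ ω u v uv∈ h = nonempty (take m₀ (sep u v)) (λ x → ∈-take m₀ (sep u v)) (ι-cancel (≤-trans below (≤-trans h (≤-reflexive (cong ι (#-map ω (u ,_) (take m₀ (sep u v))))))))
          where
          below : ι 1 ≤ ι (length (W (inj₂ (u , v)))) * p - ι Θ * ι (2 ℕ.* w)
          below = ≤-trans (ι-mono (ℕ.s≤s {0} {2 ℕ.* Θ} ℕ.z≤n)) (≤-reflexive (trans (l (ι w) (ι Θ * ι (2 ℕ.* w))) (cong (_- ι Θ * ι (2 ℕ.* w)) (trans (trans (cong (ι w +_) (sym (ι-* Θ (2 ℕ.* w)))) (trans (sym (ι-+ w (Θ ℕ.* (2 ℕ.* w)))) (cong ι (l′ Θ)))) (sym (trans (cong (λ m → ι m * p) (S-length (u , v) uv∈)) m₀p))))))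
            where
            l : ∀ a b → a ≡ a + b - b
            l = solve-∀ ℚ-ring
            l′ : ∀ t → suc (2 ℕ.* t) ℕ.+ t ℕ.* (2 ℕ.* suc (2 ℕ.* t)) ≡ suc (2 ℕ.* t) ℕ.* suc (2 ℕ.* t)
            l′ = solve 1 (λ t → (con 1 :+ con 2 :* t) :+ t :* (con 2 :* (con 1 :+ con 2 :* t)) := (con 1 :+ con 2 :* t) :* (con 1 :+ con 2 :* t)) refl
          nonempty : ∀ ys → (∀ x → x ∈ ys → x ∈ sep u v) → 1 ℕ.≤ # (λ x → ω (u , x)) ys → ∃ λ x → x ∈ sep u v × ω (u , x) ≡ true
          nonempty ys s q = pick (filterᵇ (λ x → ω (u , x)) ys) (λ x x∈ → let a , b = ∈-filterᵇ⁻ (λ x → ω (u , x)) ys x∈ in s x a , b) q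
            where
            pick : ∀ zs → (∀ x → x ∈ zs → x ∈ sep u v × ω (u , x) ≡ true) → 1 ℕ.≤ length zs → ∃ λ x → x ∈ sep u v × ω (u , x) ≡ true
            pick (z ∷ _) f _ = z , f z (here refl)

        result : Blocked
        result = proj₁ selected
          , (λ u v e → few′ (proj₁ selected) u v e (proj₂ (proj₂ selected (inj₁ (u , v)) (∈-++⁺ˡ (∈-map⁺ inj₁ (∈-filterᵇ⁺ (λ e → Graph.Adj G (proj₁ e) (proj₂ e)) (∈-cartesianProduct⁺ (∈-allFin u) (∈-allFin v)) e))))))
          , (λ {u} {v} uv∈ → hit′ (proj₁ selected) u v uv∈ (proj₁ (proj₂ selected (inj₂ (u , v)) (∈-++⁺ʳ (map inj₁ edges) (∈-map⁺ inj₂ uv∈)))))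

    blocked : Blocked
    blocked = go (inverse (ι-pos′ 1≤r₁))
      where
      go : (Σ ℚ λ p → (ι r₁ * p ≡ 1ℚ) × (0ℚ < p)) → Blocked
      go (p , rp , 0<p) = With.result p rp 0<p

∑-length : ∀ {A B : Set} (g : A → List B) xs → ∑ xs (λ x → ι (length (g x))) ≡ ι (length (concatMap g xs))
∑-length g [] = sym ι0
∑-length g (x ∷ xs) = trans (cong (ι (length (g x)) +_) (∑-length g xs)) (trans (sym (ι-+ (length (g x)) _)) (cong ι (sym (length-++ (g x)))))

∑-map : ∀ {A B : Set} (g : A → B) xs (f : B → ℚ) → ∑ (map g xs) f ≡ ∑ xs (λ x → f (g x))
∑-map g [] f = refl
∑-map g (x ∷ xs) f = cong (f (g x) +_) (∑-map g xs f)

length-concatMap-const : ∀ {A B : Set} (g : A → List B) xs {c} → (∀ x → x ∈ xs → length (g x) ≡ c) → length (concatMap g xs) ≡ length xs ℕ.* c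
length-concatMap-const g [] h = refl
length-concatMap-const g (x ∷ xs) h = trans (length-++ (g x)) (cong₂ ℕ._+_ (h x (here refl)) (length-concatMap-const g xs λ y y∈ → h y (there y∈)))

test-numbers : ∀ {p κ k d m a S S′ h} → 0ℚ ≤ p → p * k ≡ 1ℚ → ι 72 ≤ k → 0ℚ ≤ κ → 1ℚ ≤ ι 128 * κ → ι 2 * κ ≤ 1ℚ → d * k ≤ S → S′ ≤ k → 0ℚ ≤ S → 0ℚ ≤ d →
               ι 512 * (m + 1ℚ + a) ≤ d → p * κ * (1ℚ - κ * (1ℚ + ι 18 * p)) * S - p * κ * S′ - a ≤ h → m ≤ h
test-numbers {p} {κ} {k} {d} {m} {a} {S} {S′} {h} 0≤p pk 72≤k 0≤κ 1≤128κ 2κ≤1 dk≤S S′≤k 0≤S 0≤d rich est = ≤-trans (cancel-* (ι-pos 511) main) est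
  where
  0≤pκ = 0≤* 0≤p 0≤κ
  72p≤1 : ι 72 * p ≤ 1ℚ
  72p≤1 = ≤-trans (*-monoˡ 0≤p 72≤k) (≤-reflexive (trans (ℚₚ.*-comm k p) pk))
  0≤18p = 0≤* (0≤ι 18) 0≤p
  -- κ ≤ 1/2 and p ≤ 1/72 leave a quarter
  quarter : 1ℚ ≤ ι 4 * (1ℚ - κ * (1ℚ + ι 18 * p))
  quarter = by-gap (0≤+ (0≤* (0≤+ (0≤ι 2) (0≤* (0≤ι 2) 0≤18p)) (diff 2κ≤1)) (0≤+ (diff 72p≤1) (0≤* (0≤ι 2) 0≤18p)))
    (trans (cong (λ z → z * (1ℚ - κ * (1ℚ + ι 18 * p))) 4≡) (trans (cong (λ z → (z + z) * (1ℚ - κ * (1ℚ + ι 18 * p))) 2≡)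
       (trans (l κ (ι 18 * p)) (cong₂ (λ w z → 1ℚ + ((z + z * (ι 18 * p)) * (1ℚ - z * κ) + (1ℚ - w * p + z * (ι 18 * p)))) (sym 72≡) (sym 2≡) |> λ e → trans (cong (λ y → 1ℚ + ((1ℚ + 1ℚ + (1ℚ + 1ℚ) * (ι 18 * p)) * (1ℚ - (1ℚ + 1ℚ) * κ) + (1ℚ - y + (1ℚ + 1ℚ) * (ι 18 * p)))) (l₂ (ι 18) p)) e))))
    where
    infixl 1 _|>_
    _|>_ : ∀ {A B : Set} → A → (A → B) → B
    x |> f = f x
    2≡ : ι 2 ≡ 1ℚ + 1ℚ
    2≡ = trans (ι-suc 1) (cong (1ℚ +_) ι1)
    4≡ : ι 4 ≡ ι 2 + ι 2
    4≡ = ι-+ 2 2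
    72≡ : ι 72 ≡ ι 18 + (ι 18 + (ι 18 + ι 18))
    72≡ = trans (ι-+ 18 54) (cong (ι 18 +_) (trans (ι-+ 18 36) (cong (ι 18 +_) (ι-+ 18 18))))
    l₂ : ∀ c p → c * p + (c * p + (c * p + c * p)) ≡ (c + (c + (c + c))) * p
    l₂ = solve-∀ ℚ-ring
    l : ∀ k y → (1ℚ + 1ℚ + (1ℚ + 1ℚ)) * (1ℚ - k * (1ℚ + y)) ≡ 1ℚ + ((1ℚ + 1ℚ + (1ℚ + 1ℚ) * y) * (1ℚ - (1ℚ + 1ℚ) * k) + (1ℚ - (y + (y + (y + y))) + (1ℚ + 1ℚ) * y))
    l = solve-∀ ℚ-ring
  κd : κ * d ≤ p * κ * S
  κd = ≤-trans (≤-reflexive (trans (trans (sym (ℚₚ.*-identityˡ (κ * d))) (cong (_* (κ * d)) (sym pk))) (l p k κ d))) (*-monoʳ 0≤pκ dk≤S)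
    where
    l : ∀ p k x d → p * k * (x * d) ≡ p * x * (d * k)
    l = solve-∀ ℚ-ring
  first : d ≤ ι 512 * (p * κ * (1ℚ - κ * (1ℚ + ι 18 * p)) * S)
  first = ≤-trans (≤-trans (≤-reflexive (sym (ℚₚ.*-identityˡ d))) (≤-trans (*-monoˡ 0≤d 1≤128κ) (≤-trans (≤-reflexive (ℚₚ.*-assoc (ι 128) κ d)) (*-monoʳ (0≤ι 128) κd))))
      (≤-trans (≤-trans (≤-reflexive (sym (ℚₚ.*-identityˡ _))) (*-monoˡ (0≤* (0≤ι 128) (0≤* 0≤pκ 0≤S)) quarter))
        (≤-reflexive (trans (l (ι 128) (ι 4) (p * κ) S (1ℚ - κ * (1ℚ + ι 18 * p))) (cong (λ z → z * (p * κ * (1ℚ - κ * (1ℚ + ι 18 * p)) * S)) (sym (ι-* 128 4))))))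
    where
    l : ∀ a b x S y → b * y * (a * (x * S)) ≡ a * b * (x * y * S)
    l = solve-∀ ℚ-ring
  second : p * κ * S′ ≤ 1ℚ
  second = ≤-trans (*-monoʳ 0≤pκ S′≤k) (≤-trans (≤-reflexive (trans (l p κ k) (trans (cong (_* κ) pk) (ℚₚ.*-identityˡ κ)))) κ≤1)
    where
    l : ∀ p x k → p * x * k ≡ p * k * x
    l = solve-∀ ℚ-ring
    κ≤1 : κ ≤ 1ℚ
    κ≤1 = ≤-trans (≤-trans (≤-reflexive (sym (ℚₚ.*-identityˡ κ))) (*-monoˡ 0≤κ (1≤ι {2} (ℕ.s≤s ℕ.z≤n)))) 2κ≤1
  main : ι 512 * m ≤ ι 512 * (p * κ * (1ℚ - κ * (1ℚ + ι 18 * p)) * S - p * κ * S′ - a)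
  main = by-gap (0≤+ (diff rich) (0≤+ (diff first) (0≤* (0≤ι 512) (diff second)))) (l (ι 512) m a d (p * κ * (1ℚ - κ * (1ℚ + ι 18 * p)) * S) (p * κ * S′))
    where
    l : ∀ c m a d F s → c * (F - s - a) ≡ c * m + (d - c * (m + 1ℚ + a) + (c * F - d + c * (1ℚ - s)))
    l = solve-∀ ℚ-ring

module _ {n : ℕ} (G : Graph n) where

  open Colouring G
  open Threshold
  open Graph G renaming (sym to Adj-sym) using (Adj)

  I R : Set
  I = V × V
  R = V × ℕ

  _≟I_ : DecidableEquality I
  _≟I_ = Prodₚ.≡-dec Finₚ._≟_ Finₚ._≟_

  _≟R_ : DecidableEquality R
  _≟R_ = Prodₚ.≡-dec Finₚ._≟_ ℕ._≟_

  open Hypergraph _≟I_ _≟R_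

  module System (D : ℕ) (k : ℕ) (L : Fin n → Fin n → List ℕ) (L-sym : ∀ u v → Edge G u v → L u v ≡ L v u)
    (L-size : ∀ u v → Edge G u v → Unique (L u v) × length (L u v) ≡ k) where

    _<ᵛ_ : V → V → Bool
    u <ᵛ v = toℕ u ℕ.<ᵇ toℕ v

    <ᵛ⁺ : ∀ {u v} → toℕ u ℕ.< toℕ v → u <ᵛ v ≡ true
    <ᵛ⁺ h = go (ℕₚ.<⇒<ᵇ h)
      where
      go : ∀ {b} → T b → b ≡ true
      go {true} _ = refl

    <ᵛ⁻ : ∀ {u v} → u <ᵛ v ≡ true → toℕ u ℕ.< toℕ v
    <ᵛ⁻ {u} {v} e = ℕₚ.<ᵇ⇒< (toℕ u) (toℕ v) (subst T (sym e) tt)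

    <ᵛ-asym : ∀ {u v} → u <ᵛ v ≡ true → v <ᵛ u ≡ true → ⊥
    <ᵛ-asym {u} {v} h k = ℕₚ.<-asym (<ᵛ⁻ {u} {v} h) (<ᵛ⁻ {v} {u} k)

    Hᴰ : V → V → Bool
    Hᴰ = H D

    its : List I
    its = filterᵇ (λ e → (proj₁ e <ᵛ proj₂ e) ∧ Hᴰ (proj₁ e) (proj₂ e)) (cartesianProduct (allFin n) (allFin n))

    its-unique : Unique its
    its-unique = filterᵇ-unique _ (Uniqueₚ.cartesianProduct⁺ (Uniqueₚ.allFin⁺ n) (Uniqueₚ.allFin⁺ n))

    its-spec : ∀ {e} → e ∈ its → (proj₁ e <ᵛ proj₂ e ≡ true) × Hᴰ (proj₁ e) (proj₂ e) ≡ true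
    its-spec {e} h = let _ , b = ∈-filterᵇ⁻ (λ e → (proj₁ e <ᵛ proj₂ e) ∧ Hᴰ (proj₁ e) (proj₂ e)) (cartesianProduct (allFin n) (allFin n)) h in ∧-left b , ∧-right {proj₁ e <ᵛ proj₂ e} b

    its-in : ∀ {u v} → u <ᵛ v ≡ true → Hᴰ u v ≡ true → (u , v) ∈ its
    its-in {u} {v} l h = ∈-filterᵇ⁺ _ (∈-cartesianProduct⁺ (∈-allFin u) (∈-allFin v)) (∧-intro l h)

    item : V → V → I
    item u v = if u <ᵛ v then (u , v) else (v , u)

    item-cases : ∀ u v → u ≢ v → (u <ᵛ v ≡ true × item u v ≡ (u , v)) ⊎ (v <ᵛ u ≡ true × item u v ≡ (v , u))
    item-cases u v n with ℕₚ.<-cmp (toℕ u) (toℕ v)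
    ... | tri< h _ _ = inj₁ (<ᵛ⁺ {u} {v} h , eq (<ᵛ⁺ {u} {v} h))
      where
      eq : u <ᵛ v ≡ true → item u v ≡ (u , v)
      eq e rewrite e = refl
    ... | tri≈ _ h _ = ⊥-elim (n (Finₚ.toℕ-injective h))
    ... | tri> _ _ h = inj₂ (<ᵛ⁺ {v} {u} h , eq (¬true⇒false λ e → <ᵛ-asym {u} {v} e (<ᵛ⁺ {v} {u} h)))
      where
      eq : u <ᵛ v ≡ false → item u v ≡ (v , u)
      eq e rewrite e = refl

    item-sym : ∀ u v → u ≢ v → item u v ≡ item v u
    item-sym u v n with item-cases u v n | item-cases v u (λ q → n (sym q))
    ... | inj₁ (h , e) | inj₁ (h′ , e′) = ⊥-elim (<ᵛ-asym {u} {v} h h′)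
    ... | inj₁ (h , e) | inj₂ (h′ , e′) = trans e (sym e′)
    ... | inj₂ (h , e) | inj₁ (h′ , e′) = trans e (sym e′)
    ... | inj₂ (h , e) | inj₂ (h′ , e′) = ⊥-elim (<ᵛ-asym {u} {v} h′ h)

    item-in : ∀ {u v} → Hᴰ u v ≡ true → item u v ∈ its
    item-in {u} {v} h with item-cases u v (loopless (H-edge D {u} {v} h))
    ... | inj₁ (l , e) = subst (_∈ its) (sym e) (its-in l h)
    ... | inj₂ (l , e) = subst (_∈ its) (sym e) (its-in l (H-sym D {u} {v} h))

    opt : I → ℕ → Opt
    opt e x = e , (proj₁ e , x) , (proj₂ e , x)

    colour : Opt → ℕ
    colour (_ , (_ , x) , _) = x

    opts : I → List Opt
    opts e = map (opt e) (L (proj₁ e) (proj₂ e))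

    os : List Opt
    os = concatMap opts its

    record IsOpt (o : Opt) : Set where
      field
        e∈    : proj₁ o ∈ its
        x∈    : colour o ∈ L (proj₁ (proj₁ o)) (proj₂ (proj₁ o))
        shape : o ≡ opt (proj₁ o) (colour o)

    os-spec : ∀ {o} → o ∈ os → IsOpt o
    os-spec o∈ with ∈-concatMap⁻ opts its o∈
    ... | e , e∈ , h with ∈-map⁻ (opt e) h
    ...   | x , x∈ , refl = record { e∈ = e∈ ; x∈ = x∈ ; shape = refl }

    os-in : ∀ {e x} → e ∈ its → x ∈ L (proj₁ e) (proj₂ e) → opt e x ∈ os
    os-in {e} e∈ x∈ = ∈-concatMap opts e∈ (∈-map⁺ (opt e) x∈)

    L-edge : ∀ {e} → e ∈ its → Edge G (proj₁ e) (proj₂ e)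
    L-edge {e} e∈ = H-edge D {proj₁ e} {proj₂ e} (proj₂ (its-spec e∈))

    opts-unique : ∀ e → e ∈ its → Unique (opts e)
    opts-unique e e∈ = Uniqueₚ.map⁺ (cong colour) (proj₁ (L-size _ _ (L-edge e∈)))

    opts-key : ∀ e o → e ∈ its → o ∈ opts e → proj₁ o ≡ e
    opts-key e o _ h with ∈-map⁻ (opt e) h
    ... | _ , _ , refl = refl

    os-unique : Unique os
    os-unique = concatMap-unique opts proj₁ its-unique opts-unique opts-key

    item-point : ∀ {o e} → inj₁ e ∈ pts o → proj₁ o ≡ e
    item-point (here refl) = refl
    item-point (there (here ()))
    item-point (there (there (here ())))

    res-point : ∀ e x {w y} → inj₂ (w , y) ∈ pts (opt e x) → y ≡ x × (w ≡ proj₁ e ⊎ w ≡ proj₂ e)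
    res-point e x (here ())
    res-point e x (there (here refl)) = refl , inj₁ refl
    res-point e x (there (there (here refl))) = refl , inj₂ refl

    private
      linear′ : ∀ e x e′ x′ {a b} → e ∈ its → e′ ∈ its → a ≢ b → a ∈ pts (opt e x) → b ∈ pts (opt e x) → a ∈ pts (opt e′ x′) → b ∈ pts (opt e′ x′) → opt e x ≡ opt e′ x′
      linear′ e x e′ x′ {inj₁ i} {inj₁ j} _ _ n a b a′ b′ = ⊥-elim (n (cong inj₁ (trans (sym (item-point {opt e x} a)) (item-point {opt e x} b))))
      linear′ e x e′ x′ {inj₁ i} {inj₂ (w , y)} _ _ n a b a′ b′ = cong₂ opt (trans (item-point {opt e x} a) (sym (item-point {opt e′ x′} a′))) (trans (sym (proj₁ (res-point e x b))) (proj₁ (res-point e′ x′ b′)))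
      linear′ e x e′ x′ {inj₂ (w , y)} {inj₁ i} _ _ n a b a′ b′ = cong₂ opt (trans (item-point {opt e x} b) (sym (item-point {opt e′ x′} b′))) (trans (sym (proj₁ (res-point e x a))) (proj₁ (res-point e′ x′ a′)))
      linear′ e@(u , v) x e′@(u′ , v′) x′ {inj₂ (w , y)} {inj₂ (z , y′)} e∈ e′∈ n a b a′ b′ = cong₂ opt (same (proj₂ (res-point e x a)) (proj₂ (res-point e x b)) (proj₂ (res-point e′ x′ a′)) (proj₂ (res-point e′ x′ b′)))
            (trans (sym (proj₁ (res-point e x a))) (proj₁ (res-point e′ x′ a′)))
        where
        w≢z : w ≢ z
        w≢z refl = n (cong (λ c → inj₂ (w , c)) (trans (proj₁ (res-point e x a)) (sym (proj₁ (res-point e x b)))))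
        l = proj₁ (its-spec e∈)
        l′ = proj₁ (its-spec e′∈)
        same : w ≡ u ⊎ w ≡ v → z ≡ u ⊎ z ≡ v → w ≡ u′ ⊎ w ≡ v′ → z ≡ u′ ⊎ z ≡ v′ → e ≡ e′
        same (inj₁ refl) (inj₁ refl) _ _ = ⊥-elim (w≢z refl)
        same (inj₂ refl) (inj₂ refl) _ _ = ⊥-elim (w≢z refl)
        same (inj₁ refl) (inj₂ refl) (inj₁ refl) (inj₂ refl) = refl
        same (inj₁ refl) (inj₂ refl) (inj₂ refl) (inj₁ refl) = ⊥-elim (<ᵛ-asym {w} {z} l l′)
        same (inj₁ refl) (inj₂ refl) (inj₁ refl) (inj₁ refl) = ⊥-elim (w≢z refl)
        same (inj₁ refl) (inj₂ refl) (inj₂ refl) (inj₂ refl) = ⊥-elim (w≢z refl)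
        same (inj₂ refl) (inj₁ refl) (inj₁ refl) (inj₂ refl) = ⊥-elim (<ᵛ-asym {z} {w} l l′)
        same (inj₂ refl) (inj₁ refl) (inj₂ refl) (inj₁ refl) = refl
        same (inj₂ refl) (inj₁ refl) (inj₁ refl) (inj₁ refl) = ⊥-elim (w≢z refl)
        same (inj₂ refl) (inj₁ refl) (inj₂ refl) (inj₂ refl) = ⊥-elim (w≢z refl)

    linear-os : Linear os
    linear-os = record
      { unique = os-unique
      ; distinct = λ {i} {a} {b} o∈ q → let s = os-spec o∈ in loopless (L-edge (IsOpt.e∈ s)) (trans (sym (cong (λ o → proj₁ (proj₁ (proj₂ o))) (IsOpt.shape s))) (trans (cong proj₁ q) (cong (λ o → proj₁ (proj₂ (proj₂ o))) (IsOpt.shape s))))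
      ; linear = λ {o} {o′} {x} {y} o∈ o′∈ n a b a′ b′ → let s = os-spec o∈ ; s′ = os-spec o′∈ in
          trans (IsOpt.shape s) (trans (linear′ _ _ _ _ (IsOpt.e∈ s) (IsOpt.e∈ s′) n (subst (λ o → x ∈ pts o) (IsOpt.shape s) a) (subst (λ o → y ∈ pts o) (IsOpt.shape s) b)
             (subst (λ o → x ∈ pts o) (IsOpt.shape s′) a′) (subst (λ o → y ∈ pts o) (IsOpt.shape s′) b′)) (sym (IsOpt.shape s′)))
      }

    on-item⁻ : ∀ e o → on (inj₁ e) o ≡ true → proj₁ o ≡ e
    on-item⁻ e o h = item-point {o} (∈ᴾ⁻ {inj₁ e} (pts o) h)

    on-item⁺ : ∀ o → on (inj₁ (proj₁ o)) o ≡ true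
    on-item⁺ o = ∈ᴾ⁺ {inj₁ (proj₁ o)} {pts o} (here refl)

    item-deg : ∀ {e} → e ∈ its → # (on (inj₁ e)) os ≡ k
    item-deg {e} e∈ = trans (#-inside opts proj₁ (on (inj₁ e)) its-unique e∈ (λ e o → opts-key e o) (λ o h → on-item⁻ e o h)
        (λ o o∈ → subst (λ i → on (inj₁ i) o ≡ true) (opts-key e o e∈ o∈) (on-item⁺ o)))
        (trans (length-map (opt e) (L (proj₁ e) (proj₂ e))) (proj₂ (L-size _ _ (L-edge e∈))))

    other : V → I → V
    other w (u , v) = if ⌊ w ≟ⱽ u ⌋ then v else u
      where
      _≟ⱽ_ = Finₚ._≟_

    other-left : ∀ u v → other u (u , v) ≡ v
    other-left u v with u Finₚ.≟ u
    ... | yes _ = refl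
    ... | no q = ⊥-elim (q refl)

    other-right : ∀ u v → u ≢ v → other v (u , v) ≡ u
    other-right u v q with v Finₚ.≟ u
    ... | yes e = ⊥-elim (q (sym e))
    ... | no _ = refl

    End : V → I → Set
    End w e = w ≡ proj₁ e ⊎ w ≡ proj₂ e

    other-H : ∀ {w e} → e ∈ its → End w e → Hᴰ w (other w e) ≡ true × item w (other w e) ≡ e
    other-H {w} {u , v} e∈ (inj₁ refl) rewrite other-left w v | proj₁ (its-spec e∈) = proj₂ (its-spec e∈) , refl
    other-H {w} {u , v} e∈ (inj₂ refl) rewrite other-right u w (loopless (L-edge e∈)) | ¬true⇒false (λ q → <ᵛ-asym {u} {w} (proj₁ (its-spec e∈)) q) = H-sym D {u} {w} (proj₂ (its-spec e∈)) , refl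

    res-deg : ∀ {Δ} → (∀ v → degree G v ℕ.≤ Δ) → ∀ r → # (on (inj₂ r)) os ℕ.≤ Δ
    res-deg deg≤ (w , y) = ℕₚ.≤-trans (inj-length (λ o → other w (proj₁ o)) {ys = nbrs w} (filterᵇ-unique _ os-unique) inj inside) (deg≤ w)
      where
      facts : ∀ o → o ∈ filterᵇ (on (inj₂ (w , y))) os → IsOpt o × y ≡ colour o × End w (proj₁ o)
      facts o o∈ = let o∈os , h = ∈-filterᵇ⁻ (on (inj₂ (w , y))) os o∈ ; s = os-spec o∈os ; a , b = res-point (proj₁ o) (colour o) (subst (λ o → inj₂ (w , y) ∈ pts o) (IsOpt.shape s) (∈ᴾ⁻ {inj₂ (w , y)} (pts o) h)) in s , a , b
      inside : ∀ o → o ∈ filterᵇ (on (inj₂ (w , y))) os → other w (proj₁ o) ∈ nbrs w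
      inside o o∈ = let s , _ , b = facts o o∈ in ∈-nbrs (H-edge D {w} {other w (proj₁ o)} (proj₁ (other-H (IsOpt.e∈ s) b)))
      inj : ∀ o o′ → o ∈ filterᵇ (on (inj₂ (w , y))) os → o′ ∈ filterᵇ (on (inj₂ (w , y))) os → other w (proj₁ o) ≡ other w (proj₁ o′) → o ≡ o′
      inj o o′ o∈ o′∈ q = let s , a , b = facts o o∈ ; s′ , a′ , b′ = facts o′ o′∈ in
        trans (IsOpt.shape s) (trans (cong₂ opt (trans (sym (proj₂ (other-H (IsOpt.e∈ s) b))) (trans (cong (item w) q) (proj₂ (other-H (IsOpt.e∈ s′) b′)))) (trans (sym a) a′)) (sym (IsOpt.shape s′)))

    pick : List Opt → I → ℕ
    pick [] i = 0
    pick (o ∷ os) i = if on (inj₁ i) o then colour o else pick os i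

    pick-spec : ∀ os i → any (on (inj₁ i)) os ≡ true → ∃ λ o → o ∈ os × on (inj₁ i) o ≡ true × pick os i ≡ colour o
    pick-spec (o ∷ os) i h with on (inj₁ i) o in eq
    ... | true = o , here refl , eq , refl
    ... | false = let o′ , a , b = pick-spec os i h in o′ , there a , b

    module Tested {Δ : ℕ} (deg≤ : ∀ v → degree G v ℕ.≤ Δ) (Δ≤k : Δ ℕ.≤ k) where

      Hnbrs : V → List V
      Hnbrs v = filterᵇ (Hᴰ v) (allFin n)

      ∈-Hnbrs : ∀ {v w} → Hᴰ v w ≡ true → w ∈ Hnbrs v
      ∈-Hnbrs {v} {w} h = ∈-filterᵇ⁺ (Hᴰ v) (∈-allFin w) h

      Hnbrs-H : ∀ {v w} → w ∈ Hnbrs v → Hᴰ v w ≡ true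
      Hnbrs-H {v} h = proj₂ (∈-filterᵇ⁻ (Hᴰ v) (allFin n) h)

      Hnbrs-unique : ∀ v → Unique (Hnbrs v)
      Hnbrs-unique v = filterᵇ-unique (Hᴰ v) (Uniqueₚ.allFin⁺ n)

      Hnbrs-few : ∀ v → length (Hnbrs v) ℕ.≤ Δ
      Hnbrs-few v = ℕₚ.≤-trans (unique-length (Hnbrs-unique v) λ w w∈ → ∈-nbrs (H-edge D {v} {w} (Hnbrs-H w∈))) (deg≤ v)

      on-res⁻ : ∀ {o w x} → o ∈ os → on (inj₂ (w , x)) o ≡ true → x ≡ colour o × End w (proj₁ o)
      on-res⁻ {o} {w} {x} o∈ h = let s = os-spec o∈ in res-point (proj₁ o) (colour o) (subst (λ o → inj₂ (w , x) ∈ pts o) (IsOpt.shape s) (∈ᴾ⁻ {inj₂ (w , x)} (pts o) h))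

      End-point : ∀ {w e} x → End w e → inj₂ (w , x) ∈ pts (opt e x)
      End-point x (inj₁ refl) = there (here refl)
      End-point x (inj₂ refl) = there (there (here refl))

      item-shape : ∀ u v → item u v ≡ (u , v) ⊎ item u v ≡ (v , u)
      item-shape u v with u <ᵛ v
      ... | true = inj₁ refl
      ... | false = inj₂ refl

      item-end : ∀ u v → End u (item u v)
      item-end u v with item-shape u v
      ... | inj₁ e = inj₁ (sym (cong proj₁ e))
      ... | inj₂ e = inj₂ (sym (cong proj₂ e))

      L-item : ∀ {u v} → Edge G u v → L (proj₁ (item u v)) (proj₂ (item u v)) ≡ L u v
      L-item {u} {v} e with item-shape u v
      ... | inj₁ q = cong (λ i → L (proj₁ i) (proj₂ i)) q
      ... | inj₂ q = trans (cong (λ i → L (proj₁ i) (proj₂ i)) q) (sym (L-sym u v e))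

      other-end : ∀ {u v e} → End u e → End v e → u ≢ v → other u e ≡ v
      other-end {u} {v} {a , b} (inj₁ refl) (inj₁ refl) n = ⊥-elim (n refl)
      other-end {u} {v} {a , b} (inj₁ refl) (inj₂ refl) n = other-left u v
      other-end {u} {v} {a , b} (inj₂ refl) (inj₁ refl) n = other-right v u (λ q → n (sym q))
      other-end {u} {v} {a , b} (inj₂ refl) (inj₂ refl) n = ⊥-elim (n refl)

      other-item : ∀ {u v} → Hᴰ u v ≡ true → other u (item u v) ≡ v
      other-item {u} {v} h = other-end (item-end u v) (subst (End v) (item-sym v u (λ q → ne (sym q))) (item-end v u)) ne
        where
        ne : u ≢ v
        ne = loopless (H-edge D {u} {v} h)

      palette : V → List ℕ
      palette v = deduplicate ℕ._≟_ (concatMap (L v) (Hnbrs v))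

      palette-unique : ∀ v → Unique (palette v)
      palette-unique v = UniqueDec.deduplicate-! ℕ._≟_ (concatMap (L v) (Hnbrs v))

      pairs : V → V → List (R × R)
      pairs u v = map (λ x → (v , x) , (u , x)) (palette v)

      at : V → List I
      at w = map (item w) (Hnbrs w)

      at-end : ∀ {w i} → i ∈ at w → End w i
      at-end {w} h = let z , _ , e = ∈-map⁻ (item w) h in subst (End w) (sym e) (item-end w z)

      ∈-at : ∀ {w o x} → o ∈ os → on (inj₂ (w , x)) o ≡ true → proj₁ o ∈ at w
      ∈-at {w} {o} {x} o∈ h = let _ , e = on-res⁻ {o} {w} {x} o∈ h ; a , b = other-H (IsOpt.e∈ (os-spec o∈)) e in subst (_∈ at w) b (∈-map⁺ (item w) (∈-Hnbrs a))

      few-colours : ∀ u v o → # (λ ab → on (inj₂ (proj₁ ab)) o ∨ on (inj₂ (proj₂ ab)) o) (pairs u v) ℕ.≤ 3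
      few-colours u v o@(i , (a , y) , (b , z)) = ℕₚ.≤-trans (ℕₚ.≤-reflexive (#-map (λ ab → on (inj₂ (proj₁ ab)) o ∨ on (inj₂ (proj₂ ab)) o) (λ x → (v , x) , (u , x)) (palette v)))
          (ℕₚ.≤-trans (#-≤ (λ x → on (inj₂ (v , x)) o ∨ on (inj₂ (u , x)) o) {ys = y ∷ z ∷ []} (palette-unique v)
            λ x _ h → [ (λ e → cover v x (∈ᴾ⁻ {inj₂ (v , x)} (pts o) e)) , (λ e → cover u x (∈ᴾ⁻ {inj₂ (u , x)} (pts o) e)) ]′ (∨-case {on (inj₂ (v , x)) o} h)) (ℕₚ.m≤m+n 2 1))
        where
        cover : ∀ w x → inj₂ (w , x) ∈ pts o → x ∈ y ∷ z ∷ []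
        cover w x (here ())
        cover w x (there (here refl)) = here refl
        cover w x (there (there (here refl))) = there (here refl)

      τ : V × V → Test os k
      τ (u , v) = record
        { pairs = pairs u v
        ; hub = at u ++ at v
        ; few = few-colours u v
        ; thru-hub = λ {o} {ab} o∈ ab∈ h → proj₁ o , through o ab o∈ ab∈ h , on-item⁺ o
        ; hub-size = ℕₚ.≤-trans (ℕₚ.≤-reflexive (length-++ (at u))) (ℕₚ.+-mono-≤ (size u) (ℕₚ.≤-trans (size v) (ℕₚ.≤-reflexive (sym (ℕₚ.+-identityʳ k)))))
        }
        where
        size : ∀ w → length (at w) ℕ.≤ k
        size w = ℕₚ.≤-trans (ℕₚ.≤-reflexive (length-map (item w) (Hnbrs w))) (ℕₚ.≤-trans (Hnbrs-few w) Δ≤k)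
        through : ∀ o ab → o ∈ os → ab ∈ pairs u v → on (inj₂ (proj₁ ab)) o ∨ on (inj₂ (proj₂ ab)) o ≡ true → proj₁ o ∈ at u ++ at v
        through o ab o∈ ab∈ h = go (∈-map⁻ (λ x → (v , x) , (u , x)) ab∈)
          where
          go : (∃ λ x → x ∈ palette v × ab ≡ ((v , x) , (u , x))) → proj₁ o ∈ at u ++ at v
          go (x , _ , refl) = [ (λ e → ∈-++⁺ʳ (at u) (∈-at {v} {o} {x} o∈ e)) , (λ e → ∈-++⁺ˡ (∈-at {u} {o} {x} o∈ e)) ]′ (∨-case {on (inj₂ (v , x)) o} h)

      ts : List (V × V)
      ts = filterᵇ (λ e → Hᴰ (proj₁ e) (proj₂ e) ∧ not (poor D (proj₂ e))) (cartesianProduct (allFin n) (allFin n))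

      ts-unique : Unique ts
      ts-unique = filterᵇ-unique _ (Uniqueₚ.cartesianProduct⁺ (Uniqueₚ.allFin⁺ n) (Uniqueₚ.allFin⁺ n))

      ts-in : ∀ {u v} → Hᴰ u v ≡ true → poor D v ≡ false → (u , v) ∈ ts
      ts-in {u} {v} h q = ∈-filterᵇ⁺ (λ e → Hᴰ (proj₁ e) (proj₂ e) ∧ not (poor D (proj₂ e))) (∈-cartesianProduct⁺ (∈-allFin u) (∈-allFin v)) (∧-intro h (not-true q))

      ts-spec : ∀ {u v} → (u , v) ∈ ts → Hᴰ u v ≡ true × poor D v ≡ false
      ts-spec {u} {v} h = let b = proj₂ (∈-filterᵇ⁻ (λ e → Hᴰ (proj₁ e) (proj₂ e) ∧ not (poor D (proj₂ e))) (cartesianProduct (allFin n) (allFin n)) h) in ∧-left b , not-elim (∧-right {Hᴰ u v} b)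

      hub-deg : ∀ i → # (λ x → inj₁ i ∈ᴾ map inj₁ (Test.hub (τ x))) ts ℕ.≤ 4 ℕ.* Δ
      hub-deg (a , b) = ℕₚ.≤-trans (#-≤ (λ x → inj₁ (a , b) ∈ᴾ map inj₁ (Test.hub (τ x))) {ys = near a ++ near b} ts-unique λ x x∈ h → cover x x∈ (∈-map⁻ inj₁ (∈ᴾ⁻ {inj₁ (a , b)} (map inj₁ (Test.hub (τ x))) h)))
          (ℕₚ.≤-trans (ℕₚ.≤-reflexive (length-++ (near a))) (ℕₚ.≤-trans (ℕₚ.+-mono-≤ (near-size a) (near-size b)) (ℕₚ.≤-reflexive (l Δ))))
        where
        open +-*-Solver
        l : ∀ d → d ℕ.+ d ℕ.+ (d ℕ.+ d) ≡ 4 ℕ.* d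
        l = solve 1 (λ d → d :+ d :+ (d :+ d) := con 4 :* d) refl
        near : V → List (V × V)
        near w = map (w ,_) (nbrs w) ++ map (_, w) (nbrs w)
        near-size : ∀ w → length (near w) ℕ.≤ Δ ℕ.+ Δ
        near-size w = ℕₚ.≤-trans (ℕₚ.≤-reflexive (trans (length-++ (map (w ,_) (nbrs w))) (cong₂ ℕ._+_ (length-map (w ,_) (nbrs w)) (length-map (_, w) (nbrs w))))) (ℕₚ.+-mono-≤ (deg≤ w) (deg≤ w))
        left : ∀ w z → Edge G w z → (w , z) ∈ near w
        left w z e = ∈-++⁺ˡ (∈-map⁺ (w ,_) (∈-nbrs e))
        right : ∀ w z → Edge G z w → (z , w) ∈ near w
        right w z e = ∈-++⁺ʳ (map (w ,_) (nbrs w)) (∈-map⁺ (_, w) (∈-nbrs (edge-sym e)))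
        reach : ∀ {u v} → Edge G u v → End u (a , b) ⊎ End v (a , b) → (u , v) ∈ near a ++ near b
        reach {u} {v} e (inj₁ (inj₁ refl)) = ∈-++⁺ˡ (left u v e)
        reach {u} {v} e (inj₁ (inj₂ refl)) = ∈-++⁺ʳ (near a) (left u v e)
        reach {u} {v} e (inj₂ (inj₁ refl)) = ∈-++⁺ˡ (right v u e)
        reach {u} {v} e (inj₂ (inj₂ refl)) = ∈-++⁺ʳ (near a) (right v u e)
        cover : ∀ x → x ∈ ts → (∃ λ i → i ∈ Test.hub (τ x) × inj₁ (a , b) ≡ inj₁ i) → x ∈ near a ++ near b
        cover (u , v) x∈ (i , i∈ , refl) = reach (H-edge D {u} {v} (proj₁ (ts-spec {u} {v} x∈))) ([ (λ h → inj₁ (at-end {u} h)) , (λ h → inj₂ (at-end {v} h)) ]′ (∈-++⁻ (at u) i∈))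

      many-at : ∀ u v → ι (dH D v) * ι k ≤ ∑ (pairs u v) (λ ab → ι (# (on (inj₂ (proj₁ ab))) os))
      many-at u v = ≤-trans (≤-reflexive (sym (ι-* (dH D v) k))) (≤-trans (ι-mono (ℕₚ.≤-trans (ℕₚ.≤-reflexive (sym (length-concatMap-const through (Hnbrs v) size)))
          (unique-length {ys = concatMap (λ x → filterᵇ (on (inj₂ (v , x))) os) (palette v)} (concatMap-unique through (λ o → other v (proj₁ o)) (Hnbrs-unique v) (λ w w∈ → Uniqueₚ.map⁺ (cong colour) (proj₁ (L-size v w (edge w∈)))) key) inside)))
          (≤-reflexive (trans (sym (∑-length (λ x → filterᵇ (on (inj₂ (v , x))) os) (palette v))) (sym (∑-map (λ x → (v , x) , (u , x)) (palette v) (λ ab → ι (# (on (inj₂ (proj₁ ab))) os)))))))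
        where
        through : V → List Opt
        through w = map (opt (item v w)) (L v w)
        edge : ∀ {w} → w ∈ Hnbrs v → Edge G v w
        edge {w} w∈ = H-edge D {v} {w} (Hnbrs-H w∈)
        size : ∀ w → w ∈ Hnbrs v → length (through w) ≡ k
        size w w∈ = trans (length-map (opt (item v w)) (L v w)) (proj₂ (L-size v w (edge w∈)))
        key : ∀ w o → w ∈ Hnbrs v → o ∈ through w → other v (proj₁ o) ≡ w
        key w o w∈ o∈ = let x , _ , e = ∈-map⁻ (opt (item v w)) o∈ in trans (cong (λ o → other v (proj₁ o)) e) (other-item (Hnbrs-H w∈))
        inside : ∀ o → o ∈ concatMap through (Hnbrs v) → o ∈ concatMap (λ x → filterᵇ (on (inj₂ (v , x))) os) (palette v)
        inside o o∈ = go (∈-concatMap⁻ through (Hnbrs v) o∈)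
          where
          go : (∃ λ w → w ∈ Hnbrs v × o ∈ through w) → o ∈ concatMap (λ x → filterᵇ (on (inj₂ (v , x))) os) (palette v)
          go (w , w∈ , h) = let x , x∈ , e = ∈-map⁻ (opt (item v w)) h in ∈-concatMap (λ x → filterᵇ (on (inj₂ (v , x))) os) (∈-deduplicate⁺ ℕ._≟_ (∈-concatMap (L v) w∈ x∈))
              (∈-filterᵇ⁺ (on (inj₂ (v , x))) (subst (_∈ os) (sym e) (os-in (item-in {v} {w} (Hnbrs-H w∈)) (subst (x ∈_) (sym (L-item (edge w∈))) x∈)))
                (∈ᴾ⁺ {inj₂ (v , x)} {pts o} (subst (λ o → inj₂ (v , x) ∈ pts o) (sym e) (End-point x (item-end v w)))))

      few-both : ∀ u v → Hᴰ u v ≡ true → ∑ (pairs u v) (λ ab → ι (# (λ o → on (inj₂ (proj₁ ab)) o ∧ on (inj₂ (proj₂ ab)) o) os)) ≤ ι k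
      few-both u v h = ≤-trans (≤-reflexive (trans (∑-map (λ x → (v , x) , (u , x)) (palette v) (λ ab → ι (# (λ o → on (inj₂ (proj₁ ab)) o ∧ on (inj₂ (proj₂ ab)) o) os))) (∑-length common (palette v))))
          (ι-mono (ℕₚ.≤-trans (unique-length {ys = filterᵇ (on (inj₁ (item u v))) os} (concatMap-unique common colour (palette-unique v) (λ x _ → filterᵇ-unique _ os-unique) key) inside) (ℕₚ.≤-reflexive (item-deg (item-in {u} {v} h)))))
        where
        common : ℕ → List Opt
        common x = filterᵇ (λ o → on (inj₂ (v , x)) o ∧ on (inj₂ (u , x)) o) os
        split : ∀ x {o} → o ∈ common x → o ∈ os × on (inj₂ (v , x)) o ≡ true × on (inj₂ (u , x)) o ≡ true
        split x {o} o∈ = let a , b = ∈-filterᵇ⁻ (λ o → on (inj₂ (v , x)) o ∧ on (inj₂ (u , x)) o) os o∈ in a , ∧-left b , ∧-right {on (inj₂ (v , x)) o} b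
        key : ∀ x o → x ∈ palette v → o ∈ common x → colour o ≡ x
        key x o _ o∈ = let a , b , _ = split x o∈ in sym (proj₁ (on-res⁻ {o} {v} {x} a b))
        inside : ∀ o → o ∈ concatMap common (palette v) → o ∈ filterᵇ (on (inj₁ (item u v))) os
        inside o o∈ = let x , _ , m = ∈-concatMap⁻ common (palette v) o∈ ; a , b , c = split x m ; e = proj₂ (on-res⁻ {o} {u} {x} a c) ; e′ = proj₂ (on-res⁻ {o} {v} {x} a b) in
          ∈-filterᵇ⁺ (on (inj₁ (item u v))) a (subst (λ i → on (inj₁ i) o ≡ true)
            (trans (sym (proj₂ (other-H (IsOpt.e∈ (os-spec a)) e))) (cong (item u) (other-end e e′ (loopless (H-edge D {u} {v} h))))) (on-item⁺ o))

      module FirstRound (1≤Δ : 1 ℕ.≤ Δ)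
        (Θ s₀ m₀ : ℕ) (1≤Θ : 1 ℕ.≤ Θ) (1≤s₀ : 1 ℕ.≤ s₀) (k≤s² : k ℕ.≤ s₀ ℕ.* s₀) {gap : ℚ} (0≤gap : 0ℚ ≤ gap) (bound : ι Δ + (gap + ι 400) * (ι Θ * ι s₀) ≤ ι k)
        (big : 24 ℕ.* (27 ℕ.* (k ℕ.* k) ℕ.+ 9 ℕ.* (k ℕ.* (4 ℕ.* Δ))) ℕ.* (2 ℕ.* k ℕ.* k ℕ.* (3 ℕ.* k)) ℕ.≤ 2 ℕ.^ Θ) (big′ : 7 ℕ.≤ 2 ℕ.^ Θ)
        (D-large : 512 ℕ.* (m₀ ℕ.+ 1 ℕ.+ 68 ℕ.* (Θ ℕ.* s₀)) ℕ.≤ D) where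

        open Params {Θ} {k} {ι s₀} {gap} {Δ} 1≤Θ (ι-pos′ 1≤s₀) (≤-trans (ι-mono k≤s²) (≤-reflexive (ι-* s₀ s₀))) 0≤gap bound public

        private
          18≤k : 18 ℕ.≤ k
          18≤k = ℕₚ.≤-trans (ℕₚ.m≤m+n 18 382) 400≤ℓ

        round : (Σ ℚ λ p → (ι k * p ≡ 1ℚ) × (0ℚ < p)) → Summary os k Δ its a ts τ
        round (p , kp , 0<p) = Nibbling.Regular.Nibble.summary _≟I_ _≟R_ p (ℚₚ.<⇒≤ 0<p) (≤1-from (ℚₚ.<⇒≤ 0<p) pk 1≤ℓ) os linear-os k Δ 1≤Δ t≤ℓ (resources os) (resources-unique os) (λ {o} o∈ → resources-all {os} {o} o∈)
            (λ {o} o∈ i∈ → subst (λ i → # (on (inj₁ i)) os ≡ k) (item-point {o} i∈) (item-deg (IsOpt.e∈ (os-spec o∈)))) (res-deg deg≤)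
            pk 18≤k 0<σ 24≤σ σ² Θ its its-unique (λ i → item-deg) ts ts-unique τ (4 ℕ.* Δ) hub-deg 1≤Θ big big′
          where
          pk : p * ι k ≡ 1ℚ
          pk = trans (ℚₚ.*-comm p (ι k)) kp

        first-round : Summary os k Δ its a ts τ
        first-round = round (inverse (ι-pos′ 1≤ℓ))

        separating : List Opt → V → V → List ℕ
        separating kept u v = filterᵇ (λ x → any (on (inj₂ (v , x))) kept ∧ not (any (on (inj₂ (u , x))) kept)) (palette v)

        many-separating : ∀ (sm : Summary os k Δ its a ts τ) {u v} → (u , v) ∈ ts → m₀ ℕ.≤ length (separating (Summary.kept sm) u v)
        many-separating sm {u} {v} uv∈ = ι-cancel (test-numbers {p} {κ} {ι k} {ι (dH D v)} {ι m₀} {a} 0≤p pℓ (ι-mono (ℕₚ.≤-trans (ℕₚ.m≤m+n 72 328) 400≤ℓ)) 0≤κ 1≤128κ 2κ≤1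
            (many-at u v) (few-both u v (proj₁ (ts-spec {u} {v} uv∈))) (∑-≥0 (pairs u v) λ ab _ → 0≤ι (# (on (inj₂ (proj₁ ab))) os)) (0≤ι (dH D v)) rich
            (≤-trans (test-after (u , v) uv∈) (≤-reflexive (cong ι (#-map (λ ab → any (on (inj₂ (proj₁ ab))) kept ∧ not (any (on (inj₂ (proj₂ ab))) kept)) (λ x → (v , x) , (u , x)) (palette v))))))
          where
          open Summary sm
          open Rates {p} {κ} {ρ} 0≤p pℓ ρ≡ 1≤128κ 2κ≤1 using (0≤κ)
          rich : ι 512 * (ι m₀ + 1ℚ + a) ≤ ι (dH D v)
          rich = ≤-trans (≤-reflexive (trans (cong (ι 512 *_) eq) (sym (ι-* 512 _)))) (ι-mono (ℕₚ.≤-trans D-large (ℕₚ.<⇒≤ (ℕₚ.≰⇒> λ h → true≢false (T⇒true (ℕₚ.≤⇒≤ᵇ h)) (proj₂ (ts-spec {u} {v} uv∈))))))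
            where
            T⇒true : ∀ {b} → T b → b ≡ true
            T⇒true {true} _ = refl
            eq : ι m₀ + 1ℚ + a ≡ ι (m₀ ℕ.+ 1 ℕ.+ 68 ℕ.* (Θ ℕ.* s₀))
            eq = sym (trans (ι-+ (m₀ ℕ.+ 1) _) (cong₂ _+_ (trans (ι-+ m₀ 1) (cong (ι m₀ +_) ι1)) (trans (ι-* 68 (Θ ℕ.* s₀)) (trans (cong (ι 68 *_) (ι-* Θ s₀)) (sym aX)))))

      -- A first round leaves a partial matching `kept`; blocking some resources costs every item at most 2B options,
      -- and a matching of the surviving options completes `kept`.
      module Completion (1≤Δ : 1 ℕ.≤ Δ)
        (Θ r₁ f m₀ : ℕ) (1≤Θ : 1 ℕ.≤ Θ) (1≤s₀ : 1 ℕ.≤ 3 ℕ.* r₁) (k≤s² : k ℕ.≤ 3 ℕ.* r₁ ℕ.* (3 ℕ.* r₁))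
        (bound : ι Δ + (ι 340 * ι f + ι 360 + ι 400) * (ι Θ * ι (3 ℕ.* r₁)) ≤ ι k)
        (big : 24 ℕ.* (27 ℕ.* (k ℕ.* k) ℕ.+ 9 ℕ.* (k ℕ.* (4 ℕ.* Δ))) ℕ.* (2 ℕ.* k ℕ.* k ℕ.* (3 ℕ.* k)) ℕ.≤ 2 ℕ.^ Θ) (big′ : 7 ℕ.≤ 2 ℕ.^ Θ)
        (D-large : 512 ℕ.* (m₀ ℕ.+ 1 ℕ.+ 68 ℕ.* (Θ ℕ.* (3 ℕ.* r₁))) ℕ.≤ D) (fuel : ι 1023 ^ f * ι (3 ℕ.* r₁) ≤ ι 1024 ^ f) where

        s₀ : ℕ
        s₀ = 3 ℕ.* r₁

        open FirstRound 1≤Δ Θ s₀ m₀ 1≤Θ 1≤s₀ k≤s² {ι 340 * ι f + ι 360} (0≤+ (0≤* (0≤ι 340) (0≤ι f)) (0≤ι 360)) bound big big′ D-large public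

        B : ℕ
        B = 15 ℕ.* (Θ ℕ.* r₁)

        module _ (sm : Summary os k Δ its a ts τ) (Z : R → Bool) (Z-few : ∀ u v → Edge G u v → # (λ x → Z (u , x)) (L u v) ℕ.≤ B) where

          open Summary sm
          open Rates {p} {κ} {ρ} 0≤p pℓ ρ≡ 1≤128κ 2κ≤1

          blocked : Opt → Bool
          blocked (_ , r , r′) = Z r ∨ Z r′

          open-options : List Opt
          open-options = filterᵇ (λ o → not (blocked o)) left

          todo : List I
          todo = filterᵇ (λ i → not (any (on (inj₁ i)) kept)) its

          blocked-few : ∀ i → i ∈ its → # (λ o → on (inj₁ i) o ∧ blocked o) left ℕ.≤ B ℕ.+ B
          blocked-few i@(u , v) i∈ = ℕₚ.≤-trans (inj-length colour {ys = ys} (filterᵇ-unique _ (Hyperₚ.unique left-linear)) inj inside)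
              (ℕₚ.≤-trans (ℕₚ.≤-reflexive (length-++ (filterᵇ (λ x → Z (u , x)) (L u v)))) (ℕₚ.+-mono-≤ (Z-few u v e) (Z-few v u (edge-sym e))))
            where
            module Hyperₚ = Linear
            e : Edge G u v
            e = L-edge i∈
            ys = filterᵇ (λ x → Z (u , x)) (L u v) ++ filterᵇ (λ x → Z (v , x)) (L v u)
            facts : ∀ o → o ∈ filterᵇ (λ o → on (inj₁ i) o ∧ blocked o) left → (∃ λ x → x ∈ L u v × o ≡ opt i x) × blocked o ≡ true
            facts o o∈ = let a , b = ∈-filterᵇ⁻ (λ o → on (inj₁ i) o ∧ blocked o) left o∈ ; s = os-spec (left-in a) ; q = on-item⁻ i o (∧-left b) in
              (colour o , subst (λ i → colour o ∈ L (proj₁ i) (proj₂ i)) q (IsOpt.x∈ s) , trans (IsOpt.shape s) (cong (λ i → opt i (colour o)) q)) , ∧-right {on (inj₁ i) o} b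
            inj : ∀ o o′ → o ∈ filterᵇ (λ o → on (inj₁ i) o ∧ blocked o) left → o′ ∈ filterᵇ (λ o → on (inj₁ i) o ∧ blocked o) left → colour o ≡ colour o′ → o ≡ o′
            inj o o′ o∈ o′∈ c = go (proj₁ (facts o o∈)) (proj₁ (facts o′ o′∈)) c
              where
              go : ∀ {o o′} → (∃ λ x → x ∈ L u v × o ≡ opt i x) → (∃ λ x → x ∈ L u v × o′ ≡ opt i x) → colour o ≡ colour o′ → o ≡ o′
              go (x , _ , refl) (y , _ , refl) c = cong (opt i) c
            inside : ∀ o → o ∈ filterᵇ (λ o → on (inj₁ i) o ∧ blocked o) left → colour o ∈ ys
            inside o o∈ = let h , b = facts o o∈ in go h b
              where
              go : ∀ {o} → (∃ λ x → x ∈ L u v × o ≡ opt i x) → blocked o ≡ true → colour o ∈ ys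
              go (x , x∈ , refl) b = [ (λ z → ∈-++⁺ˡ (∈-filterᵇ⁺ (λ x → Z (u , x)) x∈ z)) , (λ z → ∈-++⁺ʳ (filterᵇ (λ x → Z (u , x)) (L u v)) (∈-filterᵇ⁺ (λ x → Z (v , x)) (subst (x ∈_) (L-sym u v e) x∈) z)) ]′ (∨-case {Z (u , x)} b)

          slack : ∀ {ℓ₁ t₁} → ι t₁ + (ι 340 * ι f + ι 420) * (ι Θ * (Q * ι s₀)) ≤ ι ℓ₁ → ι t₁ + (ι 340 * ι f + ι 400) * (ι Θ * (Q * ι s₀)) ≤ ι (ℓ₁ ℕ.∸ (B ℕ.+ B))
          slack {ℓ₁} {t₁} h = ≤-trans (by-gap (0≤+ (diff h) (0≤* (0≤* (0≤ι 10) 0≤X) (diff 1≤2Q)))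
              (trans (l (ι ℓ₁) (ι t₁) (ι 340 * ι f) (ι Θ) Q (ι s₀) (ι 10) (ι 2) (ι 400)) (cong (λ z → ι t₁ + (ι 340 * ι f + ι 400) * (ι Θ * (Q * ι s₀)) + (ι ℓ₁ - (ι t₁ + (ι 340 * ι f + z) * (ι Θ * (Q * ι s₀))) + ι 10 * (ι Θ * ι s₀) * (ι 2 * Q - 1ℚ))) (sym 420≡))))
              (≤-trans (≤-reflexive (cong (λ z → ι ℓ₁ - z) (sym 2B))) (by-gap (diff (≤-trans (ι-mono (ℕₚ.m≤n+m∸n ℓ₁ (B ℕ.+ B))) (≤-reflexive (ι-+ (B ℕ.+ B) _)))) (l₂ (ι ℓ₁) (ι (B ℕ.+ B)) (ι (ℓ₁ ℕ.∸ (B ℕ.+ B))))))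
            where
            open +-*-Solver using (solve; con; _:+_; _:*_; _:=_)
            420≡ : ι 420 ≡ ι 400 + ι 10 * ι 2
            420≡ = trans (ι-+ 400 20) (cong (ι 400 +_) (ι-* 10 2))
            l₁ : ∀ t r → 15 ℕ.* (t ℕ.* r) ℕ.+ 15 ℕ.* (t ℕ.* r) ≡ 10 ℕ.* (t ℕ.* (3 ℕ.* r))
            l₁ = solve 2 (λ t r → con 15 :* (t :* r) :+ con 15 :* (t :* r) := con 10 :* (t :* (con 3 :* r))) refl
            2B : ι (B ℕ.+ B) ≡ ι 10 * (ι Θ * ι s₀)
            2B = trans (cong ι (l₁ Θ r₁)) (trans (ι-* 10 (Θ ℕ.* s₀)) (cong (ι 10 *_) (ι-* Θ s₀)))
            l : ∀ n t g θ q s c e d → n - c * (θ * s) ≡ t + (g + d) * (θ * (q * s)) + (n - (t + (g + (d + c * e)) * (θ * (q * s))) + c * (θ * s) * (e * q - 1ℚ))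
            l = solve-∀ ℚ-ring
            l₂ : ∀ a b c → c ≡ a - b + (b + c - a)
            l₂ = solve-∀ ℚ-ring

          private
            more : ι Δ + (ι 340 + (ι 340 * ι f + ι 420)) * X ≤ ι k
            more = ≤-trans (≤-reflexive (cong (λ z → ι Δ + z * X) (trans (l (ι 340) (ι 340 * ι f) (ι 420)) (trans (cong (ι 340 * ι f +_) (trans (sym (ι-+ 340 420)) (ι-+ 360 400))) (sym (ℚₚ.+-assoc (ι 340 * ι f) (ι 360) (ι 400))))))) bound
              where
              l : ∀ a b c → a + (b + c) ≡ b + (a + c)
              l = solve-∀ ℚ-ring

            proceed : (∃ λ m → (ι m ≤ x) × (x ≤ 1ℚ + ι m)) → (∃ λ m → (ι m ≤ y) × (y ≤ 1ℚ + ι m)) → Matching open-options todo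
            proceed (ℓ₁ , ℓ₁≤x , x≤) (m , m≤y , y≤) = Nibbling.iterate _≟I_ _≟R_ Θ k 1≤Θ big₀ big′ f {ℓ = ℓ₁ ℕ.∸ (B ℕ.+ B)} {t = suc m} {s = Q * ι s₀}
                (Linear-⊆ (λ o → not (blocked o)) left-linear) (filterᵇ-unique _ its-unique) rich sparse (*-pos 0<Q (ι-pos′ 1≤s₀))
                (≤-trans (ι-mono (ℕₚ.m∸n≤m ℓ₁ (B ℕ.+ B))) (scale-after {ℓ₁} ℓ₁≤x))
                (≤-trans (*-monoʳ (0≤^ (0≤ι 1023) f) (≤-trans (*-monoˡ (0≤ι s₀) Q≤1) (≤-reflexive (ℚₚ.*-identityˡ (ι s₀))))) fuel)
                (slack {ℓ₁} {suc m} (gap-after {ℓ₁} {suc m} {ι 340 * ι f + ι 420} x≤ (≤-trans (≤-reflexive (ι-suc m)) (+-mono (≤-refl {1ℚ}) m≤y)) more))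
                (ℕₚ.≤-trans (ℕₚ.m∸n≤m ℓ₁ (B ℕ.+ B)) (size-after {ℓ₁} ℓ₁≤x))
              where
              big₀ : 24 ℕ.* (27 ℕ.* (k ℕ.* k) ℕ.+ 9 ℕ.* (k ℕ.* 0)) ℕ.* (2 ℕ.* k ℕ.* k ℕ.* (3 ℕ.* k)) ℕ.≤ 2 ℕ.^ Θ
              big₀ = ℕₚ.≤-trans (ℕₚ.*-monoˡ-≤ (2 ℕ.* k ℕ.* k ℕ.* (3 ℕ.* k)) (ℕₚ.*-monoʳ-≤ 24 (ℕₚ.+-monoʳ-≤ (27 ℕ.* (k ℕ.* k)) (ℕₚ.*-monoʳ-≤ 9 (ℕₚ.*-monoʳ-≤ k ℕ.z≤n))))) big
              rich : ∀ i → i ∈ todo → ℓ₁ ℕ.∸ (B ℕ.+ B) ℕ.≤ # (on (inj₁ i)) open-options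
              rich i i∈ = let b , q = ∈-filterᵇ⁻ (λ i → not (any (on (inj₁ i)) kept)) its i∈ in
                ℕₚ.≤-trans (ℕₚ.∸-monoˡ-≤ (B ℕ.+ B) (ℕₚ.≤-trans ([ (λ { (o , o∈ , h) → ⊥-elim (true≢false (any⁺ (on (inj₁ i)) o∈ h) (not-elim q)) }) , (λ h → ι-cancel (≤-trans ℓ₁≤x h)) ]′ (item-after i b))
                    (ℕₚ.≤-trans (#-split (on (inj₁ i)) blocked left) (ℕₚ.+-monoˡ-≤ _ (blocked-few i b))))) (ℕₚ.≤-reflexive (ℕₚ.m+n∸m≡n (B ℕ.+ B) _))
              sparse : ∀ r → # (on (inj₂ r)) open-options ℕ.≤ suc m
              sparse r = ℕₚ.≤-trans (unique-length (filterᵇ-unique (on (inj₂ r)) (filterᵇ-unique (λ o → not (blocked o)) (Linear.unique left-linear)))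
                  λ o o∈ → let a , b = ∈-filterᵇ⁻ (on (inj₂ r)) open-options o∈ in ∈-filterᵇ⁺ (on (inj₂ r)) (proj₁ (∈-filterᵇ⁻ (λ o → not (blocked o)) left a)) b)
                (ι-cancel (≤-trans (res-after r) (≤-trans y≤ (≤-reflexive (sym (ι-suc m))))))

          matching : Matching open-options todo
          matching = proceed (floor x 0≤x) (floor y 0≤y)

          module _ (M : Matching open-options todo) where

            open Matching M

            final : List Opt
            final = kept ++ edges

            edge-open : ∀ {o} → o ∈ edges → o ∈ left × blocked o ≡ false
            edge-open o∈ = let a , b = ∈-filterᵇ⁻ (λ o → not (blocked o)) left (within o∈) in a , not-elim b

            final-in : ∀ {o} → o ∈ final → o ∈ os
            final-in h = [ (λ h → kept-in h) , (λ h → left-in (proj₁ (edge-open h))) ]′ (∈-++⁻ kept h)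

            final-apart : ∀ {o o′} → o ∈ final → o′ ∈ final → o ≢ o′ → Disjoint o o′
            final-apart {o} {o′} h h′ n = go (∈-++⁻ kept h) (∈-++⁻ kept h′)
              where
              go : o ∈ kept ⊎ o ∈ edges → o′ ∈ kept ⊎ o′ ∈ edges → Disjoint o o′
              go (inj₁ h) (inj₁ h′) = kept-apart h h′ n
              go (inj₁ h) (inj₂ h′) = left-apart h (proj₁ (edge-open h′))
              go (inj₂ h) (inj₁ h′) = λ x x∈ x∈′ → left-apart h′ (proj₁ (edge-open h)) x x∈′ x∈
              go (inj₂ h) (inj₂ h′) = apart h h′ n

            meet : ∀ {o o′} x → o ∈ final → o′ ∈ final → x ∈ pts o → x ∈ pts o′ → o ≡ o′
            meet {o} {o′} x h h′ x∈ x∈′ = decidable-stable (o ≟O o′) λ n → final-apart h h′ n x x∈ x∈′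

            covered : ∀ i → i ∈ its → any (on (inj₁ i)) final ≡ true
            covered i i∈ = [ (λ e → let o , o∈ , h = any⁻ (on (inj₁ i)) kept e in any⁺ (on (inj₁ i)) {o} {final} (∈-++⁺ˡ o∈) h)
              , (λ e → let o , o∈ , h = covers i (∈-filterᵇ⁺ (λ i → not (any (on (inj₁ i)) kept)) i∈ (not-true e)) in any⁺ (on (inj₁ i)) {o} {final} (∈-++⁺ʳ kept o∈) h) ]′ (bool-case (any (on (inj₁ i)) kept))

            c : V → V → ℕ
            c u v = pick final (item u v)

            chosen : ∀ u v → Hᴰ u v ≡ true → opt (item u v) (c u v) ∈ final
            chosen u v h = go (pick-spec final (item u v) (covered (item u v) (item-in {u} {v} h)))
              where
              go : (∃ λ o → o ∈ final × on (inj₁ (item u v)) o ≡ true × pick final (item u v) ≡ colour o) → opt (item u v) (c u v) ∈ final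
              go (o , o∈ , q , e) = subst (_∈ final) (trans (IsOpt.shape (os-spec (final-in o∈))) (cong₂ opt (on-item⁻ (item u v) o q) (sym e))) o∈

            c-point : ∀ u v → inj₂ (u , c u v) ∈ pts (opt (item u v) (c u v))
            c-point u v = End-point (c u v) (item-end u v)

            item-only : ∀ {u v w} → Hᴰ u v ≡ true → Hᴰ u w ≡ true → item u v ≡ item u w → v ≡ w
            item-only {u} {v} {w} h h′ e = trans (sym (other-item {u} {v} h)) (trans (cong (other u) e) (other-item {u} {w} h′))

            seed : (∀ {u v} → (u , v) ∈ ts → ∃ λ x → x ∈ separating kept u v × Z (u , x) ≡ true) → Seed D L B
            seed hit = record
              { c = c
              ; c-sym = λ u v h → cong (pick final) (item-sym u v (loopless (H-edge D {u} {v} h)))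
              ; c-list = λ u v h → subst (c u v ∈_) (L-item (H-edge D {u} {v} h)) (IsOpt.x∈ (os-spec (final-in (chosen u v h))))
              ; c-proper = λ u v w h h′ e → item-only {u} {v} {w} h h′ (cong proj₁ (meet (inj₂ (u , c u v)) (chosen u v h) (chosen u w h′) (c-point u v) (subst (λ x → inj₂ (u , x) ∈ pts (opt (item u w) (c u w))) (sym e) (c-point u w))))
              ; Z = λ u x → Z (u , x)
              ; Z-few = Z-few
              ; separate = λ u v h q → separate u v h (hit (ts-in {u} {v} h q))
              }
              where
              separate : ∀ u v → Hᴰ u v ≡ true → (∃ λ x → x ∈ separating kept u v × Z (u , x) ≡ true) → ∃ λ w → Hᴰ v w ≡ true × Z (u , c v w) ≡ true × (∀ z → Hᴰ u z ≡ true → c u z ≢ c v w)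
              separate u v h (x , x∈ , ux) = go (any⁻ (on (inj₂ (v , x))) kept (∧-left b))
                where
                b = proj₂ (∈-filterᵇ⁻ (λ x → any (on (inj₂ (v , x))) kept ∧ not (any (on (inj₂ (u , x))) kept)) (palette v) x∈)
                absent : any (on (inj₂ (u , x))) kept ≡ false
                absent = not-elim (∧-right {any (on (inj₂ (v , x))) kept} b)
                clash : ∀ {e} → End u e → blocked (opt e x) ≡ true
                clash (inj₁ refl) = ∨-left ux
                clash {e} (inj₂ refl) = ∨-right {Z (proj₁ e , x)} ux
                new : ∀ z → Hᴰ u z ≡ true → c u z ≢ x
                new z hz e = [ (λ k → true≢false (any⁺ (on (inj₂ (u , x))) k (∈ᴾ⁺ {inj₂ (u , x)} {pts (opt (item u z) x)} (End-point x (item-end u z)))) absent)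
                             , (λ k → true≢false (clash (item-end u z)) (proj₂ (edge-open k))) ]′ (∈-++⁻ kept (subst (λ y → opt (item u z) y ∈ final) e (chosen u z hz)))
                go : (∃ λ o → o ∈ kept × on (inj₂ (v , x)) o ≡ true) → ∃ λ w → Hᴰ v w ≡ true × Z (u , c v w) ≡ true × (∀ z → Hᴰ u z ≡ true → c u z ≢ c v w)
                go (o , o∈ , q) = w , vw , subst (λ y → Z (u , y) ≡ true) (sym c≡x) ux , λ z hz e → new z hz (trans e c≡x)
                  where
                  s = os-spec (kept-in o∈)
                  end = on-res⁻ {o} {v} {x} (kept-in o∈) q
                  w = other v (proj₁ o)
                  vw : Hᴰ v w ≡ true
                  vw = proj₁ (other-H (IsOpt.e∈ s) (proj₂ end))
                  iw : item v w ≡ proj₁ o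
                  iw = proj₂ (other-H (IsOpt.e∈ s) (proj₂ end))
                  c≡x : c v w ≡ x
                  c≡x = trans (cong colour (meet (inj₁ (proj₁ o)) (chosen v w vw) (∈-++⁺ˡ o∈) (here (cong inj₁ (sym iw))) (here refl))) (sym (proj₁ end))

        module _ (1≤r₁ : 1 ℕ.≤ r₁) (k≤9r² : k ℕ.≤ 9 ℕ.* (r₁ ℕ.* r₁)) (m₀≤k : m₀ ℕ.≤ k) (big″ : 24 ℕ.* (Δ ℕ.+ Δ) ℕ.* k ℕ.≤ 2 ℕ.^ Θ)
          (m₀≡ : r₁ ℕ.* (suc (2 ℕ.* Θ) ℕ.* suc (2 ℕ.* Θ)) ≡ m₀) where

          Blockable : (V → V → List ℕ) → Set
          Blockable sep = Σ (R → Bool) λ Z → (∀ u v → Edge G u v → # (λ x → Z (u , x)) (L u v) ℕ.≤ B) × (∀ {u v} → (u , v) ∈ ts → ∃ λ x → x ∈ sep u v × Z (u , x) ≡ true)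

          block : ∀ sep → (∀ u v → Unique (sep u v)) → (∀ {u v} → (u , v) ∈ ts → m₀ ℕ.≤ length (sep u v)) → Blockable sep
          block sep sep-unique many = Blocking.blocked G k L L-size deg≤ Θ r₁ 1≤Θ 1≤r₁ k≤9r² (ℕₚ.≤-trans (ℕₚ.≤-reflexive m₀≡) m₀≤k) big″ big′
              ts ts-unique (λ {u} {v} h → H-edge D {u} {v} (proj₁ (ts-spec {u} {v} h))) sep sep-unique (λ h → ℕₚ.≤-trans (ℕₚ.≤-reflexive m₀≡) (many h))

          complete : (sm : Summary os k Δ its a ts τ) → Blockable (separating (Summary.kept sm)) → Seed D L B
          complete sm (Z , few , hit) = seed sm Z few (matching sm Z few) hit

          seeded : Seed D L B
          seeded = from first-round
            where
            from : Summary os k Δ its a ts τ → Seed D L B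
            from sm = complete sm (block (separating (Summary.kept sm)) (λ u v → filterᵇ-unique _ (palette-unique v)) (many-separating sm))

open Numbers using (Parameters; parameters)

open +-*-Solver using (solve; con; _:+_; _:*_; _:=_)

module _ {n : ℕ} (G : Graph n) {C Δ : ℕ} (deg≤ : ∀ v → degree G v ℕ.≤ Δ) (1≤Δ : 1 ℕ.≤ Δ) (params : Parameters C Δ) where

  open Colouring G
  open Threshold
  open Parameters params

  B : ℕ
  B = 15 ℕ.* (Θ ℕ.* r₁)

  large : ℕ
  large = m₀ ℕ.+ 1 ℕ.+ 68 ℕ.* (Θ ℕ.* (3 ℕ.* r₁))

  large≤D : large ℕ.≤ D
  large≤D = ℕₚ.≤-trans (ℕₚ.m≤n*m large 512) D-large

  B≤D : B ℕ.≤ D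
  B≤D = ℕₚ.≤-trans (ℕₚ.≤-trans (ℕₚ.m≤m+n B (189 ℕ.* (Θ ℕ.* r₁))) (ℕₚ.≤-reflexive (solve 2 (λ t r → con 15 :* (t :* r) :+ con 189 :* (t :* r) := con 68 :* (t :* (con 3 :* r))) refl Θ r₁))) (ℕₚ.≤-trans (ℕₚ.m≤n+m _ (m₀ ℕ.+ 1)) large≤D)

  m₀<D : m₀ ℕ.< D
  m₀<D = ℕₚ.≤-trans (ℕₚ.≤-reflexive (sym (ℕₚ.+-comm m₀ 1))) (ℕₚ.≤-trans (ℕₚ.m≤m+n (m₀ ℕ.+ 1) _) large≤D)

  D≤k : D ℕ.≤ k
  D≤k = ℕₚ.≤-trans (ℕₚ.m≤n*m D 8) (ℕₚ.m≤n+m (8 ℕ.* D) Δ)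

  room : Δ ℕ.+ D ℕ.+ (B ℕ.+ B) ℕ.+ (D ℕ.+ D) ℕ.< k
  room = ℕₚ.≤-trans (ℕ.s≤s (ℕₚ.+-monoˡ-≤ (D ℕ.+ D) (ℕₚ.+-monoʳ-≤ (Δ ℕ.+ D) (ℕₚ.+-mono-≤ B≤D B≤D))))
     (ℕₚ.≤-trans (ℕₚ.+-monoˡ-≤ (Δ ℕ.+ D ℕ.+ (D ℕ.+ D) ℕ.+ (D ℕ.+ D)) (ℕₚ.≤-trans (ℕ.s≤s ℕ.z≤n) m₀<D)) (ℕₚ.≤-trans (ℕₚ.m≤m+n _ (D ℕ.+ D)) (ℕₚ.≤-reflexive (solve 2 (λ a d → d :+ (a :+ d :+ (d :+ d) :+ (d :+ d)) :+ (d :+ d) := a :+ con 8 :* d) refl Δ D))))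

  module _ (L : V → V → List ℕ) (L-sym : ∀ u v → Edge G u v → L u v ≡ L v u) (L-size : ∀ u v → Edge G u v → Unique (L u v) × length (L u v) ≡ k) where

    -- Without vertices of degree above D there is nothing to prepare.
    flat-seed : Δ ℕ.≤ D → Seed D L B
    flat-seed Δ≤D = record
      { c = λ _ _ → 0
      ; c-sym = λ _ _ _ → refl
      ; c-list = λ u v h → ⊥-elim (flat u v h)
      ; c-proper = λ u v _ h _ _ → ⊥-elim (flat u v h)
      ; Z = λ _ _ → false
      ; Z-few = λ u v _ → ℕₚ.≤-trans (ℕₚ.≤-reflexive (#0 (λ _ → false) (L u v) λ _ _ → refl)) ℕ.z≤n
      ; separate = λ u v h _ → ⊥-elim (flat u v h)
      }
      where
      flat : ∀ u v → H D u v ≡ true → ⊥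
      flat u v h = true≢false (low⁺ D {u} (ℕₚ.≤-trans (deg≤ u) Δ≤D)) (not-elim (∧-left (∧-right {Graph.Adj G u v} h)))

    module Steep (D<Δ : D ℕ.< Δ) where

      s₀ : ℕ
      s₀ = 3 ℕ.* r₁

      k≤s² : k ℕ.≤ s₀ ℕ.* s₀
      k≤s² = ℕₚ.≤-trans (k≤9r² D<Δ) (ℕₚ.≤-reflexive (solve 1 (λ r → con 9 :* (r :* r) := con 3 :* r :* (con 3 :* r)) refl r₁))

      bound : ι Δ + (ι 340 * ι f + ι 360 + ι 400) * (ι Θ * ι s₀) ≤ ι k
      bound = ≤-trans (≤-reflexive (sym (trans (ι-+ Δ _) (cong (ι Δ +_) (trans (ι-* (340 ℕ.* f ℕ.+ 760) (Θ ℕ.* s₀)) (cong₂ _*_ coefficient (ι-* Θ s₀))))))) (ι-mono gap)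
        where
        coefficient : ι (340 ℕ.* f ℕ.+ 760) ≡ ι 340 * ι f + ι 360 + ι 400
        coefficient = trans (ι-+ (340 ℕ.* f) 760) (trans (cong₂ _+_ (ι-* 340 f) (ι-+ 360 400)) (sym (ℚₚ.+-assoc (ι 340 * ι f) (ι 360) (ι 400))))

      fuel′ : Num._^_ (ι 1023) f * ι s₀ ≤ Num._^_ (ι 1024) f
      fuel′ = ≤-trans (≤-reflexive (sym (trans (ι-* (1023 ℕ.^ f) s₀) (cong (_* ι s₀) (ι-^ 1023 f))))) (≤-trans (ι-mono fuel) (≤-reflexive (ι-^ 1024 f)))

      steep-seed : Seed D L B
      steep-seed = System.Tested.Completion.seeded G D k L L-sym L-size deg≤ (ℕₚ.m≤m+n Δ (8 ℕ.* D)) 1≤Δ Θ r₁ f m₀ 1≤Θ (ℕₚ.≤-trans 1≤r₁ (ℕₚ.m≤n*m r₁ 3)) k≤s² bound (big D<Δ) big′ D-large fuel′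
        1≤r₁ (k≤9r² D<Δ) (ℕₚ.≤-trans (ℕₚ.<⇒≤ m₀<D) D≤k) (big″ D<Δ) refl

    colour-lists : NoIsolatedEdge G → Σ (EdgeColouring G) λ c → (∀ u v → Edge G u v → proj₁ c u v ∈ L u v) × AVD G (proj₁ c)
    colour-lists isolated with Δ ℕ.≤? D
    ... | yes h = Extend.colouring G D isolated Δ deg≤ k L L-sym L-size B room (flat-seed h)
    ... | no h = Extend.colouring G D isolated Δ deg≤ k L L-sym L-size B room (Steep.steep-seed (ℕₚ.≰⇒> h))

at-least-two : ∀ {n} (G : Graph n) {Δ} → HasEdge G → NoIsolatedEdge G → (∀ v → degree G v ℕ.≤ Δ) → 2 ℕ.≤ Δ
at-least-two G {Δ} (u , v , e) isolated deg≤ with 2 ℕ.≤? Δ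
... | yes h = h
... | no h = ⊥-elim (isolated u v e (one e , one (edge-sym e)))
  where
  open Colouring G
  one : ∀ {a b} → Edge G a b → degree G a ≡ 1
  one {a} e = ℕₚ.≤-antisym (ℕₚ.≤-trans (deg≤ a) (ℕₚ.≤-pred (ℕₚ.≰⇒> h))) (nonempty (∈-nbrs e))
    where
    nonempty : ∀ {x : V} {xs} → x ∈ xs → 1 ℕ.≤ length xs
    nonempty (here _) = ℕ.s≤s ℕ.z≤n
    nonempty (there _) = ℕ.s≤s ℕ.z≤n

theorem1 : ∃[ C ] ((n : ℕ) (G : Graph n) (Δ : ℕ) →
             HasEdge G → NoIsolatedEdge G → MaxDegree G Δ →
             ∃[ B ] (WithinBound C Δ B × chₐ′≤ G B))
theorem1 = proj₁ parameters , λ n G Δ edge isolated (deg≤ , _) →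
  let 2≤Δ = at-least-two G edge isolated deg≤ ; params = proj₂ parameters Δ 2≤Δ in
  Parameters.k params , Parameters.within params , Parameters.k params , ℕₚ.≤-refl ,
  λ L L-sym L-size → colour-lists G deg≤ (ℕₚ.≤-trans (ℕ.s≤s ℕ.z≤n) 2≤Δ) params L L-sym L-size isolated
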